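{- (1) For every integer $r \geq 3$, $e_{r,r}(s)=e'_{r,r}(s)=s^2+(2r-7)s+\binom{r-2}{2}$ for all sufficiently large $s$. (2) For every integer $r \geq 3$, $e_{r,r+1}(s)=\Theta(s^{3/2})$ and $e'_{r,r+1}(s)=\Theta(s^{3/2})$. (3) For all integers $r \geq 3$ and $t \geq r+2$, $s^{1/(t-r+2)} \ll e_{r,t}(s) \leq e'_{r,t}(s) \ll s^{4/(t-r+2)}$. (4) For every integer $t \geq 5$, $s^{2/(t-3)} \ll e_{3,t}(s) \leq e'_{3,t}(s) \ll s^{4/(t-1)}$. (5) $\tfrac{2}{3}s + o(s) \leq e_{3,5}(s) \leq e'_{3,5}(s) \leq 2s + o(s)$.
   Context: All graphs are finite and simple; $e(H)$ is the number of edges. For $r\ge 3$, an $r$-system is a pair $(H,\mathcal{F})$ where $H$ is a graph and $\mathcal{F}$ is a family (possibly with repeated members) of subsets of $V(H)$ such that: (i) $H$ contains no $K_r$; (ii) every $S\in\mathcal{F}$ is maximally $K_{r-1}$-free, i.e. $H[S]$ contains no $K_{r-1}$ but $H[S\cup\{v\}]$ contains a $K_{r-1}$ for every $v\notin S$; (iii) for any two distinct members $S\neq T$ of $\mathcal{F}$, $H[S\cap T]$ contains a $K_{r-2}$. A maximal $r$-system is an $r$-system such that for every pair $e$ of non-adjacent vertices of $H$, either $H+e$ contains a $K_r$ or $(H+e)[S]$ contains a $K_{r-1}$ for some $S\in\mathcal{F}$. For $t\ge r-2$, an $(r,t)$-system (resp. maximal $(r,t)$-system) is an $r$-system (resp.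 maximal $r$-system) in which $\mathcal{F}$ has no repeated elements and every set in $\mathcal{F}$ has size exactly $t$. For integers $r\ge 3$, $t\ge r$, $s\ge 0$, $e_{r,t}(s)$ (resp. $e'_{r,t}(s)$) is the minimum of $e(H)$ over all $(r,t)$-systems (resp. maximal $(r,t)$-systems) $(H,\mathcal{F})$ with $|\mathcal{F}|=s$. Notation: $f\ll g$ means $f=O(g)$, $f=\Theta(g)$ means $f\ll g\ll f$, asymptotics as $s\to\infty$ with $r,t$ fixed. -}

module Defs where

open import Data.Nat using (ℕ; _+_; _*_; _∸_; _^_; _≤_; _<ᵇ_)
open import Data.Nat.Combinatorics using (_C_)
open import Data.Integer as ℤ using (ℤ; +_)
open import Data.Bool using (Bool; true; false; _∧_; _∨_; if_then_else_)
open import Data.Fin using (Fin; toℕ; _≟_)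
open import Data.Fin.Subset using (Subset; _∈_; _∉_; ⊤; _∩_; _∪_; ⁅_⁆; ∣_∣)
open import Data.List using (List; length; map; allFin)
open import Data.Nat.ListAction using (sum)
open import Data.List.Relation.Unary.All using (All)
open import Data.List.Relation.Unary.Any using (Any)
open import Data.List.Relation.Unary.Unique.Propositional using (Unique)
open import Data.List.Membership.Propositional using () renaming (_∈_ to _∈ₗ_)
open import Data.Product using (Σ; _×_)
open import Data.Sum using (_⊎_)
open import Relation.Nullary using (¬_)
open import Relation.Nullary.Decidable using (⌊_⌋)
open import Relation.Binary.PropositionalEquality using (_≡_; _≢_)

record Graph (n : ℕ) : Set where
  field
    adj    : Fin n → Fin n → Bool
    sym    : ∀ i j → adj i j ≡ adj j i
    irrefl : ∀ i → adj i i ≡ false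
open Graph public

edges : ∀ {n} → Graph n → ℕ
edges {n} H =
  sum (map (λ i → sum (map (λ j → if (toℕ i <ᵇ toℕ j) ∧ adj H i j then 1 else 0)
                           (allFin n)))
           (allFin n))

-- (A)[S] contains a K_k : k vertices of S, pairwise adjacent
-- (distinct indices map to adjacent, hence distinct, vertices).
HasClique : ∀ {n} → (Fin n → Fin n → Bool) → ℕ → Subset n → Set
HasClique {n} A k S =
  Σ (Fin k → Fin n) λ f →
    (∀ i → f i ∈ S) × (∀ i j → i ≢ j → A (f i) (f j) ≡ true)

addEdge : ∀ {n} → (Fin n → Fin n → Bool) → Fin n → Fin n → Fin n → Fin n → Bool
addEdge A u v x y =
  A x y ∨ ((⌊ x ≟ u ⌋ ∧ ⌊ y ≟ v ⌋) ∨ (⌊ x ≟ v ⌋ ∧ ⌊ y ≟ u ⌋))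

MaxFree : ∀ {n} → (Fin n → Fin n → Bool) → ℕ → Subset n → Set
MaxFree A k S = ¬ HasClique A k S × (∀ v → v ∉ S → HasClique A k (S ∪ ⁅ v ⁆))

IsRSystem : ∀ {n} → ℕ → Graph n → List (Subset n) → Set
IsRSystem r H F =
  ¬ HasClique (adj H) r ⊤ ×
  All (MaxFree (adj H) (r ∸ 1)) F ×
  (∀ S T → S ∈ₗ F → T ∈ₗ F → S ≢ T → HasClique (adj H) (r ∸ 2) (S ∩ T))

IsMaximal : ∀ {n} → ℕ → Graph n → List (Subset n) → Set
IsMaximal r H F =
  ∀ u v → u ≢ v → adj H u v ≡ false →
    HasClique (addEdge (adj H) u v) r ⊤ ⊎
    Any (λ S → HasClique (addEdge (adj H) u v) (r ∸ 1) S) F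

record RTSystem (r t s : ℕ) : Set where
  field
    n       : ℕ
    H       : Graph n
    F       : List (Subset n)
    system  : IsRSystem r H F
    noRep   : Unique F
    sizes   : All (λ S → ∣ S ∣ ≡ t) F
    card    : length F ≡ s
open RTSystem public

record MaxRTSystem (r t s : ℕ) : Set where
  field
    sys     : RTSystem r t s
    maximal : IsMaximal r (H sys) (F sys)
open MaxRTSystem public

IsE : ℕ → ℕ → ℕ → ℕ → Set
IsE r t s m =
  Σ (RTSystem r t s) (λ X → edges (H X) ≡ m) ×
  (∀ (X : RTSystem r t s) → m ≤ edges (H X))

IsE' : ℕ → ℕ → ℕ → ℕ → Set
IsE' r t s m =
  Σ (MaxRTSystem r t s) (λ X → edges (H (sys X)) ≡ m) ×
  (∀ (X : MaxRTSystem r t s) → m ≤ edges (H (sys X)))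

formula1 : ℕ → ℕ → ℤ
formula1 r s = (+ (s * s) ℤ.+ ((+ (2 * r)) ℤ.- (+ 7)) ℤ.* (+ s)) ℤ.+ (+ ((r ∸ 2) C 2))

{-# OPTIONS --safe #-}
module Submission where

-- Write r = 3 + k. Throughout, if w lies in the set S_j but not in S_i, the clique blocking w from S_i must leave
-- S_j, so w has a neighbour in S_i ∖ S_j. Hence at most r - 1 sets share t - 1 vertices, since the remaining
-- vertices form a clique.
--
-- For t = r and t = r + 1 pigeonhole gives a clique Q on r - 2 vertices contained in a positive proportion of the
-- sets. A vertex of S ∖ Q misses some vertex of Q. Exchanging vertices in the blocking cliques shows that S ∖ Q is
-- either independent with all its vertices missing the same single vertex q of Q, or contains a vertex adjacent to
-- all vertices of its type outside S; sets of the second kind force a popular vertex, as pairwise disjoint ones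
-- would yield a K_r. Sets of the first kind are maximal independent sets of a triangle-free graph.
--
-- So everything rests on counting maximal independent t-sets in a triangle-free graph with m edges. Pairs must be
-- disjoint and form a crown (a complete bipartite graph minus a perfect matching). For triples, a vertex on at least
-- four triples has a crown in its non-neighbourhood, and a triangle chase shows that a triple containing such a
-- vertex has another vertex on no other triple, up to one exceptional configuration. A discharging argument then
-- gives at most N + 256 triples on N vertices and, with Cauchy–Schwarz, O(m^(2/3)) triples. For quadruples, summing
-- degrees over each set against the bound on triples through a vertex gives (3/2 + o(1)) m; larger t follows by
-- branching on a vertex of minimum degree. The sets of a 3-system all meet a fixed one of them, so a positive
-- proportion contains a common vertex, which can be removed together with its neighbours.
--
-- The upper bounds come from triangle-free graphs with many maximal independent sets, to all of which an isolated
-- vertex is added to make them intersect: a crown for t = 3, the incidences of a grid for t = 4, a cyclic product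
-- for t ≥ 5 and two disjoint crowns for t = 5. Edges are then added greedily until the system is maximal, and r - 3
-- universal vertices are joined. The minima exist because a system with m edges has at most t + 2 m vertices.

open import Data.Nat using (ℕ; zero; suc; _+_; _*_; _∸_; _^_; _≤_; _<_; z≤n; s≤s; _<ᵇ_; NonZero; _≤?_; pred; nonZero; >-nonZero)
open import Data.Nat.Properties hiding (_≤?_; suc-injective; 0≢1+n) renaming (_≟_ to _≟ℕ_)
open import Data.Bool using (Bool; true; false; _∧_; _∨_; not; if_then_else_)
open import Data.Bool.Properties using (∧-comm; ∨-comm; ∨-zeroʳ) renaming (_≟_ to _≟ᵇ_)
open import Data.Fin using (Fin; zero; suc; toℕ; _≟_; finToFun; funToFin; _↑ˡ_; cast; combine; fromℕ; fromℕ<; inject₁; inject≤; join; punchIn; punchOut; remQuot; splitAt)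
open import Data.Fin.Properties using (any?; all?; suc-injective; 0≢1+n; finToFun-funToFin; injective⇒≤; toℕ-injective; *↔×; +↔⊎; combine-injective; combine-remQuot; funToFin-finToFin; inject≤-injective; punchIn-injective; punchIn-punchOut; punchInᵢ≢i; remQuot-combine; splitAt-join; toℕ-cast; toℕ-combine; toℕ-fromℕ; toℕ-fromℕ<; toℕ-inject₁; toℕ-inject≤; toℕ<n; ↑ˡ-injective)
open import Data.Product using (Σ; Σ-syntax; ∃-syntax; _×_; _,_; proj₁; proj₂)
open import Data.Sum using (_⊎_; inj₁; inj₂)
open import Data.Empty using (⊥; ⊥-elim)
open import Data.Vec.Functional using (_∷_)
open import Function using (_∘_; case_of_)
open import Relation.Nullary using (¬_; Dec; yes; no)
open import Relation.Nullary.Decidable using (⌊_⌋; ¬?; _×-dec_; _→-dec_; _⊎-dec_; map′)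
open import Relation.Binary.PropositionalEquality using (_≡_; _≢_; refl; sym; trans; cong; cong₂; subst; subst₂; module ≡-Reasoning)
open import Algebra.Properties.Semiring.Sum +-*-semiring using (sum; sum-cong-≗; ∑-distrib-+; ∑-comm; *-distribˡ-sum; *-distribʳ-sum)
open import Data.Nat.Tactic.RingSolver using (solve-∀)
open import Data.Fin.Patterns using (0F; 1F; 2F; 3F; 4F; 5F; 6F; 7F)
open import Relation.Binary.Definitions using (tri<; tri≈; tri>)
open import Defs using (Graph; HasClique; IsE; IsE'; IsMaximal; IsRSystem; MaxFree; MaxRTSystem; RTSystem; addEdge; adj; edges; formula1)
open import Data.Fin.Subset using (Subset; _∈_; _∉_; _∩_; _∪_; ⁅_⁆; ∣_∣; ⊤)
open import Data.Fin.Subset.Properties using (_∈?_; anySubset?; x∈p∩q⁻; x∈p∪q⁺; x∈p∪q⁻; x∈⁅x⁆; x∈⁅y⁆⇒x≡y; ∈⊤)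
open import Data.Vec using (Vec; []; fromList; here; lookup; there; toList) renaming (_∷_ to _∷ᵥ_; tabulate to tabulateᵥ)
open import Data.Vec.Properties using ([]=⇒lookup; length-toList; lookup⇒[]=; lookup∘tabulate; tabulate-cong; tabulate∘lookup; toList∘fromList; ≡-dec) renaming (∷-injectiveʳ to ∷ᵥ-injectiveʳ)
open import Data.List using (List; allFin; cartesianProduct; length; map; tabulate) renaming ([] to []ₗ; _∷_ to _∷ₗ_; lookup to lookupₗ)
open import Data.List.Relation.Unary.All using (All) renaming (all? to All-all?; lookup to All-lookup; map to All-map; tabulate to All-tabulate; [] to []ₐ; _∷_ to _∷ₐ_)
open import Data.List.Relation.Unary.AllPairs using (allPairs?) renaming (_∷_ to _∷ₚ_)
open import Data.List.Relation.Unary.Unique.Propositional using (Unique)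
open import Data.List.Membership.Propositional.Properties using (∈-allFin; ∈-cartesianProduct⁺; ∈-lookup; ∈-map⁻; ∈-tabulate⁺; ∈-tabulate⁻)
open import Data.Nat.ListAction using () renaming (sum to sumₗ)
open import Data.List.Relation.Unary.Any using (Any) renaming (any? to Any-any?; map to Any-map)
open import Data.List.Membership.Propositional using (lose) renaming (_∈_ to _∈ₗ_)
open import Data.Unit using () renaming (⊤ to Unit)
open import Data.List.Properties using (length-map; length-tabulate)
open import Data.List.Relation.Unary.All.Properties using () renaming (map⁺ to All-map⁺; tabulate⁺ to All-tabulate⁺)
open import Data.List.Relation.Unary.Any.Properties using () renaming (map⁺ to Any-map⁺)
open import Data.List.Relation.Unary.Unique.Propositional.Properties using () renaming (map⁺ to Unique-map⁺; tabulate⁺ to Unique-tabulate⁺)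
open import Function.Bundles using (Inverse; _↔_)
open import Function.Properties.Inverse using (↔-refl; ↔-trans)
open import Data.Sum.Function.Propositional using (_⊎-↔_)
open import Data.Product.Function.NonDependent.Propositional using (_×-↔_)
open import Data.Sum.Properties using (inj₁-injective; inj₂-injective)

-- Counting

-- The constant 2/3 needs two sharp inputs. First, triples must be counted as N + O(1) with leading
-- coefficient 1: in a system of quadruples on N vertices, a vertex of degree d then lies on at most
-- N - d + O(1) of them, and the sum of codegree times degree is bounded by a tangent line. Second,
-- all five-element sets must share one vertex, not merely a positive proportion of them; if every
-- vertex is avoided by some set, two successive links lead to triples, which force m to be of order
-- at least s^(3/2), far above s. The additive 256 is 2^8: eight vertices that meet every edge
-- determine a maximal independent set by its trace. In the discharging, a vertex on many triples
-- pays nothing, so its triples are paid for by their other two vertices alone. This also lets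
-- codegrees be charged to degrees, which makes the second moment in Cauchy-Schwarz linear in m.
-- Roots never occur: bounds are inequalities between powers, and o(s) is an error of order s / (k +
-- 1) for every k.

true≢false : true ≢ false
true≢false ()

decide : (b : Bool) → b ≡ true ⊎ b ≡ false
decide true  = inj₁ refl
decide false = inj₂ refl

≢true : {b : Bool} → (b ≡ true → ⊥) → b ≡ false
≢true {true}  h = ⊥-elim (h refl)
≢true {false} _ = refl

clash : {b : Bool} {X : Set} → b ≡ true → b ≡ false → X
clash refl ()

∧-elim : {a b : Bool} → a ∧ b ≡ true → a ≡ true × b ≡ true
∧-elim {true} {true} _ = refl , refl

∧-intro : {a b : Bool} → a ≡ true → b ≡ true → a ∧ b ≡ true
∧-intro refl refl = refl

not-elim : {a : Bool} → not a ≡ true → a ≡ false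
not-elim {false} _ = refl

not-intro : {a : Bool} → a ≡ false → not a ≡ true
not-intro refl = refl

witness : {X : Set} {d : Dec X} → ⌊ d ⌋ ≡ true → X
witness {d = yes x} _ = x

refute : {X : Set} {d : Dec X} → ⌊ d ⌋ ≡ false → ¬ X
refute {d = no ¬x} _ = ¬x

holds : {X : Set} {d : Dec X} → X → ⌊ d ⌋ ≡ true
holds {d = yes _} _ = refl
holds {d = no ¬x} x = ⊥-elim (¬x x)

fails : {X : Set} {d : Dec X} → ¬ X → ⌊ d ⌋ ≡ false
fails {d = yes x} ¬x = ⊥-elim (¬x x)
fails {d = no _}  _  = refl

-- A digit for `funToFin`, which turns a 0-1 vector of length m into an element of `Fin (2 ^ m)`.
bit : Bool → Fin 2
bit true  = suc zero
bit false = zero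

bit-inj : ∀ {p q} → bit p ≡ bit q → p ≡ q
bit-inj {true}  {true}  _ = refl
bit-inj {false} {false} _ = refl

𝟙 : Bool → ℕ
𝟙 b = if b then 1 else 0

𝟙≤1 : ∀ b → 𝟙 b ≤ 1
𝟙≤1 true  = s≤s z≤n
𝟙≤1 false = z≤n

𝟙-mono : {a b : Bool} → (a ≡ true → b ≡ true) → 𝟙 a ≤ 𝟙 b
𝟙-mono {true} h with refl ← h refl = s≤s z≤n
𝟙-mono {false} _ = z≤n

𝟙-∧ : ∀ a b → 𝟙 (a ∧ b) ≡ 𝟙 a * 𝟙 b
𝟙-∧ true  b = sym (+-identityʳ (𝟙 b))
𝟙-∧ false b = refl

Inj : {m n : ℕ} → (Fin m → Fin n) → Set
Inj f = ∀ i j → f i ≡ f j → i ≡ j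

sum-mono : ∀ {n} {f g : Fin n → ℕ} → (∀ i → f i ≤ g i) → sum f ≤ sum g
sum-mono {zero}  h = z≤n
sum-mono {suc n} h = +-mono-≤ (h zero) (sum-mono (h ∘ suc))

sum-const : ∀ n c → sum {n} (λ _ → c) ≡ n * c
sum-const zero    c = refl
sum-const (suc n) c = cong (c +_) (sum-const n c)

sum≤ : ∀ {n} {f : Fin n → ℕ} {c} → (∀ i → f i ≤ c) → sum f ≤ n * c
sum≤ {n} {c = c} h = ≤-trans (sum-mono h) (≤-reflexive (sum-const n c))

term≤sum : ∀ {n} (f : Fin n → ℕ) i → f i ≤ sum f
term≤sum f zero    = m≤m+n _ _
term≤sum f (suc i) = ≤-trans (term≤sum (f ∘ suc) i) (m≤n+m _ _)

-- Opaque, so that unification recovers the predicate from the count.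
opaque
  # : ∀ {n} → (Fin n → Bool) → ℕ
  # p = sum (λ i → 𝟙 (p i))

  #-sum : ∀ {n} (p : Fin n → Bool) → # p ≡ sum (λ i → 𝟙 (p i))
  #-sum p = refl

#-suc : ∀ {n} (p : Fin (suc n) → Bool) → # p ≡ 𝟙 (p zero) + # (p ∘ suc)
#-suc p = trans (#-sum p) (cong (𝟙 (p zero) +_) (sym (#-sum (p ∘ suc))))

#-mono : ∀ {n} {p q : Fin n → Bool} → (∀ i → p i ≡ true → q i ≡ true) → # p ≤ # q
#-mono {p = p} {q} h = ≤-trans (≤-reflexive (#-sum p))
  (≤-trans (sum-mono (λ i → 𝟙-mono (h i))) (≤-reflexive (sym (#-sum q))))

#-cong : ∀ {n} {p q : Fin n → Bool} → (∀ i → p i ≡ q i) → # p ≡ # q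
#-cong {p = p} {q} h = trans (#-sum p) (trans (sum-cong-≗ (λ i → cong 𝟙 (h i))) (sym (#-sum q)))

#-all : ∀ n → # {n} (λ _ → true) ≡ n
#-all n = trans (#-sum {n} (λ _ → true)) (trans (sum-const n 1) (*-identityʳ n))

#-none : ∀ n → # {n} (λ _ → false) ≡ 0
#-none n = trans (#-sum {n} (λ _ → false)) (trans (sum-const n 0) (*-zeroʳ n))

#≤n : ∀ {n} (p : Fin n → Bool) → # p ≤ n
#≤n {n} p = ≤-trans (≤-reflexive (#-sum p))
  (≤-trans (sum≤ (λ i → 𝟙≤1 (p i))) (≤-reflexive (*-identityʳ n)))

#-pos : ∀ {n} (p : Fin n → Bool) i → p i ≡ true → 1 ≤ # p
#-pos p i h = ≤-trans (≤-reflexive (cong 𝟙 (sym h)))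
  (≤-trans (term≤sum (λ i → 𝟙 (p i)) i) (≤-reflexive (sym (#-sum p))))

#-witness : ∀ {n} (p : Fin n → Bool) → 1 ≤ # p → ∃[ i ] p i ≡ true
#-witness {n} p h with any? (λ i → p i ≟ᵇ true)
... | yes w = w
... | no ¬w = ⊥-elim (1+n≰n (≤-trans h (≤-reflexive
        (trans (#-cong (λ i → ≢true (λ e → ¬w (i , e)))) (#-none n)))))

#-empty : ∀ {n} (p : Fin n → Bool) → (∀ i → p i ≡ true → ⊥) → # p ≡ 0
#-empty {n} p h = trans (#-cong (λ i → ≢true (h i))) (#-none n)

#≤1 : ∀ {n} (p : Fin n → Bool) → (∀ i j → p i ≡ true → p j ≡ true → i ≡ j) → # p ≤ 1
#≤1 {zero}  p h = ≤-trans (#≤n p) z≤n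
#≤1 {suc n} p h with decide (p zero)
... | inj₁ e rewrite #-suc p | e | #-empty (p ∘ suc) (λ i q → 0≢1+n (h zero (suc i) e q)) = s≤s z≤n
... | inj₂ e rewrite #-suc p | e = #≤1 (p ∘ suc) (λ i j a b → suc-injective (h (suc i) (suc j) a b))

#-split : ∀ {n} (p q : Fin n → Bool) → # p ≡ # (λ i → p i ∧ q i) + # (λ i → p i ∧ not (q i))
#-split p q = begin
  # p                                                        ≡⟨ #-sum p ⟩
  sum (λ i → 𝟙 (p i))                                        ≡⟨ sum-cong-≗ (λ i → eq (p i) (q i)) ⟩
  sum (λ i → 𝟙 (p i ∧ q i) + 𝟙 (p i ∧ not (q i)))            ≡⟨ ∑-distrib-+ (λ i → 𝟙 (p i ∧ q i)) _ ⟩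
  sum (λ i → 𝟙 (p i ∧ q i)) + sum (λ i → 𝟙 (p i ∧ not (q i))) ≡⟨ cong₂ _+_ (#-sum _) (#-sum _) ⟨
  # (λ i → p i ∧ q i) + # (λ i → p i ∧ not (q i))            ∎
  where
  open ≡-Reasoning
  eq : ∀ a b → 𝟙 a ≡ 𝟙 (a ∧ b) + 𝟙 (a ∧ not b)
  eq true true   = refl
  eq true false  = refl
  eq false _     = refl

#-swap : ∀ {a b} (R : Fin a → Fin b → Bool) → sum (λ i → # (R i)) ≡ sum (λ j → # (λ i → R i j))
#-swap R = begin
  sum (λ i → # (R i))                     ≡⟨ sum-cong-≗ (λ i → #-sum (R i)) ⟩
  sum (λ i → sum (λ j → 𝟙 (R i j)))       ≡⟨ ∑-comm (λ i j → 𝟙 (R i j)) ⟩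
  sum (λ j → sum (λ i → 𝟙 (R i j)))       ≡⟨ sum-cong-≗ (λ j → #-sum (λ i → R i j)) ⟨
  sum (λ j → # (λ i → R i j))             ∎
  where open ≡-Reasoning

sum-covers : ∀ {a b} (p : Fin a → Bool) (R : Fin a → Fin b → Bool) →
  (∀ i → p i ≡ true → ∃[ j ] R i j ≡ true) → # p ≤ sum (λ j → # (λ i → p i ∧ R i j))
sum-covers p R h = ≤-trans (≤-reflexive (#-sum p))
  (≤-trans (sum-mono row) (≤-reflexive (#-swap (λ i j → p i ∧ R i j))))
  where
  row : ∀ i → 𝟙 (p i) ≤ # (λ j → p i ∧ R i j)
  row i with decide (p i)
  ... | inj₂ e rewrite e = z≤n
  ... | inj₁ e = let j , r = h i e in
    ≤-trans (𝟙≤1 (p i)) (#-pos (λ j → p i ∧ R i j) j (∧-intro e r))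

double-count : ∀ {a b} (p : Fin a → Bool) (q : Fin b → Bool) (R : Fin a → Fin b → Bool) c →
  (∀ i → p i ≡ true → ∃[ j ] q j ≡ true × R i j ≡ true) →
  (∀ j → q j ≡ true → # (λ i → p i ∧ R i j) ≤ c) → # p ≤ c * # q
double-count p q R c h bound = begin
  # p                                             ≤⟨ sum-covers p (λ i j → q j ∧ R i j)
                                                       (λ i e → let j , x , y = h i e in j , ∧-intro x y) ⟩
  sum (λ j → # (λ i → p i ∧ (q j ∧ R i j)))       ≤⟨ sum-mono col ⟩
  sum (λ j → c * 𝟙 (q j))                         ≡⟨ *-distribˡ-sum c (λ j → 𝟙 (q j)) ⟨
  c * sum (λ j → 𝟙 (q j))                         ≡⟨ cong (c *_) (#-sum q) ⟨
  c * # q                                         ∎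
  where
  open ≤-Reasoning
  col : ∀ j → # (λ i → p i ∧ (q j ∧ R i j)) ≤ c * 𝟙 (q j)
  col j with decide (q j)
  ... | inj₁ e rewrite e | *-identityʳ c = bound j e
  ... | inj₂ e rewrite e = ≤-trans (≤-reflexive (#-empty _ (λ i x → clash (proj₂ (∧-elim {p i} x)) refl))) z≤n

inj⇒≤# : ∀ {k n} (f : Fin k → Fin n) (p : Fin n → Bool) → Inj f → (∀ c → p (f c) ≡ true) → k ≤ # p
inj⇒≤# {k} f p inj h = begin
  k                    ≡⟨ #-all k ⟨
  # {k} (λ _ → true)   ≤⟨ double-count (λ _ → true) p (λ c v → ⌊ f c ≟ v ⌋) 1
                           (λ c _ → f c , h c , holds refl)
                           (λ v _ → #≤1 _ (λ i j a b → inj i j (trans (witness a) (sym (witness b))))) ⟩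
  1 * # p              ≡⟨ *-identityˡ (# p) ⟩
  # p                  ∎
  where open ≤-Reasoning

covered⇒#≤ : ∀ {k n} (f : Fin k → Fin n) (p : Fin n → Bool) → (∀ v → p v ≡ true → ∃[ c ] f c ≡ v) → # p ≤ k
covered⇒#≤ {k} f p h = begin
  # p                       ≤⟨ double-count p (λ _ → true) (λ v c → ⌊ f c ≟ v ⌋) 1
                                (λ v e → let c , q = h v e in c , refl , holds q)
                                (λ c _ → #≤1 _ (λ u v a b → trans (sym (witness (proj₂ (∧-elim {p u} a))))
                                                                  (witness (proj₂ (∧-elim {p v} b))))) ⟩
  1 * # {k} (λ _ → true)    ≡⟨ *-identityˡ _ ⟩
  # {k} (λ _ → true)        ≡⟨ #-all k ⟩
  k                         ∎
  where open ≤-Reasoning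

∷-inj : ∀ {k n} {v : Fin n} {f : Fin k → Fin n} → Inj f → (∀ c → f c ≢ v) → Inj (v ∷ f)
∷-inj inj new zero    zero    _ = refl
∷-inj inj new zero    (suc j) e = ⊥-elim (new j (sym e))
∷-inj inj new (suc i) zero    e = ⊥-elim (new i e)
∷-inj inj new (suc i) (suc j) e = cong suc (inj i j e)

∷-all : ∀ {k n} {v : Fin n} {f : Fin k → Fin n} (p : Fin n → Bool) →
  p v ≡ true → (∀ c → p (f c) ≡ true) → ∀ c → p ((v ∷ f) c) ≡ true
∷-all p a b zero    = a
∷-all p a b (suc c) = b c

opaque
  extend : ∀ {k n} (f : Fin k → Fin n) (p : Fin n → Bool) → k < # p →
    ∃[ v ] p v ≡ true × (∀ c → f c ≢ v)
  extend f p k< with any? (λ v → (p v ∧ not ⌊ any? (λ c → f c ≟ v) ⌋) ≟ᵇ true)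
  ... | yes (v , e) = let a , b = ∧-elim {p v} e in v , a , λ c q → refute (not-elim b) (c , q)
  ... | no none = ⊥-elim (<⇒≱ k< (covered⇒#≤ f p (λ v e → case any? (λ c → f c ≟ v) of λ where
          (yes q) → q
          (no ¬q) → ⊥-elim (none (v , ∧-intro e (not-intro (fails ¬q)))))))

opaque
  pick : ∀ {n} k (p : Fin n → Bool) → k ≤ # p → Σ[ f ∈ (Fin k → Fin n) ] Inj f × (∀ c → p (f c) ≡ true)
  pick zero    p _ = (λ ()) , (λ ()) , (λ ())
  pick (suc k) p h =
    let f , inj , all = pick k p (≤-trans (n≤1+n k) h)
        v , pv , new  = extend f p h
    in v ∷ f , ∷-inj inj new , ∷-all p pv all

outside-unique : ∀ {k n} (f : Fin k → Fin n) (p : Fin n → Bool) → Inj f → (∀ c → p (f c) ≡ true) →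
  # p ≤ suc k → ∀ u v → p u ≡ true → p v ≡ true → (∀ c → f c ≢ u) → (∀ c → f c ≢ v) → u ≡ v
outside-unique f p inj all bound u v pu pv nu nv with u ≟ v
... | yes e = e
... | no ¬e = ⊥-elim (1+n≰n (≤-trans (inj⇒≤# (u ∷ (v ∷ f)) p
        (∷-inj (∷-inj inj nv) λ where
          zero    e → ¬e (sym e)
          (suc c) e → nu c e)
        (∷-all p pu (∷-all p pv all))) bound))

image-full : ∀ {k n} (f : Fin k → Fin n) (p : Fin n → Bool) → Inj f → (∀ c → p (f c) ≡ true) →
  # p ≤ k → ∀ v → p v ≡ true → ∃[ c ] f c ≡ v
image-full f p inj all bound v pv with any? (λ c → f c ≟ v)
... | yes e = e
... | no ¬e = ⊥-elim (1+n≰n (≤-trans (inj⇒≤# (v ∷ f) p (∷-inj inj (λ c e → ¬e (c , e))) (∷-all p pv all)) bound))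

record Enum {n : ℕ} (p : Fin n → Bool) (k : ℕ) : Set where
  field
    el    : Fin k → Fin n
    inj   : Inj el
    mem   : ∀ c → p (el c) ≡ true
    cover : ∀ v → p v ≡ true → ∃[ c ] el c ≡ v

enum : ∀ {n k} (p : Fin n → Bool) → # p ≡ k → Enum p k
enum p refl = let f , inj , all = pick (# p) p ≤-refl in
  record { el = f ; inj = inj ; mem = all ; cover = image-full f p inj all ≤-refl }

Enum⇒# : ∀ {n k} {p : Fin n → Bool} → Enum p k → # p ≡ k
Enum⇒# {p = p} E = ≤-antisym (covered⇒#≤ el p cover) (inj⇒≤# el p inj mem)
  where open Enum E

opaque
  argmax : ∀ {n} (f : Fin (suc n) → ℕ) → ∃[ v ] (∀ u → f u ≤ f v)
  argmax {zero}  f = zero , λ { zero → ≤-refl }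
  argmax {suc n} f with argmax (f ∘ suc)
  ... | v , h with ≤-total (f zero) (f (suc v))
  ...   | inj₁ le = suc v , λ { zero → le ; (suc u) → h u }
  ...   | inj₂ ge = zero  , λ { zero → ≤-refl ; (suc u) → ≤-trans (h u) ge }

argmax′ : ∀ {n} → Fin n → (f : Fin n → ℕ) → ∃[ v ] (∀ u → f u ≤ f v)
argmax′ {suc n} _ f = argmax f

#-single : ∀ {n} (v : Fin n) → # (λ u → ⌊ v ≟ u ⌋) ≡ 1
#-single v = ≤-antisym (#≤1 _ (λ i j a b → trans (sym (witness a)) (witness b))) (#-pos _ v (holds refl))

sum-single : ∀ {n} (v : Fin n) (f : Fin n → ℕ) → sum (λ u → 𝟙 ⌊ v ≟ u ⌋ * f u) ≡ f v
sum-single v f = trans (sum-cong-≗ eq) (trans (sym (*-distribʳ-sum (f v) (λ u → 𝟙 ⌊ v ≟ u ⌋)))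
                   (trans (cong (_* f v) (trans (sym (#-sum _)) (#-single v))) (+-identityʳ (f v))))
  where
  eq : ∀ u → 𝟙 ⌊ v ≟ u ⌋ * f u ≡ 𝟙 ⌊ v ≟ u ⌋ * f v
  eq u with v ≟ u
  ... | yes refl = refl
  ... | no _     = refl

#-remove : ∀ {n} (p : Fin n → Bool) x → p x ≡ true → # p ≡ suc (# (λ v → p v ∧ not ⌊ x ≟ v ⌋))
#-remove p x px = trans (#-split p (λ v → ⌊ x ≟ v ⌋)) (cong (_+ # (λ v → p v ∧ not ⌊ x ≟ v ⌋)) one)
  where
  one : # (λ v → p v ∧ ⌊ x ≟ v ⌋) ≡ 1
  one = ≤-antisym
    (#≤1 _ (λ i j a b → trans (sym (witness (proj₂ (∧-elim {p i} a)))) (witness (proj₂ (∧-elim {p j} b)))))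
    (#-pos _ x (∧-intro px (holds refl)))

sum-swap-weight : ∀ {a b} (R : Fin a → Fin b → Bool) (f : Fin b → ℕ) →
  sum (λ i → sum (λ j → 𝟙 (R i j) * f j)) ≡ sum (λ j → # (λ i → R i j) * f j)
sum-swap-weight R f = trans (∑-comm (λ i j → 𝟙 (R i j) * f j)) (sum-cong-≗ (λ j →
  trans (sym (*-distribʳ-sum (f j) (λ i → 𝟙 (R i j)))) (cong (_* f j) (sym (#-sum _)))))

*-#-sum : ∀ {n} (p : Fin n → Bool) c → # p * c ≡ sum (λ i → 𝟙 (p i) * c)
*-#-sum p c = trans (cong (_* c) (#-sum p)) (*-distribʳ-sum c (λ i → 𝟙 (p i)))

𝟙*-mono : ∀ b {x y} → (b ≡ true → x ≤ y) → 𝟙 b * x ≤ 𝟙 b * y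
𝟙*-mono true  h = *-monoʳ-≤ 1 (h refl)
𝟙*-mono false h = z≤n

-- Codegree bounds, maximal independent sets and their links

module Codegree {n s : ℕ} (A : Fin n → Fin n → Bool) (I : Fin s → Bool) (M : Fin s → Fin n → Bool) (t k : ℕ)
  (noClique : (f : Fin (3 + k) → Fin n) → (∀ c → ∃[ i ] I i ≡ true × M i (f c) ≡ true) →
              (∀ c d → c ≢ d → A (f c) (f d) ≡ true) → ⊥)
  (adjacent : ∀ i j w → I i ≡ true → I j ≡ true → M j w ≡ true → M i w ≡ false →
              ∃[ y ] M i y ≡ true × M j y ≡ false × A w y ≡ true)
  (size : ∀ i → I i ≡ true → # (M i) ≡ t)
  (distinct : ∀ i j → I i ≡ true → I j ≡ true → (∀ v → M i v ≡ true → M j v ≡ true) → i ≡ j)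
  where

  -- The elements completing the common part to the different sets are pairwise adjacent.
  codegree≤ : ∀ {p} → t ≡ suc p → (g : Fin p → Fin n) → Inj g → (J : Fin s → Bool) →
    (∀ j → J j ≡ true → I j ≡ true) → (∀ j → J j ≡ true → ∀ c → M j (g c) ≡ true) → # J ≤ 2 + k
  codegree≤ {p} t≡ g inj J J⊂I g∈ with 3 + k ≤? # J
  ... | no few = ≤-pred (≰⇒> few)
  ... | yes many = ⊥-elim (noClique e (λ c → h c , hI c , e∈ c) (λ c d c≢d → joined d c (λ q → c≢d (sym q))))
    where
    picked = pick (3 + k) J many
    h = proj₁ picked
    hI : ∀ c → I (h c) ≡ true
    hI c = J⊂I (h c) (proj₂ (proj₂ picked) c)
    g∈h : ∀ c d → M (h c) (g d) ≡ true
    g∈h c d = g∈ (h c) (proj₂ (proj₂ picked) c) d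
    size-h : ∀ c → # (M (h c)) ≡ suc p
    size-h c = trans (size (h c) (hI c)) t≡
    ext : ∀ c → ∃[ v ] M (h c) v ≡ true × (∀ d → g d ≢ v)
    ext c = extend g (M (h c)) (≤-reflexive (sym (size-h c)))
    e = λ c → proj₁ (ext c)
    e∈ : ∀ c → M (h c) (e c) ≡ true
    e∈ c = proj₁ (proj₂ (ext c))
    only : ∀ c v → M (h c) v ≡ true → (∀ d → g d ≢ v) → v ≡ e c
    only c v v∈ new = outside-unique g (M (h c)) inj (g∈h c) (≤-reflexive (size-h c)) v (e c) v∈ (e∈ c) new
                        (proj₂ (proj₂ (ext c)))
    joined : ∀ c d → c ≢ d → A (e d) (e c) ≡ true
    joined c d c≢d = subst (λ y → A (e d) y ≡ true) (only c y y∈ (λ x q → clash (subst (λ z → M (h d) z ≡ true) q (g∈h d x)) y∉)) ey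
      where
      missing : M (h c) (e d) ≡ false
      missing = ≢true λ q → c≢d (sym (proj₁ (proj₂ picked) d c
        (distinct (h d) (h c) (hI d) (hI c) λ v v∈ → case any? (λ x → g x ≟ v) of λ where
          (yes (x , refl)) → g∈h c x
          (no new) → subst (λ z → M (h c) z ≡ true) (sym (only d v v∈ (λ x r → new (x , r)))) q)))
      nb = adjacent (h c) (h d) (e d) (hI c) (hI d) (e∈ d) missing
      y = proj₁ nb
      y∈ = proj₁ (proj₂ nb)
      y∉ = proj₁ (proj₂ (proj₂ nb))
      ey = proj₂ (proj₂ (proj₂ nb))

  module _ {p} (t≡ : t ≡ 2 + p) (g : Fin p → Fin n) (inj : Inj g) (J : Fin s → Bool)
    (J⊂I : ∀ j → J j ≡ true → I j ≡ true) (g∈ : ∀ j → J j ≡ true → ∀ c → M j (g c) ≡ true) where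

    codegree₊≤ : ∀ v → (∀ c → g c ≢ v) → # (λ j → J j ∧ M j v) ≤ 2 + k
    codegree₊≤ v new = codegree≤ t≡ (v ∷ g) (∷-inj inj new) _ (λ j q → J⊂I j (proj₁ (∧-elim q)))
      (λ j q → ∷-all (M j) (proj₂ (∧-elim {J j} q)) (g∈ j (proj₁ (∧-elim q))))

    -- At most 2 + k sets of J contain b. Any other one contains a neighbour y of b outside `M i`,
    -- hence outside g, and at most 2 + k sets of J contain g together with y.
    degree-bound : ∀ i b → J i ≡ true → M i b ≡ true → (∀ c → g c ≢ b) → # J ≤ (2 + k) + (2 + k) * # (A b)
    degree-bound i b Ji b∈ new = begin
      # J                                                             ≡⟨ #-split J (λ j → M j b) ⟩
      # (λ j → J j ∧ M j b) + # (λ j → J j ∧ not (M j b))             ≤⟨ +-mono-≤ (codegree₊≤ b new) rest ⟩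
      (2 + k) + (2 + k) * # (A b)                                     ∎
      where
      open ≤-Reasoning
      rest : # (λ j → J j ∧ not (M j b)) ≤ (2 + k) * # (A b)
      rest = double-count _ (A b) (λ j y → M j y ∧ not (M i y)) (2 + k)
        (λ j q → let Jj , b∉ = ∧-elim {J j} q
                     y , y∈ , y∉ , by = adjacent j i b (J⊂I j Jj) (J⊂I i Ji) b∈ (not-elim b∉)
                 in y , by , ∧-intro y∈ (not-intro y∉))
        λ y _ → case decide (M i y) of λ where
          (inj₁ y∈) → ≤-trans (≤-reflexive (#-empty _ λ j q →
              clash y∈ (not-elim (proj₂ (∧-elim {M j y} (proj₂ (∧-elim {J j ∧ not (M j b)} q))))))) z≤n
          (inj₂ y∉) → ≤-trans (#-mono λ j q → let l , r = ∧-elim {J j ∧ not (M j b)} q in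
                                 ∧-intro (proj₁ (∧-elim l)) (proj₁ (∧-elim {M j y} r)))
                              (codegree₊≤ y (λ c q → clash (subst (λ z → M i z ≡ true) q (g∈ i Ji c)) y∉))

    -- Each set of J has a vertex b outside g, and `degree-bound` at b bounds the size of J. When
    -- this is added over J, a vertex serves as b for at most 2 + k sets. Hence only O(√m) sets can
    -- share t - 2 vertices.
    square-bound : # J * # J ≤ # J * (2 + k) + (2 + k) * ((2 + k) * sum (λ v → # (A v)))
    square-bound = begin
      # J * # J
        ≡⟨ *-#-sum J (# J) ⟩
      sum (λ j → 𝟙 (J j) * # J)
        ≤⟨ sum-mono row ⟩
      sum (λ j → 𝟙 (J j) * (2 + k) + (2 + k) * sum (λ v → 𝟙 (R j v) * # (A v)))
        ≡⟨ ∑-distrib-+ (λ j → 𝟙 (J j) * (2 + k)) _ ⟩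
      sum (λ j → 𝟙 (J j) * (2 + k)) + sum (λ j → (2 + k) * sum (λ v → 𝟙 (R j v) * # (A v)))
        ≡⟨ cong₂ _+_ (sym (*-#-sum J (2 + k))) (sym (*-distribˡ-sum (2 + k) (λ j → sum (λ v → 𝟙 (R j v) * # (A v))))) ⟩
      # J * (2 + k) + (2 + k) * sum (λ j → sum (λ v → 𝟙 (R j v) * # (A v)))
        ≡⟨ cong (λ z → # J * (2 + k) + (2 + k) * z) (sum-swap-weight R (λ v → # (A v))) ⟩
      # J * (2 + k) + (2 + k) * sum (λ v → # (λ j → R j v) * # (A v))
        ≤⟨ +-monoʳ-≤ (# J * (2 + k)) (*-monoʳ-≤ (2 + k) (sum-mono col)) ⟩
      # J * (2 + k) + (2 + k) * sum (λ v → (2 + k) * # (A v))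
        ≡⟨ cong (λ z → # J * (2 + k) + (2 + k) * z) (sym (*-distribˡ-sum (2 + k) (λ v → # (A v)))) ⟩
      # J * (2 + k) + (2 + k) * ((2 + k) * sum (λ v → # (A v))) ∎
      where
      open ≤-Reasoning
      fresh : Fin n → Bool
      fresh v = not ⌊ any? (λ c → g c ≟ v) ⌋
      R : Fin s → Fin n → Bool
      R j v = J j ∧ (M j v ∧ fresh v)
      col : ∀ v → # (λ j → R j v) * # (A v) ≤ (2 + k) * # (A v)
      col v = *-monoˡ-≤ (# (A v)) (case decide (fresh v) of λ where
        (inj₁ f) → ≤-trans (#-mono λ j q → let a , b = ∧-elim {J j} q in ∧-intro a (proj₁ (∧-elim b)))
                     (codegree₊≤ v (λ c q → refute (not-elim f) (c , q)))
        (inj₂ f) → ≤-trans (≤-reflexive (#-empty _ λ j q → clash (proj₂ (∧-elim {M j v} (proj₂ (∧-elim {J j} q)))) f)) z≤n)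
      row : ∀ j → 𝟙 (J j) * # J ≤ 𝟙 (J j) * (2 + k) + (2 + k) * sum (λ v → 𝟙 (R j v) * # (A v))
      row j with decide (J j)
      ... | inj₂ e rewrite e = z≤n
      ... | inj₁ e = begin
        𝟙 (J j) * # J                             ≡⟨ cong (λ z → 𝟙 z * # J) e ⟩
        1 * # J                                   ≡⟨ *-identityˡ (# J) ⟩
        # J                                       ≤⟨ degree-bound j b e b∈ new ⟩
        (2 + k) + (2 + k) * # (A b)               ≡⟨ cong₂ (λ x y → x + (2 + k) * y)
                                                       (trans (sym (*-identityˡ _)) (cong (λ z → 𝟙 z * (2 + k)) (sym e)))
                                                       (trans (sym (*-identityˡ _)) (cong (λ z → 𝟙 z * # (A b)) (sym Rb))) ⟩
        𝟙 (J j) * (2 + k) + (2 + k) * (𝟙 (R j b) * # (A b))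
                                                  ≤⟨ +-monoʳ-≤ (𝟙 (J j) * (2 + k)) (*-monoʳ-≤ (2 + k)
                                                       (term≤sum (λ v → 𝟙 (R j v) * # (A v)) b)) ⟩
        𝟙 (J j) * (2 + k) + (2 + k) * sum (λ v → 𝟙 (R j v) * # (A v)) ∎
        where
        ext = extend g (M j) (≤-trans (n≤1+n _) (≤-reflexive (sym (trans (size j (J⊂I j e)) t≡))))
        b = proj₁ ext
        b∈ = proj₁ (proj₂ ext)
        new = proj₂ (proj₂ ext)
        Rb : R j b ≡ true
        Rb = ∧-intro e (∧-intro b∈ (not-intro (fails λ q → new (proj₁ q) (proj₂ q))))

-- The sets M i with I i are distinct maximal independent t-subsets of the triangle-free graph A on W.
record MIS {n s : ℕ} (t : ℕ) (A : Fin n → Fin n → Bool) (W : Fin n → Bool)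
           (I : Fin s → Bool) (M : Fin s → Fin n → Bool) : Set where
  field
    A-sym    : ∀ u v → A u v ≡ true → A v u ≡ true
    A⊂W      : ∀ u v → A u v ≡ true → W u ≡ true
    no△      : ∀ u v w → A u v ≡ true → A v w ≡ true → A u w ≡ true → ⊥
    M⊂W      : ∀ i v → I i ≡ true → M i v ≡ true → W v ≡ true
    indep    : ∀ i u v → I i ≡ true → M i u ≡ true → M i v ≡ true → A u v ≡ true → ⊥
    dominate : ∀ i w → I i ≡ true → W w ≡ true → M i w ≡ false → ∃[ y ] M i y ≡ true × A w y ≡ true
    size     : ∀ i → I i ≡ true → # (M i) ≡ t
    distinct : ∀ i j → I i ≡ true → I j ≡ true → (∀ v → M i v ≡ true → M j v ≡ true) → i ≡ j

  adjacent : ∀ i j w → I i ≡ true → I j ≡ true → M j w ≡ true → M i w ≡ false →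
             ∃[ y ] M i y ≡ true × M j y ≡ false × A w y ≡ true
  adjacent i j w Ii Ij w∈ w∉ = let y , y∈ , wy = dominate i w Ii (M⊂W j w Ij w∈) w∉ in
    y , y∈ , ≢true (λ q → indep j w y Ij w∈ q wy) , wy

  noClique : (f : Fin 3 → Fin n) → (∀ c → ∃[ i ] I i ≡ true × M i (f c) ≡ true) →
             (∀ c d → c ≢ d → A (f c) (f d) ≡ true) → ⊥
  noClique f _ h = no△ (f zero) (f (suc zero)) (f (suc (suc zero)))
    (h _ _ (λ ())) (h _ _ (λ ())) (h _ _ (λ ()))

  -- The case r = 3. `Codegree` asks for little more than the exchange property `adjacent` and a
  -- clique bound, so that `Sys` can use it for every r.
  open Codegree A I M t 0 noClique adjacent size distinct public using (codegree≤; degree-bound)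

-- The types `Fin n` and `Fin s` stay fixed; only the predicates, the sets and the edge relation
-- shrink. Links can thus be iterated without renaming vertices, and degrees can only drop.
module Link {n s : ℕ} (A : Fin n → Fin n → Bool) (W : Fin n → Bool) (I : Fin s → Bool)
  (M : Fin s → Fin n → Bool) (x : Fin n) where

  Wˣ : Fin n → Bool
  Wˣ v = (W v ∧ not (A x v)) ∧ not ⌊ x ≟ v ⌋

  Aˣ : Fin n → Fin n → Bool
  Aˣ u v = A u v ∧ (Wˣ u ∧ Wˣ v)

  Iˣ : Fin s → Bool
  Iˣ i = I i ∧ M i x

  Mˣ : Fin s → Fin n → Bool
  Mˣ i v = M i v ∧ not ⌊ x ≟ v ⌋

  link : ∀ {t} → MIS (suc t) A W I M → MIS t Aˣ Wˣ Iˣ Mˣ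
  link {t} S = record
    { A-sym    = λ u v e → let a , b = ∧-elim {A u v} e ; c , d = ∧-elim {Wˣ u} b in ∧-intro (A-sym u v a) (∧-intro d c)
    ; A⊂W      = λ u v e → proj₁ (∧-elim {Wˣ u} (proj₂ (∧-elim {A u v} e)))
    ; no△      = λ u v w a b c → no△ u v w (proj₁ (∧-elim a)) (proj₁ (∧-elim b)) (proj₁ (∧-elim c))
    ; M⊂W      = sub
    ; indep    = λ i u v a b c e → indep i u v (proj₁ (∧-elim a)) (proj₁ (∧-elim b)) (proj₁ (∧-elim c)) (proj₁ (∧-elim e))
    ; dominate = dom
    ; size     = λ i a → cong pred (trans (sym (#-remove (M i) x (proj₂ (∧-elim {I i} a)))) (size i (proj₁ (∧-elim a))))
    ; distinct = λ i j a b h → distinct i j (proj₁ (∧-elim a)) (proj₁ (∧-elim b)) (λ v v∈ → case x ≟ v of λ where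
        (yes refl) → proj₂ (∧-elim {I j} b)
        (no x≢v)   → proj₁ (∧-elim (h v (∧-intro v∈ (not-intro (fails x≢v))))))
    }
    where
    open MIS S
    sub : ∀ i v → Iˣ i ≡ true → Mˣ i v ≡ true → Wˣ v ≡ true
    sub i v a b = let Ii , x∈ = ∧-elim {I i} a ; v∈ , x≢v = ∧-elim {M i v} b in
      ∧-intro (∧-intro (M⊂W i v Ii v∈) (not-intro (≢true (indep i x v Ii x∈ v∈)))) x≢v
    dom : ∀ i w → Iˣ i ≡ true → Wˣ w ≡ true → Mˣ i w ≡ false → ∃[ y ] Mˣ i y ≡ true × Aˣ w y ≡ true
    dom i w a Ww w∉ = y , y∈ˣ , ∧-intro wy (∧-intro Ww (sub i y a y∈ˣ))
      where
      c₁ = ∧-elim {W w ∧ not (A x w)} Ww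
      c₂ = ∧-elim {W w} (proj₁ c₁)
      Ii = proj₁ (∧-elim {I i} a)
      d = dominate i w Ii (proj₁ c₂) (≢true λ q → clash (∧-intro q (proj₂ c₁)) w∉)
      y = proj₁ d
      wy = proj₂ (proj₂ d)
      y∈ˣ : Mˣ i y ≡ true
      y∈ˣ = ∧-intro (proj₁ (proj₂ d)) (not-intro (fails λ q →
        clash (A-sym w x (subst (λ z → A w z ≡ true) (sym q) wy)) (not-elim (proj₂ c₂))))

  #W-link : ∀ {t} → MIS t A W I M → W x ≡ true → # W ≡ # (A x) + suc (# Wˣ)
  #W-link S Wx = trans (#-split W (A x)) (cong₂ _+_
    (#-cong λ v → eq v (decide (A x v)))
    (#-remove (λ v → W v ∧ not (A x v)) x (∧-intro Wx (not-intro (≢true λ q → no△ x x x q q q)))))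
    where
    open MIS S
    eq : ∀ v → A x v ≡ true ⊎ A x v ≡ false → W v ∧ A x v ≡ A x v
    eq v (inj₁ e) = trans (∧-intro (A⊂W v x (A-sym x v e)) e) (sym e)
    eq v (inj₂ e) = trans (≢true λ q → clash (proj₂ (∧-elim {W v} q)) e) (sym e)

  deg-link : ∀ v → # (Aˣ v) ≤ # (A v)
  deg-link v = #-mono λ u q → proj₁ (∧-elim q)

opaque
  avoid : ∀ {k m n} (f : Fin m → Fin n) → Inj f → k < m → (g : Fin k → Fin n) → ∃[ c ] (∀ d → f c ≢ g d)
  avoid {k} f inj k<m g =
    let v , e , new = extend g (λ v → ⌊ any? (λ c → f c ≟ v) ⌋)
                        (≤-trans k<m (inj⇒≤# f _ inj (λ c → holds (c , refl))))
        c , q = witness e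
    in c , λ d r → new d (trans (sym r) q)

opaque
  choose₂ : ∀ {m n} (f : Fin 3 → Fin m) (g : Fin 3 → Fin n) → Inj f → Inj g → ∀ y z → ∃[ c ] f c ≢ y × g c ≢ z
  choose₂ f g inf ing y z with any? (λ c → ¬? (f c ≟ y) ×-dec ¬? (g c ≟ z))
  ... | yes r = r
  ... | no none = ⊥-elim (three (bad zero) (bad (suc zero)) (bad (suc (suc zero))))
    where
    bad : ∀ c → f c ≡ y ⊎ g c ≡ z
    bad c with f c ≟ y | g c ≟ z
    ... | yes e | _     = inj₁ e
    ... | no _  | yes e = inj₂ e
    ... | no a  | no b  = ⊥-elim (none (c , a , b))
    ff : ∀ {c d} → c ≢ d → f c ≡ y → f d ≡ y → ⊥
    ff ne a b = ne (inf _ _ (trans a (sym b)))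
    gg : ∀ {c d} → c ≢ d → g c ≡ z → g d ≡ z → ⊥
    gg ne a b = ne (ing _ _ (trans a (sym b)))
    three : f zero ≡ y ⊎ g zero ≡ z → f (suc zero) ≡ y ⊎ g (suc zero) ≡ z →
            f (suc (suc zero)) ≡ y ⊎ g (suc (suc zero)) ≡ z → ⊥
    three (inj₁ a) (inj₁ b) _        = ff (λ ()) a b
    three (inj₁ a) _        (inj₁ b) = ff (λ ()) a b
    three _        (inj₁ a) (inj₁ b) = ff (λ ()) a b
    three (inj₂ a) (inj₂ b) _        = gg (λ ()) a b
    three (inj₂ a) _        (inj₂ b) = gg (λ ()) a b
    three _        (inj₂ a) (inj₂ b) = gg (λ ()) a b

-- Maximal independent triples in a triangle-free graph

module Triples {n s : ℕ} {A : Fin n → Fin n → Bool} {W : Fin n → Bool} {I : Fin s → Bool}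
  {M : Fin s → Fin n → Bool} (S : MIS 3 A W I M) where

  open MIS S

  infix 4 _~_
  _~_ : Fin n → Fin n → Set
  u ~ v = A u v ≡ true

  ~s : ∀ {u v} → u ~ v → v ~ u
  ~s {u} {v} = A-sym u v

  △ : ∀ {u v w} {X : Set} → u ~ v → v ~ w → u ~ w → X
  △ a b c = ⊥-elim (no△ _ _ _ a b c)

  κ : Fin n → ℕ
  κ v = # (λ i → I i ∧ M i v)

  record Tri (i : Fin s) (x a b : Fin n) : Set where
    field
      act  : I i ≡ true
      x∈   : M i x ≡ true
      a∈   : M i a ≡ true
      b∈   : M i b ≡ true
      x≢a  : x ≢ a
      x≢b  : x ≢ b
      a≢b  : a ≢ b
      only : ∀ v → M i v ≡ true → v ≡ x ⊎ v ≡ a ⊎ v ≡ b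

  open Tri

  private variable
    i j l l′ : Fin s
    x a b c d e u v w y z : Fin n

  ≢-sym : {u v : Fin n} → u ≢ v → v ≢ u
  ≢-sym p q = p (sym q)

  swap : Tri i x a b → Tri i x b a
  swap T = record { act = act T ; x∈ = x∈ T ; a∈ = b∈ T ; b∈ = a∈ T ; x≢a = x≢b T ; x≢b = x≢a T
                  ; a≢b = ≢-sym (a≢b T)
                  ; only = λ v m → case only T v m of λ where
                      (inj₁ p) → inj₁ p
                      (inj₂ (inj₁ p)) → inj₂ (inj₂ p)
                      (inj₂ (inj₂ p)) → inj₂ (inj₁ p) }

  rotate : Tri i x a b → Tri i a x b
  rotate T = record { act = act T ; x∈ = a∈ T ; a∈ = x∈ T ; b∈ = b∈ T ; x≢a = ≢-sym (x≢a T) ; x≢b = a≢b T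
                    ; a≢b = x≢b T
                    ; only = λ v m → case only T v m of λ where
                        (inj₁ p) → inj₂ (inj₁ p)
                        (inj₂ (inj₁ p)) → inj₁ p
                        (inj₂ (inj₂ p)) → inj₂ (inj₂ p) }

  tri-at₂ : I i ≡ true → M i x ≡ true → M i a ≡ true → x ≢ a → ∃[ b ] Tri i x a b
  tri-at₂ {i} {x} {a} Ii mx ma x≢a = o , record
    { act = Ii ; x∈ = mx ; a∈ = ma ; b∈ = mb ; x≢a = x≢a ; x≢b = new (suc zero) ; a≢b = new zero
    ; only = λ v m → case image-full (o ∷ g) (M i) (∷-inj ginj new) (∷-all (M i) mb gall)
                            (≤-reflexive (size i Ii)) v m of λ where
        (zero , q) → inj₂ (inj₂ (sym q))
        (suc zero , q) → inj₂ (inj₁ (sym q))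
        (suc (suc zero) , q) → inj₁ (sym q) }
    where
    g : Fin 2 → Fin n
    g = a ∷ (λ _ → x)
    ginj : Inj g
    ginj = ∷-inj {f = λ (_ : Fin 1) → x} (λ { zero zero _ → refl }) (λ _ → x≢a)
    gall : ∀ c → M i (g c) ≡ true
    gall = ∷-all {f = λ (_ : Fin 1) → x} (M i) ma (λ _ → mx)
    ext = extend g (M i) (≤-reflexive (sym (size i Ii)))
    o = proj₁ ext
    mb = proj₁ (proj₂ ext)
    new = proj₂ (proj₂ ext)

  tri-at : I i ≡ true → M i x ≡ true → ∃[ a ] ∃[ b ] Tri i x a b
  tri-at {i} {x} Ii mx =
    let a , ma , new = extend {1} (λ _ → x) (M i) (≤-trans (s≤s (s≤s z≤n)) (≤-reflexive (sym (size i Ii))))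
    in a , tri-at₂ Ii mx ma (new zero)

  hits : Tri i x a b → W w ≡ true → w ≢ x → w ≢ a → w ≢ b → w ~ x ⊎ w ~ a ⊎ w ~ b
  hits {i} {w = w} T Ww p q r with decide (M i w)
  ... | inj₁ m = ⊥-elim (case only T w m of λ where
          (inj₁ e) → p e
          (inj₂ (inj₁ e)) → q e
          (inj₂ (inj₂ e)) → r e)
  ... | inj₂ m with dominate i w (act T) Ww m
  ...   | y , y∈ , wy with only T y y∈
  ...     | inj₁ refl        = inj₁ wy
  ...     | inj₂ (inj₁ refl) = inj₂ (inj₁ wy)
  ...     | inj₂ (inj₂ refl) = inj₂ (inj₂ wy)

  ≁ : I i ≡ true → M i u ≡ true → M i v ≡ true → ¬ (u ~ v)
  ≁ {i} {u} {v} = indep i u v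

  inW : I i ≡ true → M i u ≡ true → W u ≡ true
  inW {i} {u} = M⊂W i u

  ∉⇒≢ : M i u ≡ true → M i v ≡ false → u ≢ v
  ∉⇒≢ p q refl = clash p q

  ~⇒≢ : u ~ w → ¬ (v ~ w) → u ≢ v
  ~⇒≢ p q refl = q p

  -- The codegree bound for r = 3: the third vertices of three triples through u and v would form a
  -- triangle.
  pair-in-two : I i ≡ true → I j ≡ true → I l ≡ true → i ≢ j → i ≢ l → j ≢ l → u ≢ v →
    M i u ≡ true → M j u ≡ true → M l u ≡ true → M i v ≡ true → M j v ≡ true → M l v ≡ true → ⊥
  pair-in-two {i} {j} {l} {u} {v} Ii Ij Il i≢j i≢l j≢l u≢v iu ju lu iv jv lv =
    1+n≰n (≤-trans (inj⇒≤# (i ∷ (j ∷ (λ (_ : Fin 1) → l))) J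
        (∷-inj (∷-inj (λ { zero zero _ → refl }) (λ _ q → j≢l (sym q))) λ where
          zero q → i≢j (sym q)
          (suc zero) q → i≢l (sym q))
        (∷-all J (∧-intro Ii (∧-intro iu iv)) (∷-all J (∧-intro Ij (∧-intro ju jv)) (λ _ → ∧-intro Il (∧-intro lu lv)))))
      (codegree≤ refl (u ∷ (λ (_ : Fin 1) → v)) (∷-inj (λ { zero zero _ → refl }) (λ _ q → u≢v (sym q))) J
        (λ j q → proj₁ (∧-elim q))
        (λ j q → ∷-all (M j) (proj₁ (∧-elim {M j u} (proj₂ (∧-elim {I j} q))))
                   (λ _ → proj₂ (∧-elim {M j u} (proj₂ (∧-elim {I j} q)))))))
    where
    J : Fin s → Bool
    J i = I i ∧ (M i u ∧ M i v)

  -- If all edges meet the vertices g, a maximal independent set is determined by its trace on g.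
  trace-bound : ∀ {m} (g : Fin m → Fin n) →
    (∀ u v → W u ≡ true → W v ≡ true → (∀ c → g c ≢ u) → (∀ c → g c ≢ v) → ¬ (u ~ v)) → # I ≤ 2 ^ m
  trace-bound {m} g free = begin
    # I                              ≤⟨ double-count I (λ _ → true) (λ i j → ⌊ code i ≟ j ⌋) 1
                                         (λ i _ → code i , refl , holds refl)
                                         (λ j _ → #≤1 _ λ i l p q →
                                            let Ii , ci = ∧-elim {I i} p ; Il , cl = ∧-elim {I l} q in
                                            same Ii Il (trans (witness ci) (sym (witness cl)))) ⟩
    1 * # {2 ^ m} (λ _ → true)       ≡⟨ *-identityˡ _ ⟩
    # {2 ^ m} (λ _ → true)           ≡⟨ #-all (2 ^ m) ⟩
    2 ^ m                            ∎
    where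
    open ≤-Reasoning
    code : Fin s → Fin (2 ^ m)
    code i = funToFin (λ c → bit (M i (g c)))
    same : ∀ {i l} → I i ≡ true → I l ≡ true → code i ≡ code l → i ≡ l
    same {i} {l} Ii Il eq = distinct i l Ii Il sub
      where
      agree : ∀ c → M i (g c) ≡ M l (g c)
      agree c = bit-inj (trans (sym (finToFun-funToFin (λ c → bit (M i (g c))) c))
                  (trans (cong (λ z → finToFun z c) eq) (finToFun-funToFin (λ c → bit (M l (g c))) c)))
      sub : ∀ v → M i v ≡ true → M l v ≡ true
      sub v v∈ with decide (M l v)
      ... | inj₁ r = r
      ... | inj₂ v∉ with dominate l v Il (inW Ii v∈) v∉
      ...   | y , y∈ , vy with any? (λ c → g c ≟ y)
      ...     | yes (c , refl) = ⊥-elim (≁ Ii v∈ (trans (agree c) y∈) vy)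
      ...     | no y-new = ⊥-elim (free v y (inW Ii v∈) (inW Il y∈)
                  (λ c q → clash (trans (sym (agree c)) (subst (λ z → M i z ≡ true) (sym q) v∈))
                                 (subst (λ z → M l z ≡ false) (sym q) v∉))
                  (λ c q → y-new (c , q)) vy)

  more : ∀ {m} (g : Fin m → Fin s) → m < κ x → ∃[ i ] I i ≡ true × M i x ≡ true × (∀ c → g c ≢ i)
  more {x} g lt = let i , q , new = extend g (λ i → I i ∧ M i x) lt ; a , b = ∧-elim {I i} q in i , a , b , new

  -- 256 = 2 ^ 8: `Shared` finds eight vertices that meet every edge, and `trace-bound` then allows
  -- at most 2 ^ 8 triples.
  module Large (big : 256 < # I) where

    -- Almost every vertex is then adjacent to x.
    module Shared {i j l₁ l₂ : Fin s} {x c b₁ b₂ d₁ e₁ d₂ e₂ : Fin n}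
      (Ti : Tri i x c b₁) (Tj : Tri j x c b₂) (T₁ : Tri l₁ x d₁ e₁) (T₂ : Tri l₂ x d₂ e₂)
      (i≢j : i ≢ j) (i≢l₁ : i ≢ l₁) (j≢l₁ : j ≢ l₁) (i≢l₂ : i ≢ l₂) (j≢l₂ : j ≢ l₂) (l₁≢l₂ : l₁ ≢ l₂) where

      b₂≢b₁ : b₂ ≢ b₁
      b₂≢b₁ eq = i≢j (distinct i j (act Ti) (act Tj) λ v m → case only Ti v m of λ where
        (inj₁ refl) → x∈ Tj
        (inj₂ (inj₁ refl)) → a∈ Tj
        (inj₂ (inj₂ refl)) → subst (λ z → M j z ≡ true) eq (b∈ Tj))

      b₂~b₁ : b₂ ~ b₁
      b₂~b₁ with hits Ti (inW (act Tj) (b∈ Tj)) (≢-sym (x≢b Tj)) (≢-sym (a≢b Tj)) b₂≢b₁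
      ... | inj₁ p        = ⊥-elim (≁ (act Tj) (b∈ Tj) (x∈ Tj) p)
      ... | inj₂ (inj₁ p) = ⊥-elim (≁ (act Tj) (b∈ Tj) (a∈ Tj) p)
      ... | inj₂ (inj₂ p) = p

      -- If w is not adjacent to x, its neighbours in the triples i and j cannot be b₁ and b₂
      -- respectively, as b₁ ~ b₂. So one of them is c.
      near : W w ≡ true → w ≢ x → w ≢ c → w ≢ b₁ → w ≢ b₂ → ¬ (w ~ x) → w ~ c
      near Ww nx nc n₁ n₂ w≁x with hits Ti Ww nx nc n₁ | hits Tj Ww nx nc n₂
      ... | inj₁ p        | _             = ⊥-elim (w≁x p)
      ... | inj₂ (inj₁ p) | _             = p
      ... | inj₂ (inj₂ p) | inj₁ q        = ⊥-elim (w≁x q)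
      ... | inj₂ (inj₂ p) | inj₂ (inj₁ q) = q
      ... | inj₂ (inj₂ p) | inj₂ (inj₂ q) = △ q b₂~b₁ p

      -- A vertex d of a further triple at x is not c, since three triples would then contain x and
      -- c. If it is neither b₁ nor b₂, `near` makes it adjacent to c, and w completes a triangle.
      forced : I l ≡ true → M l x ≡ true → i ≢ l → j ≢ l → M l d ≡ true → d ≢ x →
        w ~ c → w ~ d → (w ~ b₁ × M l b₁ ≡ true) ⊎ (w ~ b₂ × M l b₂ ≡ true)
      forced {l} {d} Il lx i≢l j≢l ld d≢x wc wd with d ≟ b₁ | d ≟ b₂
      ... | yes refl | _        = inj₁ (wd , ld)
      ... | no _     | yes refl = inj₂ (wd , ld)
      ... | no n₁    | no n₂    with d ≟ c
      ...   | yes refl = ⊥-elim (pair-in-two (act Ti) (act Tj) Il i≢j i≢l j≢l (x≢a Ti) (x∈ Ti) (x∈ Tj) lx (a∈ Ti) (a∈ Tj) ld)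
      ...   | no n₃    = △ wd (near (inW Il ld) d≢x n₃ n₁ n₂ (≁ Il ld lx)) wc

      through : Tri l x d e → i ≢ l → j ≢ l → W w ≡ true → w ≢ x → w ≢ d → w ≢ e → ¬ (w ~ x) → w ~ c →
        (w ~ b₁ × M l b₁ ≡ true) ⊎ (w ~ b₂ × M l b₂ ≡ true)
      through T i≢l j≢l Ww n₁ n₂ n₃ w≁x wc with hits T Ww n₁ n₂ n₃
      ... | inj₁ p        = ⊥-elim (w≁x p)
      ... | inj₂ (inj₁ p) = forced (act T) (x∈ T) i≢l j≢l (a∈ T) (≢-sym (x≢a T)) wc p
      ... | inj₂ (inj₂ p) = forced (act T) (x∈ T) i≢l j≢l (b∈ T) (≢-sym (x≢b T)) wc p

      -- Different answers give the triangle w, b₁, b₂; equal ones put x and the same vertex on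
      -- three triples.
      clash-b : (w ~ b₁ × M l₁ b₁ ≡ true) ⊎ (w ~ b₂ × M l₁ b₂ ≡ true) →
                (w ~ b₁ × M l₂ b₁ ≡ true) ⊎ (w ~ b₂ × M l₂ b₂ ≡ true) → ⊥
      clash-b (inj₁ (p , _)) (inj₂ (q , _)) = △ q b₂~b₁ p
      clash-b (inj₂ (p , _)) (inj₁ (q , _)) = △ p b₂~b₁ q
      clash-b (inj₁ (_ , p)) (inj₁ (_ , q)) =
        pair-in-two (act Ti) (act T₁) (act T₂) i≢l₁ i≢l₂ l₁≢l₂ (x≢b Ti) (x∈ Ti) (x∈ T₁) (x∈ T₂) (b∈ Ti) p q
      clash-b (inj₂ (_ , p)) (inj₂ (_ , q)) =
        pair-in-two (act Tj) (act T₁) (act T₂) j≢l₁ j≢l₂ l₁≢l₂ (x≢b Tj) (x∈ Tj) (x∈ T₁) (x∈ T₂) (b∈ Tj) p q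

      g : Fin 8 → Fin n
      g = x ∷ (c ∷ (b₁ ∷ (b₂ ∷ (d₁ ∷ (e₁ ∷ (d₂ ∷ λ _ → e₂))))))

      star : ∀ w → W w ≡ true → (∀ c → w ≢ g c) → w ~ x
      star w Ww N with decide (A w x)
      ... | inj₁ p = p
      ... | inj₂ q = ⊥-elim (clash-b (through T₁ i≢l₁ j≢l₁ Ww (N 0F) (N 4F) (N 5F) w≁ wc)
                                     (through T₂ i≢l₂ j≢l₂ Ww (N 0F) (N 6F) (N 7F) w≁ wc))
        where
        w≁ : ¬ (w ~ x)
        w≁ p = clash p q
        wc : w ~ c
        wc = near Ww (N 0F) (N 1F) (N 2F) (N 3F) w≁

      contradiction : ⊥
      contradiction = <⇒≱ big (trace-bound g λ u v Wu Wv nu nv uv →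
        △ uv (star v Wv (λ c q → nv c (sym q))) (star u Wu (λ c q → nu c (sym q))))

    -- Four triples at x are needed: the two that share y, and two more that supply d₁, e₁, d₂, e₂
    -- in `Shared`.
    disjoint-at : 4 ≤ κ x → I i ≡ true → I j ≡ true → i ≢ j → M i x ≡ true → M j x ≡ true → x ≢ y →
      M i y ≡ true → M j y ≡ true → ⊥
    disjoint-at {x} {i} {j} k≥4 Ii Ij i≢j ix jx x≢y iy jy =
      let _ , Ti = tri-at₂ Ii ix iy x≢y
          _ , Tj = tri-at₂ Ij jx jy x≢y
          l₁ , I₁ , m₁ , new₁ = more (i ∷ (λ (_ : Fin 1) → j)) (≤-trans (n≤1+n 3) k≥4)
          l₂ , I₂ , m₂ , new₂ = more (l₁ ∷ (i ∷ (λ (_ : Fin 1) → j))) k≥4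
          _ , _ , T₁ = tri-at I₁ m₁
          _ , _ , T₂ = tri-at I₂ m₂
      in Shared.contradiction Ti Tj T₁ T₂ i≢j (new₁ 0F) (new₁ 1F) (new₂ 1F) (new₂ 2F) (new₂ 0F)

-- Triples through a vertex that lies on at least four triples

module HeavyTriples {n s : ℕ} {A : Fin n → Fin n → Bool} {W : Fin n → Bool} {I : Fin s → Bool}
  {M : Fin s → Fin n → Bool} (S : MIS 3 A W I M) (big : 256 < # I) where

  open MIS S
  open Triples S
  open Tri
  open Large big

  private variable
    i j l l′ : Fin s
    x a b u v w y z e e′ f f′ : Fin n

  apart : 4 ≤ κ x → Tri i x a b → I j ≡ true → M j x ≡ true → i ≢ j → M j y ≡ true → y ≢ x → y ≢ a × y ≢ b
  apart k≥4 T Ij jx i≢j jy y≢x =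
    (λ { refl → disjoint-at k≥4 (act T) Ij i≢j (x∈ T) jx (x≢a T) (a∈ T) jy }) ,
    (λ { refl → disjoint-at k≥4 (act T) Ij i≢j (x∈ T) jx (x≢b T) (b∈ T) jy })

  hits-apart : 4 ≤ κ x → Tri i x a b → I j ≡ true → M j x ≡ true → i ≢ j → M j y ≡ true → y ≢ x → y ~ a ⊎ y ~ b
  hits-apart k≥4 T Ij jx i≢j jy y≢x =
    let y≢a , y≢b = apart k≥4 T Ij jx i≢j jy y≢x in
    case hits T (inW Ij jy) y≢x y≢a y≢b of λ where
      (inj₁ r) → ⊥-elim (≁ Ij jy jx r)
      (inj₂ r) → r

  -- A vertex of another triple at x is adjacent to u or v, hence not to a, hence adjacent to b. Two
  -- such triples then lie in the neighbourhood of b apart from x, but `hits-apart` gives an edge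
  -- between them: a triangle.
  no-double : 4 ≤ κ x → Tri i x a b → Tri j x u v → Tri l x e f → Tri l′ x e′ f′ →
    i ≢ j → i ≢ l → i ≢ l′ → j ≢ l → j ≢ l′ → l ≢ l′ → a ~ u → a ~ v → ⊥
  no-double {x} {i} {a} {b} {j} {u} {v} {l} k≥4 T U P P′ i≢j i≢l i≢l′ j≢l j≢l′ l≢l′ au av =
    case hits-apart k≥4 P′ (act P) (x∈ P) (λ r → l≢l′ (sym r)) (a∈ P) (≢-sym (x≢a P)) of λ where
      (inj₁ r) → △ r (toward P′ i≢l′ j≢l′ (a∈ P′) (≢-sym (x≢a P′))) (toward P i≢l j≢l (a∈ P) (≢-sym (x≢a P)))
      (inj₂ r) → △ r (toward P′ i≢l′ j≢l′ (b∈ P′) (≢-sym (x≢b P′))) (toward P i≢l j≢l (a∈ P) (≢-sym (x≢a P)))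
    where
    toward : ∀ {l y p q} → Tri l x p q → i ≢ l → j ≢ l → M l y ≡ true → y ≢ x → y ~ b
    toward P i≢l j≢l ly y≢x with hits-apart k≥4 T (act P) (x∈ P) i≢l ly y≢x
    ... | inj₂ r = r
    ... | inj₁ ya with hits-apart k≥4 U (act P) (x∈ P) j≢l ly y≢x
    ...   | inj₁ yu = △ ya au yu
    ...   | inj₂ yv = △ ya av yv

  Spoke : Fin s → Fin n → Fin n → Fin n → Fin n → Fin n → Set
  Spoke l x a b p q = Tri l x p q × p ~ b × q ~ a × ¬ (p ~ a) × ¬ (q ~ b)

  spoke : 4 ≤ κ x → Tri i x a b → I j ≡ true → M j x ≡ true → Tri l x e f → Tri l′ x e′ f′ →
    i ≢ j → i ≢ l → i ≢ l′ → j ≢ l → j ≢ l′ → l ≢ l′ → ∃[ u ] ∃[ v ] Spoke j x a b u v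
  spoke {x} {i} {a} {b} {j} k≥4 T Ij jx P P′ i≢j i≢l i≢l′ j≢l j≢l′ l≢l′ with tri-at Ij jx
  ... | u , v , U = case hits-apart k≥4 U (act T) (x∈ T) (λ r → i≢j (sym r)) (a∈ T) (≢-sym (x≢a T)) of λ where
      (inj₁ au) → v , u , side (swap U) au
      (inj₂ av) → u , v , side U av
    where
    side : ∀ {u v} → Tri j x u v → a ~ v → Spoke j x a b u v
    side {u} {v} U av = U , ub , ~s av , u≁a , v≁b
      where
      u≁a : ¬ (u ~ a)
      u≁a ua = no-double k≥4 T U P P′ i≢j i≢l i≢l′ j≢l j≢l′ l≢l′ (~s ua) av
      ub : u ~ b
      ub = case hits-apart k≥4 T Ij jx i≢j (a∈ U) (≢-sym (x≢a U)) of λ where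
        (inj₁ r) → ⊥-elim (u≁a r)
        (inj₂ r) → r
      v≁b : ¬ (v ~ b)
      v≁b vb = no-double k≥4 (swap T) U P P′ i≢j i≢l i≢l′ j≢l j≢l′ l≢l′ (~s ub) (~s vb)

  -- The crown left by the triples at x once x is removed: a and the p lie on one side, b and the q
  -- on the other. Three triples besides {x, a, b} are kept because the chases below rule out at
  -- most two indices.
  record Crown (i : Fin s) (x a b : Fin n) : Set where
    field
      h     : Fin 3 → Fin s
      p q   : Fin 3 → Fin n
      tri   : ∀ c → Tri (h c) x (p c) (q c)
      p~b   : ∀ c → p c ~ b
      q~a   : ∀ c → q c ~ a
      p≁a   : ∀ c → ¬ (p c ~ a)
      q≁b   : ∀ c → ¬ (q c ~ b)
      p-inj : Inj p
      q-inj : Inj q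
      cross : ∀ c d → c ≢ d → p c ~ q d

  mirror : Crown i x a b → Crown i x b a
  mirror C = record
    { h = h ; p = q ; q = p ; tri = λ c → swap (tri c) ; p~b = q~a ; q~a = p~b ; p≁a = q≁b ; q≁b = p≁a
    ; p-inj = q-inj ; q-inj = p-inj ; cross = λ c d c≢d → ~s (cross d c (λ r → c≢d (sym r))) }
    where open Crown C

  assemble : 4 ≤ κ x → (h : Fin 3 → Fin s) → (∀ c → ∃[ u ] ∃[ v ] Spoke (h c) x a b u v) → Inj h → Crown i x a b
  assemble {x} {a} {b} k≥4 h sp h-inj = record
    { h = h ; p = p* ; q = q* ; tri = T* ; p~b = p*~b
    ; q~a = λ c → proj₁ (proj₂ (proj₂ (proj₂ (proj₂ (sp c)))))
    ; p≁a = λ c → proj₁ (proj₂ (proj₂ (proj₂ (proj₂ (proj₂ (sp c))))))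
    ; q≁b = λ c → proj₂ (proj₂ (proj₂ (proj₂ (proj₂ (proj₂ (sp c))))))
    ; p-inj = λ c d r → inj c d λ ne → proj₁ (apart k≥4 (T* d) (act (T* c)) (x∈ (T* c)) (ne ∘ sym) (a∈ (T* c)) (≢-sym (x≢a (T* c)))) r
    ; q-inj = λ c d r → inj c d λ ne → proj₂ (apart k≥4 (T* d) (act (T* c)) (x∈ (T* c)) (ne ∘ sym) (b∈ (T* c)) (≢-sym (x≢b (T* c)))) r
    ; cross = λ c d c≢d → case hits-apart k≥4 (T* d) (act (T* c)) (x∈ (T* c)) (λ r → c≢d (h-inj c d (sym r))) (a∈ (T* c)) (≢-sym (x≢a (T* c))) of λ where
        (inj₁ r) → △ r (p*~b d) (p*~b c)
        (inj₂ r) → r }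
    where
    p* : Fin 3 → Fin n
    p* c = proj₁ (sp c)
    q* : Fin 3 → Fin n
    q* c = proj₁ (proj₂ (sp c))
    T* : ∀ c → Tri (h c) x (p* c) (q* c)
    T* c = proj₁ (proj₂ (proj₂ (sp c)))
    p*~b : ∀ c → p* c ~ b
    p*~b c = proj₁ (proj₂ (proj₂ (proj₂ (sp c))))
    inj : ∀ c d → (h c ≢ h d → ⊥) → c ≡ d
    inj c d no-ne with h c ≟ h d
    ... | yes r = h-inj c d r
    ... | no ne = ⊥-elim (no-ne ne)

  opaque
    crown : 4 ≤ κ x → Tri i x a b → Crown i x a b
    crown {i = i} k≥4 T with more (λ (_ : Fin 1) → i) (≤-trans (s≤s (s≤s z≤n)) k≥4)
    ... | l₀ , I₀ , m₀ , n₀ with more (l₀ ∷ (λ (_ : Fin 1) → i)) (≤-trans (s≤s (s≤s (s≤s z≤n))) k≥4)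
    ...   | l₁ , I₁ , m₁ , n₁ with more (l₁ ∷ (l₀ ∷ (λ (_ : Fin 1) → i))) k≥4
    ...     | l₂ , I₂ , m₂ , n₂ with tri-at I₀ m₀ | tri-at I₁ m₁ | tri-at I₂ m₂
    ...       | _ , _ , T₀ | _ , _ , T₁ | _ , _ , T₂ = assemble k≥4 (l₀ ∷ (l₁ ∷ λ _ → l₂))
      (λ { 0F → spoke k≥4 T I₀ m₀ T₁ T₂ (n₀ 0F) (n₁ 1F) (n₂ 2F) (n₁ 0F) (n₂ 1F) (n₂ 0F)
         ; 1F → spoke k≥4 T I₁ m₁ T₀ T₂ (n₁ 1F) (n₀ 0F) (n₂ 2F) (n₁ 0F ∘ sym) (n₂ 0F) (n₂ 1F)
         ; 2F → spoke k≥4 T I₂ m₂ T₀ T₁ (n₂ 2F) (n₀ 0F) (n₁ 1F) (n₂ 1F ∘ sym) (n₂ 0F ∘ sym) (n₁ 0F) })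
      (∷-inj (∷-inj (λ { 0F 0F _ → refl }) λ { 0F r → n₂ 0F (sym r) }) λ { 0F r → n₁ 0F (sym r) ; 1F r → n₂ 1F (sym r) })

  Half : Fin s → Fin n → Fin n → Fin n → (Fin 3 → Fin n) → Set
  Half j x a b p = ∃[ y ] ∃[ z ] Tri j a y z × b ~ y × ¬ (b ~ z) × z ~ x × (∀ c → p c ≢ y → p c ~ z)

  opaque
    -- As b is not adjacent to a, it has another neighbour y in j. A vertex p, adjacent to b and not
    -- to a, cannot be adjacent to y, so it is adjacent to z; in turn b is not adjacent to z. What
    -- is left for z, adjacent to neither a nor b, is x.
    half : Tri i x a b → (C : Crown i x a b) → I j ≡ true → M j a ≡ true → M j b ≡ false → M j x ≡ false →
      Half j x a b (Crown.p C)
    half {i} {x} {a} {b} {j} T C Ij ja jb jx with tri-at Ij ja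
    ... | y , z , U = case hits U (inW (act T) (b∈ T)) (≢-sym (a≢b T)) (off (a∈ U)) (off (b∈ U)) of λ where
        (inj₁ r)         → ⊥-elim (≁ (act T) (b∈ T) (a∈ T) r)
        (inj₂ (inj₁ by)) → y , z , U , finish U by
        (inj₂ (inj₂ bz)) → z , y , swap U , finish (swap U) bz
      where
      open Crown C
      off : ∀ {v} → M j v ≡ true → b ≢ v
      off jv r = clash (subst (λ v → M j v ≡ true) (sym r) jv) jb
      finish : ∀ {y z} → Tri j a y z → b ~ y → b ~ y × ¬ (b ~ z) × z ~ x × (∀ c → p c ≢ y → p c ~ z)
      finish {y} {z} U by = by , b≁z , z~x , pz
        where
        reach : ∀ c → p c ≢ y → p c ≢ z → p c ~ y ⊎ p c ~ z
        reach c ≢y ≢z with hits U (inW (act (tri c)) (a∈ (tri c))) (λ r → ≁ (act T) (a∈ T) (b∈ T) (subst (_~ b) r (p~b c))) ≢y ≢z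
        ... | inj₁ r = ⊥-elim (p≁a c r)
        ... | inj₂ r = r
        b≁z : ¬ (b ~ z)
        b≁z bz = let c , ≢yz = avoid p p-inj (s≤s (s≤s (s≤s z≤n))) (y ∷ (λ (_ : Fin 1) → z)) in
          case reach c (≢yz 0F) (≢yz 1F) of λ where
            (inj₁ r) → △ (p~b c) by r
            (inj₂ r) → △ (p~b c) bz r
        z~x : z ~ x
        z~x with hits T (inW Ij (b∈ U)) (∉⇒≢ (b∈ U) jx) (≢-sym (x≢b U)) (≢-sym (off (b∈ U)))
        ... | inj₁ r        = r
        ... | inj₂ (inj₁ r) = ⊥-elim (≁ Ij (b∈ U) ja r)
        ... | inj₂ (inj₂ r) = ⊥-elim (b≁z (~s r))
        pz : ∀ c → p c ≢ y → p c ~ z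
        pz c ≢y with reach c ≢y (λ r → b≁z (~s (subst (_~ b) r (p~b c))))
        ... | inj₁ r = △ (p~b c) by r
        ... | inj₂ r = r

  off-x : 4 ≤ κ x → Tri i x a b → I j ≡ true → i ≢ j → M j a ≡ true → M j x ≡ false
  off-x k≥4 T Ij i≢j ja = ≢true λ jx → disjoint-at k≥4 (act T) Ij i≢j (x∈ T) jx (x≢a T) (a∈ T) ja

  -- By `half` there are z in j and z′ in l, both adjacent to x, with p ~ z for all p but at most
  -- one and q ~ z′ for all q but at most one. As z is adjacent neither to b nor to z′ (triangle
  -- with x), it is adjacent to y′. But then y′ has no possible neighbour in a triple {x, p, q} with
  -- p ≠ y and q ≠ y′: x and p close a triangle with z, and q closes one with a.
  one-sided : 4 ≤ κ x → Tri i x a b → I j ≡ true → I l ≡ true → i ≢ j → i ≢ l →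
    M j a ≡ true → M l b ≡ true → M j b ≡ false → M l a ≡ false → ⊥
  one-sided {x} {i} {a} {b} {j} {l} k≥4 T Ij Il i≢j i≢l ja lb jb la =
    let _ , _ , U , by , b≁z , zx , pz = half T C Ij ja jb jx
        _ , _ , V , ay , a≁z , zx′ , qz = half (swap T) (mirror C) Il lb la lx
    in collide U V by b≁z zx pz ay a≁z zx′ qz
    where
    C = crown k≥4 T
    open Crown C
    jx : M j x ≡ false
    jx = off-x k≥4 T Ij i≢j ja
    lx : M l x ≡ false
    lx = off-x k≥4 (swap T) Il i≢l lb
    collide : ∀ {y z y′ z′} → Tri j a y z → Tri l b y′ z′ → b ~ y → ¬ (b ~ z) → z ~ x → (∀ c → p c ≢ y → p c ~ z) →
      a ~ y′ → ¬ (a ~ z′) → z′ ~ x → (∀ c → q c ≢ y′ → q c ~ z′) → ⊥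
    collide {y} {z} {y′} {z′} U V by b≁z zx pz ay a≁z zx′ qz = case hits V (inW Ij (b∈ U)) z≢b z≢y′ z≢z′ of λ where
        (inj₁ r)         → b≁z (~s r)
        (inj₂ (inj₂ r))  → △ r zx′ zx
        (inj₂ (inj₁ zy)) → case hits (tri c) (inW Il (a∈ V)) (∉⇒≢ (a∈ V) lx) (~⇒≢ (~s ay) (p≁a c)) (≢-sym qc) of λ where
          (inj₁ r)        → △ zy r zx
          (inj₂ (inj₁ r)) → △ zy r (~s (pz c pc))
          (inj₂ (inj₂ r)) → △ r (q~a c) (~s ay)
      where
      good = choose₂ p q p-inj q-inj y y′
      c = proj₁ good
      pc = proj₁ (proj₂ good)
      qc = proj₂ (proj₂ good)
      z≢b : z ≢ b
      z≢b r = clash (b∈ U) (subst (λ v → M j v ≡ false) (sym r) jb)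
      z≢y′ : z ≢ y′
      z≢y′ r = ≁ Ij ja (b∈ U) (subst (a ~_) (sym r) ay)
      z≢z′ : z ≢ z′
      z≢z′ refl = let d , d≢c , qd = choose₂ (λ d → d) q (λ _ _ r → r) q-inj c y′ in
        △ (pz c pc) (~s (qz d qd)) (cross c d (λ r → d≢c (sym r)))

  -- In {a, b, y} only y can be adjacent to x, and only y could be adjacent to z. As z ~ x, a vertex
  -- z other than y would complete a triangle.
  last-vertex : Tri i x a b → Tri j a b y → M j x ≡ false → Tri l a u z → M l b ≡ false → ¬ (b ~ z) → z ~ x → z ≡ y
  last-vertex {i} {x} {a} {b} {j} {y} {l} {u} {z} T U x∉ V lb b≁z zx with z ≟ y
  ... | yes e = e
  ... | no z≢y with hits U (inW (act T) (x∈ T)) (x≢a T) (x≢b T) (≢-sym (∉⇒≢ (b∈ U) x∉))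
                  | hits U (inW (act V) (b∈ V)) (≢-sym (x≢b V)) (∉⇒≢ (b∈ V) lb) z≢y
  ... | inj₁ r        | _             = ⊥-elim (≁ (act T) (x∈ T) (a∈ T) r)
  ... | inj₂ (inj₁ r) | _             = ⊥-elim (≁ (act T) (x∈ T) (b∈ T) r)
  ... | inj₂ (inj₂ r) | inj₁ r′        = ⊥-elim (≁ (act V) (b∈ V) (x∈ V) r′)
  ... | inj₂ (inj₂ r) | inj₂ (inj₁ r′) = ⊥-elim (b≁z (~s r′))
  ... | inj₂ (inj₂ r) | inj₂ (inj₂ r′) = △ zx r r′

  third-triple : 4 ≤ κ x → Tri i x a b → Tri j a b y → i ≢ j → I l ≡ true → i ≢ l → M l a ≡ true → M l b ≡ false →
    M l y ≡ true
  third-triple {x} {i} {a} {b} {j} {y} {l} k≥4 T U i≢j Il i≢l la lb =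
    finish (off-x k≥4 T (act U) i≢j (x∈ U)) (half T (crown k≥4 T) Il la lb (off-x k≥4 T Il i≢l la))
    where
    finish : ∀ {p} → M j x ≡ false → Half l x a b p → M l y ≡ true
    finish x∉ (_ , z , V , _ , b≁z , zx , _) = subst (λ v → M l v ≡ true) (last-vertex T U x∉ V lb b≁z zx) (b∈ V)

-- The weight that a vertex on k triples, h of them containing a vertex on at least four triples, sends to
-- one of its triples (e tells whether this triple contains such a vertex).
wt : (k h : ℕ) (e : Bool) → ℕ
wt 1 _ _     = 6
wt 2 _ false = 2
wt 2 1 true  = 4
wt 2 _ true  = 3
wt 3 _ _     = 2
wt _ _ _     = 0

-- Each vertex has 6 units, the least amount that splits evenly among one, two or three triples. If
-- exactly one of two triples is heavy the split is 4 + 2, which the exceptional configuration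
-- requires. A vertex on four or more triples pays nothing.
wt-total : ∀ h g → h * wt (h + g) h true + g * wt (h + g) h false ≤ 6
wt-total 0 0 = z≤n
wt-total 0 1 = m≤m+n 6 0
wt-total 0 2 = m≤m+n 4 2
wt-total 0 3 = m≤m+n 6 0
wt-total 0 (suc (suc (suc (suc g)))) rewrite *-zeroʳ g = z≤n
wt-total 1 0 = m≤m+n 6 0
wt-total 1 1 = m≤m+n 6 0
wt-total 1 2 = m≤m+n 6 0
wt-total 1 (suc (suc (suc g))) rewrite *-zeroʳ g = z≤n
wt-total 2 0 = m≤m+n 6 0
wt-total 2 1 = m≤m+n 6 0
wt-total 2 (suc (suc g)) rewrite *-zeroʳ g = z≤n
wt-total 3 0 = m≤m+n 6 0
wt-total 3 (suc g) rewrite *-zeroʳ g = z≤n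
wt-total (suc (suc (suc (suc h)))) g rewrite *-zeroʳ h | *-zeroʳ g = z≤n

wt≥2 : ∀ k h e → 1 ≤ k → k ≤ 3 → 2 ≤ wt k h e
wt≥2 1 h e _ _ = m≤m+n 2 4
wt≥2 2 0 true _ _ = m≤m+n 2 1
wt≥2 2 1 true _ _ = m≤m+n 2 2
wt≥2 2 (suc (suc h)) true _ _ = m≤m+n 2 1
wt≥2 2 h false _ _ = ≤-refl
wt≥2 3 h e _ _ = ≤-refl
wt≥2 (suc (suc (suc (suc _)))) _ _ _ (s≤s (s≤s (s≤s ())))

wt-two : ∀ h → 3 ≤ wt 2 h true
wt-two 0 = ≤-refl
wt-two 1 = m≤m+n 3 1
wt-two (suc (suc h)) = ≤-refl

sq-ineq : ∀ a b → 2 * (a * b) ≤ a * a + b * b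
sq-ineq a b with ≤-total a b
... | inj₁ le with m≤n⇒∃[o]m+o≡n le
...   | o , refl = ≤-trans (m≤m+n _ (o * o)) (≤-reflexive (eq a o))
  where eq : ∀ a o → 2 * (a * (a + o)) + o * o ≡ a * a + (a + o) * (a + o)
        eq = solve-∀
sq-ineq a b | inj₂ ge with m≤n⇒∃[o]m+o≡n ge
...   | o , refl = ≤-trans (m≤m+n _ (o * o)) (≤-reflexive (eq b o))
  where eq : ∀ b o → 2 * ((b + o) * b) + o * o ≡ (b + o) * (b + o) + b * b
        eq = solve-∀

-- Expand the square as a double sum and apply 2ab ≤ a² + b² to the term at (x, y), keeping the
-- indicator of y with `f x` and that of x with `f y`.
cauchy : ∀ {n} (d : Fin n → Bool) (f : Fin n → ℕ) →
  sum (λ x → 𝟙 (d x) * f x) * sum (λ x → 𝟙 (d x) * f x) ≤ # d * sum (λ x → f x * f x)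
cauchy {n} d f = *-cancelˡ-≤ 2 (begin
  2 * (F * F)                                                   ≡⟨ cong (2 *_) (product (λ x → 𝟙 (d x) * f x) (λ x → 𝟙 (d x) * f x)) ⟩
  2 * sum (λ x → sum (λ y → (𝟙 (d x) * f x) * (𝟙 (d y) * f y))) ≡⟨ double _ ⟩
  sum (λ x → sum (λ y → 2 * ((𝟙 (d x) * f x) * (𝟙 (d y) * f y)))) ≤⟨ sum-mono (λ x → sum-mono (λ y → am-gm (d x) (d y) (f x) (f y))) ⟩
  sum (λ x → sum (λ y → sq x * 𝟙 (d y) + 𝟙 (d x) * sq y))       ≡⟨ sum-cong-≗ (λ x → ∑-distrib-+ (λ y → sq x * 𝟙 (d y)) _) ⟩
  sum (λ x → sum (λ y → sq x * 𝟙 (d y)) + sum (λ y → 𝟙 (d x) * sq y)) ≡⟨ ∑-distrib-+ (λ x → sum (λ y → sq x * 𝟙 (d y))) _ ⟩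
  sum (λ x → sum (λ y → sq x * 𝟙 (d y))) + sum (λ x → sum (λ y → 𝟙 (d x) * sq y)) ≡⟨ cong₂ _+_ (product sq (λ y → 𝟙 (d y))) (product (λ x → 𝟙 (d x)) sq) ⟨
  sum sq * D + D * sum sq                                       ≡⟨ arith (sum sq) D ⟩
  2 * (D * sum sq)                                              ≡⟨ cong (λ z → 2 * (z * sum sq)) (#-sum d) ⟨
  2 * (# d * sum sq)                                            ∎)
  where
  open ≤-Reasoning
  F = sum (λ x → 𝟙 (d x) * f x)
  D = sum (λ x → 𝟙 (d x))
  sq : Fin n → ℕ
  sq x = f x * f x
  arith : ∀ a b → a * b + b * a ≡ 2 * (b * a)
  arith = solve-∀
  product : (g h : Fin n → ℕ) → sum g * sum h ≡ sum (λ x → sum (λ y → g x * h y))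
  product g h = trans (*-distribʳ-sum (sum h) g) (sum-cong-≗ (λ x → *-distribˡ-sum (g x) h))
  double : (g : Fin n → Fin n → ℕ) → 2 * sum (λ x → sum (g x)) ≡ sum (λ x → sum (λ y → 2 * g x y))
  double g = trans (*-distribˡ-sum 2 (λ x → sum (g x))) (sum-cong-≗ (λ x → *-distribˡ-sum 2 (g x)))
  am-gm : ∀ p q a b → 2 * ((𝟙 p * a) * (𝟙 q * b)) ≤ a * a * 𝟙 q + 𝟙 p * (b * b)
  am-gm true true a b rewrite +-identityʳ a | +-identityʳ b | *-identityʳ (a * a) | +-identityʳ (b * b) = sq-ineq a b
  am-gm true false a b rewrite *-zeroʳ (a + 0) = z≤n
  am-gm false q a b = z≤n

module MISCount {n s t : ℕ} {A : Fin n → Fin n → Bool} {W : Fin n → Bool} {I : Fin s → Bool}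
  {M : Fin s → Fin n → Bool} (S : MIS t A W I M) where

  open MIS S

  #W≤ : ∀ i → I i ≡ true → # W ≤ t + sum (λ y → 𝟙 (M i y) * # (A y))
  #W≤ i Ii = begin
    # W                                                   ≡⟨ #-split W (M i) ⟩
    # (λ w → W w ∧ M i w) + # (λ w → W w ∧ not (M i w))   ≤⟨ +-mono-≤ inside outside ⟩
    t + sum (λ y → 𝟙 (M i y) * # (A y))                   ∎
    where
    open ≤-Reasoning
    inside : # (λ w → W w ∧ M i w) ≤ t
    inside = ≤-trans (#-mono (λ w q → proj₂ (∧-elim {W w} q))) (≤-reflexive (size i Ii))
    col : ∀ y → # (λ w → (W w ∧ not (M i w)) ∧ (M i y ∧ A w y)) ≤ 𝟙 (M i y) * # (A y)
    col y with decide (M i y)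
    ... | inj₁ e rewrite e | +-identityʳ (# (A y)) =
            #-mono λ w q → A-sym w y (proj₂ (∧-elim {W w ∧ not (M i w)} q))
    ... | inj₂ e rewrite e = ≤-trans (≤-reflexive (#-empty _ λ w q → clash (proj₂ (∧-elim {W w ∧ not (M i w)} q)) refl)) z≤n
    outside : # (λ w → W w ∧ not (M i w)) ≤ sum (λ y → 𝟙 (M i y) * # (A y))
    outside = ≤-trans
      (sum-covers _ (λ w y → M i y ∧ A w y) λ w q →
        let Ww , w∉ = ∧-elim {W w} q ; y , y∈ , wy = dominate i w Ii Ww (not-elim w∉) in y , ∧-intro y∈ wy)
      (sum-mono col)

  sum-incidence : (f : Fin n → ℕ) →
    sum (λ i → 𝟙 (I i) * sum (λ v → 𝟙 (M i v) * f v)) ≡ sum (λ v → # (λ i → I i ∧ M i v) * f v)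
  sum-incidence f = trans (sum-cong-≗ λ i → trans (*-distribˡ-sum (𝟙 (I i)) (λ v → 𝟙 (M i v) * f v))
      (sum-cong-≗ λ v → trans (sym (*-assoc (𝟙 (I i)) (𝟙 (M i v)) (f v))) (cong (_* f v) (sym (𝟙-∧ (I i) (M i v))))))
    (sum-swap-weight (λ i v → I i ∧ M i v) f)

  sum-codegrees : sum (λ v → # (λ i → I i ∧ M i v)) ≡ # I * t
  sum-codegrees = begin
    sum (λ v → # (λ i → I i ∧ M i v))                   ≡⟨ sum-cong-≗ (λ v → sym (*-identityʳ (# (λ i → I i ∧ M i v)))) ⟩
    sum (λ v → # (λ i → I i ∧ M i v) * 1)               ≡⟨ sum-incidence (λ _ → 1) ⟨
    sum (λ i → 𝟙 (I i) * sum (λ v → 𝟙 (M i v) * 1))     ≡⟨ sum-cong-≗ row ⟩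
    sum (λ i → 𝟙 (I i) * t)                             ≡⟨ *-#-sum I t ⟨
    # I * t                                             ∎
    where
    open ≡-Reasoning
    row : ∀ i → 𝟙 (I i) * sum (λ v → 𝟙 (M i v) * 1) ≡ 𝟙 (I i) * t
    row i with decide (I i)
    ... | inj₁ e = cong (𝟙 (I i) *_) (trans (sum-cong-≗ (λ v → *-identityʳ (𝟙 (M i v)))) (trans (sym (#-sum (M i))) (size i e)))
    ... | inj₂ e rewrite e = refl

  -- The discharging inequality, with a unit sent by v worth `f v`. The choice f = 1 compares the
  -- number of sets with the number of vertices; f = degree compares codegrees with edges.
  weighted≤ : (w : Fin n → Fin s → ℕ) (f : Fin n → ℕ) (c : ℕ) →
    (∀ v → sum (λ i → 𝟙 (I i ∧ M i v) * w v i) ≤ c) →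
    sum (λ i → 𝟙 (I i) * sum (λ v → 𝟙 (M i v) * (w v i * f v))) ≤ c * sum (λ v → 𝟙 (W v) * f v)
  weighted≤ w f c bound = begin
    sum (λ i → 𝟙 (I i) * sum (λ v → 𝟙 (M i v) * (w v i * f v)))
      ≡⟨ sum-cong-≗ (λ i → trans (*-distribˡ-sum (𝟙 (I i)) (λ v → 𝟙 (M i v) * (w v i * f v))) (sum-cong-≗ (term i))) ⟩
    sum (λ i → sum (λ v → 𝟙 (W v) * f v * (𝟙 (I i ∧ M i v) * w v i)))
      ≡⟨ ∑-comm (λ i v → 𝟙 (W v) * f v * (𝟙 (I i ∧ M i v) * w v i)) ⟩
    sum (λ v → sum (λ i → 𝟙 (W v) * f v * (𝟙 (I i ∧ M i v) * w v i)))
      ≡⟨ sum-cong-≗ (λ v → *-distribˡ-sum (𝟙 (W v) * f v) (λ i → 𝟙 (I i ∧ M i v) * w v i)) ⟨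
    sum (λ v → 𝟙 (W v) * f v * sum (λ i → 𝟙 (I i ∧ M i v) * w v i))
      ≤⟨ sum-mono (λ v → *-monoʳ-≤ (𝟙 (W v) * f v) (bound v)) ⟩
    sum (λ v → 𝟙 (W v) * f v * c)
      ≡⟨ sum-cong-≗ (λ v → *-comm (𝟙 (W v) * f v) c) ⟩
    sum (λ v → c * (𝟙 (W v) * f v))
      ≡⟨ *-distribˡ-sum c (λ v → 𝟙 (W v) * f v) ⟨
    c * sum (λ v → 𝟙 (W v) * f v) ∎
    where
    open ≤-Reasoning
    rearrange : ∀ x y → 1 * (1 * (x * y)) ≡ 1 * y * (1 * x)
    rearrange = solve-∀
    term : ∀ i v → 𝟙 (I i) * (𝟙 (M i v) * (w v i * f v)) ≡ 𝟙 (W v) * f v * (𝟙 (I i ∧ M i v) * w v i)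
    term i v with decide (I i) | decide (M i v)
    ... | inj₂ e | _ rewrite e = sym (*-zeroʳ (𝟙 (W v) * f v))
    ... | inj₁ e | inj₂ e′ rewrite e | e′ = sym (*-zeroʳ (𝟙 (W v) * f v))
    ... | inj₁ e | inj₁ e′ rewrite e | e′ | M⊂W i v e e′ = rearrange (w v i) (f v)

-- Discharging: the number of triples and their second moment

module Weights {n s : ℕ} {A : Fin n → Fin n → Bool} {W : Fin n → Bool} {I : Fin s → Bool}
  {M : Fin s → Fin n → Bool} (S : MIS 3 A W I M) (big : 256 < # I) where

  open MIS S
  open MISCount S
  open Triples S
  open Tri
  open Large big
  open HeavyTriples S big

  private variable
    i j l : Fin s
    x a b y v : Fin n

  heavy : Fin s → Bool
  heavy i = ⌊ any? (λ v → (M i v ∧ ⌊ 4 ≤? κ v ⌋) ≟ᵇ true) ⌋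

  η : Fin n → ℕ
  η v = # (λ i → (I i ∧ M i v) ∧ heavy i)

  weight : Fin n → Fin s → ℕ
  weight v i = wt (κ v) (η v) (heavy i)

  heavy-at : M i v ≡ true → 4 ≤ κ v → heavy i ≡ true
  heavy-at {v = v} iv k≥4 = holds (v , ∧-intro iv (holds k≥4))

  vertex-weight : ∀ v → sum (λ i → 𝟙 (I i ∧ M i v) * weight v i) ≤ 6
  vertex-weight v = begin
    sum (λ i → 𝟙 (p i) * wt k h (heavy i))
      ≡⟨ sum-cong-≗ (λ i → split (p i) (heavy i)) ⟩
    sum (λ i → 𝟙 (p i ∧ heavy i) * wt k h true + 𝟙 (p i ∧ not (heavy i)) * wt k h false)
      ≡⟨ ∑-distrib-+ (λ i → 𝟙 (p i ∧ heavy i) * wt k h true) (λ i → 𝟙 (p i ∧ not (heavy i)) * wt k h false) ⟩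
    sum (λ i → 𝟙 (p i ∧ heavy i) * wt k h true) + sum (λ i → 𝟙 (p i ∧ not (heavy i)) * wt k h false)
      ≡⟨ cong₂ _+_ (*-#-sum (λ i → p i ∧ heavy i) (wt k h true)) (*-#-sum (λ i → p i ∧ not (heavy i)) (wt k h false)) ⟨
    h * wt k h true + g * wt k h false
      ≡⟨ cong (λ z → h * wt z h true + g * wt z h false) (#-split p heavy) ⟩
    h * wt (h + g) h true + g * wt (h + g) h false
      ≤⟨ wt-total h g ⟩
    6 ∎
    where
    open ≤-Reasoning
    p : Fin s → Bool
    p i = I i ∧ M i v
    k = κ v
    h = η v
    g = # (λ i → p i ∧ not (heavy i))
    split : ∀ c e → 𝟙 c * wt k h e ≡ 𝟙 (c ∧ e) * wt k h true + 𝟙 (c ∧ not e) * wt k h false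
    split true  true  = sym (+-identityʳ _)
    split true  false = refl
    split false e     = refl

  tri-sum : Tri i x a b → (f : Fin n → ℕ) → sum (λ v → 𝟙 (M i v) * f v) ≡ f x + (f a + f b)
  tri-sum {i} {x} {a} {b} T f = begin
    sum (λ v → 𝟙 (M i v) * f v)
      ≡⟨ sum-cong-≗ (λ v → trans (cong (_* f v) (expand v)) (distrib (𝟙 ⌊ x ≟ v ⌋) (𝟙 ⌊ a ≟ v ⌋) (𝟙 ⌊ b ≟ v ⌋) (f v))) ⟩
    sum (λ v → 𝟙 ⌊ x ≟ v ⌋ * f v + (𝟙 ⌊ a ≟ v ⌋ * f v + 𝟙 ⌊ b ≟ v ⌋ * f v))
      ≡⟨ ∑-distrib-+ (λ v → 𝟙 ⌊ x ≟ v ⌋ * f v) (λ v → 𝟙 ⌊ a ≟ v ⌋ * f v + 𝟙 ⌊ b ≟ v ⌋ * f v) ⟩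
    sum (λ v → 𝟙 ⌊ x ≟ v ⌋ * f v) + sum (λ v → 𝟙 ⌊ a ≟ v ⌋ * f v + 𝟙 ⌊ b ≟ v ⌋ * f v)
      ≡⟨ cong (sum (λ v → 𝟙 ⌊ x ≟ v ⌋ * f v) +_) (∑-distrib-+ (λ v → 𝟙 ⌊ a ≟ v ⌋ * f v) (λ v → 𝟙 ⌊ b ≟ v ⌋ * f v)) ⟩
    sum (λ v → 𝟙 ⌊ x ≟ v ⌋ * f v) + (sum (λ v → 𝟙 ⌊ a ≟ v ⌋ * f v) + sum (λ v → 𝟙 ⌊ b ≟ v ⌋ * f v))
      ≡⟨ cong₂ _+_ (sum-single x f) (cong₂ _+_ (sum-single a f) (sum-single b f)) ⟩
    f x + (f a + f b) ∎
    where
    open ≡-Reasoning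
    distrib : ∀ p q r c → (p + (q + r)) * c ≡ p * c + (q * c + r * c)
    distrib = solve-∀
    expand : ∀ v → 𝟙 (M i v) ≡ 𝟙 ⌊ x ≟ v ⌋ + (𝟙 ⌊ a ≟ v ⌋ + 𝟙 ⌊ b ≟ v ⌋)
    expand v with x ≟ v | a ≟ v | b ≟ v
    ... | yes refl | yes r    | _        = ⊥-elim (x≢a T (sym r))
    ... | yes refl | no _     | yes r    = ⊥-elim (x≢b T (sym r))
    ... | yes refl | no _     | no _     = cong 𝟙 (x∈ T)
    ... | no _     | yes refl | yes r    = ⊥-elim (a≢b T (sym r))
    ... | no _     | yes refl | no _     = cong 𝟙 (a∈ T)
    ... | no _     | no _     | yes refl = cong 𝟙 (b∈ T)
    ... | no p     | no q     | no r     = cong 𝟙 (≢true λ m → case only T v m of λ where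
                                               (inj₁ e)        → p (sym e)
                                               (inj₂ (inj₁ e)) → q (sym e)
                                               (inj₂ (inj₂ e)) → r (sym e))

  κ-pos : I i ≡ true → M i v ≡ true → 1 ≤ κ v
  κ-pos {i} Ii iv = #-pos _ i (∧-intro Ii iv)

  -- Since b lies only on T and U, the point is that U has no vertex on four triples. Only y could
  -- be one; but the third triple through a also contains y by `third-triple`, and two triples
  -- sharing y and a contradict `disjoint-at` at y.
  η-one : 4 ≤ κ x → Tri i x a b → Tri j a b y → i ≢ j → κ a ≡ 3 → κ b ≡ 2 → η b ≡ 1
  η-one {x} {i} {a} {b} {j} {y} k≥4 T U i≢j ka kb = ≤-antisym
    (#≤1 _ λ l l′ p q → trans (is-i l p) (sym (is-i l′ q)))
    (#-pos _ i (∧-intro (∧-intro (act T) (b∈ T)) (heavy-at (x∈ T) k≥4)))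
    where
    not-heavy : heavy j ≡ true → ⊥
    not-heavy hj = case witness hj of λ (v , q) → let jv , k4 = ∧-elim {M j v} q in light v jv (witness k4)
      where
      clash-y : 4 ≤ κ y → ⊥
      clash-y k4 = case more (i ∷ (λ (_ : Fin 1) → j)) (≤-reflexive (sym ka)) of λ where
        (l , Il , la , new) → disjoint-at k4 (act U) Il (new 1F) (b∈ U)
          (third-triple k≥4 T U i≢j Il (new 0F) la
            (≢true λ lb → pair-in-two (act T) (act U) Il i≢j (new 0F) (new 1F) (a≢b T) (a∈ T) (x∈ U) la (b∈ T) (a∈ U) lb))
          (≢-sym (x≢b U)) (x∈ U) la
      light : ∀ v → M j v ≡ true → 4 ≤ κ v → ⊥
      light v jv k4 = case only U v jv of λ where
        (inj₁ refl)        → <⇒≱ (≤-reflexive (cong suc ka)) k4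
        (inj₂ (inj₁ refl)) → <⇒≱ (≤-trans (≤-reflexive (cong suc kb)) (n≤1+n 3)) k4
        (inj₂ (inj₂ refl)) → clash-y k4
    is-i : ∀ l → (I l ∧ M l b) ∧ heavy l ≡ true → l ≡ i
    is-i l q with ∧-elim {I l ∧ M l b} q
    ... | q₁ , hl with l ≟ i
    ...   | yes r = r
    ...   | no l≢i with l ≟ j
    ...     | yes refl = ⊥-elim (not-heavy hl)
    ...     | no l≢j = ⊥-elim (1+n≰n (≤-trans (inj⇒≤# (l ∷ (i ∷ (λ (_ : Fin 1) → j))) (λ i → I i ∧ M i b)
                (∷-inj (∷-inj (λ { 0F 0F _ → refl }) (λ _ r → i≢j (sym r))) (λ { 0F r → l≢i (sym r) ; 1F r → l≢j (sym r) }))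
                (∷-all (λ i → I i ∧ M i b) q₁ (∷-all (λ i → I i ∧ M i b) (∧-intro (act T) (b∈ T)) (λ _ → ∧-intro (act U) (a∈ U)))))
              (≤-reflexive kb)))

  weight-1 : κ v ≡ 1 → 6 ≤ weight v i
  weight-1 {v} {i} k = ≤-reflexive (sym (cong (λ z → wt z (η v) (heavy i)) k))

  weight-2 : κ v ≡ 2 → heavy i ≡ true → 3 ≤ weight v i
  weight-2 {v} {i} k h = ≤-trans (wt-two (η v)) (≤-reflexive (sym (cong₂ (λ z e → wt z (η v) e) k h)))

  weight-3 : 1 ≤ κ v → κ v ≤ 3 → 2 ≤ weight v i
  weight-3 {v} {i} p q = wt≥2 (κ v) (η v) (heavy i) p q

  weight-21 : κ v ≡ 2 → η v ≡ 1 → heavy i ≡ true → 4 ≤ weight v i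
  weight-21 {v} {i} k h e = ≤-reflexive (sym (trans (cong (λ z → wt z (η v) (heavy i)) k) (cong₂ (wt 2) h e)))

  -- Sharing two vertices with j bounds the codegrees of a and b by 3. Codegrees (2, 2) and (3, 2)
  -- give 3 + 3 and 2 + 4 units; with (3, 3) the third triples of a and of b contradict `one-sided`.
  common-pair : 4 ≤ κ x → Tri i x a b → Tri j a b y → i ≢ j → 2 ≤ κ a → 2 ≤ κ b → 6 ≤ weight a i + weight b i
  common-pair {x} {i} {a} {b} {j} {y} k≥4 T U i≢j a≥2 b≥2 = cases (κ a ≤? 2) (κ b ≤? 2)
    where
    a≤3 : κ a ≤ 3
    a≤3 = ≤-pred (≰⇒> λ k4 → disjoint-at k4 (act T) (act U) i≢j (a∈ T) (x∈ U) (a≢b T) (b∈ T) (a∈ U))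
    b≤3 : κ b ≤ 3
    b≤3 = ≤-pred (≰⇒> λ k4 → disjoint-at k4 (act T) (act U) i≢j (b∈ T) (a∈ U) (≢-sym (a≢b T)) (a∈ T) (x∈ U))
    hi : heavy i ≡ true
    hi = heavy-at (x∈ T) k≥4
    cases : Dec (κ a ≤ 2) → Dec (κ b ≤ 2) → 6 ≤ weight a i + weight b i
    cases (yes a≤2) (yes b≤2) = +-mono-≤ (weight-2 (≤-antisym a≤2 a≥2) hi) (weight-2 (≤-antisym b≤2 b≥2) hi)
    cases (no a≰2) (yes b≤2) = +-mono-≤ (weight-3 (≤-trans (n≤1+n 1) a≥2) a≤3)
      (weight-21 (≤-antisym b≤2 b≥2) (η-one k≥4 T U i≢j (≤-antisym a≤3 (≰⇒> a≰2)) (≤-antisym b≤2 b≥2)) hi)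
    cases (yes a≤2) (no b≰2) = +-mono-≤
      (weight-21 (≤-antisym a≤2 a≥2) (η-one k≥4 (swap T) (rotate U) i≢j (≤-antisym b≤3 (≰⇒> b≰2)) (≤-antisym a≤2 a≥2)) hi)
      (weight-3 (≤-trans (n≤1+n 1) b≥2) b≤3)
    cases (no a≰2) (no b≰2) with more (i ∷ (λ (_ : Fin 1) → j)) (≰⇒> a≰2) | more (i ∷ (λ (_ : Fin 1) → j)) (≰⇒> b≰2)
    ... | l , Il , la , new | l′ , Il′ , lb , new′ = ⊥-elim (one-sided k≥4 T Il Il′ (new 0F) (new′ 0F) la lb
      (≢true λ q → pair-in-two (act T) (act U) Il i≢j (new 0F) (new 1F) (a≢b T) (a∈ T) (x∈ U) la (b∈ T) (a∈ U) q)
      (≢true λ q → pair-in-two (act T) (act U) Il′ i≢j (new′ 0F) (new′ 1F) (a≢b T) (a∈ T) (x∈ U) q (b∈ T) (a∈ U) lb))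

  -- The vertex x pays nothing. Either a or b is on no other triple and pays all 6 units, or
  -- `one-sided` shows that some other triple contains both.
  heavy-weight : 4 ≤ κ x → Tri i x a b → 6 ≤ weight a i + weight b i
  heavy-weight {x} {i} {a} {b} k≥4 T = cases (κ a ≤? 1) (κ b ≤? 1)
    where
    with-pair : ∀ {j} → I j ≡ true → i ≢ j → M j a ≡ true → M j b ≡ true → 2 ≤ κ a → 2 ≤ κ b → 6 ≤ weight a i + weight b i
    with-pair Ij i≢j ja jb = common-pair k≥4 T (proj₂ (tri-at₂ Ij ja jb (a≢b T))) i≢j
    cases : Dec (κ a ≤ 1) → Dec (κ b ≤ 1) → 6 ≤ weight a i + weight b i
    cases (yes p) _ = ≤-trans (weight-1 (≤-antisym p (κ-pos (act T) (a∈ T)))) (m≤m+n _ _)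
    cases (no _) (yes p) = ≤-trans (weight-1 (≤-antisym p (κ-pos (act T) (b∈ T)))) (m≤n+m _ _)
    cases (no p) (no q) with more (λ (_ : Fin 1) → i) (≰⇒> p) | more (λ (_ : Fin 1) → i) (≰⇒> q)
    ... | j , Ij , ja , new | l , Il , lb , new′ with decide (M j b) | decide (M l a)
    ...   | inj₁ jb | _       = with-pair Ij (new 0F) ja jb (≰⇒> p) (≰⇒> q)
    ...   | inj₂ _  | inj₁ la = with-pair Il (new′ 0F) la lb (≰⇒> p) (≰⇒> q)
    ...   | inj₂ jb | inj₂ la = ⊥-elim (one-sided k≥4 T Ij Il (new 0F) (new′ 0F) ja lb jb la)

  some-tri : I i ≡ true → ∃[ x ] ∃[ a ] ∃[ b ] Tri i x a b
  some-tri {i} Ii = let x , ix , _ = extend {0} (λ ()) (M i) (≤-trans (s≤s z≤n) (≤-reflexive (sym (size i Ii)))) in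
    x , tri-at Ii ix

  set-weight : ∀ i → I i ≡ true → 6 ≤ sum (λ v → 𝟙 (M i v) * weight v i)
  set-weight i Ii with decide (heavy i)
  ... | inj₁ h = let x , q = witness h
                     ix , k4 = ∧-elim {M i x} q
                     a , b , T = tri-at Ii ix
    in ≤-trans (heavy-weight (witness k4) T) (≤-trans (m≤n+m _ (weight x i)) (≤-reflexive (sym (tri-sum T (λ v → weight v i)))))
  ... | inj₂ h = let x , a , b , T = some-tri Ii in
    ≤-trans (+-mono-≤ (lo (x∈ T)) (+-mono-≤ (lo (a∈ T)) (lo (b∈ T)))) (≤-reflexive (sym (tri-sum T (λ v → weight v i))))
    where
    lo : ∀ {v} → M i v ≡ true → 2 ≤ weight v i
    lo iv = weight-3 (κ-pos Ii iv) (≤-pred (≰⇒> λ k4 → clash (heavy-at iv k4) h))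

  #I≤#W : # I ≤ # W
  #I≤#W = *-cancelˡ-≤ 6 (begin
    6 * # I                                                         ≡⟨ *-comm 6 (# I) ⟩
    # I * 6                                                         ≡⟨ *-#-sum I 6 ⟩
    sum (λ i → 𝟙 (I i) * 6)                                         ≤⟨ sum-mono (λ i → 𝟙*-mono (I i) (λ Ii →
                                                                         ≤-trans (set-weight i Ii) (sum-mono (λ v → *-monoʳ-≤ (𝟙 (M i v))
                                                                           (≤-reflexive (sym (*-identityʳ (weight v i)))))))) ⟩
    sum (λ i → 𝟙 (I i) * sum (λ v → 𝟙 (M i v) * (weight v i * 1)))  ≤⟨ weighted≤ weight (λ _ → 1) 6 vertex-weight ⟩
    6 * sum (λ v → 𝟙 (W v) * 1)                                     ≡⟨ cong (6 *_) (trans (sum-cong-≗ (λ v → *-identityʳ (𝟙 (W v)))) (sym (#-sum W))) ⟩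
    6 * # W                                                         ∎)
    where open ≤-Reasoning

  κ-degree : Tri i x a b → κ x ≤ 2 + 2 * # (A a)
  κ-degree {i} {x} {a} T = degree-bound refl (λ (_ : Fin 1) → x) (λ { 0F 0F _ → refl }) (λ i → I i ∧ M i x)
    (λ j q → proj₁ (∧-elim q)) (λ j q _ → proj₂ (∧-elim {I j} q)) i a (∧-intro (act T) (x∈ T)) (a∈ T) (λ _ → x≢a T)

  -- The codegree of x is at most 2 + 2 deg a and 2 + 2 deg b, so the 6 units from a and b,
  -- multiplied by these degrees, pay for 3 (κ x - 3). Truncated subtraction of 3 makes the claim
  -- void unless x is on four triples, where `heavy-weight` applies.
  weighted-degree : Tri i x a b → 3 * (κ x ∸ 3) ≤ sum (λ v → 𝟙 (M i v) * (weight v i * # (A v)))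
  weighted-degree {i} {x} {a} {b} T with 4 ≤? κ x
  ... | no k≱4 rewrite m≤n⇒m∸n≡0 (≤-pred (≰⇒> k≱4)) = z≤n
  ... | yes k≥4 = *-cancelˡ-≤ 2 (begin
    2 * (3 * (κ x ∸ 3))            ≡⟨ *-assoc 2 3 (κ x ∸ 3) ⟨
    6 * (κ x ∸ 3)                  ≤⟨ *-mono-≤ (heavy-weight k≥4 T) (∸-monoʳ-≤ (κ x) (n≤1+n 2)) ⟩
    (wa + wb) * (κ x ∸ 2)          ≡⟨ *-distribʳ-+ (κ x ∸ 2) wa wb ⟩
    wa * (κ x ∸ 2) + wb * (κ x ∸ 2) ≤⟨ +-mono-≤ (*-monoʳ-≤ wa (m≤n+o⇒m∸n≤o (κ x) 2 (κ-degree T)))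
                                                (*-monoʳ-≤ wb (m≤n+o⇒m∸n≤o (κ x) 2 (κ-degree (swap T)))) ⟩
    wa * (2 * da) + wb * (2 * db)  ≡⟨ arith wa wb da db ⟩
    2 * (wa * da + wb * db)        ≤⟨ *-monoʳ-≤ 2 (m≤n+m _ (weight x i * # (A x))) ⟩
    2 * (weight x i * # (A x) + (wa * da + wb * db)) ≡⟨ cong (2 *_) (tri-sum T (λ v → weight v i * # (A v))) ⟨
    2 * sum (λ v → 𝟙 (M i v) * (weight v i * # (A v))) ∎)
    where
    open ≤-Reasoning
    wa = weight a i
    wb = weight b i
    da = # (A a)
    db = # (A b)
    arith : ∀ p q r t → p * (2 * r) + q * (2 * t) ≡ 2 * (p * r + q * t)
    arith = solve-∀

  -- In each triple the three numbers κ - 3 are each at most a third of the same weighted degree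
  -- sum, so discharging with f = degree is needed only once.
  codegree-squares : sum (λ x → κ x * (κ x ∸ 3)) ≤ 6 * sum (λ v → # (A v))
  codegree-squares = begin
    sum (λ x → κ x * (κ x ∸ 3))                                           ≡⟨ sum-incidence (λ x → κ x ∸ 3) ⟨
    sum (λ i → 𝟙 (I i) * sum (λ x → 𝟙 (M i x) * (κ x ∸ 3)))               ≤⟨ sum-mono (λ i → 𝟙*-mono (I i) (row i)) ⟩
    sum (λ i → 𝟙 (I i) * sum (λ v → 𝟙 (M i v) * (weight v i * # (A v))))  ≤⟨ weighted≤ weight (λ v → # (A v)) 6 vertex-weight ⟩
    6 * sum (λ v → 𝟙 (W v) * # (A v))                                     ≤⟨ *-monoʳ-≤ 6 (sum-mono (λ v → drop (W v) (# (A v)))) ⟩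
    6 * sum (λ v → # (A v))                                               ∎
    where
    open ≤-Reasoning
    drop : ∀ c d → 𝟙 c * d ≤ d
    drop true  d = ≤-reflexive (+-identityʳ d)
    drop false d = z≤n
    three : ∀ {p q r z} → 3 * p ≤ z → 3 * q ≤ z → 3 * r ≤ z → p + (q + r) ≤ z
    three {p} {q} {r} {z} a b c = *-cancelˡ-≤ 3 (≤-trans (≤-reflexive (e₁ p q r))
      (≤-trans (+-mono-≤ a (+-mono-≤ b c)) (≤-reflexive (e₂ z))))
      where
      e₁ : ∀ p q r → 3 * (p + (q + r)) ≡ 3 * p + (3 * q + 3 * r)
      e₁ = solve-∀
      e₂ : ∀ z → z + (z + z) ≡ 3 * z
      e₂ = solve-∀
    row : ∀ i → I i ≡ true → sum (λ x → 𝟙 (M i x) * (κ x ∸ 3)) ≤ sum (λ v → 𝟙 (M i v) * (weight v i * # (A v)))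
    row i Ii = let x , a , b , T = some-tri Ii in
      ≤-trans (≤-reflexive (tri-sum T (λ x → κ x ∸ 3)))
        (three {κ x ∸ 3} {κ a ∸ 3} {κ b ∸ 3} (weighted-degree T) (weighted-degree (rotate T)) (weighted-degree (rotate (swap T))))

-- 1440 = 12 · 120 comes from the last step of `triple-cube-large`; the term c³ covers the case of
-- at most c triples, as m ≥ 1.
C-small : ∀ c {z m} → z ≤ c → 1 ≤ m → z * z * z ≤ (1440 + c * c * c) * (m * m)
C-small c {z} {m} z≤c 1≤m = begin
  z * z * z                       ≤⟨ *-mono-≤ (*-mono-≤ z≤c z≤c) z≤c ⟩
  c * c * c                       ≤⟨ m≤n+m (c * c * c) 1440 ⟩
  1440 + c * c * c                ≡⟨ *-identityʳ (1440 + c * c * c) ⟨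
  (1440 + c * c * c) * 1          ≤⟨ *-monoʳ-≤ (1440 + c * c * c) (*-mono-≤ 1≤m 1≤m) ⟩
  (1440 + c * c * c) * (m * m)    ∎
  where open ≤-Reasoning

-- Opaque, since the numeral must never be unfolded to unary.
opaque
  C₃ : ℕ
  C₃ = 1440 + 256 * 256 * 256

  1440≤C₃ : 1440 ≤ C₃
  1440≤C₃ = m≤m+n 1440 (256 * 256 * 256)

  C₃-small : ∀ {z m} → z ≤ 256 → 1 ≤ m → z * z * z ≤ C₃ * (m * m)
  C₃-small = C-small 256

module _ {n s : ℕ} {A : Fin n → Fin n → Bool} {W : Fin n → Bool} {I : Fin s → Bool} {M : Fin s → Fin n → Bool} where

  triple-count : MIS 3 A W I M → # I ≤ # W + 256
  triple-count S with # I ≤? 256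
  ... | yes few = ≤-trans few (m≤n+m 256 (# W))
  ... | no many = ≤-trans (Weights.#I≤#W S (≰⇒> many)) (m≤m+n (# W) 256)

  -- Every triple contains a vertex of degree about # W / 3; Cauchy–Schwarz over these vertices.
  triple-cube-large : (S : MIS 3 A W I M) → 256 < # I → ∀ m → sum (λ v → # (A v)) ≤ 2 * m →
    # I * # I * # I ≤ 1440 * (m * m)
  triple-cube-large S big m edges = final
    where
    open MIS S
    open MISCount S
    open Triples S using (κ; Tri; tri-at)
    open Weights S big using (#I≤#W; codegree-squares; tri-sum; some-tri)
    open ≤-Reasoning
    D : Fin n → Bool
    D x = ⌊ # W ≤? 3 + 3 * # (A x) ⌋
    p = # D
    N = # W
    z = # I
    Σdeg = sum (λ v → # (A v))
    one-of : ∀ c x y w → c ≤ 3 + (x + (y + w)) → c ≤ 3 + 3 * x ⊎ c ≤ 3 + 3 * y ⊎ c ≤ 3 + 3 * w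
    one-of c x y w h with c ≤? 3 + 3 * x | c ≤? 3 + 3 * y | c ≤? 3 + 3 * w
    ... | yes r | _     | _     = inj₁ r
    ... | no _  | yes r | _     = inj₂ (inj₁ r)
    ... | no _  | no _  | yes r = inj₂ (inj₂ r)
    ... | no a  | no b  | no d  = ⊥-elim (<⇒≱ (+-mono-< (≰⇒> a) (+-mono-< (≰⇒> b) (≰⇒> d)))
            (≤-trans (+-mono-≤ h (+-mono-≤ h h)) (≤-reflexive (eq x y w))))
      where
      eq : ∀ x y w → 3 + (x + (y + w)) + (3 + (x + (y + w)) + (3 + (x + (y + w)))) ≡ 3 + 3 * x + (3 + 3 * y + (3 + 3 * w))
      eq = solve-∀
    wide : ∀ i → I i ≡ true → ∃[ x ] D x ≡ true × M i x ≡ true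
    wide i Ii = let x , a , b , T = some-tri Ii in
      case one-of N (# (A x)) (# (A a)) (# (A b)) (≤-trans (#W≤ i Ii) (≤-reflexive (cong (3 +_) (tri-sum T (λ v → # (A v)))))) of λ where
        (inj₁ r)        → x , holds r , Tri.x∈ T
        (inj₂ (inj₁ r)) → a , holds r , Tri.a∈ T
        (inj₂ (inj₂ r)) → b , holds r , Tri.b∈ T
    cover : z ≤ sum (λ x → 𝟙 (D x) * κ x)
    cover = ≤-trans (sum-covers I (λ i x → D x ∧ M i x) (λ i Ii → let x , d , m = wide i Ii in x , ∧-intro d m))
                    (sum-mono col)
      where
      col : ∀ x → # (λ i → I i ∧ (D x ∧ M i x)) ≤ 𝟙 (D x) * κ x
      col x with D x
      ... | true  = ≤-reflexive (sym (+-identityʳ (κ x)))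
      ... | false = ≤-trans (≤-reflexive (#-empty _ (λ i q → true≢false (sym (proj₂ (∧-elim {I i} q)))))) z≤n
    squares : sum (λ x → κ x * κ x) ≤ 12 * m + z * 3 * 3
    squares = begin
      sum (λ x → κ x * κ x)                              ≤⟨ sum-mono (λ x → sq (κ x)) ⟩
      sum (λ x → κ x * (κ x ∸ 3) + κ x * 3)              ≡⟨ ∑-distrib-+ (λ x → κ x * (κ x ∸ 3)) (λ x → κ x * 3) ⟩
      sum (λ x → κ x * (κ x ∸ 3)) + sum (λ x → κ x * 3)  ≤⟨ +-mono-≤ codegree-squares
                                                            (≤-reflexive (trans (sym (*-distribʳ-sum 3 κ)) (cong (_* 3) sum-codegrees))) ⟩
      6 * Σdeg + z * 3 * 3                               ≤⟨ +-monoˡ-≤ (z * 3 * 3) (≤-trans (*-monoʳ-≤ 6 edges) (≤-reflexive (sym (*-assoc 6 2 m)))) ⟩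
      12 * m + z * 3 * 3                                 ∎
      where
      sq : ∀ c → c * c ≤ c * (c ∸ 3) + c * 3
      sq c = ≤-trans (*-monoʳ-≤ c (≤-trans (m≤n+m∸n c 3) (≤-reflexive (+-comm 3 (c ∸ 3))))) (≤-reflexive (*-distribˡ-+ c (c ∸ 3) 3))
    z² : z * z ≤ p * (12 * m + z * 3 * 3)
    z² = ≤-trans (*-mono-≤ cover cover) (≤-trans (cauchy D κ) (*-monoʳ-≤ p squares))
    pz : p * z ≤ p * 3 + 6 * m
    pz = begin
      p * z                                        ≤⟨ *-monoʳ-≤ p #I≤#W ⟩
      p * N                                        ≡⟨ *-#-sum D N ⟩
      sum (λ x → 𝟙 (D x) * N)                      ≤⟨ sum-mono (λ x → row x (decide (D x))) ⟩
      sum (λ x → 𝟙 (D x) * 3 + 3 * # (A x))        ≡⟨ ∑-distrib-+ (λ x → 𝟙 (D x) * 3) (λ x → 3 * # (A x)) ⟩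
      sum (λ x → 𝟙 (D x) * 3) + sum (λ x → 3 * # (A x)) ≡⟨ cong₂ _+_ (*-#-sum D 3) (*-distribˡ-sum 3 (λ x → # (A x))) ⟨
      p * 3 + 3 * Σdeg                             ≤⟨ +-monoʳ-≤ (p * 3) (≤-trans (*-monoʳ-≤ 3 edges) (≤-reflexive (sym (*-assoc 3 2 m)))) ⟩
      p * 3 + 6 * m                                ∎
      where
      row : ∀ x → D x ≡ true ⊎ D x ≡ false → 𝟙 (D x) * N ≤ 𝟙 (D x) * 3 + 3 * # (A x)
      row x (inj₂ e) rewrite e = z≤n
      row x (inj₁ e) rewrite e | +-identityʳ N = witness {d = # W ≤? 3 + 3 * # (A x)} e
    -- This absorbs the term 3 p in `pz`: twice 3 p is at most p z.
    6≤z : 6 ≤ z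
    6≤z = ≤-trans (m≤m+n 6 251) big
    pz≤12m : p * z ≤ 12 * m
    pz≤12m = +-cancelˡ-≤ (p * z) (p * z) (12 * m) (begin
      p * z + p * z                     ≤⟨ +-mono-≤ pz pz ⟩
      p * 3 + 6 * m + (p * 3 + 6 * m)   ≡⟨ eq p m ⟩
      p * 6 + 12 * m                    ≤⟨ +-monoˡ-≤ (12 * m) (*-monoʳ-≤ p 6≤z) ⟩
      p * z + 12 * m                    ∎)
      where
      eq : ∀ p m → p * 3 + 6 * m + (p * 3 + 6 * m) ≡ p * 6 + 12 * m
      eq = solve-∀
    1≤p : 1 ≤ p
    1≤p with #-witness I (≤-trans (s≤s z≤n) big)
    ... | i , Ii = let x , d , _ = wide i Ii in #-pos D x d
    z≤12m : z ≤ 12 * m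
    z≤12m = ≤-trans (≤-trans (≤-reflexive (sym (*-identityˡ z))) (*-monoˡ-≤ z 1≤p)) pz≤12m
    final : z * z * z ≤ 1440 * (m * m)
    final = begin
      z * z * z                                  ≤⟨ *-monoˡ-≤ z z² ⟩
      p * (12 * m + z * 3 * 3) * z               ≡⟨ e₁ p m z ⟩
      p * z * (12 * m + 9 * z)                   ≤⟨ *-mono-≤ pz≤12m (+-monoʳ-≤ (12 * m) (*-monoʳ-≤ 9 z≤12m)) ⟩
      12 * m * (12 * m + 9 * (12 * m))           ≡⟨ e₂ m ⟩
      1440 * (m * m)                             ∎
      where
      e₁ : ∀ p m z → p * (12 * m + z * 3 * 3) * z ≡ p * z * (12 * m + 9 * z)
      e₁ = solve-∀
      e₂ : ∀ m → 12 * m * (12 * m + 9 * (12 * m)) ≡ 1440 * (m * m)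
      e₂ = solve-∀

  triple-cube : MIS 3 A W I M → ∀ m → 1 ≤ m → sum (λ v → # (A v)) ≤ 2 * m → # I * # I * # I ≤ C₃ * (m * m)
  triple-cube S m 1≤m edges = case # I ≤? 256 of λ where
    (yes few) → C₃-small few 1≤m
    (no many) → ≤-trans (triple-cube-large S (≰⇒> many) m edges) (*-monoˡ-≤ (m * m) 1440≤C₃)

-- Quadruples and larger independent sets

codegree : ∀ {n s} → (Fin s → Bool) → (Fin s → Fin n → Bool) → Fin n → ℕ
codegree I M x = # (λ i → I i ∧ M i x)

degrees : ∀ {n} → (Fin n → Fin n → Bool) → ℕ
degrees A = sum (λ v → # (A v))

opaque
  -- 6 suffices when there are more than 256 vertices, and 256 · 512 bounds N (N + 256) otherwise.
  C₄ : ℕ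
  C₄ = 6 + 256 * 512

  6≤C₄ : 6 ≤ C₄
  6≤C₄ = m≤m+n 6 (256 * 512)

  C₄-small : ∀ {z m N} → z ≤ N * (N + 256) → N ≤ 256 → 1 ≤ m → z ≤ C₄ * m
  C₄-small {z} {m} {N} h N≤ 1≤m = begin
    z                  ≤⟨ h ⟩
    N * (N + 256)      ≤⟨ *-mono-≤ N≤ (+-monoˡ-≤ 256 N≤) ⟩
    256 * 512          ≤⟨ m≤n+m (256 * 512) 6 ⟩
    C₄                 ≡⟨ *-identityʳ C₄ ⟨
    C₄ * 1             ≤⟨ *-monoʳ-≤ C₄ 1≤m ⟩
    C₄ * m             ∎
    where open ≤-Reasoning

-- Tangent line of the convex function d / (M - d) at d = M / 4.
tangent : ∀ k d M → k + d ≤ M → 16 * (k * d) ≤ 9 * M * d + M * k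
tangent k d M h with m≤n⇒∃[o]m+o≡n h
... | o , refl = begin
  16 * (k * d)                                      ≡⟨ e₁ k d ⟩
  10 * (k * d) + 2 * (3 * d * k)                    ≤⟨ +-monoʳ-≤ (10 * (k * d)) (sq-ineq (3 * d) k) ⟩
  10 * (k * d) + (3 * d * (3 * d) + k * k)          ≤⟨ m≤m+n _ (9 * o * d + o * k) ⟩
  10 * (k * d) + (3 * d * (3 * d) + k * k) + (9 * o * d + o * k) ≡⟨ e₂ k d o ⟩
  9 * (k + d + o) * d + (k + d + o) * k             ∎
  where
  open ≤-Reasoning
  e₁ : ∀ k d → 16 * (k * d) ≡ 10 * (k * d) + 2 * (3 * d * k)
  e₁ = solve-∀
  e₂ : ∀ k d o → 10 * (k * d) + (3 * d * (3 * d) + k * k) + (9 * o * d + o * k) ≡ 9 * (k + d + o) * d + (k + d + o) * k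
  e₂ = solve-∀

module _ {n s : ℕ} {A : Fin n → Fin n → Bool} {W : Fin n → Bool} {I : Fin s → Bool} {M : Fin s → Fin n → Bool} where

  degrees-link : ∀ x → degrees (Link.Aˣ A W I M x) ≤ degrees A
  degrees-link x = sum-mono (Link.deg-link A W I M x)

  codegree-outside : ∀ {t} → MIS t A W I M → ∀ x → W x ≡ false → codegree I M x ≡ 0
  codegree-outside S x x∉ = #-empty _ λ i q → let a , b = ∧-elim {I i} q in clash (MIS.M⊂W S i x a b) x∉

  sum-codegree≥ : ∀ {t} → MIS t A W I M → # I * # W ≤ # I * t + sum (λ v → codegree I M v * # (A v))
  sum-codegree≥ {t} S = begin
    # I * # W                                          ≡⟨ *-#-sum I (# W) ⟩
    sum (λ i → 𝟙 (I i) * # W)                          ≤⟨ sum-mono (λ i → 𝟙*-mono (I i) (#W≤ i)) ⟩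
    sum (λ i → 𝟙 (I i) * (t + sum (λ y → 𝟙 (M i y) * # (A y))))
                                                       ≡⟨ sum-cong-≗ (λ i → *-distribˡ-+ (𝟙 (I i)) t (sum (λ y → 𝟙 (M i y) * # (A y)))) ⟩
    sum (λ i → 𝟙 (I i) * t + 𝟙 (I i) * sum (λ y → 𝟙 (M i y) * # (A y)))
                                                       ≡⟨ ∑-distrib-+ (λ i → 𝟙 (I i) * t) (λ i → 𝟙 (I i) * sum (λ y → 𝟙 (M i y) * # (A y))) ⟩
    sum (λ i → 𝟙 (I i) * t) + sum (λ i → 𝟙 (I i) * sum (λ y → 𝟙 (M i y) * # (A y)))
                                                       ≡⟨ cong₂ _+_ (sym (*-#-sum I t)) (sum-incidence (λ y → # (A y))) ⟩
    # I * t + sum (λ v → codegree I M v * # (A v))     ∎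
    where
    open ≤-Reasoning
    open MISCount S

  module Quadruples (S : MIS 4 A W I M) where
    open MIS S
    open MISCount S
    open ≤-Reasoning

    -- The link of x is a system of triples on the vertices other than x and its neighbours. The
    -- coefficient 1 of the number of vertices in `triple-count` enters here and decides the
    -- constant 2/3.
    κ+deg≤ : ∀ x → codegree I M x + # (A x) ≤ # W + 256
    κ+deg≤ x with decide (W x)
    ... | inj₂ x∉ = ≤-trans (≤-reflexive (cong₂ _+_ (codegree-outside S x x∉)
                      (#-empty (A x) λ v q → clash (A⊂W x v q) x∉))) z≤n
    ... | inj₁ x∈ = begin
      codegree I M x + # (A x)         ≤⟨ +-monoˡ-≤ (# (A x)) (triple-count (link S)) ⟩
      # Wˣ + 256 + # (A x)             ≡⟨ e (# Wˣ) (# (A x)) ⟩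
      # (A x) + # Wˣ + 256             ≤⟨ +-monoˡ-≤ 256 (+-monoʳ-≤ (# (A x)) (n≤1+n (# Wˣ))) ⟩
      # (A x) + suc (# Wˣ) + 256       ≡⟨ cong (_+ 256) (#W-link S x∈) ⟨
      # W + 256                        ∎
      where
      open Link A W I M x
      e : ∀ a b → a + 256 + b ≡ b + a + 256
      e a b = trans (cong (_+ b) (+-comm a 256)) (trans (+-assoc 256 a b) (trans (+-comm 256 (a + b)) (cong (_+ 256) (+-comm a b))))

    -- Write z for the number of sets and N for that of vertices. Summing `#W≤` over the sets bounds
    -- z N by 4 z plus the sum of codegree times degree, and `tangent` makes each product linear.
    -- For large N this reads 16 z N ≤ 18 N m + 4 N z, that is z ≤ (3/2) m, up to lower order.
    quadruple-bound : ∀ m → degrees A ≤ 2 * m →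
      16 * (# I * # W) ≤ 16 * (# I * 4) + (9 * (# W + 256) * (2 * m) + (# W + 256) * (# I * 4))
    quadruple-bound m edges = begin
      16 * (# I * # W)                                              ≤⟨ *-monoʳ-≤ 16 (sum-codegree≥ S) ⟩
      16 * (# I * 4 + sum (λ v → codegree I M v * # (A v)))         ≡⟨ *-distribˡ-+ 16 (# I * 4) _ ⟩
      16 * (# I * 4) + 16 * sum (λ v → codegree I M v * # (A v))    ≤⟨ +-monoʳ-≤ (16 * (# I * 4)) inner ⟩
      16 * (# I * 4) + (9 * K * (2 * m) + K * (# I * 4))            ∎
      where
      K = # W + 256
      inner : 16 * sum (λ v → codegree I M v * # (A v)) ≤ 9 * K * (2 * m) + K * (# I * 4)
      inner = begin
        16 * sum (λ v → codegree I M v * # (A v))                          ≡⟨ *-distribˡ-sum 16 (λ v → codegree I M v * # (A v)) ⟩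
        sum (λ v → 16 * (codegree I M v * # (A v)))                        ≤⟨ sum-mono (λ v → tangent (codegree I M v) (# (A v)) K (κ+deg≤ v)) ⟩
        sum (λ v → 9 * K * # (A v) + K * codegree I M v)                   ≡⟨ ∑-distrib-+ (λ v → 9 * K * # (A v)) (λ v → K * codegree I M v) ⟩
        sum (λ v → 9 * K * # (A v)) + sum (λ v → K * codegree I M v)       ≡⟨ cong₂ _+_ (*-distribˡ-sum (9 * K) (λ v → # (A v))) (*-distribˡ-sum K (codegree I M)) ⟨
        9 * K * degrees A + K * sum (codegree I M)                         ≤⟨ +-mono-≤ (*-monoʳ-≤ (9 * K) edges) (≤-reflexive (cong (K *_) sum-codegrees)) ⟩
        9 * K * (2 * m) + K * (# I * 4)                                    ∎

    -- A crude bound, whose purpose is to force the vertex set to be large when there are many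
    -- quadruples.
    quadruple-count : # I ≤ # W * (# W + 256)
    quadruple-count = begin
      # I                                  ≤⟨ sum-covers I M (λ i Ii → #-witness (M i) (≤-trans (s≤s z≤n) (≤-reflexive (sym (size i Ii))))) ⟩
      sum (codegree I M)                   ≤⟨ sum-mono row ⟩
      sum (λ x → 𝟙 (W x) * (# W + 256))    ≡⟨ *-#-sum W (# W + 256) ⟨
      # W * (# W + 256)                    ∎
      where
      row : ∀ x → codegree I M x ≤ 𝟙 (W x) * (# W + 256)
      row x with decide (W x)
      ... | inj₁ e rewrite e = ≤-trans (m≤m+n _ _) (≤-trans (κ+deg≤ x) (≤-reflexive (sym (+-identityʳ _))))
      ... | inj₂ e rewrite e = ≤-reflexive (codegree-outside S x e)

    quadruple-linear : ∀ m → 1 ≤ m → degrees A ≤ 2 * m → # I ≤ C₄ * m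
    quadruple-linear m 1≤m edges = case # W ≤? 256 of λ where
        (yes small) → C₄-small quadruple-count small 1≤m
        (no large)  → ≤-trans (dense (# I) m (# W) (≤-trans (n≤1+n 256) (≰⇒> large)) (quadruple-bound m edges)) (*-monoˡ-≤ m 6≤C₄)
      where
      dense : ∀ z m N → 256 ≤ N → 16 * (z * N) ≤ 16 * (z * 4) + (9 * (N + 256) * (2 * m) + (N + 256) * (z * 4)) → z ≤ 6 * m
      dense z m N N≥ h = *-cancelʳ-≤ z (6 * m) (6 * N) {{m*n≢0′}} (+-cancelˡ-≤ (10 * (z * N)) _ _ (begin
        10 * (z * N) + z * (6 * N)                        ≡⟨ e₁ z N ⟩
        16 * (z * N)                                      ≤⟨ h ⟩
        16 * (z * 4) + (9 * (N + 256) * (2 * m) + (N + 256) * (z * 4))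
          ≤⟨ +-mono-≤ (≤-trans (≤-reflexive (e₂ z)) (*-monoʳ-≤ z (≤-trans (m≤m+n 64 192) N≥)))
               (+-mono-≤ (*-monoˡ-≤ (2 * m) (*-monoʳ-≤ 9 (+-monoʳ-≤ N N≥))) (*-monoˡ-≤ (z * 4) (+-monoʳ-≤ N N≥))) ⟩
        z * N + (9 * (N + N) * (2 * m) + (N + N) * (z * 4)) ≡⟨ e₃ z m N ⟩
        9 * (z * N) + 6 * m * (6 * N)                      ≤⟨ +-monoˡ-≤ (6 * m * (6 * N)) (*-monoˡ-≤ (z * N) (n≤1+n 9)) ⟩
        10 * (z * N) + 6 * m * (6 * N)                     ∎))
        where
        m*n≢0′ : NonZero (6 * N)
        m*n≢0′ = >-nonZero (≤-trans (s≤s z≤n) (*-mono-≤ (m≤m+n 1 5) (≤-trans (m≤m+n 1 255) N≥)))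
        e₁ : ∀ z N → 10 * (z * N) + z * (6 * N) ≡ 16 * (z * N)
        e₁ = solve-∀
        e₂ : ∀ z → 16 * (z * 4) ≡ z * 64
        e₂ = solve-∀
        e₃ : ∀ z m N → z * N + (9 * (N + N) * (2 * m) + (N + N) * (z * 4)) ≡ 9 * (z * N) + 6 * m * (6 * N)
        e₃ = solve-∀

  -- Every set contains a vertex w of minimum degree δ or a neighbour of w, so the number of sets is
  -- at most δ + 1 times the largest codegree. With N vertices, δ + 1 ≤ N and N δ ≤ 2 m, whence (δ +
  -- 1)² ≤ 4 m; the case δ = 0 uses m ≥ 1.
  branch : ∀ {t} → MIS (suc t) A W I M → ∀ m → 1 ≤ m → degrees A ≤ 2 * m → ∀ B →
    (∀ x → codegree I M x * codegree I M x ≤ B) → # I * # I ≤ 4 * m * B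
  branch {t} S m 1≤m edges B bound = case 1 ≤? # I of λ where
      (no none)  → ≤-trans (≤-reflexive (cong (λ z → z * z) (n≤0⇒n≡0 (≤-pred (≰⇒> none))))) z≤n
      (yes some) → let i , Ii = #-witness I some
                       v , iv = #-witness (M i) (≤-trans (s≤s z≤n) (≤-reflexive (sym (size i Ii))))
        in core v (M⊂W i v Ii iv)
    where
    open MIS S
    open ≤-Reasoning
    core : ∀ v → W v ≡ true → # I * # I ≤ 4 * m * B
    core v Wv = begin
      # I * # I                ≤⟨ *-mono-≤ z≤ z≤ ⟩
      K * # P * (K * # P)      ≡⟨ e K (# P) ⟩
      # P * # P * (K * K)      ≤⟨ *-mono-≤ (≤-trans (*-mono-≤ #P≤ #P≤) δ²) (bound x) ⟩
      4 * m * B                ∎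
      where
      e : ∀ a b → a * b * (a * b) ≡ b * b * (a * a)
      e = solve-∀
      -- The minimum degree over W is found by maximising a reversed degree, which is positive
      -- exactly on W because degrees are at most n.
      lowest = argmax′ v (λ u → 𝟙 (W u) * (suc n ∸ # (A u)))
      w = proj₁ lowest
      δ = # (A w)
      most = argmax′ v (codegree I M)
      x = proj₁ most
      K = codegree I M x
      Ww : W w ≡ true
      Ww = positive (W w) (≤-trans (≤-trans (m<n⇒0<n∸m (s≤s (#≤n (A v)))) (≤-reflexive (sym (trans (cong (λ c → 𝟙 c * (suc n ∸ # (A v))) Wv) (+-identityʳ _)))))
                             (proj₂ lowest v))
        where
        positive : ∀ c {d} → 1 ≤ 𝟙 c * d → c ≡ true
        positive true _ = refl
      minimal : ∀ u → W u ≡ true → δ ≤ # (A u)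
      minimal u Wu = ∸-cancelʳ-≤ {o = suc n} (≤-trans (#≤n (A w)) (n≤1+n n))
        (≤-trans (≤-reflexive (sym (trans (cong (λ c → 𝟙 c * (suc n ∸ # (A u))) Wu) (+-identityʳ _))))
          (≤-trans (proj₂ lowest u) (≤-reflexive (trans (cong (λ c → 𝟙 c * (suc n ∸ δ)) Ww) (+-identityʳ _)))))
      P : Fin n → Bool
      P x = ⌊ w ≟ x ⌋ ∨ A w x
      #P≤ : # P ≤ suc δ
      #P≤ = begin
        # P                                                          ≡⟨ #-split P (λ x → ⌊ w ≟ x ⌋) ⟩
        # (λ x → P x ∧ ⌊ w ≟ x ⌋) + # (λ x → P x ∧ not ⌊ w ≟ x ⌋)    ≤⟨ +-mono-≤
                                                                         (≤-trans (#-mono λ x q → proj₂ (∧-elim {P x} q)) (≤-reflexive (#-single w)))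
                                                                         (#-mono λ x q → let a , b = ∧-elim {P x} q in right a (not-elim b)) ⟩
        suc δ                                                        ∎
        where
        right : ∀ {a b} → a ∨ b ≡ true → a ≡ false → b ≡ true
        right h refl = h
      reach : ∀ i → I i ≡ true → ∃[ x ] P x ≡ true × M i x ≡ true
      reach i Ii with decide (M i w)
      ... | inj₁ iw = w , cong (_∨ A w w) (holds {d = w ≟ w} refl) , iw
      ... | inj₂ w∉ = let y , iy , wy = dominate i w Ii Ww w∉ in y , ∨-right wy , iy
        where
        ∨-right : ∀ {a b} → b ≡ true → a ∨ b ≡ true
        ∨-right {true}  _ = refl
        ∨-right {false} h = h
      z≤ : # I ≤ K * # P
      z≤ = double-count I P M K reach (λ x _ → proj₂ most x)
      δ<W : suc δ ≤ # W
      δ<W = ≤-trans (s≤s (#-mono λ x q → ∧-intro (A⊂W x w (A-sym w x q)) (not-intro (fails λ r → no△ w w w (loop r q) (loop r q) (loop r q)))))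
                    (≤-reflexive (sym (#-remove W w Ww)))
        where
        loop : ∀ {x} → w ≡ x → A w x ≡ true → A w w ≡ true
        loop refl q = q
      spread : ∀ c → c ≤ δ → # W * c ≤ 2 * m
      spread c c≤ = begin
        # W * c                   ≡⟨ *-#-sum W c ⟩
        sum (λ v → 𝟙 (W v) * c)   ≤⟨ sum-mono (λ v → row v (decide (W v))) ⟩
        degrees A                 ≤⟨ edges ⟩
        2 * m                     ∎
        where
        row : ∀ v → W v ≡ true ⊎ W v ≡ false → 𝟙 (W v) * c ≤ # (A v)
        row v (inj₁ e) rewrite e | +-identityʳ c = ≤-trans c≤ (minimal v e)
        row v (inj₂ e) rewrite e = z≤n
      δ² : suc δ * suc δ ≤ 4 * m
      δ² = case 1 ≤? δ of λ where
        (no δ<1) → ≤-trans (≤-trans (*-mono-≤ (≰⇒> δ<1) (≰⇒> δ<1)) 1≤m) (m≤m+n m (3 * m))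
        (yes 1≤δ) → begin
          suc δ * suc δ             ≤⟨ *-monoˡ-≤ (suc δ) δ<W ⟩
          # W * suc δ               ≡⟨ *-suc (# W) δ ⟩
          # W + # W * δ             ≡⟨ cong (_+ # W * δ) (sym (*-identityʳ (# W))) ⟩
          # W * 1 + # W * δ         ≤⟨ +-mono-≤ (spread 1 1≤δ) (spread δ ≤-refl) ⟩
          2 * m + 2 * m             ≡⟨ *-distribʳ-+ m 2 2 ⟨
          4 * m                     ∎

-- Stated for the square of the count, so that exponents stay integral: each element beyond the
-- fourth multiplies the bound on the count by 2 √m.
mis-square : ∀ j {n s} {A : Fin n → Fin n → Bool} {W : Fin n → Bool} {I : Fin s → Bool} {M : Fin s → Fin n → Bool} →
  MIS (4 + j) A W I M → ∀ m → 1 ≤ m → degrees A ≤ 2 * m → # I * # I ≤ 4 ^ j * (C₄ * C₄) * m ^ (2 + j)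
mis-square zero S m 1≤m edges = ≤-trans (*-mono-≤ z z) (≤-reflexive (e C₄ m))
  where
  z = Quadruples.quadruple-linear S m 1≤m edges
  e : ∀ c m → c * m * (c * m) ≡ (1 * (c * c)) * (m * (m * 1))
  e = solve-∀
mis-square (suc j) {A = A} {W} {I} {M} S m 1≤m edges = ≤-trans
  (branch S m 1≤m edges (4 ^ j * (C₄ * C₄) * m ^ (2 + j))
    (λ x → mis-square j (Link.link A W I M x S) m 1≤m (≤-trans (degrees-link {A = A} {W} {I} {M} x) edges)))
  (≤-reflexive (e (4 ^ j) (C₄ * C₄) m (m ^ (2 + j))))
  where
  e : ∀ a b m d → 4 * m * (a * b * d) ≡ 4 * a * b * (m * d)
  e = solve-∀

-- Systems for arbitrary r, as indicator functions

Clique : ∀ {n p} → (Fin n → Fin n → Bool) → (Fin p → Fin n) → Set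
Clique A f = ∀ c d → c ≢ d → A (f c) (f d) ≡ true

-- An (r, t)-system with r = 3 + k, the s sets being given by their indicator functions.
record Sys (k t : ℕ) {n s : ℕ} (A : Fin n → Fin n → Bool) (M : Fin s → Fin n → Bool) : Set where
  field
    A-sym    : ∀ u v → A u v ≡ true → A v u ≡ true
    A-irrefl : ∀ u → A u u ≡ true → ⊥
    noK      : (f : Fin (3 + k) → Fin n) → Clique A f → ⊥
    free     : ∀ i (f : Fin (2 + k) → Fin n) → (∀ c → M i (f c) ≡ true) → Clique A f → ⊥
    saturate : ∀ i w → M i w ≡ false →
               Σ[ f ∈ (Fin (2 + k) → Fin n) ] (∀ c → M i (f c) ≡ true ⊎ f c ≡ w) × Clique A f
    meet     : ∀ i j → i ≢ j →
               Σ[ f ∈ (Fin (1 + k) → Fin n) ] (∀ c → M i (f c) ≡ true × M j (f c) ≡ true) × Clique A f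
    size     : ∀ i → # (M i) ≡ t
    distinct : ∀ i j → (∀ v → M i v ≡ true → M j v ≡ true) → i ≡ j

  clique-inj : ∀ {p} {f : Fin p → Fin n} → Clique A f → Inj f
  clique-inj {f = f} cl c d e with c ≟ d
  ... | yes r = r
  ... | no ne = ⊥-elim (A-irrefl (f c) (subst (λ z → A (f c) z ≡ true) (sym e) (cl c d ne)))

  apex : ∀ i w (f : Fin (2 + k) → Fin n) → (∀ c → M i (f c) ≡ true ⊎ f c ≡ w) → Clique A f → ∃[ c ] f c ≡ w
  apex i w f f∈ cl with any? (λ c → f c ≟ w)
  ... | yes r = r
  ... | no ¬r = ⊥-elim (free i f (λ c → case f∈ c of λ where
          (inj₁ m) → m
          (inj₂ e) → ⊥-elim (¬r (c , e))) cl)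

  adjacent : ∀ i j w → M j w ≡ true → M i w ≡ false → ∃[ y ] M i y ≡ true × M j y ≡ false × A w y ≡ true
  adjacent i j w w∈ w∉ with saturate i w w∉
  ... | f , f∈ , cl with any? (λ c → M j (f c) ≟ᵇ false) | apex i w f f∈ cl
  ...   | no all | _ = ⊥-elim (free j f (λ c → case decide (M j (f c)) of λ where
            (inj₁ m) → m
            (inj₂ m) → ⊥-elim (all (c , m))) cl)
  ...   | yes (c , fc∉) | c₀ , refl = f c , inside , fc∉ , cl c₀ c (λ { refl → clash w∈ fc∉ })
    where
    inside : M i (f c) ≡ true
    inside = case f∈ c of λ where
      (inj₁ m) → m
      (inj₂ e) → clash w∈ (subst (λ z → M j z ≡ false) e fc∉)

  open Codegree A (λ _ → true) M t k (λ f _ → noK f) (λ i j w _ _ → adjacent i j w) (λ i _ → size i)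
    (λ i j _ _ → distinct i j) public using (codegree≤; degree-bound; square-bound)

  -- A vertex outside one fixed set lies in its blocking clique, which has at least two vertices, so
  -- it is not isolated.
  n≤t+degrees : Fin s → n ≤ t + degrees A
  n≤t+degrees i = begin
    n                                      ≡⟨ #-all n ⟨
    # {n} (λ _ → true)                     ≡⟨ #-split (λ _ → true) (M i) ⟩
    # (M i) + # (λ w → not (M i w))        ≤⟨ +-mono-≤ (≤-reflexive (size i)) outside ⟩
    t + degrees A                          ∎
    where
    open ≤-Reasoning
    row : ∀ w → 𝟙 (not (M i w)) ≤ # (A w)
    row w with decide (M i w)
    ... | inj₁ e rewrite e = z≤n
    ... | inj₂ e = let f , f∈ , cl = saturate i w e
                       c , fc = apex i w f f∈ cl
      in ≤-trans (𝟙≤1 _) (neighbour f cl c fc)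
      where
      neighbour : (f : Fin (2 + k) → Fin n) → Clique A f → ∀ c → f c ≡ w → 1 ≤ # (A w)
      neighbour f cl zero    e = #-pos (A w) (f 1F) (subst (λ z → A z (f 1F) ≡ true) e (cl 0F 1F (λ ())))
      neighbour f cl (suc c) e = #-pos (A w) (f 0F) (subst (λ z → A z (f 0F) ≡ true) e (cl (suc c) 0F (λ ())))
    outside : # (λ w → not (M i w)) ≤ degrees A
    outside = ≤-trans (≤-reflexive (#-sum (λ w → not (M i w)))) (sum-mono row)

  private-vertex : ∀ i j → i ≢ j → ∃[ w ] M j w ≡ true × M i w ≡ false
  private-vertex i j i≢j with any? (λ w → (M j w ∧ not (M i w)) ≟ᵇ true)
  ... | yes (w , e) = let a , b = ∧-elim {M j w} e in w , a , not-elim b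
  ... | no none = ⊥-elim (i≢j (sym (distinct j i (λ v v∈ → case decide (M i v) of λ where
          (inj₁ m) → m
          (inj₂ m) → ⊥-elim (none (v , ∧-intro v∈ (not-intro m)))))))

  degrees-pos : ∀ i j → i ≢ j → 1 ≤ degrees A
  degrees-pos i j i≢j = let w , w∈ , w∉ = private-vertex i j i≢j
                            y , _ , _ , wy = adjacent i j w w∈ w∉
    in ≤-trans (#-pos (A w) y wy) (term≤sum (λ v → # (A v)) w)

  -- Each set is determined by 1 + k indices into a fixed set and its remaining u elements.
  count-by-codes : ∀ {u} → t ≡ (1 + k) + u → Fin s → s ≤ t ^ (1 + k) * n ^ u
  count-by-codes {u} t≡ i₀ = injective⇒≤ {f = encode} (λ {i} {j} → encode-inj i j)
    where
    E = enum (M i₀) (size i₀)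
    open Enum E
    Core : Fin s → Set
    Core i = Σ[ g ∈ (Fin (1 + k) → Fin t) ] Inj g × (∀ c → M i (el (g c)) ≡ true)
    core : ∀ i → Core i
    core i with i₀ ≟ i
    -- For the reference set itself no intersection is available; its first 1 + k elements serve as
    -- well.
    ... | yes refl = (λ c → cast′ (c ↑ˡ u)) , (λ c d e → inj-cast c d e) , (λ c → mem _)
      where
      cast′ : Fin ((1 + k) + u) → Fin t
      cast′ = cast (sym t≡)
      inj-cast : ∀ c d → cast′ (c ↑ˡ u) ≡ cast′ (d ↑ˡ u) → c ≡ d
      inj-cast c d e = ↑ˡ-injective u c d (toℕ-injective
        (trans (sym (toℕ-cast (sym t≡) (c ↑ˡ u))) (trans (cong toℕ e) (toℕ-cast (sym t≡) (d ↑ˡ u)))))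
    ... | no ne = let f , f∈ , cl = meet i₀ i ne
                      idx = λ c → cover (f c) (proj₁ (f∈ c))
      in (λ c → proj₁ (idx c)) ,
         (λ c d e → clique-inj cl c d (trans (sym (proj₂ (idx c))) (trans (cong el e) (proj₂ (idx d))))) ,
         (λ c → subst (λ z → M i z ≡ true) (sym (proj₂ (idx c))) (proj₂ (f∈ c)))
    g : ∀ i → Fin (1 + k) → Fin t
    g i = proj₁ (core i)
    rest : Fin s → Fin n → Bool
    rest i v = M i v ∧ not ⌊ any? (λ c → el (g i c) ≟ v) ⌋
    #rest : ∀ i → # (rest i) ≡ u
    #rest i = +-cancelˡ-≡ (1 + k) _ _ (trans (cong (_+ # (rest i)) (sym part)) (trans (sym (#-split (M i) im)) (trans (size i) t≡)))
      where
      im : Fin n → Bool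
      im v = ⌊ any? (λ c → el (g i c) ≟ v) ⌋
      part : # (λ v → M i v ∧ im v) ≡ 1 + k
      part = Enum⇒# {p = λ v → M i v ∧ im v} record
        { el = λ c → el (g i c)
        ; inj = λ c d e → proj₁ (proj₂ (core i)) c d (inj _ _ e)
        ; mem = λ c → ∧-intro (proj₂ (proj₂ (core i)) c) (holds (c , refl))
        ; cover = λ v q → witness (proj₂ (∧-elim {M i v} q)) }
    h : ∀ i → Enum (rest i) u
    h i = enum (rest i) (#rest i)
    encode : Fin s → Fin (t ^ (1 + k) * n ^ u)
    encode i = combine (funToFin (g i)) (funToFin (Enum.el (h i)))
    same-fun : ∀ {a b} (f f′ : Fin a → Fin b) → funToFin f ≡ funToFin f′ → ∀ c → f c ≡ f′ c
    same-fun f f′ e c = trans (sym (finToFun-funToFin f c)) (trans (cong (λ z → finToFun z c) e) (finToFun-funToFin f′ c))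
    encode-inj : ∀ i j → encode i ≡ encode j → i ≡ j
    encode-inj i j e = distinct i j sub
      where
      parts = combine-injective (funToFin (g i)) (funToFin (Enum.el (h i))) (funToFin (g j)) (funToFin (Enum.el (h j))) e
      sub : ∀ v → M i v ≡ true → M j v ≡ true
      sub v v∈ with any? (λ c → el (g i c) ≟ v)
      ... | yes (c , refl) = subst (λ z → M j (el z) ≡ true) (sym (same-fun (g i) (g j) (proj₁ parts) c)) (proj₂ (proj₂ (core j)) c)
      ... | no new = let d , q = Enum.cover (h i) v (∧-intro v∈ (not-intro (fails new))) in
              subst (λ z → M j z ≡ true) (trans (sym (same-fun (Enum.el (h i)) (Enum.el (h j)) (proj₂ parts) d)) q) (proj₁ (∧-elim (Enum.mem (h j) d)))

sys⇒MIS : ∀ {t n s} {A : Fin n → Fin n → Bool} {M : Fin s → Fin n → Bool} → Sys 0 t A M →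
  MIS t A (λ _ → true) (λ _ → true) M
sys⇒MIS {A = A} {M} X = record
  { A-sym = A-sym
  ; A⊂W = λ _ _ _ → refl
  ; no△ = λ u v w uv vw uw → noK (u ∷ (v ∷ λ _ → w)) λ where
      0F 0F ne → ⊥-elim (ne refl)
      0F 1F _ → uv
      0F 2F _ → uw
      1F 0F _ → A-sym u v uv
      1F 1F ne → ⊥-elim (ne refl)
      1F 2F _ → vw
      2F 0F _ → A-sym u w uw
      2F 1F _ → A-sym v w vw
      2F 2F ne → ⊥-elim (ne refl)
  ; M⊂W = λ _ _ _ _ → refl
  ; indep = λ i u v _ u∈ v∈ uv → free i (u ∷ λ _ → v) (∷-all (M i) u∈ (λ _ → v∈)) λ where
      0F 0F ne → ⊥-elim (ne refl)
      0F 1F _ → uv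
      1F 0F _ → A-sym u v uv
      1F 1F ne → ⊥-elim (ne refl)
  ; dominate = dom
  ; size = λ i _ → size i
  ; distinct = λ i j _ _ → distinct i j }
  where
  open Sys X
  dom : ∀ i w → true ≡ true → true ≡ true → M i w ≡ false → ∃[ y ] M i y ≡ true × A w y ≡ true
  dom i w _ _ w∉ with saturate i w w∉
  ... | f , f∈ , cl with apex i w f f∈ cl
  ...   | 0F , refl = f 1F , inside (f∈ 1F) , cl 0F 1F (λ ())
    where
    inside : M i (f 1F) ≡ true ⊎ f 1F ≡ f 0F → M i (f 1F) ≡ true
    inside (inj₁ m) = m
    inside (inj₂ e) = case clique-inj cl 1F 0F e of λ ()
  ...   | 1F , refl = f 0F , inside (f∈ 0F) , cl 1F 0F (λ ())
    where
    inside : M i (f 0F) ≡ true ⊎ f 0F ≡ f 1F → M i (f 0F) ≡ true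
    inside (inj₁ m) = m
    inside (inj₂ e) = case clique-inj cl 0F 1F e of λ ()

-- From graphs and lists of subsets to indicator functions

listsum-tabulate : ∀ {n} {B : Set} (f : B → ℕ) (g : Fin n → B) → sumₗ (map f (tabulate g)) ≡ sum (λ i → f (g i))
listsum-tabulate {zero}  f g = refl
listsum-tabulate {suc n} f g = cong (f (g zero) +_) (listsum-tabulate f (g ∘ suc))

<⇒<ᵇ≡true : ∀ {a b} → a < b → (a <ᵇ b) ≡ true
<⇒<ᵇ≡true {zero}  {suc b} _       = refl
<⇒<ᵇ≡true {suc a} {suc b} (s≤s h) = <⇒<ᵇ≡true h

≮⇒<ᵇ≡false : ∀ {a b} → ¬ (a < b) → (a <ᵇ b) ≡ false
≮⇒<ᵇ≡false {a}     {zero}  h = refl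
≮⇒<ᵇ≡false {zero}  {suc b} h = ⊥-elim (h (s≤s z≤n))
≮⇒<ᵇ≡false {suc a} {suc b} h = ≮⇒<ᵇ≡false (λ r → h (s≤s r))

edgesOn : ∀ {n} → (Fin n → Fin n → Bool) → ℕ
edgesOn A = sum (λ i → sum (λ j → 𝟙 ((toℕ i <ᵇ toℕ j) ∧ A i j)))

edges≡edgesOn : ∀ {n} (H : Graph n) → edges H ≡ edgesOn (adj H)
edges≡edgesOn {n} H = trans (listsum-tabulate (λ i → sumₗ (map (up i) (allFin n))) (λ i → i))
                            (sum-cong-≗ (λ i → listsum-tabulate (up i) (λ j → j)))
  where
  up : Fin n → Fin n → ℕ
  up i j = 𝟙 ((toℕ i <ᵇ toℕ j) ∧ adj H i j)

handshake : ∀ {n} (H : Graph n) → degrees (adj H) ≡ 2 * edges H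
handshake {n} H = begin
  degrees (adj H)                                            ≡⟨ sum-cong-≗ (λ i → #-sum (adj H i)) ⟩
  sum (λ i → sum (λ j → 𝟙 (adj H i j)))                      ≡⟨ sum-cong-≗ (λ i → sum-cong-≗ (λ j → split i j)) ⟩
  sum (λ i → sum (λ j → up i j + up j i))                    ≡⟨ sum-cong-≗ (λ i → ∑-distrib-+ (up i) (λ j → up j i)) ⟩
  sum (λ i → sum (up i) + sum (λ j → up j i))                ≡⟨ ∑-distrib-+ (λ i → sum (up i)) (λ i → sum (λ j → up j i)) ⟩
  sum (λ i → sum (up i)) + sum (λ i → sum (λ j → up j i))    ≡⟨ cong (sum (λ i → sum (up i)) +_) (∑-comm (λ i j → up j i)) ⟩
  E + E                                                      ≡⟨ cong (E +_) (sym (+-identityʳ E)) ⟩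
  2 * E                                                      ≡⟨ cong (2 *_) (sym (edges≡edgesOn H)) ⟩
  2 * edges H                                                ∎
  where
  open ≡-Reasoning
  up : Fin n → Fin n → ℕ
  up i j = 𝟙 ((toℕ i <ᵇ toℕ j) ∧ adj H i j)
  E = sum (λ i → sum (up i))
  pick-one : ∀ (i j : Fin n) b → (i ≡ j → b ≡ false) → 𝟙 b ≡ 𝟙 ((toℕ i <ᵇ toℕ j) ∧ b) + 𝟙 ((toℕ j <ᵇ toℕ i) ∧ b)
  pick-one i j b h with <-cmp (toℕ i) (toℕ j)
  ... | tri< a _ c rewrite <⇒<ᵇ≡true a | ≮⇒<ᵇ≡false c = sym (+-identityʳ (𝟙 b))
  ... | tri> a _ c rewrite <⇒<ᵇ≡true c | ≮⇒<ᵇ≡false a = refl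
  ... | tri≈ a e c rewrite ≮⇒<ᵇ≡false a | ≮⇒<ᵇ≡false c | h (toℕ-injective e) = refl
  split : ∀ i j → 𝟙 (adj H i j) ≡ up i j + up j i
  split i j = trans (pick-one i j (adj H i j) (λ { refl → Graph.irrefl H i }))
    (cong (λ b → up i j + 𝟙 ((toℕ j <ᵇ toℕ i) ∧ b)) (Graph.sym H i j))

∣∣≡# : ∀ {n} (S : Subset n) → ∣ S ∣ ≡ # (lookup S)
∣∣≡# S = trans (go S) (sym (#-sum (lookup S)))
  where
  go : ∀ {n} (S : Subset n) → ∣ S ∣ ≡ sum (λ i → 𝟙 (lookup S i))
  go []            = refl
  go (true ∷ᵥ S)   = cong suc (go S)
  go (false ∷ᵥ S)  = go S

lookup-ext : ∀ {n} (S T : Subset n) → (∀ v → lookup S v ≡ lookup T v) → S ≡ T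
lookup-ext S T h = trans (sym (tabulate∘lookup S)) (trans (tabulate-cong h) (tabulate∘lookup T))

⊂∧#≡ : ∀ {n} (p q : Fin n → Bool) → (∀ v → p v ≡ true → q v ≡ true) → # p ≡ # q → ∀ v → p v ≡ q v
⊂∧#≡ p q sub eq v with decide (p v) | decide (q v)
... | inj₁ a | _      = trans a (sym (sub v a))
... | inj₂ a | inj₂ b = trans a (sym b)
... | inj₂ a | inj₁ b = ⊥-elim (1+n≰n (≤-trans (+-mono-≤ (#-pos (λ u → q u ∧ not (p u)) v (∧-intro b (not-intro a)))
    (#-mono (λ u r → ∧-intro (sub u r) r))) (≤-reflexive (trans (+-comm _ (# (λ u → q u ∧ p u)))
      (trans (sym (#-split q p)) (sym eq))))))

lookup-injective : ∀ {B : Set} {xs : List B} → Unique xs → ∀ i j → lookupₗ xs i ≡ lookupₗ xs j → i ≡ j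
lookup-injective (_ ∷ₚ u) zero zero e = refl
lookup-injective {xs = _ ∷ₗ xs} (a ∷ₚ u) zero (suc j) e = ⊥-elim (All-lookup a (∈-lookup j) e)
lookup-injective {xs = _ ∷ₗ xs} (a ∷ₚ u) (suc i) zero e = ⊥-elim (All-lookup a (∈-lookup i) (sym e))
lookup-injective (_ ∷ₚ u) (suc i) (suc j) e = cong suc (lookup-injective u i j e)

system⇒Sys : ∀ {k t s} (X : RTSystem (3 + k) t s) →
  Σ[ M ∈ (Fin s → Fin (RTSystem.n X) → Bool) ] Sys k t (adj (RTSystem.H X)) M
system⇒Sys {k} {t} record { n = n ; H = H ; F = F ; system = noK , max , int ; noRep = u ; sizes = sz ; card = refl } = M , record
  { A-sym = λ a b e → trans (sym (Graph.sym H a b)) e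
  ; A-irrefl = λ a e → clash e (Graph.irrefl H a)
  ; noK = λ f cl → noK (f , (λ _ → ∈⊤) , cl)
  ; free = λ i f f∈ cl → proj₁ (All-lookup max (∈-lookup i)) (f , (λ c → lookup⇒[]= (f c) (S i) (f∈ c)) , cl)
  ; saturate = λ i w w∉ → let f , f∈ , cl = proj₂ (All-lookup max (∈-lookup i)) w (λ q → clash ([]=⇒lookup q) w∉) in
      f , (λ c → case x∈p∪q⁻ (S i) ⁅ w ⁆ (f∈ c) of λ where
        (inj₁ q) → inj₁ ([]=⇒lookup q)
        (inj₂ q) → inj₂ (x∈⁅y⁆⇒x≡y w q)) , cl
  ; meet = λ i j i≢j → let f , f∈ , cl = int (S i) (S j) (∈-lookup i) (∈-lookup j) (λ e → i≢j (lookup-injective u i j e)) in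
      f , (λ c → let a , b = x∈p∩q⁻ (S i) (S j) (f∈ c) in []=⇒lookup a , []=⇒lookup b) , cl
  ; size = size
  -- Inclusion is enough for equality because all sets have the same size.
  ; distinct = λ i j sub → lookup-injective u i j (lookup-ext (S i) (S j)
      (⊂∧#≡ (M i) (M j) sub (trans (size i) (sym (size j))))) }
  where
  S : Fin (length F) → Subset n
  S = lookupₗ F
  M : Fin (length F) → Fin n → Bool
  M i = lookup (S i)
  size : ∀ i → # (M i) ≡ t
  size i = trans (sym (∣∣≡# (S i))) (All-lookup sz (∈-lookup i))

-- Lower bounds for large t

^-distribʳ-* : ∀ u a b → (a * b) ^ u ≡ a ^ u * b ^ u
^-distribʳ-* zero    a b = refl
^-distribʳ-* (suc u) a b = trans (cong (a * b *_) (^-distribʳ-* u a b)) (e a b (a ^ u) (b ^ u))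
  where
  e : ∀ a b c d → a * b * (c * d) ≡ a * c * (b * d)
  e = solve-∀

module _ {k t s : ℕ} (X : RTSystem (3 + k) t s) where

  private
    m = edges (RTSystem.H X)

  edges-pos : 2 ≤ s → 1 ≤ m
  edges-pos (s≤s (s≤s _)) = case m ≟ℕ 0 of λ where
    (yes e) → ⊥-elim (1+n≰n (≤-trans (Sys.degrees-pos (proj₂ (system⇒Sys X)) 0F 1F (λ ()))
                (≤-reflexive (trans (handshake (RTSystem.H X)) (cong (2 *_) e)))))
    (no ne) → n≢0⇒n>0 ne

  vertices≤ : 1 ≤ s → RTSystem.n X ≤ t + 2 * m
  vertices≤ (s≤s _) = ≤-trans (Sys.n≤t+degrees (proj₂ (system⇒Sys X)) 0F) (≤-reflexive (cong (t +_) (handshake (RTSystem.H X))))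

  -- The exponent is u = t - r + 2, the number of elements of a set outside the coded part; once m ≥
  -- 1, `vertices≤` bounds the number of vertices by (t + 2) m.
  count-lower : ∀ {u} → t ≡ (1 + k) + u → 2 ≤ s → s ≤ t ^ (1 + k) * (t + 2) ^ u * m ^ u
  count-lower {u} t≡ 2≤s = begin
    s                                       ≤⟨ Sys.count-by-codes (proj₂ (system⇒Sys X)) t≡ (first 2≤s) ⟩
    t ^ (1 + k) * RTSystem.n X ^ u          ≤⟨ *-monoʳ-≤ (t ^ (1 + k)) (^-monoˡ-≤ u (vertices≤ (≤-trans (n≤1+n 1) 2≤s))) ⟩
    t ^ (1 + k) * (t + 2 * m) ^ u           ≤⟨ *-monoʳ-≤ (t ^ (1 + k)) (^-monoˡ-≤ u bound) ⟩
    t ^ (1 + k) * ((t + 2) * m) ^ u         ≡⟨ cong (t ^ (1 + k) *_) (^-distribʳ-* u (t + 2) m) ⟩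
    t ^ (1 + k) * ((t + 2) ^ u * m ^ u)     ≡⟨ *-assoc (t ^ (1 + k)) _ _ ⟨
    t ^ (1 + k) * (t + 2) ^ u * m ^ u       ∎
    where
    open ≤-Reasoning
    first : 2 ≤ s → Fin s
    first (s≤s _) = zero
    bound : t + 2 * m ≤ (t + 2) * m
    bound = ≤-trans (+-monoˡ-≤ (2 * m) (m≤m*n t m {{>-nonZero (edges-pos 2≤s)}})) (≤-reflexive (sym (*-distribʳ-+ m t 2)))

module _ {t s : ℕ} (X : RTSystem 3 t s) where

  private
    m = edges (RTSystem.H X)
    A = adj (RTSystem.H X)
    M = proj₁ (system⇒Sys X)
    Y = proj₂ (system⇒Sys X)
    edges≤ : degrees A ≤ 2 * m
    edges≤ = ≤-reflexive (handshake (RTSystem.H X))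

  touch : ∀ {i₀ : Fin s} {i} → 1 ≤ t → ∃[ x ] M i₀ x ≡ true × M i x ≡ true
  touch {i₀} {i} 1≤t with i₀ ≟ i
  ... | yes refl = let x , e = #-witness (M i) (≤-trans 1≤t (≤-reflexive (sym (Sys.size Y i)))) in x , e , e
  ... | no ne = let f , f∈ , _ = Sys.meet Y i₀ i ne in f 0F , f∈ 0F

  square-lower : ∀ j → t ≡ 5 + j → 2 ≤ s → s * s ≤ t * t * (4 ^ j * (C₄ * C₄)) * m ^ (2 + j)
  square-lower j refl 2≤s@(s≤s _) = begin
    s * s                                    ≤⟨ *-mono-≤ s≤ s≤ ⟩
    K * t * (K * t)                          ≡⟨ e K t ⟩
    t * t * (K * K)                          ≤⟨ *-monoʳ-≤ (t * t) (mis-square j (Link.link A (λ _ → true) (λ _ → true) M x (sys⇒MIS Y)) m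
                                                  (edges-pos X 2≤s) (≤-trans (degrees-link {A = A} {λ _ → true} {λ _ → true} {M} x) edges≤)) ⟩
    t * t * (4 ^ j * (C₄ * C₄) * m ^ (2 + j)) ≡⟨ *-assoc (t * t) (4 ^ j * (C₄ * C₄)) _ ⟨
    t * t * (4 ^ j * (C₄ * C₄)) * m ^ (2 + j) ∎
    where
    open ≤-Reasoning
    e : ∀ a b → a * b * (a * b) ≡ b * b * (a * a)
    e = solve-∀
    most = argmax′ (proj₁ (touch {0F} {0F} (s≤s z≤n))) (λ x → # (λ i → M i x))
    x = proj₁ most
    K = # (λ i → M i x)
    s≤ : s ≤ K * t
    s≤ = begin
      s                          ≡⟨ #-all s ⟨
      # {s} (λ _ → true)         ≤⟨ double-count (λ _ → true) (M 0F) M K (λ i _ → touch (s≤s z≤n)) (λ x _ → proj₂ most x) ⟩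
      K * # (M 0F)               ≡⟨ cong (K *_) (Sys.size Y 0F) ⟩
      K * t                      ∎

-- The lower bound for r = 3 and t = 5

cube-scale : ∀ c {s K C B} → s ≤ K * c → K * K * K ≤ C * B → s * s * s ≤ c * c * c * C * B
cube-scale c {s} {K} {C} {B} s≤ K³ = begin
  s * s * s                          ≤⟨ *-mono-≤ (*-mono-≤ s≤ s≤) s≤ ⟩
  K * c * (K * c) * (K * c)          ≡⟨ e₁ c K ⟩
  c * c * c * (K * K * K)            ≤⟨ *-monoʳ-≤ (c * c * c) K³ ⟩
  c * c * c * (C * B)                ≡⟨ *-assoc (c * c * c) C B ⟨
  c * c * c * C * B                  ∎
  where
  open ≤-Reasoning
  e₁ : ∀ c z → z * c * (z * c) * (z * c) ≡ c * c * c * (z * z * z)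
  e₁ = solve-∀

-- Cancelling 4 s N leaves 12 s N ≤ 18 N m + (64 + 22 c) s: here 64 = 16 · 4, and 22 c = 4 c + 18 c
-- once m is replaced by s in the last term. When N is at least (64 + 22 c)(k + 1), the error is at
-- most s N / (k + 1).
absorb : ∀ c N k s m → m ≤ s → (64 + 22 * c) * suc k ≤ N → NonZero N →
  16 * (s * N) ≤ 16 * (s * 4) + (9 * (N + c) * (2 * m) + (N + c) * (s * 4)) → 2 * suc k * s ≤ 3 * suc k * m + 3 * s
absorb c N k s m m≤s N≥ nz h = *-cancelʳ-≤ _ _ (6 * N) {{m*n≢0 6 N {{_}} {{nz}}}} (begin
  2 * suc k * s * (6 * N)                                     ≡⟨ e₂ (suc k) s N ⟩
  suc k * (12 * (s * N))                                      ≤⟨ *-monoʳ-≤ (suc k) twelve ⟩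
  suc k * (18 * (N * m) + (64 + 22 * c) * s)                  ≡⟨ e₃ (suc k) N m (64 + 22 * c) s ⟩
  18 * suc k * (N * m) + (64 + 22 * c) * suc k * s            ≤⟨ +-monoʳ-≤ (18 * suc k * (N * m)) (*-monoˡ-≤ s (≤-trans N≥ (m≤m+n N (17 * N)))) ⟩
  18 * suc k * (N * m) + 18 * N * s                           ≡⟨ e₄ (suc k) N m s ⟩
  (3 * suc k * m + 3 * s) * (6 * N)                           ∎)
  where
  open ≤-Reasoning
  e₁ : ∀ s N → 16 * (s * N) ≡ 4 * (N * s) + 12 * (s * N)
  e₁ = solve-∀
  e₂ : ∀ k s N → 2 * k * s * (6 * N) ≡ k * (12 * (s * N))
  e₂ = solve-∀
  e₃ : ∀ k N m d s → k * (18 * (N * m) + d * s) ≡ 18 * k * (N * m) + d * k * s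
  e₃ = solve-∀
  e₄ : ∀ k N m s → 18 * k * (N * m) + 18 * N * s ≡ (3 * k * m + 3 * s) * (6 * N)
  e₄ = solve-∀
  e₅ : ∀ c N s m → 16 * (s * 4) + (9 * (N + c) * (2 * m) + (N + c) * (s * 4)) ≡
                   4 * (N * s) + (18 * (N * m) + (64 * s + 4 * c * s + 18 * c * m))
  e₅ = solve-∀
  e₆ : ∀ c s → 64 * s + 4 * c * s + 18 * c * s ≡ (64 + 22 * c) * s
  e₆ = solve-∀
  twelve : 12 * (s * N) ≤ 18 * (N * m) + (64 + 22 * c) * s
  twelve = +-cancelˡ-≤ (4 * (N * s)) _ _ (begin
    4 * (N * s) + 12 * (s * N)                                               ≡⟨ e₁ s N ⟨
    16 * (s * N)                                                             ≤⟨ h ⟩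
    16 * (s * 4) + (9 * (N + c) * (2 * m) + (N + c) * (s * 4))               ≡⟨ e₅ c N s m ⟩
    4 * (N * s) + (18 * (N * m) + (64 * s + 4 * c * s + 18 * c * m))         ≤⟨ +-monoʳ-≤ (4 * (N * s)) (+-monoʳ-≤ (18 * (N * m))
                                                                                  (+-monoʳ-≤ (64 * s + 4 * c * s) (*-monoʳ-≤ (18 * c) m≤s))) ⟩
    4 * (N * s) + (18 * (N * m) + (64 * s + 4 * c * s + 18 * c * s))         ≡⟨ cong (λ z → 4 * (N * s) + (18 * (N * m) + z)) (e₆ c s) ⟩
    4 * (N * s) + (18 * (N * m) + (64 + 22 * c) * s)                         ∎)

opaque
  -- 25 = 5 · 5: `no-common-vertex` applies the pigeonhole principle twice to the five vertices of a
  -- set.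
  C₅ : ℕ
  C₅ = 25 * 25 * 25 * C₃

  C₅-scale : ∀ s K B → s ≤ K * 25 → K * K * K ≤ C₃ * B → s * s * s ≤ C₅ * B
  C₅-scale s K B = cube-scale 25 {s} {K} {C₃} {B}

  D₅ : ℕ
  D₅ = 64 + 22 * 256

  D₅-pos : 1 ≤ D₅
  D₅-pos = m≤m+n 1 5695

  D₅-absorb : ∀ N k s m → m ≤ s → D₅ * suc k ≤ N → NonZero N →
    16 * (s * N) ≤ 16 * (s * 4) + (9 * (N + 256) * (2 * m) + (N + 256) * (s * 4)) → 2 * suc k * s ≤ 3 * suc k * m + 3 * s
  D₅-absorb = absorb 256

-- The first product forces the link to have at least D₅ (k + 1) vertices, by `quadruple-count`; the
-- summand C₅ contradicts s³ ≤ C₅ m² when m ≤ s.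
five-threshold : ℕ → ℕ
five-threshold k = suc (D₅ * suc k * (D₅ * suc k + 256) + C₅)

module _ {s : ℕ} (X : RTSystem 3 5 s) where

  private
    m = edges (RTSystem.H X)
    A = adj (RTSystem.H X)
    M = proj₁ (system⇒Sys X)
    Y = proj₂ (system⇒Sys X)
    ⊤ₙ : Fin (RTSystem.n X) → Bool
    ⊤ₙ _ = true
    ⊤ₛ : Fin s → Bool
    ⊤ₛ _ = true
    edges≤ : degrees A ≤ 2 * m
    edges≤ = ≤-reflexive (handshake (RTSystem.H X))

  -- Let x be a most popular vertex and let j avoid it. Every set through x meets j, necessarily
  -- outside x, so linking twice keeps a positive proportion of the sets and leaves triples. The
  -- resulting bound is incompatible with m ≤ s for large s, so in that case all sets share a
  -- vertex.
  no-common-vertex : 2 ≤ s → (∀ x → ∃[ i ] M i x ≡ false) → s * s * s ≤ C₅ * (m * m)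
  no-common-vertex 2≤s@(s≤s _) avoid-x = C₅-scale s K₂ (m * m) (≤-trans s≤ (≤-reflexive (*-assoc K₂ 5 5)))
      (triple-cube linked m (edges-pos X 2≤s)
        (≤-trans (≤-trans (degrees-link {A = Aˣ} {Wˣ} {Iˣ} {Mˣ} y) (degrees-link {A = A} {⊤ₙ} {⊤ₛ} {M} x)) edges≤))
    where
    open ≤-Reasoning
    v₀ = proj₁ (touch X {0F} {0F} (s≤s z≤n))
    most = argmax′ v₀ (λ x → # (λ i → M i x))
    x = proj₁ most
    open Link A ⊤ₙ ⊤ₛ M x
    most₂ = argmax′ v₀ (λ y → # (λ i → M i x ∧ Mˣ i y))
    y = proj₁ most₂
    K₂ = # (λ i → M i x ∧ Mˣ i y)
    linked = Link.link Aˣ Wˣ Iˣ Mˣ y (link (sys⇒MIS Y))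
    j = proj₁ (avoid-x x)
    through : ∀ i → M i x ≡ true → ∃[ y ] M j y ≡ true × Mˣ i y ≡ true
    through i ix = let y , jy , iy = touch X {j} {i} (s≤s z≤n) in
      y , jy , ∧-intro iy (not-intro (fails λ e → clash (subst (λ z → M j z ≡ true) (sym e) jy) (proj₂ (avoid-x x))))
    K≤ : # (λ i → M i x) ≤ K₂ * 5
    K≤ = ≤-trans (double-count (λ i → M i x) (M j) Mˣ K₂ through (λ y _ → proj₂ most₂ y))
                 (≤-reflexive (cong (K₂ *_) (Sys.size Y j)))
    s≤ : s ≤ K₂ * 5 * 5
    s≤ = begin
      s                          ≡⟨ #-all s ⟨
      # {s} (λ _ → true)         ≤⟨ double-count (λ _ → true) (M 0F) M (# (λ i → M i x)) (λ i _ → touch X (s≤s z≤n)) (λ x _ → proj₂ most x) ⟩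
      # (λ i → M i x) * # (M 0F) ≡⟨ cong (# (λ i → M i x) *_) (Sys.size Y 0F) ⟩
      # (λ i → M i x) * 5        ≤⟨ *-monoˡ-≤ 5 K≤ ⟩
      K₂ * 5 * 5                 ∎

  common-vertex : ∀ x → (∀ i → M i x ≡ true) → Σ[ N ∈ ℕ ]
    (s ≤ N * (N + 256)) × (16 * (s * N) ≤ 16 * (s * 4) + (9 * (N + 256) * (2 * m) + (N + 256) * (s * 4)))
  common-vertex x x∈ = # Wˣ , subst (_≤ # Wˣ * (# Wˣ + 256)) #I≡s quadruple-count ,
    subst (λ z → 16 * (z * # Wˣ) ≤ 16 * (z * 4) + (9 * (# Wˣ + 256) * (2 * m) + (# Wˣ + 256) * (z * 4))) #I≡s
      (quadruple-bound m (≤-trans (degrees-link {A = A} {⊤ₙ} {⊤ₛ} {M} x) edges≤))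
    where
    open Link A ⊤ₙ ⊤ₛ M x
    open Quadruples (link (sys⇒MIS Y))
    #I≡s : # Iˣ ≡ s
    #I≡s = trans (#-cong x∈) (#-all s)

  five-lower : ∀ k → 2 + five-threshold k ≤ s → 2 * suc k * s ≤ 3 * suc k * m + 3 * s
  five-lower k s≥ = case s ≤? m of λ where
      (yes s≤m) → ≤-trans (*-mono-≤ (*-monoˡ-≤ (suc k) (n≤1+n 2)) s≤m) (m≤m+n _ (3 * s))
      (no s≰m)  → few-edges (≤-trans (n≤1+n m) (≰⇒> s≰m))
    where
    2≤s : 2 ≤ s
    2≤s = ≤-trans (m≤m+n 2 _) s≥
    0<s : NonZero s
    0<s = >-nonZero (≤-trans (n≤1+n 1) 2≤s)
    L = D₅ * suc k
    large : suc (L * (L + 256) + C₅) ≤ s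
    large = ≤-trans (m≤n+m _ 2) s≥
    shared : (∃[ x ] (∀ i → M i x ≡ true)) → m ≤ s → 2 * suc k * s ≤ 3 * suc k * m + 3 * s
    shared (x , x∈) m≤s = use (common-vertex x x∈)
      where
      use : (Σ[ N ∈ ℕ ] (s ≤ N * (N + 256)) × (16 * (s * N) ≤ 16 * (s * 4) + (9 * (N + 256) * (2 * m) + (N + 256) * (s * 4)))) →
        2 * suc k * s ≤ 3 * suc k * m + 3 * s
      use (N , s≤ , h) = D₅-absorb N k s m m≤s L≤N (>-nonZero (≤-trans (*-mono-≤ D₅-pos (s≤s z≤n)) L≤N)) h
        where
        L≤N : L ≤ N
        L≤N = case L ≤? N of λ where
          (yes r) → r
          (no r)  → ⊥-elim (<⇒≱ (≤-trans (s≤s (m≤m+n (L * (L + 256)) _)) large)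
                      (≤-trans s≤ (*-mono-≤ (≤-trans (n≤1+n N) (≰⇒> r)) (+-monoˡ-≤ 256 (≤-trans (n≤1+n N) (≰⇒> r))))))
    unshared : ¬ (∃[ x ] (∀ i → M i x ≡ true)) → m ≤ s → ⊥
    unshared none m≤s = <⇒≱ (≤-trans (s≤s (m≤n+m C₅ _)) large)
      (*-cancelʳ-≤ s C₅ (s * s) {{m*n≢0 s s {{0<s}} {{0<s}}}}
        (≤-trans (≤-reflexive (sym (*-assoc s s s)))
          (≤-trans (no-common-vertex 2≤s miss) (*-monoʳ-≤ C₅ (*-mono-≤ m≤s m≤s)))))
      where
      miss : ∀ x → ∃[ i ] M i x ≡ false
      miss x = case any? (λ i → M i x ≟ᵇ false) of λ where
        (yes r) → r
        (no ¬r) → ⊥-elim (none (x , λ i → case decide (M i x) of λ where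
              (inj₁ e) → e
              (inj₂ e) → ⊥-elim (¬r (i , e))))
    few-edges : m ≤ s → 2 * suc k * s ≤ 3 * suc k * m + 3 * s
    few-edges m≤s = case any? (λ x → all? (λ i → M i x ≟ᵇ true)) of λ where
      (yes common) → shared common m≤s
      (no none)    → ⊥-elim (unshared none m≤s)

-- Dominant vertices and good sets relative to a common clique

select : ∀ {s} m (P : Fin s → Bool) (conf : Fin s → Fin s → Bool) D → (∀ i j → conf i j ≡ true → conf j i ≡ true) →
  (∀ i → P i ≡ true → # (λ j → P j ∧ conf i j) ≤ D) → m * D < # P →
  Σ[ h ∈ (Fin (suc m) → Fin s) ] (∀ c → P (h c) ≡ true) × (∀ c d → c ≢ d → conf (h c) (h d) ≡ false)
select zero P conf D csym bound lt = let i , Pi = #-witness P lt in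
  (λ _ → i) , (λ _ → Pi) , λ { 0F 0F ne → ⊥-elim (ne refl) }
select {s} (suc m) P conf D csym bound lt = go (#-witness P (≤-trans (s≤s z≤n) lt))
  where
  go : (∃[ i ] P i ≡ true) → Σ[ h ∈ (Fin (2 + m) → Fin s) ] (∀ c → P (h c) ≡ true) × (∀ c d → c ≢ d → conf (h c) (h d) ≡ false)
  go (i , Pi) = finish (select m P′ conf D csym bound′ lt′)
    where
    P′ : Fin s → Bool
    P′ j = P j ∧ not (conf i j)
    bound′ : ∀ l → P′ l ≡ true → # (λ j → P′ j ∧ conf l j) ≤ D
    bound′ l e = ≤-trans (#-mono λ j q → let a , b = ∧-elim {P′ j} q in ∧-intro (proj₁ (∧-elim a)) b) (bound l (proj₁ (∧-elim e)))
    lt′ : m * D < # P′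
    lt′ = +-cancelˡ-< D _ _ (≤-trans lt (≤-trans (≤-reflexive (#-split P (conf i))) (+-monoˡ-≤ (# P′) (bound i Pi))))
    finish : Σ[ h ∈ (Fin (suc m) → Fin s) ] (∀ c → P′ (h c) ≡ true) × (∀ c d → c ≢ d → conf (h c) (h d) ≡ false) →
      Σ[ h ∈ (Fin (2 + m) → Fin s) ] (∀ c → P (h c) ≡ true) × (∀ c d → c ≢ d → conf (h c) (h d) ≡ false)
    finish (h , hP , hc) = i ∷ h , ∷-all P Pi (λ c → proj₁ (∧-elim (hP c))) , λ where
        0F 0F ne → ⊥-elim (ne refl)
        0F (suc d) _ → away d
        (suc c) 0F _ → ≢true λ q → clash (csym (h c) i q) (away c)
        (suc c) (suc d) ne → hc c d (λ r → ne (cong suc r))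
      where
      away : ∀ d → conf i (h d) ≡ false
      away d = not-elim (proj₂ (∧-elim {P (h d)} (hP d)))

-- Sets containing a fixed clique g on r - 2 vertices. The type of a vertex is its adjacency to g.
module Core {k t n s : ℕ} {A : Fin n → Fin n → Bool} {M : Fin s → Fin n → Bool} (X : Sys k t A M)
  (g : Fin (1 + k) → Fin n) (gcl : Clique A g) where

  open Sys X

  inQ : Fin n → Bool
  inQ v = ⌊ any? (λ c → g c ≟ v) ⌋

  J : Fin s → Bool
  J i = ⌊ all? (λ c → M i (g c) ≟ᵇ true) ⌋

  T : Fin s → Fin n → Bool
  T i v = M i v ∧ not (inQ v)

  g∈ : ∀ {i} → J i ≡ true → ∀ c → M i (g c) ≡ true
  g∈ Ji = witness Ji

  T⇒M : ∀ {i v} → T i v ≡ true → M i v ≡ true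
  T⇒M e = proj₁ (∧-elim e)

  T⇒∉Q : ∀ {i v} → T i v ≡ true → ∀ c → g c ≢ v
  T⇒∉Q {i} {v} e c q = refute (not-elim (proj₂ (∧-elim {M i v} e))) (c , q)

  M⇒Q⊎T : ∀ {i v} → M i v ≡ true → (∃[ c ] g c ≡ v) ⊎ T i v ≡ true
  M⇒Q⊎T {i} {v} m with any? (λ c → g c ≟ v)
  ... | yes r = inj₁ r
  ... | no ¬r = inj₂ (∧-intro m refl)

  Misses : Fin n → Set
  Misses v = ∃[ c ] A v (g c) ≡ false

  Only : Fin (1 + k) → Fin n → Set
  Only q v = A v (g q) ≡ false × (∀ c → c ≢ q → A v (g c) ≡ true)

  Same : Fin n → Fin n → Set
  Same u v = ∀ c → A u (g c) ≡ A v (g c)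

  only-unique : ∀ {q q′ v} → Only q v → Only q′ v → q ≡ q′
  only-unique {q} {q′} a b with q ≟ q′
  ... | yes r = r
  ... | no ne = clash (proj₂ b q ne) (proj₁ a)

  only-same : ∀ {q u v} → Same u v → Only q u → Only q v
  only-same s (a , b) = trans (sym (s _)) a , λ c ne → trans (sym (s c)) (b c ne)

  misses : ∀ {i v} → J i ≡ true → M i v ≡ true → Misses v
  misses {i} {v} Ji m with any? (λ c → A v (g c) ≟ᵇ false)
  ... | yes r = r
  ... | no ¬r = ⊥-elim (free i (v ∷ g) (∷-all (M i) m (g∈ Ji)) λ where
          0F 0F ne → ⊥-elim (ne refl)
          0F (suc d) _ → full d
          (suc c) 0F _ → A-sym v (g c) (full c)
          (suc c) (suc d) ne → gcl c d (λ r → ne (cong suc r)))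
    where
    full : ∀ c → A v (g c) ≡ true
    full c = case decide (A v (g c)) of λ where
      (inj₁ e) → e
      (inj₂ e) → ⊥-elim (¬r (c , e))

  replace : Fin (1 + k) → Fin n → Fin (1 + k) → Fin n
  replace q v c = if ⌊ c ≟ q ⌋ then v else g c

  replace-adj : ∀ {q u v} → (∀ c → c ≢ q → A u (g c) ≡ true) → A u v ≡ true → ∀ c → A u (replace q v c) ≡ true
  replace-adj {q} h uv c with c ≟ q
  ... | yes _ = uv
  ... | no ne = h c ne

  replace-clique : ∀ {q v} → Only q v → Clique A (replace q v)
  replace-clique {q} {v} (_ , h) c d c≢d with c ≟ q | d ≟ q
  ... | yes refl | yes refl = ⊥-elim (c≢d refl)
  ... | yes refl | no ne    = h d ne
  ... | no ne    | yes refl = A-sym v (g c) (h c ne)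
  ... | no _     | no _     = gcl c d c≢d

  ∷-clique : ∀ {p v} {f : Fin p → Fin n} → Clique A f → (∀ c → A v (f c) ≡ true) → Clique A (v ∷ f)
  ∷-clique cl h 0F 0F ne = ⊥-elim (ne refl)
  ∷-clique cl h 0F (suc d) _ = h d
  ∷-clique cl h (suc c) 0F _ = A-sym _ _ (h c)
  ∷-clique cl h (suc c) (suc d) ne = cl c d (λ r → ne (cong suc r))

  -- Such a triangle together with Q minus q would be a clique on 3 + k vertices. This is what
  -- reduces the good sets to the triangle-free case.
  only-no△ : ∀ {q u v w} → Only q u → Only q v → Only q w → A u v ≡ true → A v w ≡ true → A u w ≡ true → ⊥
  only-no△ {q} {u} {v} {w} ou ov ow uv vw uw = noK (u ∷ (v ∷ replace q w))
    (∷-clique (∷-clique (replace-clique ow) (replace-adj (proj₂ ov) vw)) λ where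
      0F → uv
      (suc c) → replace-adj (proj₂ ou) uw c)

  only-nonadj : ∀ {i q u v} → J i ≡ true → M i u ≡ true → M i v ≡ true → Only q u → Only q v → A u v ≡ true → ⊥
  only-nonadj {i} {q} {u} {v} Ji mu mv ou ov uv = free i (u ∷ replace q v)
    (∷-all (M i) mu inside) (∷-clique (replace-clique ov) (replace-adj (proj₂ ou) uv))
    where
    inside : ∀ c → M i (replace q v c) ≡ true
    inside c with c ≟ q
    ... | yes _ = mv
    ... | no _  = g∈ Ji c

  -- Otherwise sending w and y to the two missed vertices would inject 2 + k vertices into Q.
  missed-unique : (f : Fin (2 + k) → Fin n) → Inj f → ∀ {w y} → (∀ c → (∃[ d ] g d ≡ f c) ⊎ f c ≡ w ⊎ f c ≡ y) →
    ∀ {c₁ c₂} → (∀ c → f c ≢ g c₁) → (∀ c → f c ≢ g c₂) → c₁ ≡ c₂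
  missed-unique f inj {w} {y} f∈ {c₁} {c₂} m₁ m₂ with c₁ ≟ c₂
  ... | yes r = r
  ... | no ne = ⊥-elim (1+n≰n (injective⇒≤ {f = λ c → φ c (f∈ c)} (λ {c} {d} e → inj c d (φ-inj c d (f∈ c) (f∈ d) e))))
    where
    φ : ∀ c → (∃[ d ] g d ≡ f c) ⊎ f c ≡ w ⊎ f c ≡ y → Fin (1 + k)
    φ c (inj₁ (d , _))    = d
    φ c (inj₂ (inj₁ _))   = c₁
    φ c (inj₂ (inj₂ _))   = c₂
    φ-inj : ∀ c d a b → φ c a ≡ φ d b → f c ≡ f d
    φ-inj c d (inj₁ (_ , p)) (inj₁ (_ , q)) refl = trans (sym p) q
    φ-inj c d (inj₁ (_ , p)) (inj₂ (inj₁ _)) refl = ⊥-elim (m₁ c (sym p))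
    φ-inj c d (inj₁ (_ , p)) (inj₂ (inj₂ _)) refl = ⊥-elim (m₂ c (sym p))
    φ-inj c d (inj₂ (inj₁ _)) (inj₁ (_ , q)) refl = ⊥-elim (m₁ d (sym q))
    φ-inj c d (inj₂ (inj₂ _)) (inj₁ (_ , q)) refl = ⊥-elim (m₂ d (sym q))
    φ-inj c d (inj₂ (inj₁ p)) (inj₂ (inj₁ q)) _ = trans p (sym q)
    φ-inj c d (inj₂ (inj₂ p)) (inj₂ (inj₂ q)) _ = trans p (sym q)
    φ-inj c d (inj₂ (inj₁ _)) (inj₂ (inj₂ _)) e = ⊥-elim (ne e)
    φ-inj c d (inj₂ (inj₂ _)) (inj₂ (inj₁ _)) e = ⊥-elim (ne (sym e))

  missed-none : (f : Fin (2 + k) → Fin n) → Inj f → ∀ {w} → (∀ c → (∃[ d ] g d ≡ f c) ⊎ f c ≡ w) →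
    ∀ {c₁} → (∀ c → f c ≢ g c₁) → ⊥
  missed-none f inj {w} f∈ {c₁} m₁ = 1+n≰n (injective⇒≤ {f = λ c → φ c (f∈ c)} (λ {c} {d} e → inj c d (φ-inj c d (f∈ c) (f∈ d) e)))
    where
    φ : ∀ c → (∃[ d ] g d ≡ f c) ⊎ f c ≡ w → Fin (1 + k)
    φ c (inj₁ (d , _)) = d
    φ c (inj₂ _)       = c₁
    φ-inj : ∀ c d a b → φ c a ≡ φ d b → f c ≡ f d
    φ-inj c d (inj₁ (_ , p)) (inj₁ (_ , q)) refl = trans (sym p) q
    φ-inj c d (inj₁ (_ , p)) (inj₂ _) refl = ⊥-elim (m₁ c (sym p))
    φ-inj c d (inj₂ _) (inj₁ (_ , q)) refl = ⊥-elim (m₁ d (sym q))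
    φ-inj c d (inj₂ p) (inj₂ q) _ = trans p (sym q)

  module Witness {i : Fin s} {w : Fin n} (Ji : J i ≡ true) (w∉ : M i w ≡ false) (f : Fin (2 + k) → Fin n)
    (f∈ : ∀ c → M i (f c) ≡ true ⊎ f c ≡ w) (cl : Clique A f) where

    c₀ = proj₁ (apex i w f f∈ cl)
    fc₀ : f c₀ ≡ w
    fc₀ = proj₂ (apex i w f f∈ cl)

    toward : ∀ c → f c ≢ w → A w (f c) ≡ true
    toward c ne = subst (λ z → A z (f c) ≡ true) fc₀ (cl c₀ c (λ { refl → ne fc₀ }))

    member : ∀ c → f c ≢ w → M i (f c) ≡ true
    member c ne = case f∈ c of λ where
      (inj₁ m) → m
      (inj₂ e) → ⊥-elim (ne e)

    M⇒≢w : ∀ {v} → M i v ≡ true → v ≢ w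
    M⇒≢w m refl = clash m w∉

    avoids : ∀ {c₁} → A w (g c₁) ≡ false → ∀ c → f c ≢ g c₁
    avoids {c₁} miss c e = clash (subst (λ z → A w z ≡ true) e (toward c (λ r → M⇒≢w (g∈ Ji c₁) (trans (sym e) r)))) miss

    avoids-at : ∀ {d c₂} → T i (f d) ≡ true → A (f d) (g c₂) ≡ false → ∀ c → f c ≢ g c₂
    avoids-at {d} {c₂} Td miss c e = clash (subst (λ z → A (f d) z ≡ true) e (cl d c λ { refl → T⇒∉Q {i} Td c₂ (sym e) })) miss

    -- Of the 2 + k vertices of the clique f only w and `f d` lie outside Q, so exactly one vertex q
    -- of Q is not in it. A vertex of Q missed by w or by `f d` cannot be in the clique, hence is q.
    two-outside : ∀ d → T i (f d) ≡ true → Misses w → (∀ c → c ≢ d → f c ≢ w → T i (f c) ≡ true → ⊥) →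
      ∃[ q ] Only q w × Only q (f d)
    two-outside d Td (c₁ , m₁) none = c₁ , (m₁ , only-w) , (fd-miss , only-d)
      where
      place : ∀ c → (∃[ e ] g e ≡ f c) ⊎ f c ≡ w ⊎ f c ≡ f d
      place c with c ≟ d | f c ≟ w
      ... | yes refl | _ = inj₂ (inj₂ refl)
      ... | no _ | yes e = inj₂ (inj₁ e)
      ... | no c≢d | no ne = case M⇒Q⊎T (member c ne) of λ where
        (inj₁ r) → inj₁ r
        (inj₂ r) → ⊥-elim (none c c≢d ne r)
      same : ∀ {c₁ c₂} → A w (g c₁) ≡ false → A (f d) (g c₂) ≡ false → c₁ ≡ c₂
      same a b = missed-unique f (clique-inj cl) place (avoids a) (avoids-at Td b)
      md = misses Ji (T⇒M {i} Td)
      fd-miss : A (f d) (g c₁) ≡ false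
      fd-miss = subst (λ z → A (f d) (g z) ≡ false) (sym (same m₁ (proj₂ md))) (proj₂ md)
      only-w : ∀ c → c ≢ c₁ → A w (g c) ≡ true
      only-w c ne = case decide (A w (g c)) of λ where
        (inj₁ e) → e
        (inj₂ e) → ⊥-elim (ne (same e fd-miss))
      only-d : ∀ c → c ≢ c₁ → A (f d) (g c) ≡ true
      only-d c ne = case decide (A (f d) (g c)) of λ where
        (inj₁ e) → e
        (inj₂ e) → ⊥-elim (ne (sym (same m₁ e)))

  Dominant : Fin s → Fin n → Set
  Dominant i p = T i p ≡ true × (∀ w → M i w ≡ false → Same w p → A w p ≡ true)

  -- What holds when p is not dominant. If y has no neighbour in `T i` besides possibly p, the
  -- blocking clique has no further vertex outside Q and `two-outside` applies; this is the
  -- conditional last component.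
  Partner : Fin s → Fin n → Set
  Partner i p = ∃[ y ] T i y ≡ true × y ≢ p × A p y ≡ false ×
    ((∀ z → T i z ≡ true → z ≢ p → z ≢ y → A y z ≡ false) → ∃[ q ] Only q p × Only q y)

  -- Replacing w by p in the clique through w must fail.
  partner : ∀ {i p w} → J i ≡ true → T i p ≡ true → M i w ≡ false → Same w p → A w p ≡ false → Partner i p
  partner {i} {p} {w} Ji Tp w∉ same w≁p with saturate i w w∉
  ... | f , f∈ , cl = find (any? (λ d → ((not ⌊ f d ≟ w ⌋) ∧ not (A p (f d))) ≟ᵇ true))
    where
    open Witness Ji w∉ f f∈ cl
    p∉f : ∀ c → f c ≢ p
    p∉f c e = clash (subst (λ z → A w z ≡ true) e (toward c λ r → M⇒≢w (T⇒M {i} Tp) (trans (sym e) r))) w≁p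
    swapped : Fin (2 + k) → Fin n
    swapped c = if ⌊ f c ≟ w ⌋ then p else f c
    find : Dec (∃[ d ] (not ⌊ f d ≟ w ⌋) ∧ not (A p (f d)) ≡ true) → Partner i p
    find (no none) = ⊥-elim (free i swapped inside clique)
      where
      joined : ∀ d → f d ≢ w → A p (f d) ≡ true
      joined d ne = case decide (A p (f d)) of λ where
        (inj₁ e) → e
        (inj₂ e) → ⊥-elim (none (d , ∧-intro (not-intro (fails ne)) (not-intro e)))
      inside : ∀ c → M i (swapped c) ≡ true
      inside c with f c ≟ w
      ... | yes _ = T⇒M {i} Tp
      ... | no ne = member c ne
      clique : Clique A swapped
      clique c d c≢d with f c ≟ w | f d ≟ w
      ... | yes a | yes b = ⊥-elim (c≢d (clique-inj cl c d (trans a (sym b))))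
      ... | yes _ | no b  = joined d b
      ... | no a  | yes _ = A-sym p (f c) (joined c a)
      ... | no _  | no _  = cl c d c≢d
    find (yes (d , e)) = f d , Td , p∉f d , p≁y , finish
      where
      fd≢w : f d ≢ w
      fd≢w = refute (not-elim (proj₁ (∧-elim {not ⌊ f d ≟ w ⌋} e)))
      p≁y : A p (f d) ≡ false
      p≁y = not-elim (proj₂ (∧-elim {not ⌊ f d ≟ w ⌋} e))
      Td : T i (f d) ≡ true
      Td = case M⇒Q⊎T (member d fd≢w) of λ where
        (inj₁ (c , r)) → clash (trans (sym (same c)) (subst (λ z → A w z ≡ true) (sym r) (toward d fd≢w)))
                               (subst (λ z → A p z ≡ false) (sym r) p≁y)
        (inj₂ r) → r
      w-misses : Misses w
      w-misses = let c , m = misses Ji (T⇒M {i} Tp) in c , trans (same c) m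
      finish : (∀ z → T i z ≡ true → z ≢ p → z ≢ f d → A (f d) z ≡ false) → ∃[ q ] Only q p × Only q (f d)
      finish iso = let q , ow , od = two-outside d Td w-misses (λ c c≢d ne Tc →
                         clash (cl d c (λ r → c≢d (sym r))) (iso (f c) Tc (p∉f c) (λ r → c≢d (clique-inj cl c d r))))
        in q , only-same same ow , od

  dominant-or-partner : ∀ {i p} → J i ≡ true → T i p ≡ true → Dominant i p ⊎ Partner i p
  dominant-or-partner {i} {p} Ji Tp = find (any? (λ w → ((not (M i w) ∧ not (A w p)) ∧ ⌊ all? (λ c → A w (g c) ≟ᵇ A p (g c)) ⌋) ≟ᵇ true))
    where
    find : Dec (∃[ w ] (not (M i w) ∧ not (A w p)) ∧ ⌊ all? (λ c → A w (g c) ≟ᵇ A p (g c)) ⌋ ≡ true) → Dominant i p ⊎ Partner i p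
    find (yes (w , e)) = let a , b = ∧-elim {not (M i w) ∧ not (A w p)} e ; c , d = ∧-elim {not (M i w)} a in
      inj₂ (partner Ji Tp (not-elim c) (witness b) (not-elim d))
    find (no none) = inj₁ (Tp , λ w w∉ same → case decide (A w p) of λ where
      (inj₁ e) → e
      (inj₂ e) → ⊥-elim (none (w , ∧-intro (∧-intro (not-intro w∉) (not-intro e)) (holds same))))

  Good : Fin (1 + k) → Fin s → Set
  Good q i = (∀ u v → T i u ≡ true → T i v ≡ true → A u v ≡ false) × (∀ v → T i v ≡ true → Only q v)

  good-two : ∀ {i a b} → J i ≡ true → T i a ≡ true → T i b ≡ true → (∀ v → T i v ≡ true → v ≡ a ⊎ v ≡ b) →
    (∃[ p ] Dominant i p) ⊎ (∃[ q ] Good q i)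
  good-two {i} {a} {b} Ji Ta Tb all-T with dominant-or-partner Ji Ta
  ... | inj₁ dom = inj₁ (a , dom)
  ... | inj₂ (y , Ty , y≢a , a≁y , fin) with all-T y Ty
  ...   | inj₁ r = ⊥-elim (y≢a r)
  ...   | inj₂ refl = let q , oa , ob = fin (λ z Tz z≢a z≢y → ⊥-elim (case all-T z Tz of λ where
                            (inj₁ r) → z≢a r
                            (inj₂ r) → z≢y r))
          in inj₂ (q , (λ u v Tu Tv → indep u v (all-T u Tu) (all-T v Tv)) , λ v Tv → case all-T v Tv of λ where
                (inj₁ refl) → oa
                (inj₂ refl) → ob)
    where
    indep : ∀ u v → u ≡ a ⊎ u ≡ y → v ≡ a ⊎ v ≡ y → A u v ≡ false
    indep u v (inj₁ refl) (inj₁ refl) = ≢true (A-irrefl a)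
    indep u v (inj₁ refl) (inj₂ refl) = a≁y
    indep u v (inj₂ refl) (inj₁ refl) = ≢true λ e → clash (A-sym y a e) a≁y
    indep u v (inj₂ refl) (inj₂ refl) = ≢true (A-irrefl y)

module GoodSets {k t n s : ℕ} {A : Fin n → Fin n → Bool} {M : Fin s → Fin n → Bool} (X : Sys k t A M)
  (g : Fin (1 + k) → Fin n) (gcl : Clique A g) where

  open Sys X
  open Core X g gcl

  module _ {i : Fin s} {a b c : Fin n} (Ji : J i ≡ true) (Ta : T i a ≡ true) (Tb : T i b ≡ true) (Tc : T i c ≡ true)
    (all-T : ∀ v → T i v ≡ true → v ≡ a ⊎ v ≡ b ⊎ v ≡ c) where

    -- As bc is the only edge, a is the partner of both b and c. Each of the pairs {b, a} and {c, a}
    -- misses a single common vertex of Q, the same one because of a. Then b and c contradict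
    -- `only-nonadj`.
    one-edge : A a b ≡ false → A a c ≡ false → A b c ≡ true → Partner i b → Partner i c → ⊥
    one-edge a≁b a≁c b~c (y , Ty , y≢b , b≁y , fin) (y′ , Ty′ , y′≢c , c≁y′ , fin′) with all-T y Ty | all-T y′ Ty′
    ... | inj₂ (inj₁ r) | _ = y≢b r
    ... | inj₂ (inj₂ refl) | _ = clash b~c b≁y
    ... | inj₁ refl | inj₂ (inj₂ r) = y′≢c r
    ... | inj₁ refl | inj₂ (inj₁ refl) = clash (A-sym b c b~c) c≁y′
    ... | inj₁ refl | inj₁ refl =
      let q , ob , oa = fin (λ z Tz z≢b z≢a → case all-T z Tz of λ where
              (inj₁ r) → ⊥-elim (z≢a r)
              (inj₂ (inj₁ r)) → ⊥-elim (z≢b r)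
              (inj₂ (inj₂ refl)) → a≁c)
          q′ , oc , oa′ = fin′ (λ z Tz z≢c z≢a → case all-T z Tz of λ where
              (inj₁ r) → ⊥-elim (z≢a r)
              (inj₂ (inj₁ refl)) → a≁b
              (inj₂ (inj₂ r)) → ⊥-elim (z≢c r))
      in only-nonadj Ji (T⇒M {i} Tb) (T⇒M {i} Tc) ob (subst (λ z → Only z c) (only-unique oa′ oa) oc) b~c

    no-center : ∀ {x y z} → (∀ v → T i v ≡ true → v ≡ x ⊎ v ≡ y ⊎ v ≡ z) → A x y ≡ true → A x z ≡ true → Partner i x → ⊥
    no-center all-x xy xz (w , Tw , w≢x , x≁w , _) with all-x w Tw
    ... | inj₁ r = w≢x r
    ... | inj₂ (inj₁ refl) = clash xy x≁w
    ... | inj₂ (inj₂ refl) = clash xz x≁w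

    -- Partners miss the same single vertex of Q. Three vertices, each with a partner among the
    -- other two, are connected by these pairs, so one q serves all.
    partnered : A a b ≡ false → A a c ≡ false → A b c ≡ false → Partner i a → Partner i b → Partner i c → ∃[ q ] Good q i
    partnered a≁b a≁c b≁c Pa Pb Pc = go (pair a Ta Pa) (pair b Tb Pb) (pair c Tc Pc)
      where
      indep′ : ∀ u v → u ≡ a ⊎ u ≡ b ⊎ u ≡ c → v ≡ a ⊎ v ≡ b ⊎ v ≡ c → A u v ≡ false
      indep′ u v (inj₁ refl) (inj₁ refl) = ≢true (A-irrefl u)
      indep′ u v (inj₁ refl) (inj₂ (inj₁ refl)) = a≁b
      indep′ u v (inj₁ refl) (inj₂ (inj₂ refl)) = a≁c
      indep′ u v (inj₂ (inj₁ refl)) (inj₁ refl) = ≢true λ e → clash (A-sym u v e) a≁b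
      indep′ u v (inj₂ (inj₁ refl)) (inj₂ (inj₁ refl)) = ≢true (A-irrefl u)
      indep′ u v (inj₂ (inj₁ refl)) (inj₂ (inj₂ refl)) = b≁c
      indep′ u v (inj₂ (inj₂ refl)) (inj₁ refl) = ≢true λ e → clash (A-sym u v e) a≁c
      indep′ u v (inj₂ (inj₂ refl)) (inj₂ (inj₁ refl)) = ≢true λ e → clash (A-sym u v e) b≁c
      indep′ u v (inj₂ (inj₂ refl)) (inj₂ (inj₂ refl)) = ≢true (A-irrefl u)
      indep : ∀ u v → T i u ≡ true → T i v ≡ true → A u v ≡ false
      indep u v Tu Tv = indep′ u v (all-T u Tu) (all-T v Tv)
      pair : ∀ p → T i p ≡ true → Partner i p → ∃[ y ] (y ≢ p × (y ≡ a ⊎ y ≡ b ⊎ y ≡ c)) × ∃[ q ] Only q p × Only q y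
      pair p Tp (y , Ty , y≢p , _ , fin) = y , (y≢p , all-T y Ty) , fin (λ z Tz _ _ → indep y z Ty Tz)
      make : ∀ {q} → Only q a → Only q b → Only q c → ∃[ q ] Good q i
      make {q} oa ob oc = q , indep , λ v Tv → case all-T v Tv of λ where
        (inj₁ refl) → oa
        (inj₂ (inj₁ refl)) → ob
        (inj₂ (inj₂ refl)) → oc
      move : ∀ {q q′ u v} → Only q u → Only q′ u → Only q′ v → Only q v
      move {v = v} x y z = subst (λ r → Only r v) (only-unique y x) z
      Pair : Fin n → Set
      Pair p = ∃[ y ] (y ≢ p × (y ≡ a ⊎ y ≡ b ⊎ y ≡ c)) × ∃[ q ] Only q p × Only q y
      go : Pair a → Pair b → Pair c → ∃[ q ] Good q i
      go (_ , (ne , inj₁ r) , _) _ _ = ⊥-elim (ne r)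
      go (_ , (_ , inj₂ (inj₁ refl)) , q , oa , ob) _ (_ , (_ , inj₁ refl) , q′ , oc , oa′) = make oa ob (move oa oa′ oc)
      go (_ , (_ , inj₂ (inj₁ refl)) , q , oa , ob) _ (_ , (_ , inj₂ (inj₁ refl)) , q′ , oc , ob′) = make oa ob (move ob ob′ oc)
      go (_ , (_ , inj₂ (inj₁ refl)) , _) _ (_ , (ne , inj₂ (inj₂ r)) , _) = ⊥-elim (ne r)
      go (_ , (_ , inj₂ (inj₂ refl)) , q , oa , oc) (_ , (_ , inj₁ refl) , q′ , ob , oa′) _ = make oa (move oa oa′ ob) oc
      go (_ , (_ , inj₂ (inj₂ refl)) , _) (_ , (ne , inj₂ (inj₁ r)) , _) _ = ⊥-elim (ne r)
      go (_ , (_ , inj₂ (inj₂ refl)) , q , oa , oc) (_ , (_ , inj₂ (inj₂ refl)) , q′ , ob , oc′) _ = make oa (move oc oc′ ob) oc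

  good-three : ∀ {i a b c} → J i ≡ true → T i a ≡ true → T i b ≡ true → T i c ≡ true →
    (∀ v → T i v ≡ true → v ≡ a ⊎ v ≡ b ⊎ v ≡ c) → (∃[ p ] Dominant i p) ⊎ (∃[ q ] Good q i)
  good-three {i} {a} {b} {c} Ji Ta Tb Tc all-T with dominant-or-partner Ji Ta | dominant-or-partner Ji Tb | dominant-or-partner Ji Tc
  ... | inj₁ dom | _ | _ = inj₁ (a , dom)
  ... | inj₂ _ | inj₁ dom | _ = inj₁ (b , dom)
  ... | inj₂ _ | inj₂ _ | inj₁ dom = inj₁ (c , dom)
  ... | inj₂ Pa | inj₂ Pb | inj₂ Pc with decide (A a b) | decide (A a c) | decide (A b c)
  ...   | inj₂ ab | inj₂ ac | inj₂ bc = inj₂ (partnered Ji Ta Tb Tc all-T ab ac bc Pa Pb Pc)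
  ...   | inj₂ ab | inj₂ ac | inj₁ bc = ⊥-elim (one-edge Ji Ta Tb Tc all-T ab ac bc Pb Pc)
  ...   | inj₂ ab | inj₁ ac | inj₂ bc = ⊥-elim (one-edge Ji Tb Ta Tc rot (≢true λ e → clash (A-sym b a e) ab) bc ac Pa Pc)
    where
    rot : ∀ v → T i v ≡ true → v ≡ b ⊎ v ≡ a ⊎ v ≡ c
    rot v Tv = case all-T v Tv of λ where
      (inj₁ r) → inj₂ (inj₁ r)
      (inj₂ (inj₁ r)) → inj₁ r
      (inj₂ (inj₂ r)) → inj₂ (inj₂ r)
  ...   | inj₁ ab | inj₂ ac | inj₂ bc = ⊥-elim (one-edge Ji Tc Ta Tb rot (≢true λ e → clash (A-sym c a e) ac) (≢true λ e → clash (A-sym c b e) bc) ab Pa Pb)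
    where
    rot : ∀ v → T i v ≡ true → v ≡ c ⊎ v ≡ a ⊎ v ≡ b
    rot v Tv = case all-T v Tv of λ where
      (inj₁ r) → inj₂ (inj₁ r)
      (inj₂ (inj₁ r)) → inj₂ (inj₂ r)
      (inj₂ (inj₂ r)) → inj₁ r
  ...   | inj₁ ab | inj₁ ac | _ = ⊥-elim (no-center Ji Ta Tb Tc all-T all-T ab ac Pa)
  ...   | inj₁ ab | inj₂ _ | inj₁ bc = ⊥-elim (no-center Ji Ta Tb Tc all-T (λ v Tv → case all-T v Tv of λ where
            (inj₁ r) → inj₂ (inj₁ r)
            (inj₂ (inj₁ r)) → inj₁ r
            (inj₂ (inj₂ r)) → inj₂ (inj₂ r)) (A-sym a b ab) bc Pb)
  ...   | inj₂ _ | inj₁ ac | inj₁ bc = ⊥-elim (no-center Ji Ta Tb Tc all-T (λ v Tv → case all-T v Tv of λ where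
            (inj₁ r) → inj₂ (inj₁ r)
            (inj₂ (inj₁ r)) → inj₂ (inj₂ r)
            (inj₂ (inj₂ r)) → inj₁ r) (A-sym a c ac) (A-sym b c bc) Pc)

  -- The blocking clique of w has at most one vertex in the independent set `T i`. It has one, since
  -- otherwise it would consist of w and all of Q, including the vertex missed by w. So
  -- `two-outside` applies.
  good-dominates : ∀ {i q w} → J i ≡ true → Good q i → M i w ≡ false → Misses w →
    Only q w × ∃[ y ] T i y ≡ true × A w y ≡ true
  good-dominates {i} {q} {w} Ji (indep , typ) w∉ miss with saturate i w w∉
  ... | f , f∈ , cl = find (any? (λ d → T i (f d) ≟ᵇ true))
    where
    open Witness Ji w∉ f f∈ cl
    find : Dec (∃[ d ] T i (f d) ≡ true) → Only q w × ∃[ y ] T i y ≡ true × A w y ≡ true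
    find (yes (d , Td)) = let q′ , ow , od = two-outside d Td miss (λ c c≢d _ Tc → clash (cl c d c≢d) (indep (f c) (f d) Tc Td)) in
      subst (λ z → Only z w) (only-unique od (typ (f d) Td)) ow , f d , Td , toward d (M⇒≢w (T⇒M {i} Td))
    find (no none) = ⊥-elim (missed-none f (clique-inj cl) place (avoids (proj₂ miss)))
      where
      place : ∀ c → (∃[ d ] g d ≡ f c) ⊎ f c ≡ w
      place c with f c ≟ w
      ... | yes e = inj₂ e
      ... | no ne = case M⇒Q⊎T (member c ne) of λ where
        (inj₁ r) → inj₁ r
        (inj₂ r) → ⊥-elim (none (c , r))

  -- This lets all good sets be treated as maximal independent sets of one and the same graph.
  same-core : ∀ {i j q q′ v} → J i ≡ true → Good q i → J j ≡ true → Good q′ j → T j v ≡ true → q ≡ q′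
  same-core {i} {j} {v = v} Ji Gi Jj Gj Tv with decide (M i v)
  ... | inj₁ m = only-unique (proj₂ Gi v (∧-intro m (proj₂ (∧-elim {M j v} Tv)))) (proj₂ Gj v Tv)
  ... | inj₂ m = only-unique (proj₁ (good-dominates Ji Gi m (misses Jj (T⇒M {j} Tv)))) (proj₂ Gj v Tv)

  type : Fin n → Fin (2 ^ (1 + k))
  type v = funToFin (λ c → bit (A v (g c)))

  type-same : ∀ {u v} → type u ≡ type v → Same u v
  type-same {u} {v} e c = bit-inj (trans (sym (finToFun-funToFin (λ c → bit (A u (g c))) c))
    (trans (cong (λ z → finToFun z c) e) (finToFun-funToFin (λ c → bit (A v (g c))) c)))

  dominant? : ∀ i p → Dec (T i p ≡ true × (∀ w → (not (M i w) ∧ ⌊ all? (λ c → A w (g c) ≟ᵇ A p (g c)) ⌋) ∧ not (A w p) ≡ false))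
  dominant? i p = (T i p ≟ᵇ true) ×-dec all? (λ w → ((not (M i w) ∧ ⌊ all? (λ c → A w (g c) ≟ᵇ A p (g c)) ⌋) ∧ not (A w p)) ≟ᵇ false)

  dom : Fin s → Fin n → Bool
  dom i p = ⌊ dominant? i p ⌋

  dom⇒Dominant : ∀ {i p} → dom i p ≡ true → Dominant i p
  dom⇒Dominant {i} {p} e = let Tp , h = witness e in Tp , λ w w∉ same → case decide (A w p) of λ where
    (inj₁ r) → r
    (inj₂ r) → clash (∧-intro (∧-intro (not-intro w∉) (holds same)) (not-intro r)) (h w)

  Dominant⇒dom : ∀ {i p} → Dominant i p → dom i p ≡ true
  Dominant⇒dom {i} {p} (Tp , h) = holds (Tp , λ w → ≢true λ e →
    let a , b = ∧-elim {not (M i w) ∧ ⌊ all? (λ c → A w (g c) ≟ᵇ A p (g c)) ⌋} e ; c , d = ∧-elim {not (M i w)} a in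
    clash (h w (not-elim c) (witness d)) (not-elim b))

  domᵢ : Fin s → Bool
  domᵢ i = ⌊ any? (λ p → dom i p ≟ᵇ true) ⌋

  -- Dominant vertices of equal type in disjoint sets would form a clique.
  dominant-bound : ∀ K → (∀ v → inQ v ≡ false → # (λ i → J i ∧ M i v) ≤ K) →
    # (λ i → J i ∧ domᵢ i) ≤ 2 ^ (1 + k) * ((2 + k) * (t * K))
  dominant-bound K few = begin
    # (λ i → J i ∧ domᵢ i)                                   ≤⟨ sum-covers _ R (λ i e → let p , d = witness (proj₂ (∧-elim {J i} e)) in
                                                                  type p , holds (p , ∧-intro d (holds refl))) ⟩
    sum (λ τ → # (λ i → (J i ∧ domᵢ i) ∧ R i τ))             ≤⟨ sum≤ each ⟩
    2 ^ (1 + k) * ((2 + k) * (t * K))                        ∎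
    where
    open ≤-Reasoning
    R : Fin s → Fin (2 ^ (1 + k)) → Bool
    R i τ = ⌊ any? (λ p → (dom i p ∧ ⌊ type p ≟ τ ⌋) ≟ᵇ true) ⌋
    module _ (τ : Fin (2 ^ (1 + k))) where
      P : Fin s → Bool
      P i = (J i ∧ domᵢ i) ∧ R i τ
      conf : Fin s → Fin s → Bool
      conf i j = ⌊ any? (λ v → (T i v ∧ T j v) ≟ᵇ true) ⌋
      conf-sym : ∀ i j → conf i j ≡ true → conf j i ≡ true
      conf-sym i j e = let v , q = witness e ; a , b = ∧-elim {T i v} q in holds (v , ∧-intro b a)
      conf-few : ∀ i → P i ≡ true → # (λ j → P j ∧ conf i j) ≤ t * K
      conf-few i _ = begin
        # (λ j → P j ∧ conf i j)  ≤⟨ double-count _ (T i) T K (λ j e → let v , q = witness (proj₂ (∧-elim {P j} e)) in v , ∧-elim {T i v} q)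
                                       (λ v Tv → ≤-trans (#-mono λ j e → let a , b = ∧-elim {P j ∧ conf i j} e in
                                            ∧-intro (proj₁ (∧-elim (proj₁ (∧-elim (proj₁ (∧-elim a)))))) (T⇒M {j} b))
                                          (few v (not-elim (proj₂ (∧-elim {M i v} Tv))))) ⟩
        K * # (T i)               ≤⟨ *-monoʳ-≤ K (≤-trans (#-mono (λ v e → T⇒M {i} e)) (≤-reflexive (size i))) ⟩
        K * t                     ≡⟨ *-comm K t ⟩
        t * K                     ∎
      each : # P ≤ (2 + k) * (t * K)
      each = case # P ≤? (2 + k) * (t * K) of λ where
          (yes r) → r
          (no r)  → ⊥-elim (big (select (2 + k) P conf (t * K) conf-sym conf-few (≰⇒> r)))
        where
        big : Σ[ h ∈ (Fin (3 + k) → Fin s) ] (∀ c → P (h c) ≡ true) × (∀ c d → c ≢ d → conf (h c) (h d) ≡ false) → ⊥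
        big (h , hP , hc) = noK (λ c → proj₁ (p c)) λ c d c≢d →
            A-sym _ _ (proj₂ (D c) (proj₁ (p d)) (away c d c≢d) (type-same (trans (ty d) (sym (ty c)))))
          where
          p : ∀ c → ∃[ p ] dom (h c) p ∧ ⌊ type p ≟ τ ⌋ ≡ true
          p c = witness (proj₂ (∧-elim {J (h c) ∧ domᵢ (h c)} (hP c)))
          D : ∀ c → Dominant (h c) (proj₁ (p c))
          D c = dom⇒Dominant (proj₁ (∧-elim (proj₂ (p c))))
          ty : ∀ c → type (proj₁ (p c)) ≡ τ
          ty c = witness (proj₂ (∧-elim {dom (h c) (proj₁ (p c))} (proj₂ (p c))))
          away : ∀ c d → c ≢ d → M (h c) (proj₁ (p d)) ≡ false
          away c d c≢d = ≢true λ m → clash (holds (proj₁ (p d) , ∧-intro (∧-intro m (proj₂ (∧-elim {M (h d) (proj₁ (p d))} (proj₁ (D d))))) (proj₁ (D d)))) (hc c d c≢d)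

  only? : ∀ q v → Dec (Only q v)
  only? q v = (A v (g q) ≟ᵇ false) ×-dec all? (λ c → ¬? (c ≟ q) →-dec (A v (g c) ≟ᵇ true))

  good? : ∀ q i → Dec (Good q i)
  good? q i = all? (λ u → all? (λ v → (T i u ≟ᵇ true) →-dec ((T i v ≟ᵇ true) →-dec (A u v ≟ᵇ false))))
              ×-dec all? (λ v → (T i v ≟ᵇ true) →-dec only? q v)

  Wq : Fin (1 + k) → Fin n → Bool
  Wq q v = ⌊ only? q v ⌋ ∧ not (inQ v)

  Aq : Fin (1 + k) → Fin n → Fin n → Bool
  Aq q u v = A u v ∧ (Wq q u ∧ Wq q v)

  Iq : Fin (1 + k) → Fin s → Bool
  Iq q i = J i ∧ ⌊ good? q i ⌋

  #T : ∀ {i u} → J i ≡ true → t ≡ (1 + k) + u → # (T i) ≡ u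
  #T {i} {u} Ji t≡ = +-cancelˡ-≡ (1 + k) _ _ (trans (cong (_+ # (T i)) (sym part)) (trans (sym (#-split (M i) inQ)) (trans (size i) t≡)))
    where
    part : # (λ v → M i v ∧ inQ v) ≡ 1 + k
    part = Enum⇒# {p = λ v → M i v ∧ inQ v} record
      { el = g ; inj = clique-inj gcl
      ; mem = λ c → ∧-intro (g∈ Ji c) (holds (c , refl))
      ; cover = λ v e → witness (proj₂ (∧-elim {M i v} e)) }

  -- The vertices are those outside Q that miss exactly q: `only-no△` makes their graph
  -- triangle-free and `good-dominates` makes the sets maximal in it.
  good-MIS : ∀ q {u} → t ≡ (1 + k) + u → MIS u (Aq q) (Wq q) (Iq q) T
  good-MIS q t≡ = record
    { A-sym = λ u v e → let a , b = ∧-elim {A u v} e ; c , d = ∧-elim {Wq q u} b in ∧-intro (A-sym u v a) (∧-intro d c)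
    ; A⊂W = λ u v e → proj₁ (∧-elim {Wq q u} (proj₂ (∧-elim {A u v} e)))
    ; no△ = λ u v w uv vw uw → only-no△ (ty (proj₁ (ends uv))) (ty (proj₂ (ends uv))) (ty (proj₂ (ends vw)))
        (proj₁ (∧-elim uv)) (proj₁ (∧-elim vw)) (proj₁ (∧-elim uw))
    ; M⊂W = sub
    ; indep = λ i u v e Tu Tv uv → clash (proj₁ (∧-elim uv)) (proj₁ (gd {i} e) u v Tu Tv)
    ; dominate = domin
    ; size = λ i e → #T (proj₁ (∧-elim e)) t≡
    ; distinct = λ i j a b h → distinct i j λ v v∈ → case M⇒Q⊎T {i} v∈ of λ where
        (inj₁ (c , refl)) → g∈ (proj₁ (∧-elim b)) c
        (inj₂ Tv) → T⇒M {j} (h v Tv) }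
    where
    ty : ∀ {v} → Wq q v ≡ true → Only q v
    ty {v} e = witness {d = only? q v} (proj₁ (∧-elim {⌊ only? q v ⌋} e))
    ends : ∀ {u v} → Aq q u v ≡ true → Wq q u ≡ true × Wq q v ≡ true
    ends {u} {v} e = ∧-elim (proj₂ (∧-elim {A u v} e))
    gd : ∀ {i} → Iq q i ≡ true → Good q i
    gd {i} e = witness (proj₂ (∧-elim {J i} e))
    sub : ∀ i v → Iq q i ≡ true → T i v ≡ true → Wq q v ≡ true
    sub i v e Tv = ∧-intro (holds (proj₂ (gd {i} e) v Tv)) (proj₂ (∧-elim {M i v} Tv))
    domin : ∀ i w → Iq q i ≡ true → Wq q w ≡ true → T i w ≡ false → ∃[ y ] T i y ≡ true × Aq q w y ≡ true
    domin i w e Ww w∉ = let Ji = proj₁ (∧-elim e)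
                            _ , y , Ty , wy = good-dominates Ji (gd {i} e)
                              (≢true λ m → clash (∧-intro m (proj₂ (∧-elim {⌊ only? q w ⌋} Ww))) w∉) (q , proj₁ (ty Ww))
      in y , Ty , ∧-intro wy (∧-intro Ww (sub i y e Ty))

-- The lower bound for t = r + 1

#-others : ∀ {s} (i : Fin s) → s ≡ suc (# (λ j → not ⌊ i ≟ j ⌋))
#-others {s} i = trans (sym (#-all s)) (#-remove (λ _ → true) i refl)

-- Every other set meets set 0 in a clique on r - 2 vertices, and set 0 contains t ^ (1 + k)
-- sequences of that length. The leading `suc` accounts for set 0 itself.
core-exists : ∀ {k t n s} {A : Fin n → Fin n → Bool} {M : Fin s → Fin n → Bool} (X : Sys k t A M) → 2 ≤ s →
  Σ[ g ∈ (Fin (1 + k) → Fin n) ] Σ[ cl ∈ Clique A g ] (s ≤ suc (t ^ (1 + k) * # (Core.J X g cl)))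
core-exists {k} {t} {n} {s} {A} {M} X (s≤s (s≤s _)) = finish (any? (λ i → R i j ≟ᵇ true))
  where
  open Sys X
  E = enum (M 0F) (size 0F)
  open Enum E using (el; cover)
  others : Fin s → Bool
  others i = not ⌊ 0F ≟ i ⌋
  clique? : (f : Fin (1 + k) → Fin n) → Dec (Clique A f)
  clique? f = all? (λ c → all? (λ d → ¬? (c ≟ d) →-dec (A (f c) (f d) ≟ᵇ true)))
  point : Fin (t ^ (1 + k)) → Fin (1 + k) → Fin n
  point j c = el (finToFun j c)
  R : Fin s → Fin (t ^ (1 + k)) → Bool
  R i j = ⌊ all? (λ c → M i (point j c) ≟ᵇ true) ×-dec clique? (point j) ⌋
  code : ∀ i → 0F ≢ i → ∃[ j ] R i j ≡ true
  code i ne = funToFin h , holds ((λ c → subst (λ z → M i z ≡ true) (sym (pt c)) (proj₂ (f∈ c))) ,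
      λ c d c≢d → trans (cong₂ A (pt c) (pt d)) (cl c d c≢d))
    where
    f = proj₁ (meet 0F i ne)
    f∈ = proj₁ (proj₂ (meet 0F i ne))
    cl = proj₂ (proj₂ (meet 0F i ne))
    h : Fin (1 + k) → Fin t
    h c = proj₁ (cover (f c) (proj₁ (f∈ c)))
    pt : ∀ c → point (funToFin h) c ≡ f c
    pt c = trans (cong el (finToFun-funToFin h c)) (proj₂ (cover (f c) (proj₁ (f∈ c))))
  best = argmax′ (proj₁ (code 1F (λ ()))) (λ j → # (λ i → others i ∧ R i j))
  j = proj₁ best
  count : # others ≤ t ^ (1 + k) * # (λ i → others i ∧ R i j)
  count = ≤-trans (sum-covers others R (λ i e → code i (refute (not-elim e)))) (sum≤ (proj₂ best))
  finish : Dec (∃[ i ] R i j ≡ true) →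
    Σ[ g ∈ (Fin (1 + k) → Fin n) ] Σ[ cl ∈ Clique A g ] (s ≤ suc (t ^ (1 + k) * # (Core.J X g cl)))
  -- If the most frequent code occurs for no set then no code occurs, although set 1 has one.
  finish (no none) = ⊥-elim (1+n≰n (≤-trans (#-pos others 1F refl) (≤-trans count (≤-reflexive
    (trans (cong (t ^ (1 + k) *_) (#-empty _ (λ i e → none (i , proj₂ (∧-elim {others i} e))))) (*-zeroʳ (t ^ (1 + k))))))))
  finish (yes (i , Rij)) = point j , proj₂ (witness Rij) , ≤-trans (≤-reflexive (#-others {s} 0F))
    (s≤s (≤-trans count (*-monoʳ-≤ (t ^ (1 + k)) (#-mono λ i e → holds (proj₁ (witness {d = all? (λ c → M i (point j c) ≟ᵇ true) ×-dec clique? (point j)}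
      (proj₂ (∧-elim {others i} e))))))))

cube-sum : ∀ a b → (a + b) * (a + b) * (a + b) ≤ 8 * (a * a * a + b * b * b)
cube-sum a b = case ≤-total a b of λ where
    (inj₁ a≤b) → ≤-trans (*-mono-≤ (*-mono-≤ (+-monoˡ-≤ b a≤b) (+-monoˡ-≤ b a≤b)) (+-monoˡ-≤ b a≤b))
                   (≤-trans (≤-reflexive (e b)) (*-monoʳ-≤ 8 (m≤n+m (b * b * b) (a * a * a))))
    (inj₂ b≤a) → ≤-trans (*-mono-≤ (*-mono-≤ (+-monoʳ-≤ a b≤a) (+-monoʳ-≤ a b≤a)) (+-monoʳ-≤ a b≤a))
                   (≤-trans (≤-reflexive (e a)) (*-monoʳ-≤ 8 (m≤m+n (a * a * a) (b * b * b))))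
  where
  e : ∀ b → (b + b) * (b + b) * (b + b) ≡ 8 * (b * b * b)
  e = solve-∀

-- Either K ≤ 2 e, or K e is at most half of K² and can be absorbed.
quadratic : ∀ K e m → 1 ≤ m → K * K ≤ K * e + e * (e * (2 * m)) → K * K ≤ 4 * (e * e) * m
quadratic K e m 1≤m h = case K ≤? 2 * e of λ where
    (yes K≤) → ≤-trans (*-mono-≤ K≤ K≤) (≤-trans (≤-reflexive (e₁ e)) (m≤m*n (4 * (e * e)) m {{>-nonZero 1≤m}}))
    (no K≰)  → +-cancelˡ-≤ (K * K) _ _ (begin
      K * K + K * K                                   ≤⟨ +-mono-≤ h h ⟩
      K * e + e * (e * (2 * m)) + (K * e + e * (e * (2 * m))) ≡⟨ e₂ K e m ⟩
      K * (2 * e) + 4 * (e * e) * m                   ≤⟨ +-monoˡ-≤ (4 * (e * e) * m) (*-monoʳ-≤ K (≤-trans (n≤1+n (2 * e)) (≰⇒> K≰))) ⟩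
      K * K + 4 * (e * e) * m                         ∎)
  where
  open ≤-Reasoning
  e₁ : ∀ e → 2 * e * (2 * e) ≡ 4 * (e * e)
  e₁ = solve-∀
  e₂ : ∀ K e m → K * e + e * (e * (2 * m)) + (K * e + e * (e * (2 * m))) ≡ K * (2 * e) + 4 * (e * e) * m
  e₂ = solve-∀

cube≤fourth : ∀ K d m → K * K ≤ d * m → K * K * K ≤ d * d * (m * m)
cube≤fourth zero    d m h = z≤n
cube≤fourth K@(suc _) d m h = ≤-trans (m≤m*n (K * K * K) K) (≤-trans (≤-reflexive (e₁ K)) (≤-trans (*-mono-≤ h h) (≤-reflexive (e₂ d m))))
  where
  e₁ : ∀ K → K * K * K * K ≡ K * K * (K * K)
  e₁ = solve-∀
  e₂ : ∀ d m → d * m * (d * m) ≡ d * d * (m * m)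
  e₂ = solve-∀

lower₂-constant : ℕ → ℕ
lower₂-constant k = c₁ * c₁ * c₁ * (8 * (c₂ * c₂ * c₂ * (d * d) + C₃))
  where
  c₁ = 2 * (4 + k) ^ (1 + k)
  c₂ = 2 ^ (1 + k) * ((2 + k) * (4 + k))
  d = 4 * ((2 + k) * (2 + k))

module _ {k n s : ℕ} {A : Fin n → Fin n → Bool} {M : Fin s → Fin n → Bool} (X : Sys k (4 + k) A M)
  (m : ℕ) (1≤m : 1 ≤ m) (edges : degrees A ≤ 2 * m) (2≤s : 2 ≤ s) where

  open Sys X

  module _ (g : Fin (1 + k) → Fin n) (gcl : Clique A g) where
    open Core X g gcl
    open GoodSets X g gcl

    private
      -- Vertices of Q lie in all sets of J; the value 0 makes the maximum range over the vertices
      -- outside Q.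
      f : Fin n → ℕ
      f v = if inQ v then 0 else # (λ i → J i ∧ M i v)

    -- K is the largest number of sets of J through a vertex outside Q. Sets with a dominant vertex
    -- number O(K) by `dominant-bound`, and K² = O(m) because Q and one more vertex make t - 2
    -- common vertices. The remaining sets are good for one q and are counted as triples.
    core-bound : Σ[ K ∈ ℕ ] Σ[ G ∈ ℕ ] (# J ≤ 2 ^ (1 + k) * ((2 + k) * (4 + k)) * K + G) ×
      (K * K ≤ 4 * ((2 + k) * (2 + k)) * m) × (G * G * G ≤ C₃ * (m * m))
    core-bound = K , # (λ i → J i ∧ not (domᵢ i)) , total , square , cube (any? (λ i → (J i ∧ not (domᵢ i)) ≟ᵇ true))
      where
      open ≤-Reasoning
      top = argmax′ (g 0F) f
      v = proj₁ top
      K = f v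
      few : ∀ u → inQ u ≡ false → # (λ i → J i ∧ M i u) ≤ K
      few u u∉ = ≤-trans (≤-reflexive (sym (cong (λ b → if b then 0 else # (λ i → J i ∧ M i u)) u∉))) (proj₂ top u)
      e : ∀ a b c K → a * (b * (c * K)) ≡ a * (b * c) * K
      e = solve-∀
      total : # J ≤ 2 ^ (1 + k) * ((2 + k) * (4 + k)) * K + # (λ i → J i ∧ not (domᵢ i))
      total = ≤-trans (≤-reflexive (#-split J domᵢ)) (+-monoˡ-≤ _ (≤-trans (dominant-bound K few) (≤-reflexive (e (2 ^ (1 + k)) (2 + k) (4 + k) K))))
      square : K * K ≤ 4 * ((2 + k) * (2 + k)) * m
      square with decide (inQ v)
      ... | inj₁ q rewrite q = z≤n
      ... | inj₂ q rewrite q = quadratic (# (λ i → J i ∧ M i v)) (2 + k) m 1≤m (≤-trans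
          (square-bound refl (v ∷ g) (∷-inj (clique-inj gcl) (λ c r → refute q (c , r))) (λ i → J i ∧ M i v) (λ _ _ → refl)
            (λ i a → ∷-all (M i) (proj₂ (∧-elim {J i} a)) (g∈ (proj₁ (∧-elim a)))))
          (+-monoʳ-≤ (# (λ i → J i ∧ M i v) * (2 + k)) (*-monoʳ-≤ (2 + k) (*-monoʳ-≤ (2 + k) edges))))
      triple : ∀ i → J i ≡ true → domᵢ i ≡ false → ∃[ q ] Good q i
      triple i Ji nd = case good-three Ji (mem 0F) (mem 1F) (mem 2F) all-T of λ where
          (inj₁ (p , D)) → ⊥-elim (refute nd (p , Dominant⇒dom D))
          (inj₂ r) → r
        where
        E = enum (T i) (#T {i} {3} Ji (cong suc (+-comm 3 k)))
        open Enum E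
        all-T : ∀ v → T i v ≡ true → v ≡ el 0F ⊎ v ≡ el 1F ⊎ v ≡ el 2F
        all-T v Tv = case cover v Tv of λ where
          (0F , r) → inj₁ (sym r)
          (1F , r) → inj₂ (inj₁ (sym r))
          (2F , r) → inj₂ (inj₂ (sym r))
      cube : Dec (∃[ i ] J i ∧ not (domᵢ i) ≡ true) → # (λ i → J i ∧ not (domᵢ i)) * # (λ i → J i ∧ not (domᵢ i)) * # (λ i → J i ∧ not (domᵢ i)) ≤ C₃ * (m * m)
      cube (no none) = ≤-trans (≤-reflexive (cong (λ z → z * z * z) (#-empty _ (λ i q → none (i , q))))) z≤n
      cube (yes (i₀ , e₀)) = ≤-trans (*-mono-≤ (*-mono-≤ le le) le)
          (triple-cube (good-MIS q {3} t≡) m 1≤m (≤-trans (sum-mono sub) edges))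
        where
        t≡ : 4 + k ≡ (1 + k) + 3
        t≡ = cong suc (+-comm 3 k)
        J₀ = proj₁ (∧-elim e₀)
        G₀ = triple i₀ J₀ (not-elim (proj₂ (∧-elim {J i₀} e₀)))
        q = proj₁ G₀
        sub : ∀ v → # (Aq q v) ≤ # (A v)
        sub v = #-mono λ u r → proj₁ (∧-elim {A v u} r)
        le : # (λ i → J i ∧ not (domᵢ i)) ≤ # (Iq q)
        le = #-mono λ i r → let Ji , nd = ∧-elim {J i} r
                                q′ , G = triple i Ji (not-elim nd)
                                v , Tv = #-witness (T i) (≤-trans (s≤s z≤n) (≤-reflexive (sym (#T {i} Ji t≡))))
          in ∧-intro Ji (holds {d = good? q i} (subst (λ z → Good z i) (sym (same-core J₀ (proj₂ G₀) Ji G Tv)) G))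

  lower₂ : s * s * s ≤ lower₂-constant k * (m * m)
  lower₂ = let g , cl , s≤ = core-exists X 2≤s
               K , G , J≤ , K² , G³ = core-bound g cl
    in assembled s≤ J≤ K² G³
    where
    open ≤-Reasoning
    c₂ = 2 ^ (1 + k) * ((2 + k) * (4 + k))
    d = 4 * ((2 + k) * (2 + k))
    p = (4 + k) ^ (1 + k)
    assembled : ∀ {j K G} → s ≤ suc (p * j) → j ≤ c₂ * K + G → K * K ≤ d * m → G * G * G ≤ C₃ * (m * m) →
      s * s * s ≤ lower₂-constant k * (m * m)
    assembled {j} {K} {G} s≤ j≤ K² G³ = begin
      s * s * s                                     ≤⟨ *-mono-≤ (*-mono-≤ s≤2 s≤2) s≤2 ⟩
      2 * p * Z * (2 * p * Z) * (2 * p * Z)         ≡⟨ e₁ (2 * p) Z ⟩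
      2 * p * (2 * p) * (2 * p) * (Z * Z * Z)       ≤⟨ *-monoʳ-≤ (2 * p * (2 * p) * (2 * p)) Z³ ⟩
      2 * p * (2 * p) * (2 * p) * (8 * ((c₂ * c₂ * c₂ * (d * d) + C₃) * (m * m)))
                                                    ≡⟨ e₃ (2 * p * (2 * p) * (2 * p)) (c₂ * c₂ * c₂ * (d * d) + C₃) (m * m) ⟩
      lower₂-constant k * (m * m)                   ∎
      where
      Z = c₂ * K + G
      e₁ : ∀ a Z → a * Z * (a * Z) * (a * Z) ≡ a * a * a * (Z * Z * Z)
      e₁ = solve-∀
      e₃ : ∀ a b c → a * (8 * (b * c)) ≡ a * (8 * b) * c
      e₃ = solve-∀
      e₄ : ∀ c K G → c * K * (c * K) * (c * K) + G ≡ c * c * c * (K * K * K) + G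
      e₄ = solve-∀
      e₅ : ∀ a b c M → a * (b * M) + c * M ≡ (a * b + c) * M
      e₅ = solve-∀
      -- The summand 1 in s ≤ 1 + p j is traded for a factor 2, as s ≥ 2.
      s≤2 : s ≤ 2 * p * Z
      s≤2 = +-cancelˡ-≤ s _ _ (begin
        s + s                          ≤⟨ +-mono-≤ s≤ s≤ ⟩
        suc (p * j) + suc (p * j)      ≡⟨ e₆ (p * j) ⟩
        2 + 2 * (p * j)                ≤⟨ +-mono-≤ 2≤s (*-monoʳ-≤ 2 (*-monoʳ-≤ p j≤)) ⟩
        s + 2 * (p * Z)                ≡⟨ cong (s +_) (sym (*-assoc 2 p Z)) ⟩
        s + 2 * p * Z                  ∎)
        where
        e₆ : ∀ a → suc a + suc a ≡ 2 + 2 * a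
        e₆ = solve-∀
      Z³ : Z * Z * Z ≤ 8 * ((c₂ * c₂ * c₂ * (d * d) + C₃) * (m * m))
      Z³ = ≤-trans (cube-sum (c₂ * K) G) (*-monoʳ-≤ 8 (begin
        c₂ * K * (c₂ * K) * (c₂ * K) + G * G * G            ≡⟨ e₄ c₂ K (G * G * G) ⟩
        c₂ * c₂ * c₂ * (K * K * K) + G * G * G              ≤⟨ +-mono-≤ (*-monoʳ-≤ (c₂ * c₂ * c₂) (cube≤fourth K d m K²)) G³ ⟩
        c₂ * c₂ * c₂ * (d * d * (m * m)) + C₃ * (m * m)     ≡⟨ e₅ (c₂ * c₂ * c₂) (d * d) C₃ (m * m) ⟩
        (c₂ * c₂ * c₂ * (d * d) + C₃) * (m * m)             ∎))

-- The exact lower bound for t = r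

sum-image : ∀ {p n} (g : Fin p → Fin n) → Inj g → (f : Fin n → ℕ) →
  sum (λ c → f (g c)) ≤ sum (λ v → 𝟙 ⌊ any? (λ c → g c ≟ v) ⌋ * f v)
sum-image {p} {n} g inj f = begin
  sum (λ c → f (g c))                                   ≡⟨ sum-cong-≗ (λ c → sum-single (g c) f) ⟨
  sum (λ c → sum (λ v → 𝟙 ⌊ g c ≟ v ⌋ * f v))           ≡⟨ sum-swap-weight (λ c v → ⌊ g c ≟ v ⌋) f ⟩
  sum (λ v → # (λ c → ⌊ g c ≟ v ⌋) * f v)               ≤⟨ sum-mono (λ v → *-monoˡ-≤ (f v) (col v)) ⟩
  sum (λ v → 𝟙 ⌊ any? (λ c → g c ≟ v) ⌋ * f v)          ∎
  where
  open ≤-Reasoning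
  col : ∀ v → # (λ c → ⌊ g c ≟ v ⌋) ≤ 𝟙 ⌊ any? (λ c → g c ≟ v) ⌋
  col v = case decide ⌊ any? (λ c → g c ≟ v) ⌋ of λ where
    (inj₁ e) → ≤-trans (#≤1 _ (λ c d a b → inj c d (trans (witness a) (sym (witness b))))) (≤-reflexive (cong 𝟙 (sym e)))
    (inj₂ e) → ≤-trans (≤-reflexive (#-empty _ (λ c a → refute e (c , witness a)))) z≤n

-- Two maximal independent pairs {c, b₁}, {c, b₂}: every other vertex is adjacent to c.
module Pairs {n s : ℕ} {A : Fin n → Fin n → Bool} {W : Fin n → Bool} {I : Fin s → Bool} {M : Fin s → Fin n → Bool}
  (S : MIS 2 A W I M) (big : 10 < # I) where

  open MIS S

  -- A vertex lies in at most two pairs, so at most ten pairs meet up to five given vertices.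
  avoiding : ∀ {p} (g : Fin p → Fin n) → 2 * p ≤ 10 → ∃[ l ] I l ≡ true × (∀ c → M l (g c) ≡ false)
  avoiding {p} g small with any? (λ l → (I l ∧ ⌊ all? (λ c → M l (g c) ≟ᵇ false) ⌋) ≟ᵇ true)
  ... | yes (l , e) = let a , b = ∧-elim {I l} e in l , a , witness b
  ... | no none = ⊥-elim (<⇒≱ big (≤-trans (≤-trans
          (double-count I (λ _ → true) (λ l c → M l (g c)) 2 (λ l Il → let c , m = meets l Il in c , refl , m)
            (λ c _ → codegree≤ refl (λ (_ : Fin 1) → g c) (λ { 0F 0F _ → refl }) (λ l → I l ∧ M l (g c))
              (λ l e → proj₁ (∧-elim e)) (λ l e _ → proj₂ (∧-elim {I l} e))))
          (≤-reflexive (cong (2 *_) (#-all p)))) small))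
    where
    meets : ∀ l → I l ≡ true → ∃[ c ] M l (g c) ≡ true
    meets l Il = case any? (λ c → M l (g c) ≟ᵇ true) of λ where
      (yes r) → r
      (no ¬r) → ⊥-elim (none (l , ∧-intro Il (holds (λ c → ≢true (λ e → ¬r (c , e))))))

  pair-at : ∀ {i a} → I i ≡ true → M i a ≡ true → ∃[ b ] M i b ≡ true × (∀ v → M i v ≡ true → v ≡ a ⊎ v ≡ b)
  pair-at {i} {a} Ii ma =
    let b , mb , new = extend {1} (λ _ → a) (M i) (≤-reflexive (sym (size i Ii))) in
    b , mb , λ v m → case image-full (b ∷ (λ (_ : Fin 1) → a)) (M i) (∷-inj (λ { 0F 0F _ → refl }) new)
                            (∷-all {f = λ (_ : Fin 1) → a} (M i) mb (λ _ → ma)) (≤-reflexive (size i Ii)) v m of λ where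
      (0F , r) → inj₂ (sym r)
      (1F , r) → inj₁ (sym r)

  -- A pair avoiding c, b₁, b₂ contains some y adjacent to c. In a further pair that also avoids y,
  -- the neighbour z of y is adjacent to c too: a triangle.
  disjoint : ∀ i j c → I i ≡ true → I j ≡ true → i ≢ j → M i c ≡ true → M j c ≡ true → ⊥
  disjoint i j c Ii Ij i≢j ic jc = go (pair-at Ii ic) (pair-at Ij jc)
    where
    go : (∃[ b ] M i b ≡ true × (∀ v → M i v ≡ true → v ≡ c ⊎ v ≡ b)) →
         (∃[ b ] M j b ≡ true × (∀ v → M j v ≡ true → v ≡ c ⊎ v ≡ b)) → ⊥
    go (b₁ , ib , all-i) (b₂ , jb , all-j) = last (avoiding (c ∷ (b₁ ∷ λ (_ : Fin 1) → b₂)) (m≤m+n 6 4))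
      where
      b₂∉i : M i b₂ ≡ false
      b₂∉i = ≢true λ m → i≢j (sym (distinct j i Ij Ii λ v mv → case all-j v mv of λ where
        (inj₁ refl) → ic
        (inj₂ refl) → m))
      b₂~b₁ : A b₂ b₁ ≡ true
      b₂~b₁ with dominate i b₂ Ii (M⊂W j b₂ Ij jb) b₂∉i
      ... | y , iy , e with all-i y iy
      ...   | inj₁ refl = ⊥-elim (indep j b₂ c Ij jb jc e)
      ...   | inj₂ refl = e
      toward : ∀ w → W w ≡ true → M i w ≡ false → M j w ≡ false → A w c ≡ true
      toward w Ww iw jw with dominate i w Ii Ww iw | dominate j w Ij Ww jw
      ... | y , iy , e | y′ , jy , e′ with all-i y iy | all-j y′ jy
      ...   | inj₁ refl | _         = e
      ...   | inj₂ refl | inj₁ refl = e′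
      ...   | inj₂ refl | inj₂ refl = ⊥-elim (no△ w b₂ b₁ e′ b₂~b₁ e)
      last : (∃[ l ] I l ≡ true × (∀ d → M l ((c ∷ (b₁ ∷ λ (_ : Fin 1) → b₂)) d) ≡ false)) → ⊥
      last (l , Il , l∉) = last₂ (#-witness (M l) (≤-trans (s≤s z≤n) (≤-reflexive (sym (size l Il)))))
        where
        outside : ∀ {l w} → I l ≡ true → (∀ d → M l ((c ∷ (b₁ ∷ λ (_ : Fin 1) → b₂)) d) ≡ false) → M l w ≡ true → A w c ≡ true
        outside {l} {w} Il l∉ lw = toward w (M⊂W l w Il lw)
          (≢true λ m → case all-i w m of λ where
            (inj₁ refl) → clash lw (l∉ 0F)
            (inj₂ refl) → clash lw (l∉ 1F))
          (≢true λ m → case all-j w m of λ where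
            (inj₁ refl) → clash lw (l∉ 0F)
            (inj₂ refl) → clash lw (l∉ 2F))
        last₂ : (∃[ y ] M l y ≡ true) → ⊥
        last₂ (y , ly) with avoiding (y ∷ (c ∷ (b₁ ∷ λ (_ : Fin 1) → b₂))) (m≤m+n 8 2)
        ... | l′ , Il′ , l′∉ with dominate l′ y Il′ (M⊂W l y Il ly) (l′∉ 0F)
        ...   | z , lz , yz = no△ y z c yz (outside Il′ (λ { 0F → l′∉ 1F ; 1F → l′∉ 2F ; 2F → l′∉ 3F }) lz) (outside Il l∉ ly)

-- The three summands in the bracket serve in turn to show that all sets contain Q (`J-all`), that
-- some set has no dominant vertex (`some-good`), and that there are more than ten pairs (`Pairs`).
lower₁-threshold : ℕ → ℕ
lower₁-threshold k = 2 + ((3 + k) ^ (1 + k) * ((2 + k) * (3 + k)) + (2 ^ (1 + k) * ((2 + k) * ((3 + k) * (2 + k))) + 10))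

12≤threshold : ∀ k → 12 ≤ lower₁-threshold k
12≤threshold k = +-monoʳ-≤ 2 (≤-trans (m≤n+m 10 (2 ^ (1 + k) * ((2 + k) * ((3 + k) * (2 + k)))))
                              (m≤n+m _ ((3 + k) ^ (1 + k) * ((2 + k) * (3 + k)))))

module Exact {k n s : ℕ} {A : Fin n → Fin n → Bool} {M : Fin s → Fin n → Bool} (X : Sys k (3 + k) A M)
  (s≥ : lower₁-threshold k ≤ s) where

  open Sys X

  module AtCore (g : Fin (1 + k) → Fin n) (gcl : Clique A g) (s≤ : s ≤ suc ((3 + k) ^ (1 + k) * # (Core.J X g gcl))) where
    open Core X g gcl
    open GoodSets X g gcl

    few : ∀ v → inQ v ≡ false → # (λ i → J i ∧ M i v) ≤ 2 + k
    few v v∉ = codegree≤ refl (v ∷ g) (∷-inj (clique-inj gcl) (λ c r → refute v∉ (c , r))) (λ i → J i ∧ M i v) (λ _ _ → refl)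
      (λ i a → ∷-all (M i) (proj₂ (∧-elim {J i} a)) (g∈ (proj₁ (∧-elim a))))

    -- The common clique has 1 + k vertices. If it lay inside Q it would be all of Q, which i does
    -- not contain.
    outside-Q : ∀ i j → J j ≡ true → J i ≡ false → i ≢ j → ∃[ y ] T i y ≡ true × M j y ≡ true
    outside-Q i j Jj Ji i≢j with meet i j i≢j
    ... | f , f∈ , cl = find (any? (λ d → not (inQ (f d)) ≟ᵇ true))
      where
      find : Dec (∃[ d ] not (inQ (f d)) ≡ true) → ∃[ y ] T i y ≡ true × M j y ≡ true
      find (yes (d , e)) = f d , ∧-intro (proj₁ (f∈ d)) e , proj₂ (f∈ d)
      find (no none) = ⊥-elim (refute Ji λ c → case decide (M i (g c)) of λ where
          (inj₁ e) → e
          (inj₂ e) → ⊥-elim (1+n≰n (injective⇒≤ {f = c ∷ idx} (λ {a} {b} → ∷-inj idx-inj (λ d r → clash (proj₁ (f∈ d))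
            (subst (λ z → M i z ≡ false) (trans (cong g (sym r)) (proj₂ (at d))) e)) a b))))
        where
        at : ∀ d → ∃[ c ] g c ≡ f d
        at d = case decide (inQ (f d)) of λ where
          (inj₁ e) → witness e
          (inj₂ e) → ⊥-elim (none (d , not-intro e))
        idx : Fin (1 + k) → Fin (1 + k)
        idx d = proj₁ (at d)
        idx-inj : Inj idx
        idx-inj a b r = clique-inj cl a b (trans (sym (proj₂ (at a))) (trans (cong g r) (proj₂ (at b))))

    -- If i did not contain Q, every set of J would meet `T i`, whose at most 3 + k vertices lie in
    -- at most 2 + k sets of J each. Then J would be bounded, although it holds a positive
    -- proportion of the sets.
    J-all : ∀ i → J i ≡ true
    J-all i = case decide (J i) of λ where
        (inj₁ e) → e
        (inj₂ e) → ⊥-elim (<⇒≱ s≥ (≤-trans s≤ (≤-trans (s≤s (*-monoʳ-≤ ((3 + k) ^ (1 + k)) (bound e))) (s≤s (m≤m+n _ _)))))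
      where
      bound : J i ≡ false → # J ≤ (2 + k) * (3 + k)
      bound Ji = ≤-trans (double-count J (T i) M (2 + k)
          (λ j Jj → outside-Q i j Jj Ji (λ { refl → clash Jj Ji }))
          (λ y Ty → few y (not-elim (proj₂ (∧-elim {M i y} Ty)))))
        (*-monoʳ-≤ (2 + k) (≤-trans (#-mono λ v e → T⇒M {i} e) (≤-reflexive (size i))))

    t≡ : 3 + k ≡ (1 + k) + 2
    t≡ = cong suc (+-comm 2 k)

    some-good : ∃[ i ] ∃[ q ] Good q i
    some-good with any? (λ i → not (domᵢ i) ≟ᵇ true)
    ... | no none = ⊥-elim (<⇒≱ s≥ (≤-trans (≤-trans (≤-reflexive (sym (#-all s)))
            (#-mono λ i _ → ∧-intro (J-all i) (case decide (domᵢ i) of λ where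
              (inj₁ e) → e
              (inj₂ e) → ⊥-elim (none (i , not-intro e)))))
            (≤-trans (dominant-bound (2 + k) few) (≤-trans (≤-trans (m≤m+n _ 10) (m≤n+m _ ((3 + k) ^ (1 + k) * ((2 + k) * (3 + k))))) (n≤1+n _)))))
    ... | yes (i , nd) = i , (case good-two (J-all i) (mem 0F) (mem 1F) (λ v Tv → case cover v Tv of λ where
              (0F , r) → inj₁ (sym r)
              (1F , r) → inj₂ (sym r)) of λ where
            (inj₁ (p , D)) → ⊥-elim (refute (not-elim nd) (p , Dominant⇒dom D))
            (inj₂ r) → r)
      where
      open Enum (enum (T i) (#T {i} {2} (J-all i) t≡))

    module Uniform (q : Fin (1 + k)) (i₀ : Fin s) (G₀ : Good q i₀) where

      only-T : ∀ {i v} → T i v ≡ true → Only q v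
      only-T {i} {v} Tv = case decide (M i₀ v) of λ where
        (inj₁ m) → proj₂ G₀ v (∧-intro m (proj₂ (∧-elim {M i v} Tv)))
        (inj₂ m) → proj₁ (good-dominates (J-all i₀) G₀ m (misses (J-all i) (T⇒M {i} Tv)))

      good : ∀ i → Good q i
      good i = (λ u v Tu Tv → ≢true (only-nonadj (J-all i) (T⇒M {i} Tu) (T⇒M {i} Tv) (only-T {i} Tu) (only-T {i} Tv))) ,
               (λ v Tv → only-T {i} Tv)

      Iq-all : ∀ i → Iq q i ≡ true
      Iq-all i = ∧-intro (J-all i) (holds {d = good? q i} (good i))

      disjoint-T : ∀ i j c → i ≢ j → T i c ≡ true → T j c ≡ true → ⊥
      disjoint-T i j c = Pairs.disjoint (good-MIS q t≡) big i j c (Iq-all i) (Iq-all j)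
        where
        big : 10 < # (Iq q)
        big = ≤-trans (≤-trans (s≤s (≤-trans (m≤n+m 10 _) (m≤n+m _ ((3 + k) ^ (1 + k) * ((2 + k) * (3 + k)))))) (≤-trans (n≤1+n _) s≥))
                      (≤-trans (≤-reflexive (sym (#-all s))) (#-mono λ i _ → Iq-all i))

      U : Fin n → Bool
      U v = ⌊ any? (λ i → T i v ≟ᵇ true) ⌋

      #U : s * 2 ≤ # U
      #U = begin
        s * 2                             ≡⟨ sum-const s 2 ⟨
        sum {s} (λ _ → 2)                 ≡⟨ sum-cong-≗ (λ i → #T {i} (J-all i) t≡) ⟨
        sum (λ i → # (T i))               ≡⟨ #-swap T ⟩
        sum (λ v → # (λ i → T i v))       ≤⟨ sum-mono col ⟩
        sum (λ v → 𝟙 (U v))               ≡⟨ #-sum U ⟨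
        # U                               ∎
        where
        open ≤-Reasoning
        col : ∀ v → # (λ i → T i v) ≤ 𝟙 (U v)
        col v = case decide (U v) of λ where
          (inj₁ e) → ≤-trans (#≤1 _ (λ i j a b → case i ≟ j of λ where
                        (yes r) → r
                        (no ne) → ⊥-elim (disjoint-T i j v ne a b))) (≤-reflexive (cong 𝟙 (sym e)))
          (inj₂ e) → ≤-trans (≤-reflexive (#-empty _ (λ i a → refute e (i , a)))) z≤n

      inside-deg : ∀ {v} c → (∀ d → d ≢ c → A v (g d) ≡ true) → k ≤ # (λ u → A v u ∧ inQ u)
      inside-deg {v} c h = inj⇒≤# (λ d → g (punchIn c d)) (λ u → A v u ∧ inQ u)
        (λ a b e → punchIn-injective c a b (clique-inj gcl _ _ e))
        (λ d → ∧-intro (h (punchIn c d) (punchInᵢ≢i c d)) (holds (punchIn c d , refl)))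

      -- There are k neighbours in Q, and one in each of the s - 1 other sets, which are disjoint
      -- outside Q.
      deg-U : ∀ v → U v ≡ true → k + (s ∸ 1) ≤ # (A v)
      deg-U v Uv with witness {d = any? (λ i → T i v ≟ᵇ true)} Uv
      ... | i , Tv = begin
        k + (s ∸ 1)                                                  ≤⟨ +-mono-≤ (inside-deg q (proj₂ (only-T {i} Tv))) outer ⟩
        # (λ u → A v u ∧ inQ u) + # (λ u → A v u ∧ not (inQ u))      ≡⟨ #-split (A v) inQ ⟨
        # (A v)                                                      ∎
        where
        open ≤-Reasoning
        neighbour : ∀ j → i ≢ j → ∃[ y ] A v y ∧ not (inQ y) ≡ true × T j y ≡ true
        neighbour j i≢j = let v∉ = ≢true λ m → disjoint-T i j v i≢j Tv (∧-intro m (proj₂ (∧-elim {M i v} Tv)))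
                              _ , y , Ty , vy = good-dominates (J-all j) (good j) v∉ (misses (J-all i) (T⇒M {i} Tv))
          in y , ∧-intro vy (proj₂ (∧-elim {M j y} Ty)) , Ty
        outer : s ∸ 1 ≤ # (λ u → A v u ∧ not (inQ u))
        outer = begin
          s ∸ 1                                    ≡⟨ cong (_∸ 1) (#-others i) ⟩
          # (λ j → not ⌊ i ≟ j ⌋)                  ≤⟨ double-count _ (λ u → A v u ∧ not (inQ u)) T 1
                                                       (λ j e → neighbour j (refute (not-elim e)))
                                                       (λ y _ → #≤1 _ (λ j l a b → case j ≟ l of λ where
                                                          (yes r) → r
                                                          (no ne) → ⊥-elim (disjoint-T j l y ne (proj₂ (∧-elim {not ⌊ i ≟ j ⌋} a)) (proj₂ (∧-elim {not ⌊ i ≟ l ⌋} b))))) ⟩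
          1 * # (λ u → A v u ∧ not (inQ u))        ≡⟨ *-identityˡ _ ⟩
          # (λ u → A v u ∧ not (inQ u))            ∎

      deg-Q : ∀ c → k + 𝟙 (not ⌊ q ≟ c ⌋) * (s * 2) ≤ # (A (g c))
      deg-Q c = ≤-trans (+-mono-≤ (inside-deg c (λ d ne → gcl c d (λ r → ne (sym r)))) outer) (≤-reflexive (sym (#-split (A (g c)) inQ)))
        where
        outer : 𝟙 (not ⌊ q ≟ c ⌋) * (s * 2) ≤ # (λ u → A (g c) u ∧ not (inQ u))
        outer with q ≟ c
        ... | yes _ = z≤n
        ... | no ne = ≤-trans (≤-reflexive (+-identityʳ (s * 2))) (≤-trans #U (#-mono λ v Uv →
                let i , Tv = witness {d = any? (λ i → T i v ≟ᵇ true)} Uv in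
                ∧-intro (A-sym v (g c) (proj₂ (only-T {i} Tv) c (λ r → ne (sym r)))) (proj₂ (∧-elim {M i v} Tv))))

      -- Twice the claimed value: 2 s vertices outside Q have degree at least k + s - 1, and each of
      -- the 1 + k vertices of Q has k neighbours in Q and, except for q, all 2 s vertices outside.
      total : s * 2 * (k + (s ∸ 1)) + ((1 + k) * k + k * (s * 2)) ≤ degrees A
      total = begin
        s * 2 * (k + (s ∸ 1)) + ((1 + k) * k + k * (s * 2))
          ≤⟨ +-mono-≤ partU partQ ⟩
        sum (λ v → 𝟙 (U v) * # (A v)) + sum (λ v → 𝟙 (inQ v) * # (A v))
          ≡⟨ ∑-distrib-+ (λ v → 𝟙 (U v) * # (A v)) (λ v → 𝟙 (inQ v) * # (A v)) ⟨
        sum (λ v → 𝟙 (U v) * # (A v) + 𝟙 (inQ v) * # (A v))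
          ≤⟨ sum-mono (λ v → ≤-trans (≤-reflexive (sym (*-distribʳ-+ (# (A v)) (𝟙 (U v)) (𝟙 (inQ v)))))
               (≤-trans (*-monoˡ-≤ (# (A v)) (exclusive v)) (≤-reflexive (*-identityˡ (# (A v)))))) ⟩
        degrees A ∎
        where
        open ≤-Reasoning
        exclusive : ∀ v → 𝟙 (U v) + 𝟙 (inQ v) ≤ 1
        exclusive v = case decide (U v) of λ where
          (inj₂ e) → ≤-trans (≤-reflexive (cong (λ b → 𝟙 b + 𝟙 (inQ v)) e)) (𝟙≤1 (inQ v))
          (inj₁ e) → ≤-reflexive (cong₂ (λ a b → 𝟙 a + 𝟙 b) e
            (let i , Tv = witness {d = any? (λ i → T i v ≟ᵇ true)} e in not-elim (proj₂ (∧-elim {M i v} Tv))))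
        partU : s * 2 * (k + (s ∸ 1)) ≤ sum (λ v → 𝟙 (U v) * # (A v))
        partU = ≤-trans (*-monoˡ-≤ (k + (s ∸ 1)) #U) (≤-trans (≤-reflexive (*-#-sum U (k + (s ∸ 1))))
          (sum-mono (λ v → 𝟙*-mono (U v) (deg-U v))))
        partQ : (1 + k) * k + k * (s * 2) ≤ sum (λ v → 𝟙 (inQ v) * # (A v))
        partQ = begin
          (1 + k) * k + k * (s * 2)                              ≡⟨ cong₂ _+_ (sum-const (1 + k) k) (cong (_* (s * 2)) (cong pred (sym (#-others q)))) ⟨
          sum {1 + k} (λ _ → k) + # (λ c → not ⌊ q ≟ c ⌋) * (s * 2) ≡⟨ cong (sum {1 + k} (λ _ → k) +_) (*-#-sum (λ c → not ⌊ q ≟ c ⌋) (s * 2)) ⟩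
          sum {1 + k} (λ _ → k) + sum (λ c → 𝟙 (not ⌊ q ≟ c ⌋) * (s * 2)) ≡⟨ ∑-distrib-+ (λ _ → k) (λ c → 𝟙 (not ⌊ q ≟ c ⌋) * (s * 2)) ⟨
          sum (λ c → k + 𝟙 (not ⌊ q ≟ c ⌋) * (s * 2))            ≤⟨ sum-mono deg-Q ⟩
          sum (λ c → # (A (g c)))                                ≤⟨ sum-image g (clique-inj gcl) (λ v → # (A v)) ⟩
          sum (λ v → 𝟙 (inQ v) * # (A v))                        ∎

  lower₁ : s * 2 * (k + (s ∸ 1)) + ((1 + k) * k + k * (s * 2)) ≤ degrees A
  lower₁ = let g , cl , s≤ = core-exists X (≤-trans (m≤m+n 2 _) s≥)
               i , q , G = AtCore.some-good g cl s≤
    in AtCore.Uniform.total g cl s≤ q i G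

-- Decidable search and the existence of the minima

Adj : ℕ → Set
Adj n = Fin n → Fin n → Bool

Searchable : Set → Set₁
Searchable B = {P : B → Set} → (∀ b → Dec (P b)) → Dec (Σ B P)

search-Vec : ∀ {B : Set} → Searchable B → ∀ k → Searchable (Vec B k)
search-Vec sB zero    P? = map′ (λ p → [] , p) (λ { ([] , p) → p }) (P? [])
search-Vec sB (suc k) P? = map′ (λ { (b , v , p) → (b ∷ᵥ v) , p }) (λ { ((b ∷ᵥ v) , p) → b , v , p })
  (sB (λ b → search-Vec sB k (λ v → P? (b ∷ᵥ v))))

HasClique-map : ∀ {n} {A B : Adj n} {k} {S T : Subset n} → (∀ u v → A u v ≡ true → B u v ≡ true) → (∀ {v} → v ∈ S → v ∈ T) →
  HasClique A k S → HasClique B k T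
HasClique-map AB ST (f , f∈ , cl) = f , (λ c → ST (f∈ c)) , λ c d ne → AB _ _ (cl c d ne)

hasClique? : ∀ {n} (A : Adj n) k S → Dec (HasClique A k S)
hasClique? {n} A k S = map′
  (λ (j , h) → finToFun j , h)
  (λ (f , f∈ , cl) → funToFin f , (λ c → subst (_∈ S) (sym (finToFun-funToFin f c)) (f∈ c)) ,
      λ c d ne → trans (cong₂ A (finToFun-funToFin f c) (finToFun-funToFin f d)) (cl c d ne))
  (any? (λ (j : Fin (n ^ k)) → all? (λ c → finToFun j c ∈? S) ×-dec
    all? (λ c → all? (λ d → ¬? (c ≟ d) →-dec (A (finToFun j c) (finToFun j d) ≟ᵇ true)))))

maxFree? : ∀ {n} (A : Adj n) k S → Dec (MaxFree A k S)
maxFree? A k S = ¬? (hasClique? A k S) ×-dec all? (λ v → ¬? (v ∈? S) →-dec hasClique? A k (S ∪ ⁅ v ⁆))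

SystemOn : ∀ {n} → ℕ → Adj n → List (Subset n) → Set
SystemOn r A F = ¬ HasClique A r ⊤ × All (MaxFree A (r ∸ 1)) F ×
  (∀ S T → S ∈ₗ F → T ∈ₗ F → S ≢ T → HasClique A (r ∸ 2) (S ∩ T))

MaximalOn : ∀ {n} → ℕ → Adj n → List (Subset n) → Set
MaximalOn r A F = ∀ u v → u ≢ v → A u v ≡ false →
  HasClique (addEdge A u v) r ⊤ ⊎ Any (λ S → HasClique (addEdge A u v) (r ∸ 1) S) F

_≟ˢ_ : ∀ {n} (S T : Subset n) → Dec (S ≡ T)
_≟ˢ_ = ≡-dec _≟ᵇ_

systemOn? : ∀ {n} r (A : Adj n) F → Dec (SystemOn r A F)
systemOn? r A F = ¬? (hasClique? A r ⊤) ×-dec (All-all? (maxFree? A (r ∸ 1)) F ×-dec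
  map′ (λ h S T S∈ T∈ → All-lookup (All-lookup h S∈) T∈) (λ h → All-tabulate λ S∈ → All-tabulate λ T∈ → h _ _ S∈ T∈)
    (All-all? (λ S → All-all? (λ T → ¬? (S ≟ˢ T) →-dec hasClique? A (r ∸ 2) (S ∩ T)) F) F))

maximalOn? : ∀ {n} r (A : Adj n) F → Dec (MaximalOn r A F)
maximalOn? r A F = all? λ u → all? λ v → ¬? (u ≟ v) →-dec ((A u v ≟ᵇ false) →-dec
  (hasClique? (addEdge A u v) r ⊤ ⊎-dec Any-any? (hasClique? (addEdge A u v) (r ∸ 1)) F))

module _ {n : ℕ} {A B : Adj n} (eq : ∀ u v → A u v ≡ B u v) where

  HasClique-cong : ∀ {k S} → HasClique A k S → HasClique B k S
  HasClique-cong = HasClique-map (λ u v e → trans (sym (eq u v)) e) (λ s → s)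

  addEdge-cong : ∀ x y u v → addEdge A x y u v ≡ addEdge B x y u v
  addEdge-cong x y u v = cong (_∨ ((⌊ u ≟ x ⌋ ∧ ⌊ v ≟ y ⌋) ∨ (⌊ u ≟ y ⌋ ∧ ⌊ v ≟ x ⌋))) (eq u v)

module _ {n : ℕ} {A B : Adj n} (eq : ∀ u v → A u v ≡ B u v) where

  SystemOn-cong : ∀ {r F} → SystemOn r A F → SystemOn r B F
  SystemOn-cong (noK , max , int) =
    (λ h → noK (HasClique-cong (λ u v → sym (eq u v)) h)) ,
    All-map (λ (a , b) → (λ h → a (HasClique-cong (λ u v → sym (eq u v)) h)) , λ v v∉ → HasClique-cong eq (b v v∉)) max ,
    λ S T S∈ T∈ ne → HasClique-cong eq (int S T S∈ T∈ ne)

  MaximalOn-cong : ∀ {r F} → MaximalOn r A F → MaximalOn r B F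
  MaximalOn-cong h u v ne e = case h u v ne (trans (eq u v) e) of λ where
    (inj₁ c) → inj₁ (HasClique-cong (addEdge-cong eq u v) c)
    (inj₂ c) → inj₂ (Any-map (HasClique-cong (addEdge-cong eq u v)) c)

edgesOn-cong : ∀ {n} {A B : Adj n} → (∀ u v → A u v ≡ B u v) → edgesOn A ≡ edgesOn B
edgesOn-cong eq = sum-cong-≗ (λ i → sum-cong-≗ (λ j → cong (λ b → 𝟙 ((toℕ i <ᵇ toℕ j) ∧ b)) (eq i j)))

least : (P : ℕ → Set) → (∀ m → Dec (P m)) → ∀ m₀ → P m₀ → Σ[ m ∈ ℕ ] P m × (∀ m′ → P m′ → m ≤ m′)
least P P? m₀ p₀ = go m₀ 0 (λ _ ()) (subst P (sym (+-identityʳ m₀)) p₀)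
  where
  go : ∀ d m → (∀ j → j < m → ¬ P j) → P (d + m) → Σ[ m ∈ ℕ ] P m × (∀ m′ → P m′ → m ≤ m′)
  go d m below p with P? m
  ... | yes q = m , q , λ m′ q′ → ≮⇒≥ (λ lt → below m′ lt q′)
  go zero    m below p | no ¬q = ⊥-elim (¬q p)
  go (suc d) m below p | no ¬q = go d (suc m)
    (λ j lt q → case m≤n⇒m<n∨m≡n (≤-pred lt) of λ where
      (inj₁ j<m) → below j j<m q
      (inj₂ refl) → ¬q q) (subst P (sym (+-suc d m)) p)

-- Whether a system with additional property Ψ and m edges exists is decidable, since it has at most t + 2 m vertices.
module Minimum (k t s : ℕ) (1≤s : 1 ≤ s) (Ψ : ∀ {n} → Adj n → List (Subset n) → Set)
  (Ψ? : ∀ {n} (A : Adj n) F → Dec (Ψ A F)) (Ψ-cong : ∀ {n} {A B : Adj n} {F} → (∀ u v → A u v ≡ B u v) → Ψ A F → Ψ B F) where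

  Raw : ℕ → (n : ℕ) → Adj n → List (Subset n) → Set
  Raw m n A F = (∀ u v → A u v ≡ A v u) × (∀ u → A u u ≡ false) × SystemOn (3 + k) A F × Unique F ×
                All (λ S → ∣ S ∣ ≡ t) F × edgesOn A ≡ m × Ψ A F

  raw? : ∀ m n A F → Dec (Raw m n A F)
  raw? m n A F = all? (λ u → all? (λ v → A u v ≟ᵇ A v u)) ×-dec (all? (λ u → A u u ≟ᵇ false) ×-dec (systemOn? (3 + k) A F ×-dec
    (allPairs? (λ S T → ¬? (S ≟ˢ T)) F ×-dec (All-all? (λ S → ∣ S ∣ ≟ℕ t) F ×-dec ((edgesOn A ≟ℕ m) ×-dec Ψ? A F)))))

  matrix : ∀ {n} → Vec (Subset n) n → Adj n
  matrix mat u v = lookup (lookup mat u) v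

  -- Rows are subsets, so the matrix ranges over a searchable type. A graph and its matrix agree
  -- only pointwise, which is why `Ψ-cong` is assumed.
  Code : ℕ → ℕ → Set
  Code m n = Σ[ mat ∈ Vec (Subset n) n ] Σ[ F ∈ Vec (Subset n) s ] Raw m n (matrix mat) (toList F)

  code? : ∀ m n → Dec (Code m n)
  code? m n = search-Vec anySubset? n (λ mat → search-Vec anySubset? s (λ F → raw? m n (matrix mat) (toList F)))

  Has : ℕ → Set
  Has m = Σ[ X ∈ RTSystem (3 + k) t s ] edges (RTSystem.H X) ≡ m × Ψ (adj (RTSystem.H X)) (RTSystem.F X)

  decode : ∀ {m n} → Code m n → Has m
  decode (mat , F , sy , ir , S , u , z , e , ψ) = record
    { n = _ ; H = H ; F = toList F ; system = S ; noRep = u ; sizes = z ; card = length-toList F } ,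
    trans (edges≡edgesOn H) e , ψ
    where H = record { adj = matrix mat ; sym = sy ; irrefl = ir }

  encode : ∀ {m} (X : Has m) → Code m (RTSystem.n (proj₁ X))
  encode {m} (record { n = n ; H = H ; F = F ; system = S ; noRep = u ; sizes = z ; card = refl } , e , ψ) =
    mat , fromList F , subst (Raw m n (matrix mat)) (sym (toList∘fromList F))
      ((λ a b → trans (sym (eq a b)) (trans (Graph.sym H a b) (eq b a))) , (λ a → trans (sym (eq a a)) (Graph.irrefl H a)) ,
       SystemOn-cong eq {3 + k} S , u , z ,
       trans (edgesOn-cong (λ a b → sym (eq a b))) (trans (sym (edges≡edgesOn H)) e) , Ψ-cong eq ψ)
    where
    mat : Vec (Subset n) n
    mat = tabulateᵥ (λ a → tabulateᵥ (adj H a))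
    eq : ∀ a b → adj H a b ≡ matrix mat a b
    eq a b = sym (trans (cong (λ row → lookup row b) (lookup∘tabulate (λ a → tabulateᵥ (adj H a)) a)) (lookup∘tabulate (adj H a) b))

  has? : ∀ m → Dec (Has m)
  has? m = map′ (λ (n , c) → decode c)
    (λ X → let n≤ = s≤s (≤-trans (vertices≤ (proj₁ X) 1≤s) (≤-reflexive (cong (λ z → t + 2 * z) (proj₁ (proj₂ X))))) in
      fromℕ< n≤ , subst (Code m) (sym (toℕ-fromℕ< n≤)) (encode X))
    (any? (λ (n : Fin (suc (t + 2 * m))) → code? m (toℕ n)))

  minimum : ∀ {m₀} → Has m₀ → Σ[ m ∈ ℕ ] Has m × (∀ m′ → Has m′ → m ≤ m′)
  minimum = least Has has? _

min-IsE : ∀ {k t s} → 1 ≤ s → RTSystem (3 + k) t s → Σ[ m ∈ ℕ ] IsE (3 + k) t s m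
min-IsE {k} {t} {s} 1≤s X =
  let m , (Y , e , _) , low = minimum (X , refl , _) in m , (Y , e) , λ Z → low _ (Z , refl , _)
  where open Minimum k t s 1≤s (λ _ _ → Unit) (λ _ _ → yes _) (λ _ _ → _)

min-IsE' : ∀ {k t s} → 1 ≤ s → MaxRTSystem (3 + k) t s → Σ[ m ∈ ℕ ] IsE' (3 + k) t s m
min-IsE' {k} {t} {s} 1≤s X =
  let m , (Y , e , max) , low = minimum (MaxRTSystem.sys X , refl , MaxRTSystem.maximal X) in
  m , (record { sys = Y ; maximal = max } , e) , λ Z → low _ (MaxRTSystem.sys Z , refl , MaxRTSystem.maximal Z)
  where open Minimum k t s 1≤s (MaximalOn (3 + k)) (maximalOn? (3 + k)) (λ {_} {_} {_} {F} eq → MaximalOn-cong eq {3 + k} {F})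

e# : ∀ {r t s} → MaxRTSystem r t s → ℕ
e# X = edges (RTSystem.H (MaxRTSystem.sys X))

v# : ∀ {r t s} → MaxRTSystem r t s → ℕ
v# X = RTSystem.n (MaxRTSystem.sys X)

-- Greedy completion to a maximal system

addEdge-⊂ : ∀ {n} (A : Adj n) u v x y → A x y ≡ true → addEdge A u v x y ≡ true
addEdge-⊂ A u v x y e = cong (_∨ ((⌊ x ≟ u ⌋ ∧ ⌊ y ≟ v ⌋) ∨ (⌊ x ≟ v ⌋ ∧ ⌊ y ≟ u ⌋))) e

addEdge-mono : ∀ {n} {A B : Adj n} u v → (∀ x y → A x y ≡ true → B x y ≡ true) → ∀ x y →
  addEdge A u v x y ≡ true → addEdge B u v x y ≡ true
addEdge-mono {A = A} {B} u v h x y e with decide (A x y)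
... | inj₁ a = addEdge-⊂ B u v x y (h x y a)
... | inj₂ a = trans (cong (B x y ∨_) (trans (cong (_∨ new) (sym a)) e)) (∨-zeroʳ (B x y))
  where new = (⌊ x ≟ u ⌋ ∧ ⌊ y ≟ v ⌋) ∨ (⌊ x ≟ v ⌋ ∧ ⌊ y ≟ u ⌋)

addEdge-at : ∀ {n} (A : Adj n) u v → addEdge A u v u v ≡ true
addEdge-at A u v = trans (cong (A u v ∨_) (cong (_∨ (⌊ u ≟ v ⌋ ∧ ⌊ v ≟ u ⌋)) (∧-intro (holds {d = u ≟ u} refl) (holds {d = v ≟ v} refl)))) (∨-zeroʳ (A u v))

plus : ∀ {n} (H : Graph n) u v → u ≢ v → Graph n
plus H u v u≢v = record
  { adj = addEdge (adj H) u v
  ; sym = λ x y → cong₂ _∨_ (Graph.sym H x y)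
      (trans (∨-comm (⌊ x ≟ u ⌋ ∧ ⌊ y ≟ v ⌋) (⌊ x ≟ v ⌋ ∧ ⌊ y ≟ u ⌋)) (cong₂ _∨_ (∧-comm ⌊ x ≟ v ⌋ ⌊ y ≟ u ⌋) (∧-comm ⌊ x ≟ u ⌋ ⌊ y ≟ v ⌋)))
  ; irrefl = λ x → cong₂ _∨_ (Graph.irrefl H x) (cong₂ _∨_
      (≢true λ e → let a , b = ∧-elim {⌊ x ≟ u ⌋} e in u≢v (trans (sym (witness a)) (witness b)))
      (≢true λ e → let a , b = ∧-elim {⌊ x ≟ v ⌋} e in u≢v (trans (sym (witness b)) (witness a)))) }

module Completion {n : ℕ} (r : ℕ) (F : List (Subset n)) where

  Extendable : Graph n → Fin n × Fin n → Set
  Extendable H (u , v) = u ≢ v × adj H u v ≡ false × ¬ HasClique (addEdge (adj H) u v) r ⊤ ×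
    ¬ Any (λ S → HasClique (addEdge (adj H) u v) (r ∸ 1) S) F

  extendable? : ∀ H e → Dec (Extendable H e)
  extendable? H (u , v) = ¬? (u ≟ v) ×-dec ((adj H u v ≟ᵇ false) ×-dec (¬? (hasClique? (addEdge (adj H) u v) r ⊤) ×-dec
    ¬? (Any-any? (hasClique? (addEdge (adj H) u v) (r ∸ 1)) F)))

  infix 4 _⊑_
  _⊑_ : Graph n → Graph n → Set
  H ⊑ H′ = ∀ x y → adj H x y ≡ true → adj H′ x y ≡ true

  extendable-anti : ∀ {H H′} e → H ⊑ H′ → Extendable H′ e → Extendable H e
  extendable-anti {H} {H′} (u , v) sub (ne , e , a , b) = ne , ≢true (λ q → clash (sub u v q) e) ,
    (λ c → a (grow c)) , λ c → b (Any-map grow c)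
    where
    grow : ∀ {k S} → HasClique (addEdge (adj H) u v) k S → HasClique (addEdge (adj H′) u v) k S
    grow = HasClique-map (addEdge-mono {A = adj H} {adj H′} u v sub) (λ s → s)

  -- Blocking cliques and cliques in intersections survive the addition of an edge; the two freeness
  -- conditions are exactly what `Extendable` records.
  extend-system : ∀ {H u v} → IsRSystem r H F → (x : Extendable H (u , v)) → IsRSystem r (plus H u v (proj₁ x)) F
  extend-system {H} {u} {v} (_ , max , int) (_ , _ , a , b) = a ,
    All-tabulate (λ {S} S∈ → (λ c → b (lose S∈ c)) , λ w w∉ → grow (proj₂ (All-lookup max S∈) w w∉)) ,
    λ S T S∈ T∈ ne → grow (int S T S∈ T∈ ne)
    where
    grow : ∀ {k S} → HasClique (adj H) k S → HasClique (addEdge (adj H) u v) k S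
    grow = HasClique-map (addEdge-⊂ (adj H) u v) (λ s → s)

  -- One pass over the pairs suffices: by `extendable-anti`, a pair that is blocked stays blocked
  -- when edges are added.
  complete : ∀ (L : List (Fin n × Fin n)) H → IsRSystem r H F →
    Σ[ H′ ∈ Graph n ] H ⊑ H′ × IsRSystem r H′ F × All (λ e → ¬ Extendable H′ e) L
  complete []ₗ H S = H , (λ _ _ e → e) , S , []ₐ
  complete (e ∷ₗ L) H S with extendable? H e
  ... | no ¬x = let H′ , sub , S′ , rest = complete L H S in
          H′ , sub , S′ , (λ x → ¬x (extendable-anti {H} {H′} e sub x)) ∷ₐ rest
  ... | yes x = let H′ , sub , S′ , rest = complete L (plus H (proj₁ e) (proj₂ e) (proj₁ x)) (extend-system {H} S x) in
          H′ , (λ a b q → sub a b (addEdge-⊂ (adj H) (proj₁ e) (proj₂ e) a b q)) , S′ ,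
          (λ x′ → clash (sub (proj₁ e) (proj₂ e) (addEdge-at (adj H) (proj₁ e) (proj₂ e))) (proj₁ (proj₂ x′))) ∷ₐ rest

  completion : ∀ H → IsRSystem r H F → Σ[ H′ ∈ Graph n ] H ⊑ H′ × IsRSystem r H′ F × IsMaximal r H′ F
  completion H S =
    let H′ , sub , S′ , stuck = complete (cartesianProduct (allFin n) (allFin n)) H S
    in H′ , sub , S′ , λ u v ne e → case hasClique? (addEdge (adj H′) u v) r ⊤ of λ where
         (yes c) → inj₁ c
         (no ¬c) → case Any-any? (hasClique? (addEdge (adj H′) u v) (r ∸ 1)) F of λ where
           (yes d) → inj₂ d
           (no ¬d) → ⊥-elim (All-lookup stuck (∈-cartesianProduct⁺ (∈-allFin u) (∈-allFin v)) (ne , e , ¬c , ¬d))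

-- Maximal 3-systems from maximal independent sets: add an isolated vertex 0 to every set, then complete

edge-clique : ∀ {n} {A : Adj n} {S : Subset n} (H : ∀ x y → A x y ≡ true → A y x ≡ true) {u v} → u ∈ S → v ∈ S → A u v ≡ true → HasClique A 2 S
edge-clique H {u} {v} u∈ v∈ e = (u ∷ λ _ → v) , (λ { 0F → u∈ ; 1F → v∈ }) , λ where
  0F 0F ne → ⊥-elim (ne refl)
  0F 1F _ → e
  1F 0F _ → H u v e
  1F 1F ne → ⊥-elim (ne refl)

module Coned {n s t : ℕ} {A : Adj n} {M : Fin s → Fin n → Bool} (S : MIS t A (λ _ → true) (λ _ → true) M) where

  open MIS S

  cone : Adj (suc n)
  cone zero    _       = false
  cone (suc _) zero    = false
  cone (suc u) (suc v) = A u v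

  cone-sym : ∀ u v → cone u v ≡ cone v u
  cone-sym zero    zero    = refl
  cone-sym zero    (suc v) = refl
  cone-sym (suc u) zero    = refl
  cone-sym (suc u) (suc v) with decide (A u v) | decide (A v u)
  ... | inj₁ a | _      = trans a (sym (A-sym u v a))
  ... | inj₂ a | inj₁ b = clash (A-sym v u b) a
  ... | inj₂ a | inj₂ b = trans a (sym b)

  coneGraph : Graph (suc n)
  coneGraph = record { adj = cone ; sym = cone-sym ; irrefl = λ { zero → refl ; (suc u) → ≢true λ e → no△ u u u e e e } }

  set : Fin s → Subset (suc n)
  set i = true ∷ᵥ tabulateᵥ (M i)

  family : List (Subset (suc n))
  family = tabulate set

  lookup-set : ∀ i v → lookup (set i) (suc v) ≡ M i v
  lookup-set i v = lookup∘tabulate (M i) v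

  suc∈ : ∀ {i v} → M i v ≡ true → suc v ∈ set i
  suc∈ {i} {v} e = lookup⇒[]= (suc v) (set i) (trans (lookup-set i v) e)

  suc∈⁻ : ∀ {i v} → suc v ∈ set i → M i v ≡ true
  suc∈⁻ {i} {v} e = trans (sym (lookup-set i v)) ([]=⇒lookup e)

  set-injective : ∀ {i j} → set i ≡ set j → i ≡ j
  set-injective {i} {j} e = distinct i j refl refl λ v m → trans (sym (lookup-set j v)) (trans (cong (λ z → lookup z (suc v)) (sym e)) (trans (lookup-set i v) m))

  no-triangle : ¬ HasClique cone 3 ⊤
  no-triangle (f , _ , cl) = go (f 0F) (f 1F) (f 2F) (cl 0F 1F (λ ())) (cl 1F 2F (λ ())) (cl 0F 2F (λ ()))
    where
    go : ∀ u v w → cone u v ≡ true → cone v w ≡ true → cone u w ≡ true → ⊥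
    go (suc u) (suc v) (suc w) = no△ u v w

  cone-system : IsRSystem 3 coneGraph family
  cone-system = no-triangle , All-tabulate⁺ (λ i → free i , dom i) , int
    where
    free : ∀ i → ¬ HasClique cone 2 (set i)
    free i (f , f∈ , cl) = go (f 0F) (f 1F) (f∈ 0F) (f∈ 1F) (cl 0F 1F (λ ()))
      where
      go : ∀ u v → u ∈ set i → v ∈ set i → cone u v ≡ true → ⊥
      go (suc u) (suc v) a b = indep i u v refl (suc∈⁻ a) (suc∈⁻ b)
    dom : ∀ i v → v ∉ set i → HasClique cone 2 (set i ∪ ⁅ v ⁆)
    dom i zero    v∉ = ⊥-elim (v∉ here)
    dom i (suc v) v∉ = let y , y∈ , vy = dominate i v refl refl (≢true λ m → v∉ (suc∈ m)) in
      edge-clique {A = cone} (λ x y e → trans (cone-sym y x) e) (x∈p∪q⁺ {p = set i} {⁅ suc v ⁆} (inj₂ (x∈⁅x⁆ (suc v)))) (x∈p∪q⁺ {p = set i} {⁅ suc v ⁆} (inj₁ (suc∈ y∈))) vy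
    int : ∀ S T → S ∈ₗ family → T ∈ₗ family → S ≢ T → HasClique cone 1 (S ∩ T)
    int S T S∈ T∈ _ with ∈-tabulate⁻ S∈ | ∈-tabulate⁻ T∈
    ... | i , refl | j , refl = (λ _ → zero) , (λ _ → here) , λ { 0F 0F ne → ⊥-elim (ne refl) }

  -- What the adjacency of every system extending the coned graph satisfies.
  record Admissible (B : Adj (suc n)) : Set where
    field
      B-sym   : ∀ u v → B u v ≡ true → B v u ≡ true
      B-irr   : ∀ u → B u u ≡ true → ⊥
      cherry  : ∀ u v y → A u y ≡ true → A y v ≡ true → B (suc u) (suc v) ≡ true → ⊥
      inside  : ∀ i u v → M i u ≡ true → M i v ≡ true → B (suc u) (suc v) ≡ true → ⊥
      apex    : ∀ i u → M i u ≡ true → B zero (suc u) ≡ true → ⊥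

  -- The completed graph is the outcome of a greedy process and not known explicitly, so its degrees
  -- are bounded through what every admissible graph satisfies.
  maximal-system : (b : Fin (suc n) → ℕ) → (∀ B → Admissible B → ∀ u → # (B u) ≤ b u) →
    Σ[ X ∈ MaxRTSystem 3 (suc t) s ] (v# X ≡ suc n) × (2 * e# X ≤ sum b)
  maximal-system b bound = build (Completion.completion 3 family coneGraph cone-system)
    where
    build : Σ[ H′ ∈ Graph (suc n) ] (∀ x y → cone x y ≡ true → adj H′ x y ≡ true) × IsRSystem 3 H′ family × IsMaximal 3 H′ family →
      Σ[ X ∈ MaxRTSystem 3 (suc t) s ] (v# X ≡ suc n) × (2 * e# X ≤ sum b)
    build (H′ , sub , S′ , max) = record
      { sys = record { n = suc n ; H = H′ ; F = family ; system = S′ ; noRep = Unique-tabulate⁺ set-injective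
                     ; sizes = All-tabulate⁺ λ i → trans (∣∣≡# (set i)) (trans (#-suc (lookup (set i))) (cong suc
                         (trans (#-cong (lookup-set i)) (size i refl))))
                     ; card = length-tabulate set }
      ; maximal = max } , refl , ≤-trans (≤-reflexive (sym (handshake H′))) (sum-mono (bound (adj H′) adm))
      where
      sym′ : ∀ u v → adj H′ u v ≡ true → adj H′ v u ≡ true
      sym′ u v e = trans (Graph.sym H′ v u) e
      block : ∀ i {u v} → u ∈ set i → v ∈ set i → adj H′ u v ≡ true → ⊥
      block i u∈ v∈ e = proj₁ (All-lookup (proj₁ (proj₂ S′)) (∈-tabulate⁺ {f = set} i)) (edge-clique sym′ u∈ v∈ e)
      adm : Admissible (adj H′)
      adm = record
        { B-sym = sym′
        ; B-irr = λ u e → clash e (Graph.irrefl H′ u)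
        ; cherry = λ u v y uy yv uv → proj₁ S′ ((suc u ∷ (suc y ∷ λ _ → suc v)) , (λ _ → ∈⊤) , λ where
            0F 0F ne → ⊥-elim (ne refl)
            0F 1F _ → sub (suc u) (suc y) uy
            0F 2F _ → uv
            1F 0F _ → sym′ (suc u) (suc y) (sub (suc u) (suc y) uy)
            1F 1F ne → ⊥-elim (ne refl)
            1F 2F _ → sub (suc y) (suc v) yv
            2F 0F _ → sym′ (suc u) (suc v) uv
            2F 1F _ → sym′ (suc y) (suc v) (sub (suc y) (suc v) yv)
            2F 2F ne → ⊥-elim (ne refl))
        ; inside = λ i u v mu mv e → block i (suc∈ mu) (suc∈ mv) e
        ; apex = λ i u mu e → block i here (suc∈ mu) e }

-- Joining a universal vertex

module Join {n : ℕ} (A : Adj n) where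

  joined : Adj (suc n)
  joined zero    zero    = false
  joined zero    (suc _) = true
  joined (suc _) zero    = true
  joined (suc u) (suc v) = A u v

lift-clique : ∀ {n p} {A : Adj n} {B : Adj (suc n)} {S : Subset n} → (∀ v → B zero (suc v) ≡ true) → (∀ v → B (suc v) zero ≡ true) →
  (∀ u v → A u v ≡ true → B (suc u) (suc v) ≡ true) → HasClique A p S → HasClique B (suc p) (true ∷ᵥ S)
lift-clique {B = B} l r h (f , f∈ , cl) = (zero ∷ λ c → suc (f c)) , (λ { zero → here ; (suc c) → there (f∈ c) }) , λ where
  zero zero ne → ⊥-elim (ne refl)
  zero (suc d) _ → l (f d)
  (suc c) zero _ → r (f c)
  (suc c) (suc d) ne → h (f c) (f d) (cl c d (λ e → ne (cong suc e)))

drop-clique : ∀ {n p} {A : Adj n} {S : Subset n} → HasClique (Join.joined A) (suc p) (true ∷ᵥ S) → HasClique A p S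
drop-clique {n} {p} {A} {S} (f , f∈ , cl) with any? (λ c → f c ≟ zero)
... | yes (c , e) = pull (punchIn c) (punchIn-injective c) (λ d → apart (f (punchIn c d)) (λ r → collide (punchIn c d) (punchInᵢ≢i c d) (trans r (sym e))))
  where
  collide : ∀ d → d ≢ c → f d ≢ f c
  collide d d≢c r = clash (cl d c d≢c) (subst (λ z → Join.joined A z (f c) ≡ false) (sym r) (subst (λ z → Join.joined A z z ≡ false) (sym e) refl))
  apart : ∀ v → v ≢ zero → ∃[ w ] v ≡ suc w
  apart zero    ne = ⊥-elim (ne refl)
  apart (suc w) _  = w , refl
  pull : (e : Fin p → Fin (suc p)) → (∀ a b → e a ≡ e b → a ≡ b) → (∀ d → ∃[ w ] f (e d) ≡ suc w) → HasClique A p S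
  pull e inj w = (λ d → proj₁ (w d)) ,
    (λ d → case subst (_∈ (true ∷ᵥ S)) (proj₂ (w d)) (f∈ (e d)) of λ { (there q) → q }) ,
    λ a b ne → trans (cong₂ (Join.joined A) (sym (proj₂ (w a))) (sym (proj₂ (w b)))) (cl (e a) (e b) (λ r → ne (inj a b r)))
-- A clique that does not use vertex 0 loses its first vertex instead.
... | no none = pull′
  where
  apart : ∀ v → v ≢ zero → ∃[ w ] v ≡ suc w
  apart zero    ne = ⊥-elim (ne refl)
  apart (suc w) _  = w , refl
  w : ∀ d → ∃[ w ] f (suc d) ≡ suc w
  w d = apart (f (suc d)) (λ r → none (suc d , r))
  pull′ : HasClique A p S
  pull′ = (λ d → proj₁ (w d)) ,
    (λ d → case subst (_∈ (true ∷ᵥ S)) (proj₂ (w d)) (f∈ (suc d)) of λ { (there q) → q }) ,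
    λ a b ne → trans (cong₂ (Join.joined A) (sym (proj₂ (w a))) (sym (proj₂ (w b)))) (cl (suc a) (suc b) (λ r → ne (suc-injective r)))

addEdge-suc : ∀ {n} (A : Adj n) u v x y → addEdge A u v x y ≡ true → addEdge (Join.joined A) (suc u) (suc v) (suc x) (suc y) ≡ true
addEdge-suc A u v x y e = trans (cong (A x y ∨_) (cong₂ _∨_ (cong₂ _∧_ (≟-suc x u) (≟-suc y v)) (cong₂ _∧_ (≟-suc x v) (≟-suc y u)))) e
  where
  ≟-suc : ∀ {n} (a b : Fin n) → ⌊ suc a ≟ suc b ⌋ ≡ ⌊ a ≟ b ⌋
  ≟-suc a b = case a ≟ b of λ where
    (yes e) → trans (holds {d = suc a ≟ suc b} (cong suc e)) (sym (holds {d = a ≟ b} e))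
    (no ne) → trans (fails {d = suc a ≟ suc b} (λ r → ne (suc-injective r))) (sym (fails {d = a ≟ b} ne))

join-system : ∀ {p t s} (X : MaxRTSystem (2 + p) t s) → Σ[ Y ∈ MaxRTSystem (3 + p) (suc t) s ]
  (v# Y ≡ suc (v# X)) ×
  (e# Y ≡ e# X + v# X)
join-system {p} {t} record { sys = record { n = n ; H = H ; F = F ; system = noK , max , int ; noRep = u ; sizes = z ; card = c } ; maximal = m } =
  record { sys = record { n = suc n ; H = H⁺ ; F = map (true ∷ᵥ_) F ; system = noK⁺ , All-map⁺ (All-map max⁺ max) , int⁺
                        ; noRep = Unique-map⁺ ∷ᵥ-injectiveʳ u ; sizes = All-map⁺ (All-map (cong suc) z)
                        ; card = trans (length-map (true ∷ᵥ_) F) c }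
         ; maximal = m⁺ } , refl , edges⁺
  where
  open Join (adj H)
  H⁺ : Graph (suc n)
  H⁺ = record { adj = joined
              ; sym = λ { zero zero → refl ; zero (suc _) → refl ; (suc _) zero → refl ; (suc a) (suc b) → Graph.sym H a b }
              ; irrefl = λ { zero → refl ; (suc a) → Graph.irrefl H a } }
  lift : ∀ {q S} → HasClique (adj H) q S → HasClique joined (suc q) (true ∷ᵥ S)
  lift = lift-clique {A = adj H} {joined} (λ _ → refl) (λ _ → refl) (λ _ _ e → e)
  noK⁺ : ¬ HasClique joined (3 + p) ⊤
  noK⁺ h = noK (drop-clique h)
  max⁺ : ∀ {S} → MaxFree (adj H) (1 + p) S → MaxFree joined (2 + p) (true ∷ᵥ S)
  max⁺ (a , b) = (λ h → a (drop-clique h)) , λ where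
    zero v∉ → ⊥-elim (v∉ here)
    (suc v) v∉ → lift (b v (λ q → v∉ (there q)))
  int⁺ : ∀ S T → S ∈ₗ map (true ∷ᵥ_) F → T ∈ₗ map (true ∷ᵥ_) F → S ≢ T → HasClique joined (1 + p) (S ∩ T)
  int⁺ S T S∈ T∈ ne with ∈-map⁻ (true ∷ᵥ_) S∈ | ∈-map⁻ (true ∷ᵥ_) T∈
  ... | S₀ , S₀∈ , refl | T₀ , T₀∈ , refl = lift (int S₀ T₀ S₀∈ T₀∈ (λ e → ne (cong (true ∷ᵥ_) e)))
  lift⁺ : ∀ {a b q S} → HasClique (addEdge (adj H) a b) q S → HasClique (addEdge joined (suc a) (suc b)) (suc q) (true ∷ᵥ S)
  lift⁺ {a} {b} = lift-clique {A = addEdge (adj H) a b} {addEdge joined (suc a) (suc b)} (λ _ → refl) (λ _ → refl) (addEdge-suc (adj H) a b)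
  m⁺ : IsMaximal (3 + p) H⁺ (map (true ∷ᵥ_) F)
  m⁺ zero zero ne _ = ⊥-elim (ne refl)
  m⁺ (suc a) (suc b) ne e = case m a b (λ r → ne (cong suc r)) e of λ where
    (inj₁ h) → inj₁ (lift⁺ h)
    (inj₂ h) → inj₂ (Any-map⁺ (Any-map lift⁺ h))
  edges⁺ : edges H⁺ ≡ edges H + n
  edges⁺ = *-cancelˡ-≡ (edges H⁺) (edges H + n) 2 (begin
    2 * edges H⁺                             ≡⟨ handshake H⁺ ⟨
    degrees joined                           ≡⟨ cong₂ _+_ (trans (#-suc (joined zero)) (#-all n)) (sum-cong-≗ (λ v → #-suc (joined (suc v)))) ⟩
    n + sum (λ v → 1 + # (adj H v))          ≡⟨ cong (n +_) (∑-distrib-+ (λ (_ : Fin n) → 1) (λ v → # (adj H v))) ⟩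
    n + (sum {n} (λ _ → 1) + degrees (adj H)) ≡⟨ cong₂ (λ a b → n + (a + b)) (trans (sum-const n 1) (*-identityʳ n)) (handshake H) ⟩
    n + (n + 2 * edges H)                    ≡⟨ e n (edges H) ⟩
    2 * (edges H + n)                        ∎)
    where
    open ≡-Reasoning
    e : ∀ n m → n + (n + 2 * m) ≡ 2 * (m + n)
    e = solve-∀

-- With n vertices in X this is e(Y) = e(X) + k n + (k choose 2), doubled, and with k added on both
-- sides to avoid subtraction.
join-many : ∀ k {t s} (X : MaxRTSystem 3 t s) → Σ[ Y ∈ MaxRTSystem (3 + k) (k + t) s ]
  (e# Y * 2 + k ≡ e# X * 2 + k * (2 * v# X) + k * k) ×
  (v# Y ≡ k + v# X)
join-many zero X = X , cong (_+ 0) (sym (+-identityʳ _)) , refl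
join-many (suc k) X = step (join-many k X)
  where
  step : (Σ[ Y ∈ MaxRTSystem (3 + k) (k + _) _ ] (e# Y * 2 + k ≡ e# X * 2 + k * (2 * v# X) + k * k) × (v# Y ≡ k + v# X)) →
    Σ[ Z ∈ MaxRTSystem (4 + k) (suc k + _) _ ] (e# Z * 2 + suc k ≡ e# X * 2 + suc k * (2 * v# X) + suc k * suc k) × (v# Z ≡ suc k + v# X)
  step (Y , e , ne) = let Z , ze , me = join-system Y in Z , arith (e# Z) (e# Y) k (e# X) (v# X) (v# Y) me ne e , trans ze (cong suc ne)
    where
    arith : ∀ z y k x N M → z ≡ y + M → M ≡ k + N → y * 2 + k ≡ x * 2 + k * (2 * N) + k * k →
      z * 2 + suc k ≡ x * 2 + suc k * (2 * N) + suc k * suc k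
    arith z y k x N M refl refl h = trans (e₁ y k N) (trans (cong (_+ (2 * k + 2 * N + 1)) h) (e₂ x k N))
      where
      e₁ : ∀ y k N → (y + (k + N)) * 2 + suc k ≡ y * 2 + k + (2 * k + 2 * N + 1)
      e₁ = solve-∀
      e₂ : ∀ x k N → x * 2 + k * (2 * N) + k * k + (2 * k + 2 * N + 1) ≡ x * 2 + suc k * (2 * N) + suc k * suc k
      e₂ = solve-∀

-- Constructions: crowns, grids, cyclic products

opposite : Fin 2 → Fin 2
opposite 0F = 1F
opposite 1F = 0F

opposite-≢ : ∀ x → opposite x ≢ x
opposite-≢ 0F ()
opposite-≢ 1F ()

≢⇒opposite : ∀ x y → x ≢ y → y ≡ opposite x
≢⇒opposite 0F 0F ne = ⊥-elim (ne refl)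
≢⇒opposite 0F 1F ne = refl
≢⇒opposite 1F 0F ne = refl
≢⇒opposite 1F 1F ne = ⊥-elim (ne refl)

-- Constructions live on a structured vertex type V, with sets listed by their points; `FromPoints`
-- moves them to `Fin n` along a bijection.
record Points (V : Set) (s t : ℕ) : Set where
  field
    A         : V → V → Bool
    A-sym     : ∀ u v → A u v ≡ true → A v u ≡ true
    no△       : ∀ u v w → A u v ≡ true → A v w ≡ true → A u w ≡ true → ⊥
    pts       : Fin s → Fin t → V
    pts-inj   : ∀ i c d → pts i c ≡ pts i d → c ≡ d
    indep     : ∀ i c d → A (pts i c) (pts i d) ≡ true → ⊥
    dominate  : ∀ i v → (∃[ c ] pts i c ≡ v) ⊎ (∃[ c ] A v (pts i c) ≡ true)
    distinct  : ∀ i j → (∀ c → ∃[ d ] pts j d ≡ pts i c) → i ≡ j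

module FromPoints {V : Set} {n s t : ℕ} (iso : Fin n ↔ V) (P : Points V s t) where

  open Points P
  open Inverse iso using (to; from; strictlyInverseˡ; strictlyInverseʳ)

  Aᶠ : Adj n
  Aᶠ u v = A (to u) (to v)

  Mᶠ : Fin s → Fin n → Bool
  Mᶠ i u = ⌊ any? (λ c → from (pts i c) ≟ u) ⌋

  from-inj : ∀ {u v} → from u ≡ from v → u ≡ v
  from-inj {u} {v} e = trans (sym (strictlyInverseˡ u)) (trans (cong to e) (strictlyInverseˡ v))

  point : ∀ {i u} → Mᶠ i u ≡ true → ∃[ c ] pts i c ≡ to u
  point {i} {u} e = let c , q = witness e in c , trans (sym (strictlyInverseˡ (pts i c))) (cong to q)

  is-point : ∀ i c {u} → pts i c ≡ to u → Mᶠ i u ≡ true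
  is-point i c {u} e = holds (c , trans (cong from e) (strictlyInverseʳ u))

  mis : MIS t Aᶠ (λ _ → true) (λ _ → true) Mᶠ
  mis = record
    { A-sym = λ u v → A-sym (to u) (to v)
    ; A⊂W = λ _ _ _ → refl
    ; no△ = λ u v w → no△ (to u) (to v) (to w)
    ; M⊂W = λ _ _ _ _ → refl
    ; indep = λ i u v _ mu mv e → let c , p = point mu ; d , q = point mv in indep i c d (trans (cong₂ A p q) e)
    ; dominate = λ i w _ _ w∉ → case dominate i (to w) of λ where
        (inj₁ (c , e)) → clash (is-point i c e) w∉
        (inj₂ (c , e)) → from (pts i c) , is-point i c (sym (strictlyInverseˡ (pts i c))) ,
                         trans (cong (A (to w)) (strictlyInverseˡ (pts i c))) e
    ; size = λ i _ → Enum⇒# {p = Mᶠ i} record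
        { el = λ c → from (pts i c) ; inj = λ c d e → pts-inj i c d (from-inj e)
        ; mem = λ c → holds (c , refl) ; cover = λ v e → witness e }
    ; distinct = λ i j _ _ h → distinct i j λ c → let d , e = point (h (from (pts i c)) (holds (c , refl))) in
        d , trans e (strictlyInverseˡ (pts i c)) }

  open Coned mis public using (Admissible; maximal-system)

  module Blocked {B : Adj (suc n)} (adm : Admissible B) where
    open Admissible adm

    vtx : V → Fin (suc n)
    vtx v = suc (from v)

    vertex : ∀ u → u ≡ zero ⊎ (∃[ v ] vtx v ≡ u)
    vertex zero    = inj₁ refl
    vertex (suc u) = inj₂ (to u , cong suc (strictlyInverseʳ u))

    no-cherry : ∀ u v y → A u y ≡ true → A y v ≡ true → B (vtx u) (vtx v) ≡ true → ⊥
    no-cherry u v y uy yv = cherry (from u) (from v) (from y)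
      (trans (cong₂ A (strictlyInverseˡ u) (strictlyInverseˡ y)) uy) (trans (cong₂ A (strictlyInverseˡ y) (strictlyInverseˡ v)) yv)

    no-inside : ∀ i c d → B (vtx (pts i c)) (vtx (pts i d)) ≡ true → ⊥
    no-inside i c d = inside i (from (pts i c)) (from (pts i d)) (holds (c , refl)) (holds (d , refl))

    no-apex : ∀ i c → B zero (vtx (pts i c)) ≡ true → ⊥
    no-apex i c = apex i (from (pts i c)) (holds (c , refl))

    no-apex′ : ∀ i c → B (vtx (pts i c)) zero ≡ true → ⊥
    no-apex′ i c e = no-apex i c (B-sym _ _ e)

    no-loop : ∀ u → B u u ≡ true → ⊥
    no-loop = B-irr

    degree≤ : ∀ {k} u (f : Fin k → Fin (suc n)) → (∀ w → B u w ≡ true → ∃[ c ] f c ≡ w) → # (B u) ≤ k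
    degree≤ u f h = covered⇒#≤ f (B u) h

crown-adj : ∀ {s} → Fin s × Fin 2 → Fin s × Fin 2 → Bool
crown-adj (i , x) (j , y) = not ⌊ i ≟ j ⌋ ∧ not ⌊ x ≟ y ⌋

crown-edge : ∀ {s} {i j : Fin s} {x y : Fin 2} → i ≢ j → x ≢ y → crown-adj (i , x) (j , y) ≡ true
crown-edge {i = i} {j} {x} {y} i≢j x≢y = ∧-intro {not ⌊ i ≟ j ⌋} (not-intro (fails {d = i ≟ j} i≢j)) (not-intro (fails {d = x ≟ y} x≢y))

crown-edge⁻ : ∀ {s} {i j : Fin s} {x y : Fin 2} → crown-adj (i , x) (j , y) ≡ true → i ≢ j × x ≢ y
crown-edge⁻ {i = i} {j} {x} {y} e = let a , b = ∧-elim {not ⌊ i ≟ j ⌋} e in refute {d = i ≟ j} (not-elim a) , refute {d = x ≟ y} (not-elim b)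

crown-sym : ∀ {s} (u v : Fin s × Fin 2) → crown-adj u v ≡ true → crown-adj v u ≡ true
crown-sym (i , x) (j , y) e = let a , b = crown-edge⁻ {i = i} {j} {x} {y} e in crown-edge (a ∘ sym) (b ∘ sym)

crown-no△ : ∀ {s} (u v w : Fin s × Fin 2) → crown-adj u v ≡ true → crown-adj v w ≡ true → crown-adj u w ≡ true → ⊥
crown-no△ (i , x) (j , y) (l , z) e₁ e₂ e₃ = proj₂ (crown-edge⁻ {i = i} {l} {x} {z} e₃) (trans
  (sym (trans (cong opposite (≢⇒opposite x y (proj₂ (crown-edge⁻ {i = i} {j} {x} {y} e₁)))) (twice x)))
  (sym (≢⇒opposite y z (proj₂ (crown-edge⁻ {i = j} {l} {y} {z} e₂)))))
  where
  twice : ∀ x → opposite (opposite x) ≡ x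
  twice 0F = refl
  twice 1F = refl

crown-dominate : ∀ {s} (i : Fin s) v → (∃[ c ] (i , c) ≡ v) ⊎ (∃[ c ] crown-adj v (i , c) ≡ true)
crown-dominate i (j , y) with i ≟ j
... | yes refl = inj₁ (y , refl)
... | no i≢j = inj₂ (opposite y , crown-edge (i≢j ∘ sym) (opposite-≢ y ∘ sym))

crown-indep : ∀ {s} (i : Fin s) c d → crown-adj (i , c) (i , d) ≡ true → ⊥
crown-indep i c d e = proj₁ (crown-edge⁻ {i = i} {i} {c} {d} e) refl

crown-points : ∀ s → Points (Fin s × Fin 2) s 2
crown-points s = record
  { A = crown-adj
  ; A-sym = crown-sym
  ; no△ = crown-no△
  ; pts = λ i c → i , c
  ; pts-inj = λ i c d e → cong proj₂ e
  ; indep = crown-indep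
  ; dominate = crown-dominate
  ; distinct = λ i j h → sym (cong proj₁ (proj₂ (h 0F))) }

third : ∀ {s} (i j : Fin (3 + s)) → ∃[ l ] l ≢ i × l ≢ j
third {s} i j = let l , _ , new = extend {2} (i ∷ (λ (_ : Fin 1) → j)) (λ (_ : Fin (3 + s)) → true)
                      (≤-trans (s≤s (s≤s (s≤s z≤n))) (≤-reflexive (sym (#-all (3 + s)))))
  in l , (λ r → new 0F (sym r)) , λ r → new 1F (sym r)

-- With at least three pairs a third index is available. Consequently a triangle-free completion
-- joins no two vertices on the same side.
crown-cherry : ∀ {s} (i j : Fin (3 + s)) x → ∃[ y ] crown-adj (i , x) y ≡ true × crown-adj y (j , x) ≡ true
crown-cherry i j x = let l , l≢i , l≢j = third i j in
  (l , opposite x) , crown-edge (l≢i ∘ sym) (opposite-≢ x ∘ sym) , crown-edge l≢j (opposite-≢ x)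

-- The completion adds nothing: edges within a side are excluded by `crown-cherry`, edges within a
-- pair or to the isolated vertex by the sets. So 2 + s is the degree in the crown itself, which
-- makes the edge count sharp.
module CrownBound (s : ℕ) {n : ℕ} (iso : Fin n ↔ (Fin (3 + s) × Fin 2)) where

  open FromPoints iso (crown-points (3 + s))

  module _ {B : Adj (suc n)} (adm : Admissible B) where
    open Blocked adm

    between : ∀ i j x y → Dec (i ≡ j) → Dec (x ≡ y) → B (vtx (i , x)) (vtx (j , y)) ≡ true → ∃[ d ] vtx (punchIn i d , opposite x) ≡ vtx (j , y)
    between i j x y (yes refl) _ e = ⊥-elim (no-inside i x y e)
    between i j x y (no i≢j) (yes refl) e = let z , a , b = crown-cherry i j x in ⊥-elim (no-cherry (i , x) (j , x) z a b e)
    between i j x y (no i≢j) (no x≢y) e = punchOut i≢j , cong₂ (λ a b → vtx (a , b)) (punchIn-punchOut i≢j) (sym (≢⇒opposite x y x≢y))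

    near : ∀ i x w → B (vtx (i , x)) w ≡ true → ∃[ d ] vtx (punchIn i d , opposite x) ≡ w
    near i x w e = case vertex w of λ where
      (inj₁ refl) → ⊥-elim (no-apex′ i x e)
      (inj₂ ((j , y) , refl)) → between i j x y (i ≟ j) (x ≟ y) e

    bound : ∀ u → # (B u) ≤ (0 ∷ λ _ → 2 + s) u
    bound u = case vertex u of λ where
      (inj₁ refl) → degree≤ zero (λ ()) λ w e → ⊥-elim (case vertex w of λ where
        (inj₁ refl) → no-loop zero e
        (inj₂ ((i , x) , refl)) → no-apex i x e)
      (inj₂ ((i , x) , refl)) → degree≤ (vtx (i , x)) (λ d → vtx (punchIn i d , opposite x)) (near i x)

  crown-maximal : Σ[ X ∈ MaxRTSystem 3 3 (3 + s) ] (v# X ≡ suc n) × (2 * e# X ≤ n * (2 + s))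
  crown-maximal = let X , n≡ , le = maximal-system (0 ∷ λ _ → 2 + s) (λ B adm → bound adm) in
    X , n≡ , ≤-trans le (≤-reflexive (sum-const n (2 + s)))

crown-system : ∀ s → Σ[ X ∈ MaxRTSystem 3 3 (3 + s) ] (v# X ≡ suc ((3 + s) * 2)) × (2 * e# X ≤ (3 + s) * 2 * (2 + s))
crown-system s = CrownBound.crown-maximal s *↔×

module Exceptions {V : Set} {n s t : ℕ} (iso : Fin n ↔ V) (P : Points V s t) where

  open FromPoints iso P

  -- Completion may add uncontrolled edges at a few vertices; the trivial degree bound for these is
  -- cheap enough.
  few-exceptions : ∀ {p} (D : ℕ) (f : Fin p → Fin (suc n)) →
    (∀ {B} → Admissible B → ∀ u → (∀ c → f c ≢ u) → # (B u) ≤ D) →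
    Σ[ X ∈ MaxRTSystem 3 (suc t) s ] (v# X ≡ suc n) × (2 * e# X ≤ suc n * D + p * suc n)
  few-exceptions {p} D f bound = let X , n≡ , le = maximal-system b ok in X , n≡ , ≤-trans le total
    where
    special : Fin (suc n) → Bool
    special u = ⌊ any? (λ c → f c ≟ u) ⌋
    b : Fin (suc n) → ℕ
    b u = D + 𝟙 (special u) * suc n
    ok : ∀ B → Admissible B → ∀ u → # (B u) ≤ b u
    ok B adm u with decide (special u)
    ... | inj₁ e = ≤-trans (#≤n (B u)) (≤-trans (≤-reflexive (sym (trans (cong (λ z → 𝟙 z * suc n) e) (+-identityʳ (suc n))))) (m≤n+m _ D))
    ... | inj₂ e = ≤-trans (bound adm u (λ c q → refute e (c , q))) (m≤m+n D _)
    total : sum b ≤ suc n * D + p * suc n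
    total = ≤-trans (≤-reflexive (trans (∑-distrib-+ (λ _ → D) (λ u → 𝟙 (special u) * suc n))
        (cong₂ _+_ (sum-const (suc n) D) (sym (*-#-sum special (suc n))))))
      (+-monoʳ-≤ (suc n * D) (*-monoˡ-≤ (suc n) (covered⇒#≤ f special (λ v e → witness e))))

-- Roots, rounded up

root : ∀ p s → 1 ≤ p → 1 ≤ s → Σ[ q ∈ ℕ ] (s ≤ q ^ p) × (q ^ p ≤ 2 ^ p * s)
root p s 1≤p 1≤s = let q , s≤ , low = least (λ q → s ≤ q ^ p) (λ q → s ≤? q ^ p) s start in q , s≤ , upper q s≤ low
  where
  start : s ≤ s ^ p
  start = ≤-trans (≤-reflexive (sym (^-identityʳ s))) (^-monoʳ-≤ s {{>-nonZero 1≤s}} 1≤p)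
  upper : ∀ q → s ≤ q ^ p → (∀ q′ → s ≤ q′ ^ p → q ≤ q′) → q ^ p ≤ 2 ^ p * s
  upper zero s≤ _ = ≤-trans (≤-reflexive (zero-pow 1≤p)) z≤n
    where
    zero-pow : ∀ {p} → 1 ≤ p → 0 ^ p ≡ 0
    zero-pow (s≤s _) = refl
  upper (suc zero) _ _ = ≤-trans (≤-reflexive (^-zeroˡ p)) (*-mono-≤ (m^n>0 2 p) 1≤s)
  upper (suc (suc q)) _ low = begin
    suc (suc q) ^ p            ≤⟨ ^-monoˡ-≤ p (≤-trans (s≤s (s≤s (m≤m+n q q))) (≤-reflexive (e q))) ⟩
    (2 * suc q) ^ p            ≡⟨ ^-distribʳ-* p 2 (suc q) ⟩
    2 ^ p * suc q ^ p          ≤⟨ *-monoʳ-≤ (2 ^ p) (<⇒≤ (≰⇒> (λ h → 1+n≰n (low (suc q) h)))) ⟩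
    2 ^ p * s                  ∎
    where
    open ≤-Reasoning
    e : ∀ q → 2 + (q + q) ≡ 2 * suc q
    e = solve-∀

-- One vertex per chosen cell of a K × K grid, adjacent to all rows and columns but its own

module Grid (s K : ℕ) (K≥3 : 3 ≤ K) (row col : Fin s → Fin K) (cell : ∀ a b → row a ≡ row b → col a ≡ col b → a ≡ b) where

  V : Set
  V = Fin s ⊎ (Fin K ⊎ Fin K)

  line : Fin s → Fin K ⊎ Fin K → Bool
  line a (inj₁ x) = ⌊ row a ≟ x ⌋
  line a (inj₂ y) = ⌊ col a ≟ y ⌋

  A : V → V → Bool
  A (inj₁ a) (inj₁ _) = false
  A (inj₁ a) (inj₂ z) = not (line a z)
  A (inj₂ z) (inj₁ a) = not (line a z)
  A (inj₂ _) (inj₂ _) = false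

  pts : Fin s → Fin 3 → V
  pts i 0F = inj₁ i
  pts i 1F = inj₂ (inj₁ (row i))
  pts i 2F = inj₂ (inj₂ (col i))

  own-row : ∀ i → line i (inj₁ (row i)) ≡ true
  own-row i = holds {d = row i ≟ row i} refl

  own-col : ∀ i → line i (inj₂ (col i)) ≡ true
  own-col i = holds {d = col i ≟ col i} refl

  points : Points V s 3
  points = record
    { A = A
    ; A-sym = λ { (inj₁ _) (inj₂ _) e → e ; (inj₂ _) (inj₁ _) e → e }
    ; no△ = λ { (inj₁ _) (inj₂ _) (inj₁ _) _ _ () ; (inj₂ _) (inj₁ _) (inj₂ _) _ _ () }
    ; pts = pts
    ; pts-inj = inj
    ; indep = ind
    ; dominate = dom
    ; distinct = λ i j h → dist i j (h 0F) }
    where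
    inj : ∀ i c d → pts i c ≡ pts i d → c ≡ d
    inj i 0F 0F _ = refl
    inj i 0F 1F ()
    inj i 0F 2F ()
    inj i 1F 1F _ = refl
    inj i 1F 2F ()
    inj i 2F 2F _ = refl
    ind : ∀ i c d → A (pts i c) (pts i d) ≡ true → ⊥
    ind i 0F 1F e = clash (own-row i) (not-elim e)
    ind i 0F 2F e = clash (own-col i) (not-elim e)
    ind i 1F 0F e = clash (own-row i) (not-elim e)
    ind i 1F 1F ()
    ind i 1F 2F ()
    ind i 2F 0F e = clash (own-col i) (not-elim e)
    ind i 2F 1F ()
    ind i 2F 2F ()
    dist : ∀ i j → (∃[ d ] pts j d ≡ inj₁ i) → i ≡ j
    dist i j (0F , refl) = refl
    dist i j (1F , ())
    dist i j (2F , ())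
    dom : ∀ i v → (∃[ c ] pts i c ≡ v) ⊎ (∃[ c ] A v (pts i c) ≡ true)
    dom i (inj₁ a) = case row a ≟ row i of λ where
      (no ne) → inj₂ (1F , not-intro (fails {d = row a ≟ row i} ne))
      (yes r) → case col a ≟ col i of λ where
        (no ne) → inj₂ (2F , not-intro (fails {d = col a ≟ col i} ne))
        (yes q) → inj₁ (0F , cong inj₁ (sym (cell a i r q)))
    dom i (inj₂ (inj₁ x)) = case row i ≟ x of λ where
      (yes r) → inj₁ (1F , cong (λ z → inj₂ (inj₁ z)) r)
      (no ne) → inj₂ (0F , not-intro (fails {d = row i ≟ x} ne))
    dom i (inj₂ (inj₂ y)) = case col i ≟ y of λ where
      (yes r) → inj₁ (2F , cong (λ z → inj₂ (inj₂ z)) r)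
      (no ne) → inj₂ (0F , not-intro (fails {d = col i ≟ y} ne))

  -- One of three rows belongs to neither cell and is thus adjacent to both, so no completion joins
  -- two cells.
  free-row : ∀ a b → ∃[ x ] row a ≢ x × row b ≢ x
  free-row a b = let x , _ , new = extend {2} (row a ∷ (λ (_ : Fin 1) → row b)) (λ (_ : Fin K) → true)
                        (≤-trans K≥3 (≤-reflexive (sym (#-all K))))
    in x , new 0F , new 1F

  module _ {n : ℕ} (iso : Fin n ↔ V) where

    open FromPoints iso points
    open Exceptions iso points

    lines : Fin (1 + (K + K)) → Fin (suc n)
    lines zero    = zero
    lines (suc c) = suc (Inverse.from iso (inj₂ (splitAt K c)))

    degree : ∀ {B} → Admissible B → ∀ u → (∀ c → lines c ≢ u) → # (B u) ≤ 1 + (K + K)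
    degree {B} adm u new = case vertex u of λ where
        (inj₁ refl) → ⊥-elim (new 0F refl)
        (inj₂ (inj₂ z , refl)) → ⊥-elim (new (suc (join K K z)) (cong (λ y → vtx (inj₂ y)) (splitAt-join K K z)))
        (inj₂ (inj₁ a , refl)) → degree≤ (vtx (inj₁ a)) lines λ w e → case vertex w of λ where
          (inj₁ refl) → 0F , refl
          (inj₂ (inj₂ z , refl)) → suc (join K K z) , cong (λ y → vtx (inj₂ y)) (splitAt-join K K z)
          (inj₂ (inj₁ b , refl)) → let x , p , q = free-row a b in
            ⊥-elim (no-cherry (inj₁ a) (inj₁ b) (inj₂ (inj₁ x)) (not-intro (fails {d = row a ≟ x} p)) (not-intro (fails {d = row b ≟ x} q)) e)
      where open Blocked adm

    grid-maximal : Σ[ X ∈ MaxRTSystem 3 4 s ] (v# X ≡ suc n) × (2 * e# X ≤ suc n * (1 + (K + K)) + (1 + (K + K)) * suc n)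
    grid-maximal = few-exceptions (1 + (K + K)) lines degree

grid-system : ∀ s K → 3 ≤ K → s ≤ K * K → Σ[ X ∈ MaxRTSystem 3 4 s ] (v# X ≡ suc (s + (K + K))) ×
  (2 * e# X ≤ suc (s + (K + K)) * (1 + (K + K)) + (1 + (K + K)) * suc (s + (K + K)))
grid-system s K K≥3 s≤ = Grid.grid-maximal s K K≥3 (λ a → proj₁ (place a)) (λ a → proj₂ (place a)) cell
    (↔-trans +↔⊎ (↔-refl ⊎-↔ +↔⊎))
  where
  place : Fin s → Fin K × Fin K
  place a = remQuot K (inject≤ a s≤)
  cell : ∀ a b → proj₁ (place a) ≡ proj₁ (place b) → proj₂ (place a) ≡ proj₂ (place b) → a ≡ b
  cell a b p q = inject≤-injective s≤ s≤ a b (trans (sym (combine-remQuot {K} K (inject≤ a s≤)))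
    (trans (cong₂ combine p q) (combine-remQuot {K} K (inject≤ b s≤))))

-- A cyclic product: (i , x , y) ~ (i + 1 , x′ , y′) iff y ≢ x′; a word z gives the independent set of all (i , zᵢ , zᵢ₊₁)

prev : ∀ {p} → Fin (suc p) → Fin (suc p)
prev {p} zero    = fromℕ p
prev     (suc i) = inject₁ i

next : ∀ {p} → Fin (suc p) → Fin (suc p)
next {p} i with toℕ i <? p
... | yes h = suc (fromℕ< h)
... | no _  = zero

next-prev : ∀ {p} (i : Fin (suc p)) → next (prev i) ≡ i
next-prev {p} zero with toℕ (fromℕ p) <? p
... | yes h = ⊥-elim (<⇒≢ h (toℕ-fromℕ p))
... | no _  = refl
next-prev {p} (suc i) with toℕ (inject₁ i) <? p
... | yes h = cong suc (toℕ-injective (trans (toℕ-fromℕ< h) (toℕ-inject₁ i)))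
... | no ¬h = ⊥-elim (¬h (≤-trans (s≤s (≤-reflexive (toℕ-inject₁ i))) (toℕ<n i)))

prev-next : ∀ {p} (i : Fin (suc p)) → prev (next i) ≡ i
prev-next {p} i with toℕ i <? p
... | yes h = toℕ-injective (trans (toℕ-inject₁ (fromℕ< h)) (toℕ-fromℕ< h))
... | no ¬h = toℕ-injective (trans (toℕ-fromℕ p) (≤-antisym (≮⇒≥ ¬h) (≤-pred (toℕ<n i))))

prev-injective : ∀ {p} {i j : Fin (suc p)} → prev i ≡ prev j → i ≡ j
prev-injective {i = i} {j} e = trans (sym (next-prev i)) (trans (cong next e) (next-prev j))

prev-≢ : ∀ {p} (i : Fin (2 + p)) → prev i ≢ i
prev-≢ zero ()
prev-≢ (suc i) e = 1+n≢n (sym (trans (sym (toℕ-inject₁ i)) (cong toℕ e)))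

prev³-≢ : ∀ {p} (i : Fin (4 + p)) → prev (prev (prev i)) ≢ i
prev³-≢ 0F ()
prev³-≢ 1F ()
prev³-≢ 2F ()
prev³-≢ (suc (suc (suc i))) e = <⇒≢ (s≤s (m≤n+m (toℕ i) 2))
  (trans (sym (trans (toℕ-inject₁ _) (trans (toℕ-inject₁ _) (toℕ-inject₁ i)))) (cong toℕ e))

module Cycle (p q s : ℕ) (word : Fin s → Fin (4 + p) → Fin q) (word-inj : ∀ a b → (∀ c → word a c ≡ word b c) → a ≡ b) where

  V : Set
  V = Fin (4 + p) × (Fin q × Fin q)

  arc : V → V → Bool
  arc (i , _ , y) (j , x , _) = ⌊ i ≟ prev j ⌋ ∧ not ⌊ y ≟ x ⌋

  A : V → V → Bool
  A u v = arc u v ∨ arc v u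

  pos : V → Fin (4 + p)
  pos = proj₁

  arc-pos : ∀ u v → arc u v ≡ true → pos u ≡ prev (pos v)
  arc-pos (i , _ , y) (j , x , _) e = witness {d = i ≟ prev j} (proj₁ (∧-elim e))

  ∨-cases : ∀ {a b} → a ∨ b ≡ true → a ≡ true ⊎ b ≡ true
  ∨-cases {true}  _ = inj₁ refl
  ∨-cases {false} e = inj₂ e

  ∨-left : ∀ {a b} → a ≡ true → a ∨ b ≡ true
  ∨-left refl = refl

  ∨-right : ∀ {a b} → b ≡ true → a ∨ b ≡ true
  ∨-right {true}  _ = refl
  ∨-right {false} e = e

  Link₃ : Fin (4 + p) → Fin (4 + p) → Set
  Link₃ i j = i ≡ prev j ⊎ j ≡ prev i

  -- Orient each pair from predecessor to successor. A cyclic orientation gives a fixed point of the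
  -- third iterate of `prev`, any other one a fixed point of `prev`; neither exists on four or more
  -- positions.
  no-three : ∀ {i j l} → Link₃ i j → Link₃ j l → Link₃ i l → ⊥
  no-three {i} {j} {l} (inj₁ a) (inj₁ b) (inj₁ c) = prev-≢ l (trans (sym b) (prev-injective (trans (sym a) c)))
  no-three {i} {j} {l} (inj₁ a) (inj₁ b) (inj₂ c) = prev³-≢ i (sym (trans a (cong prev (trans b (cong prev c)))))
  no-three {i} {j} {l} (inj₁ a) (inj₂ b) (inj₁ c) = prev-≢ l (trans (sym c) (trans a (sym b)))
  no-three {i} {j} {l} (inj₁ a) (inj₂ b) (inj₂ c) = prev-≢ i (trans (sym c) (trans b (sym a)))
  no-three {i} {j} {l} (inj₂ a) (inj₁ b) (inj₁ c) = prev-≢ l (trans (sym c) (prev-injective (trans (sym a) b)))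
  no-three {i} {j} {l} (inj₂ a) (inj₁ b) (inj₂ c) = prev-≢ i (trans (sym c) (sym (prev-injective (trans (sym a) b))))
  no-three {i} {j} {l} (inj₂ a) (inj₂ b) (inj₁ c) = prev³-≢ i (sym (trans c (cong prev (trans b (cong prev a)))))
  no-three {i} {j} {l} (inj₂ a) (inj₂ b) (inj₂ c) = prev-≢ j (trans (sym b) (trans c (sym a)))

  linked : ∀ u v → A u v ≡ true → Link₃ (pos u) (pos v)
  linked u v e = case ∨-cases {arc u v} e of λ where
    (inj₁ a) → inj₁ (arc-pos u v a)
    (inj₂ a) → inj₂ (arc-pos v u a)

  pts : Fin s → Fin (4 + p) → V
  pts a i = i , word a i , word a (next i)

  arc-free : ∀ a c d → arc (pts a c) (pts a d) ≡ true → ⊥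
  arc-free a c d e = let h , ne = ∧-elim {⌊ c ≟ prev d ⌋} e in
    refute (not-elim ne) (cong (word a) (trans (cong next (witness {d = c ≟ prev d} h)) (next-prev d)))

  points : Points V s (4 + p)
  points = record
    { A = A
    ; A-sym = λ u v e → case ∨-cases {arc u v} e of λ where
        (inj₁ a) → ∨-right {arc v u} a
        (inj₂ a) → ∨-left a
    ; no△ = λ u v w a b c → no-three (linked u v a) (linked v w b) (linked u w c)
    ; pts = pts
    ; pts-inj = λ _ _ _ e → cong proj₁ e
    ; indep = λ a c d e → case ∨-cases {arc (pts a c) (pts a d)} e of λ where
        (inj₁ h) → arc-free a c d h
        (inj₂ h) → arc-free a d c h
    ; dominate = dom
    ; distinct = λ a b h → word-inj a b λ c → letter a b c (h c) }
    where
    letter : ∀ a b c → (∃[ d ] pts b d ≡ pts a c) → word a c ≡ word b c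
    letter a b c (d , e) = trans (sym (cong (λ v → proj₁ (proj₂ v)) e)) (cong (word b) (cong proj₁ e))
    dom : ∀ a v → (∃[ c ] pts a c ≡ v) ⊎ (∃[ c ] A v (pts a c) ≡ true)
    dom a (j , x , y) = case x ≟ word a j of λ where
      (no x≢) → inj₂ (prev j , ∨-right {arc (j , x , y) (pts a (prev j))}
        (∧-intro {⌊ prev j ≟ prev j ⌋} (holds {d = prev j ≟ prev j} refl)
          (not-intro (fails {d = word a (next (prev j)) ≟ x} λ e → x≢ (trans (sym e) (cong (word a) (next-prev j)))))))
      (yes x≡) → case y ≟ word a (next j) of λ where
        (no y≢) → inj₂ (next j , ∨-left (∧-intro {⌊ j ≟ prev (next j) ⌋} (holds {d = j ≟ prev (next j)} (sym (prev-next j)))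
          (not-intro (fails {d = y ≟ word a (next j)} y≢))))
        (yes y≡) → inj₁ (j , cong₂ (λ u v → j , u , v) (sym x≡) (sym y≡))

  module _ {n : ℕ} (iso : Fin n ↔ V) where
    open Exceptions iso points

    -- No control of the completion is needed: there are O(q²) vertices, and even all O(q⁴) pairs
    -- are few against s of order q ^ (4 + p).
    cycle-maximal : Σ[ X ∈ MaxRTSystem 3 (5 + p) s ] (v# X ≡ suc n) × (2 * e# X ≤ suc n * suc n + 0)
    cycle-maximal = few-exceptions {0} (suc n) (λ ()) (λ {B} _ u _ → #≤n (B u))

funToFin-cong : ∀ {m n} {f g : Fin m → Fin n} → (∀ c → f c ≡ g c) → funToFin f ≡ funToFin g
funToFin-cong {zero}  h = refl
funToFin-cong {suc m} h = cong₂ combine (h zero) (funToFin-cong (h ∘ suc))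

cycle-system : ∀ p q s → s ≤ q ^ (4 + p) → Σ[ X ∈ MaxRTSystem 3 (5 + p) s ] (v# X ≡ suc ((4 + p) * (q * q))) ×
  (2 * e# X ≤ suc ((4 + p) * (q * q)) * suc ((4 + p) * (q * q)) + 0)
cycle-system p q s s≤ = Cycle.cycle-maximal p q s (λ a → finToFun (inject≤ a s≤)) inj (↔-trans *↔× (↔-refl ×-↔ *↔×))
  where
  inj : ∀ a b → (∀ c → finToFun (inject≤ a s≤) c ≡ finToFun (inject≤ b s≤) c) → a ≡ b
  inj a b h = inject≤-injective s≤ s≤ a b (trans (sym (funToFin-finToFin {4 + p} {q} (inject≤ a s≤)))
    (trans (funToFin-cong h) (funToFin-finToFin {4 + p} {q} (inject≤ b s≤))))

-- Disjoint union of two crowns; row q is only partially used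

data Last {q : ℕ} : Fin (suc q) → Set where
  last  : Last (fromℕ q)
  inner : ∀ a → Last (inject₁ a)

last? : ∀ {q} (a : Fin (suc q)) → Last a
last? {zero}  zero    = last
last? {suc q} zero    = inner zero
last? {suc q} (suc a) with last? a
... | last    = last
... | inner b = inner (suc b)

-- A set is a pair of the first crown together with a pair of the second, hence a cell. By `at`
-- every cell outside the last row is used, and a used cell blocks all edges between its two pairs;
-- what remains uncontrolled involves the two vertices of the last row and the isolated vertex.
module TwoCrowns (q κ s : ℕ) (x : Fin s → Fin (4 + q)) (y : Fin s → Fin (3 + κ))
  (cell : ∀ a b → x a ≡ x b → y a ≡ y b → a ≡ b)
  (at : ∀ a b → ∃[ i ] x i ≡ inject₁ a × y i ≡ b) where

  V : Set
  V = (Fin (4 + q) × Fin 2) ⊎ (Fin (3 + κ) × Fin 2)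

  A : V → V → Bool
  A (inj₁ u) (inj₁ v) = crown-adj u v
  A (inj₁ _) (inj₂ _) = false
  A (inj₂ _) (inj₁ _) = false
  A (inj₂ u) (inj₂ v) = crown-adj u v

  pts : Fin s → Fin 4 → V
  pts i 0F = inj₁ (x i , 0F)
  pts i 1F = inj₁ (x i , 1F)
  pts i 2F = inj₂ (y i , 0F)
  pts i 3F = inj₂ (y i , 1F)

  at₁ : Fin 2 → Fin 4
  at₁ 0F = 0F
  at₁ 1F = 1F

  at₂ : Fin 2 → Fin 4
  at₂ 0F = 2F
  at₂ 1F = 3F

  pts₁ : ∀ i c → pts i (at₁ c) ≡ inj₁ (x i , c)
  pts₁ i 0F = refl
  pts₁ i 1F = refl

  pts₂ : ∀ i c → pts i (at₂ c) ≡ inj₂ (y i , c)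
  pts₂ i 0F = refl
  pts₂ i 1F = refl

  points : Points V s 4
  points = record
    { A = A
    ; A-sym = λ { (inj₁ u) (inj₁ v) → crown-sym u v ; (inj₂ u) (inj₂ v) → crown-sym u v }
    ; no△ = λ { (inj₁ u) (inj₁ v) (inj₁ w) → crown-no△ u v w ; (inj₂ u) (inj₂ v) (inj₂ w) → crown-no△ u v w }
    ; pts = pts
    ; pts-inj = inj
    ; indep = ind
    ; dominate = dom
    ; distinct = λ i j h → cell i j (same₁ i j (h 0F)) (same₂ i j (h 2F)) }
    where
    inj : ∀ i c d → pts i c ≡ pts i d → c ≡ d
    inj i 0F 0F _ = refl
    inj i 0F 1F ()
    inj i 0F 2F ()
    inj i 0F 3F ()
    inj i 1F 1F _ = refl
    inj i 1F 2F ()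
    inj i 1F 3F ()
    inj i 2F 2F _ = refl
    inj i 2F 3F ()
    inj i 3F 2F ()
    inj i 3F 3F _ = refl
    ind : ∀ i c d → A (pts i c) (pts i d) ≡ true → ⊥
    ind i 0F 0F = crown-indep (x i) 0F 0F
    ind i 0F 1F = crown-indep (x i) 0F 1F
    ind i 0F 2F ()
    ind i 0F 3F ()
    ind i 1F 0F = crown-indep (x i) 1F 0F
    ind i 1F 1F = crown-indep (x i) 1F 1F
    ind i 1F 2F ()
    ind i 1F 3F ()
    ind i 2F 0F ()
    ind i 2F 1F ()
    ind i 2F 2F = crown-indep (y i) 0F 0F
    ind i 2F 3F = crown-indep (y i) 0F 1F
    ind i 3F 0F ()
    ind i 3F 1F ()
    ind i 3F 2F = crown-indep (y i) 1F 0F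
    ind i 3F 3F = crown-indep (y i) 1F 1F
    dom : ∀ i v → (∃[ c ] pts i c ≡ v) ⊎ (∃[ c ] A v (pts i c) ≡ true)
    dom i (inj₁ v) = case crown-dominate (x i) v of λ where
      (inj₁ (c , e)) → inj₁ (at₁ c , trans (pts₁ i c) (cong inj₁ e))
      (inj₂ (c , e)) → inj₂ (at₁ c , trans (cong (A (inj₁ v)) (pts₁ i c)) e)
    dom i (inj₂ v) = case crown-dominate (y i) v of λ where
      (inj₁ (c , e)) → inj₁ (at₂ c , trans (pts₂ i c) (cong inj₂ e))
      (inj₂ (c , e)) → inj₂ (at₂ c , trans (cong (A (inj₂ v)) (pts₂ i c)) e)
    same₁ : ∀ i j → (∃[ d ] pts j d ≡ inj₁ (x i , 0F)) → x i ≡ x j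
    same₁ i j (0F , e) = sym (cong proj₁ (inj₁-injective e))
    same₁ i j (1F , e) = sym (cong proj₁ (inj₁-injective e))
    same₁ i j (2F , ())
    same₁ i j (3F , ())
    same₂ : ∀ i j → (∃[ d ] pts j d ≡ inj₂ (y i , 0F)) → y i ≡ y j
    same₂ i j (0F , ())
    same₂ i j (1F , ())
    same₂ i j (2F , e) = sym (cong proj₁ (inj₂-injective e))
    same₂ i j (3F , e) = sym (cong proj₁ (inj₂-injective e))

  module _ (κ≤q : κ ≤ q) {n : ℕ} (iso : Fin n ↔ V) where

    open FromPoints iso points
    open Exceptions iso points

    special : Fin 3 → Fin (suc n)
    special 0F = zero
    special 1F = suc (Inverse.from iso (inj₁ (fromℕ (3 + q) , 0F)))
    special 2F = suc (Inverse.from iso (inj₁ (fromℕ (3 + q) , 1F)))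

    module _ {B : Adj (suc n)} (adm : Admissible B) where
      open Blocked adm

      is-special : ∀ c → ∃[ d ] special d ≡ vtx (inj₁ (fromℕ (3 + q) , c))
      is-special 0F = 1F , refl
      is-special 1F = 2F , refl

      no-inside₁ : ∀ i c d → B (vtx (inj₁ (x i , c))) (vtx (inj₁ (x i , d))) ≡ true → ⊥
      no-inside₁ i c d e = no-inside i (at₁ c) (at₁ d) (trans (cong₂ (λ u v → B (vtx u) (vtx v)) (pts₁ i c) (pts₁ i d)) e)

      no-inside₂ : ∀ i c d → B (vtx (inj₂ (y i , c))) (vtx (inj₂ (y i , d))) ≡ true → ⊥
      no-inside₂ i c d e = no-inside i (at₂ c) (at₂ d) (trans (cong₂ (λ u v → B (vtx u) (vtx v)) (pts₂ i c) (pts₂ i d)) e)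

      no-cross : ∀ i c d → B (vtx (inj₁ (x i , c))) (vtx (inj₂ (y i , d))) ≡ true → ⊥
      no-cross i c d e = no-inside i (at₁ c) (at₂ d) (trans (cong₂ (λ u v → B (vtx u) (vtx v)) (pts₁ i c) (pts₂ i d)) e)

      inner-cross : ∀ a c b d → B (vtx (inj₁ (inject₁ a , c))) (vtx (inj₂ (b , d))) ≡ true → ⊥
      inner-cross a c b d e = let i , p , r = at a b in
        no-cross i c d (trans (cong₂ (λ u v → B (vtx (inj₁ (u , c))) (vtx (inj₂ (v , d)))) p r) e)

      inner-row : ∀ a c d → B (vtx (inj₁ (inject₁ a , c))) (vtx (inj₁ (inject₁ a , d))) ≡ true → ⊥
      inner-row a c d e = let i , p , _ = at a 0F in
        no-inside₁ i c d (trans (cong (λ u → B (vtx (inj₁ (u , c))) (vtx (inj₁ (u , d)))) p) e)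

      column : ∀ b c d → B (vtx (inj₂ (b , c))) (vtx (inj₂ (b , d))) ≡ true → ⊥
      column b c d e = let i , _ , r = at 0F b in
        no-inside₂ i c d (trans (cong (λ u → B (vtx (inj₂ (u , c))) (vtx (inj₂ (u , d)))) r) e)

      rows : Fin 2 → Fin (3 + (3 + q)) → Fin (suc n)
      rows c e with splitAt 3 e
      ... | inj₁ z = special z
      ... | inj₂ a = vtx (inj₁ (inject₁ a , opposite c))

      columns : Fin 2 → Fin (3 + (3 + κ)) → Fin (suc n)
      columns c e with splitAt 3 e
      ... | inj₁ z = special z
      ... | inj₂ b = vtx (inj₂ (b , opposite c))

      in-rows : ∀ c z → rows c (join 3 (3 + q) (inj₁ z)) ≡ special z
      in-rows c z rewrite splitAt-join 3 (3 + q) (inj₁ z) = refl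

      in-rows′ : ∀ c a → rows c (join 3 (3 + q) (inj₂ a)) ≡ vtx (inj₁ (inject₁ a , opposite c))
      in-rows′ c a rewrite splitAt-join 3 (3 + q) (inj₂ a) = refl

      in-columns : ∀ c z → columns c (join 3 (3 + κ) (inj₁ z)) ≡ special z
      in-columns c z rewrite splitAt-join 3 (3 + κ) (inj₁ z) = refl

      in-columns′ : ∀ c b → columns c (join 3 (3 + κ) (inj₂ b)) ≡ vtx (inj₂ (b , opposite c))
      in-columns′ c b rewrite splitAt-join 3 (3 + κ) (inj₂ b) = refl

      row-row : ∀ a c a′ d → Dec (a ≡ a′) → Dec (c ≡ d) → B (vtx (inj₁ (inject₁ a , c))) (vtx (inj₁ (inject₁ a′ , d))) ≡ true →
        ∃[ e ] rows c e ≡ vtx (inj₁ (inject₁ a′ , d))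
      row-row a c a′ d (yes refl) _ h = ⊥-elim (inner-row a c d h)
      row-row a c a′ d (no _) (yes refl) h = let z , l , r = crown-cherry (inject₁ a) (inject₁ a′) c in
        ⊥-elim (no-cherry (inj₁ (inject₁ a , c)) (inj₁ (inject₁ a′ , c)) (inj₁ z) l r h)
      row-row a c a′ d (no _) (no ne) h = join 3 (3 + q) (inj₂ a′) ,
        trans (in-rows′ c a′) (cong (λ z → vtx (inj₁ (inject₁ a′ , z))) (sym (≢⇒opposite c d ne)))

      col-col : ∀ b c b′ d → Dec (b ≡ b′) → Dec (c ≡ d) → B (vtx (inj₂ (b , c))) (vtx (inj₂ (b′ , d))) ≡ true →
        ∃[ e ] columns c e ≡ vtx (inj₂ (b′ , d))
      col-col b c b′ d (yes refl) _ h = ⊥-elim (column b c d h)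
      col-col b c b′ d (no _) (yes refl) h = let z , l , r = crown-cherry b b′ c in
        ⊥-elim (no-cherry (inj₂ (b , c)) (inj₂ (b′ , c)) (inj₂ z) l r h)
      col-col b c b′ d (no _) (no ne) h = join 3 (3 + κ) (inj₂ b′) ,
        trans (in-columns′ c b′) (cong (λ z → vtx (inj₂ (b′ , z))) (sym (≢⇒opposite c d ne)))

      from-row : ∀ a c w → B (vtx (inj₁ (inject₁ a , c))) w ≡ true → ∃[ e ] rows c e ≡ w
      from-row a c w h = case vertex w of λ where
          (inj₁ refl) → join 3 (3 + q) (inj₁ 0F) , in-rows c 0F
          (inj₂ (inj₂ (b , d) , refl)) → ⊥-elim (inner-cross a c b d h)
          (inj₂ (inj₁ (a′ , d) , refl)) → go a′ d (last? a′) h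
        where
        go : ∀ a′ d → Last a′ → B (vtx (inj₁ (inject₁ a , c))) (vtx (inj₁ (a′ , d))) ≡ true → ∃[ e ] rows c e ≡ vtx (inj₁ (a′ , d))
        go _ d last h = let z , e = is-special d in join 3 (3 + q) (inj₁ z) , trans (in-rows c z) e
        go _ d (inner a′) h = row-row a c a′ d (a ≟ a′) (c ≟ d) h

      from-column : ∀ b c w → B (vtx (inj₂ (b , c))) w ≡ true → ∃[ e ] columns c e ≡ w
      from-column b c w h = case vertex w of λ where
          (inj₁ refl) → join 3 (3 + κ) (inj₁ 0F) , in-columns c 0F
          (inj₂ (inj₂ (b′ , d) , refl)) → col-col b c b′ d (b ≟ b′) (c ≟ d) h
          (inj₂ (inj₁ (a′ , d) , refl)) → go a′ d (last? a′) h
        where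
        go : ∀ a′ d → Last a′ → B (vtx (inj₂ (b , c))) (vtx (inj₁ (a′ , d))) ≡ true → ∃[ e ] columns c e ≡ vtx (inj₁ (a′ , d))
        go _ d last h = let z , e = is-special d in join 3 (3 + κ) (inj₁ z) , trans (in-columns c z) e
        go _ d (inner a′) h = ⊥-elim (inner-cross a′ d b c (Admissible.B-sym adm _ _ h))

      degree : ∀ u → (∀ c → special c ≢ u) → # (B u) ≤ 3 + (3 + q)
      degree u new = case vertex u of λ where
          (inj₁ refl) → ⊥-elim (new 0F refl)
          (inj₂ (inj₂ (b , c) , refl)) → ≤-trans (degree≤ (vtx (inj₂ (b , c))) (columns c) (from-column b c)) (+-monoʳ-≤ 6 κ≤q)
          (inj₂ (inj₁ (a , c) , refl)) → go a c (last? a) new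
        where
        go : ∀ a c → Last a → (∀ d → special d ≢ vtx (inj₁ (a , c))) → # (B (vtx (inj₁ (a , c)))) ≤ 3 + (3 + q)
        go _ c last new = let z , e = is-special c in ⊥-elim (new z e)
        go _ c (inner a) _ = degree≤ (vtx (inj₁ (inject₁ a , c))) (rows c) (from-row a c)

    two-crowns-maximal : Σ[ X ∈ MaxRTSystem 3 5 s ] (v# X ≡ suc n) × (2 * e# X ≤ suc n * (3 + (3 + q)) + 3 * suc n)
    two-crowns-maximal = few-exceptions (3 + (3 + q)) special degree

-- The range of s says that all rows but the last are full. With q and κ near √s, about 4 √s
-- vertices have degree about √s, which makes about 2 s edges.
two-crowns : ∀ q κ s → κ ≤ q → (3 + q) * (3 + κ) ≤ s → s ≤ (4 + q) * (3 + κ) →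
  Σ[ X ∈ MaxRTSystem 3 5 s ] 2 * e# X ≤ suc ((4 + q) * 2 + (3 + κ) * 2) * (3 + (3 + q)) + 3 * suc ((4 + q) * 2 + (3 + κ) * 2)
two-crowns q κ s κ≤q lo hi =
  let X , _ , e = TwoCrowns.two-crowns-maximal q κ s (λ i → proj₁ (place i)) (λ i → proj₂ (place i)) cell at κ≤q (↔-trans +↔⊎ (*↔× ⊎-↔ *↔×))
  in X , e
  where
  place : Fin s → Fin (4 + q) × Fin (3 + κ)
  place i = remQuot (3 + κ) (inject≤ i hi)
  cell : ∀ a b → proj₁ (place a) ≡ proj₁ (place b) → proj₂ (place a) ≡ proj₂ (place b) → a ≡ b
  cell a b p r = inject≤-injective hi hi a b (trans (sym (combine-remQuot {4 + q} (3 + κ) (inject≤ a hi)))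
    (trans (cong₂ combine p r) (combine-remQuot {4 + q} (3 + κ) (inject≤ b hi))))
  at : ∀ a b → ∃[ i ] proj₁ (place i) ≡ inject₁ a × proj₂ (place i) ≡ b
  at a b = fromℕ< lt , cong proj₁ placed , cong proj₂ placed
    where
    c = combine a b
    c′ = combine (inject₁ a) b
    lt : toℕ c′ < s
    lt = ≤-trans (s≤s (≤-reflexive (trans (toℕ-combine (inject₁ a) b) (trans (cong (λ z → (3 + κ) * z + toℕ b) (toℕ-inject₁ a)) (sym (toℕ-combine a b))))))
           (≤-trans (toℕ<n c) lo)
    placed : place (fromℕ< lt) ≡ (inject₁ a , b)
    placed = trans (cong (remQuot (3 + κ)) (toℕ-injective (trans (toℕ-inject≤ (fromℕ< lt) hi) (toℕ-fromℕ< lt)))) (remQuot-combine (inject₁ a) b)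

-- Combining lower bounds and constructions

open import Data.Integer as ℤ using (+_)
open import Data.Integer.Properties using (pos-+; pos-*)
open import Data.Integer.Tactic.RingSolver using () renaming (solve-∀ to solve-∀ᶻ)
open import Data.Nat.Combinatorics using (_C_; nC1≡n; nCk+nC[k+1]≡[n+1]C[k+1])

2*nC2 : ∀ k → 2 * ((1 + k) C 2) ≡ (1 + k) * k
2*nC2 zero    = refl
2*nC2 (suc k) = begin
  2 * ((2 + k) C 2)                    ≡⟨ cong (2 *_) (nCk+nC[k+1]≡[n+1]C[k+1] (1 + k) 1) ⟨
  2 * ((1 + k) C 1 + (1 + k) C 2)      ≡⟨ *-distribˡ-+ 2 ((1 + k) C 1) ((1 + k) C 2) ⟩
  2 * ((1 + k) C 1) + 2 * ((1 + k) C 2) ≡⟨ cong₂ _+_ (cong (2 *_) (nC1≡n (1 + k))) (2*nC2 k) ⟩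
  2 * (1 + k) + (1 + k) * k            ≡⟨ e k ⟩
  (2 + k) * (1 + k)                    ∎
  where
  open ≡-Reasoning
  e : ∀ k → 2 * (1 + k) + (1 + k) * k ≡ (2 + k) * (1 + k)
  e = solve-∀

-- The identity is checked in ℤ because 2 r - 7 is negative for r = 3.
formula1-value : ∀ k s₁ m → 2 * m ≡ suc s₁ * 2 * (k + s₁) + ((1 + k) * k + k * (suc s₁ * 2)) → + m ≡ formula1 (3 + k) (suc s₁)
formula1-value k s₁ m eq = begin
  + m                                                                     ≡⟨ cong +_ m≡ ⟩
  + (suc s₁ * (k + s₁) + c + k * suc s₁)                                  ≡⟨ in-ℤ ⟩
  (((+ 1 ℤ.+ + s₁) ℤ.* (+ k ℤ.+ + s₁)) ℤ.+ + c) ℤ.+ (+ k ℤ.* (+ 1 ℤ.+ + s₁)) ≡⟨ ring (+ k) (+ s₁) (+ c) ⟩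
  (((+ 1 ℤ.+ + s₁) ℤ.* (+ 1 ℤ.+ + s₁)) ℤ.+ ((+ 2 ℤ.* (+ 3 ℤ.+ + k)) ℤ.- + 7) ℤ.* (+ 1 ℤ.+ + s₁)) ℤ.+ + c ≡⟨ back ⟨
  formula1 (3 + k) (suc s₁)                                               ∎
  where
  open ≡-Reasoning
  c = (1 + k) C 2
  e : ∀ s k s₁ c → s * 2 * (k + s₁) + (2 * c + k * (s * 2)) ≡ 2 * (s * (k + s₁) + c + k * s)
  e = solve-∀
  m≡ : m ≡ suc s₁ * (k + s₁) + c + k * suc s₁
  m≡ = *-cancelˡ-≡ m _ 2 (trans eq (trans (cong (λ z → suc s₁ * 2 * (k + s₁) + (z + k * (suc s₁ * 2))) (sym (2*nC2 k))) (e (suc s₁) k s₁ c)))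
  ring : ∀ K S C′ → (((+ 1 ℤ.+ S) ℤ.* (K ℤ.+ S)) ℤ.+ C′) ℤ.+ (K ℤ.* (+ 1 ℤ.+ S)) ≡
    (((+ 1 ℤ.+ S) ℤ.* (+ 1 ℤ.+ S)) ℤ.+ ((+ 2 ℤ.* (+ 3 ℤ.+ K)) ℤ.- + 7) ℤ.* (+ 1 ℤ.+ S)) ℤ.+ C′
  ring = solve-∀ᶻ
  in-ℤ : + (suc s₁ * (k + s₁) + c + k * suc s₁) ≡ (((+ 1 ℤ.+ + s₁) ℤ.* (+ k ℤ.+ + s₁)) ℤ.+ + c) ℤ.+ (+ k ℤ.* (+ 1 ℤ.+ + s₁))
  in-ℤ = trans (pos-+ (suc s₁ * (k + s₁) + c) (k * suc s₁)) (cong₂ ℤ._+_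
    (trans (pos-+ (suc s₁ * (k + s₁)) c) (cong (ℤ._+ + c) (pos-* (suc s₁) (k + s₁)))) (pos-* k (suc s₁)))
  back : formula1 (3 + k) (suc s₁) ≡ (((+ 1 ℤ.+ + s₁) ℤ.* (+ 1 ℤ.+ + s₁)) ℤ.+ ((+ 2 ℤ.* (+ 3 ℤ.+ + k)) ℤ.- + 7) ℤ.* (+ 1 ℤ.+ + s₁)) ℤ.+ + c
  back = cong₂ (λ a b → (a ℤ.+ (b ℤ.- + 7) ℤ.* + suc s₁) ℤ.+ + c) (pos-* (suc s₁) (suc s₁)) (pos-* 2 (3 + k))

At : ℕ → ℕ → ℕ → (ℕ → Set) → Set
At r t s P = Σ[ Y ∈ MaxRTSystem r t s ] P (e# Y)

-- A single maximal system shows that both minima exist and bounds both from above; L is any lower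
-- bound valid for all systems.
both-minima : ∀ {k t s b} → 1 ≤ s → At (3 + k) t s (_≤ b) → (L : ℕ → Set) → (∀ (X : RTSystem (3 + k) t s) → L (edges (RTSystem.H X))) →
  Σ[ m ∈ ℕ ] Σ[ m′ ∈ ℕ ] IsE (3 + k) t s m × IsE' (3 + k) t s m′ × L m × L m′ × (m ≤ m′) × (m′ ≤ b)
both-minima 1≤s (Y , le) L low =
  let m , (X , e) , min = min-IsE 1≤s (MaxRTSystem.sys Y)
      m′ , (X′ , e′) , min′ = min-IsE' 1≤s Y
  in m , m′ , ((X , e) , min) , ((X′ , e′) , min′) , subst L e (low X) , subst L e′ (low (MaxRTSystem.sys X′)) ,
     ≤-trans (min (MaxRTSystem.sys X′)) (≤-reflexive e′) , ≤-trans (min′ Y) le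

joined-value : ∀ {k x m N} → m * 2 + k ≡ x * 2 + k * (2 * N) + k * k → 2 * m ≤ 2 * x + k * (2 * N) + k * k
joined-value {k} {x} {m} {N} eq = ≤-trans (≤-reflexive (*-comm 2 m)) (≤-trans (m≤m+n (m * 2) k)
  (≤-reflexive (trans eq (cong (λ z → z + k * (2 * N) + k * k) (*-comm x 2)))))

exact-minimum : ∀ k → Σ ℕ λ s₀ → ∀ s → s₀ ≤ s → Σ ℕ λ m → (+ m ≡ formula1 (3 + k) s) × IsE (3 + k) (3 + k) s m × IsE' (3 + k) (3 + k) s m
exact-minimum k = lower₁-threshold k , λ s s≥ → at s s≥ (≤-trans (m≤m+n 3 9) (≤-trans (12≤threshold k) s≥))
  where
  value : ∀ s₁ → ℕ
  value s₁ = suc s₁ * 2 * (k + s₁) + ((1 + k) * k + k * (suc s₁ * 2))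
  upper : ∀ s → At (3 + k) (3 + k) (3 + s) (λ e → 2 * e ≤ value (2 + s))
  upper s = subst (λ t → At (3 + k) t (3 + s) (λ e → 2 * e ≤ value (2 + s))) (+-comm k 3) (build (crown-system s))
    where
    build : (Σ[ X ∈ MaxRTSystem 3 3 (3 + s) ] (v# X ≡ suc ((3 + s) * 2)) × (2 * e# X ≤ (3 + s) * 2 * (2 + s))) →
      At (3 + k) (k + 3) (3 + s) (λ e → 2 * e ≤ value (2 + s))
    build (X , n≡ , le) = let Y , eq , _ = join-many k X in Y , bound (e# Y) eq
      where
      bound : ∀ y → y * 2 + k ≡ e# X * 2 + k * (2 * v# X) + k * k → 2 * y ≤ value (2 + s)
      bound y eq = +-cancelʳ-≤ k _ _ (begin
        2 * y + k                                                       ≡⟨ cong (_+ k) (*-comm 2 y) ⟩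
        y * 2 + k                                                       ≡⟨ eq ⟩
        e# X * 2 + k * (2 * v# X) + k * k                               ≡⟨ cong₂ (λ a b → a + k * (2 * b) + k * k) (*-comm (e# X) 2) n≡ ⟩
        2 * e# X + k * (2 * suc ((3 + s) * 2)) + k * k                  ≤⟨ +-monoˡ-≤ (k * k) (+-monoˡ-≤ (k * (2 * suc ((3 + s) * 2))) le) ⟩
        (3 + s) * 2 * (2 + s) + k * (2 * suc ((3 + s) * 2)) + k * k     ≡⟨ e k s ⟩
        value (2 + s) + k                                               ∎)
        where
        open ≤-Reasoning
        e : ∀ k s → (3 + s) * 2 * (2 + s) + k * (2 * suc ((3 + s) * 2)) + k * k ≡
          suc (2 + s) * 2 * (k + (2 + s)) + ((1 + k) * k + k * (suc (2 + s) * 2)) + k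
        e = solve-∀
  at : ∀ s → lower₁-threshold k ≤ s → 3 ≤ s → Σ ℕ λ m → (+ m ≡ formula1 (3 + k) s) × IsE (3 + k) (3 + k) s m × IsE' (3 + k) (3 + k) s m
  at (suc (suc (suc s))) s≥ (s≤s (s≤s (s≤s _))) = finish (upper s)
    where
    low : ∀ (X : RTSystem (3 + k) (3 + k) (3 + s)) → value (2 + s) ≤ 2 * edges (RTSystem.H X)
    low X = ≤-trans (Exact.lower₁ (proj₂ (system⇒Sys X)) s≥) (≤-reflexive (handshake (RTSystem.H X)))
    finish : At (3 + k) (3 + k) (3 + s) (λ e → 2 * e ≤ value (2 + s)) →
      Σ ℕ λ m → (+ m ≡ formula1 (3 + k) (3 + s)) × IsE (3 + k) (3 + k) (3 + s) m × IsE' (3 + k) (3 + k) (3 + s) m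
    -- Upper and lower bound coincide, so the constructed system is itself minimal in both senses
    -- and no search is involved.
    finish (Y , le) = e# Y , formula1-value k (2 + s) (e# Y) (≤-antisym le (low (MaxRTSystem.sys Y))) ,
      ((MaxRTSystem.sys Y , refl) , λ X → *-cancelˡ-≤ 2 (≤-trans le (low X))) ,
      ((Y , refl) , λ X → *-cancelˡ-≤ 2 (≤-trans le (low (MaxRTSystem.sys X))))

upper₂-constant : ℕ → ℕ
upper₂-constant k = 60 + 20 * k + k * k

order-three-halves : ∀ k → Σ ℕ λ C → Σ ℕ λ s₀ → ∀ s → s₀ ≤ s →
  (Σ ℕ λ m → IsE (3 + k) (4 + k) s m × (m ^ 2 ≤ C * s ^ 3) × (s ^ 3 ≤ C * m ^ 2)) ×
  (Σ ℕ λ m′ → IsE' (3 + k) (4 + k) s m′ × (m′ ^ 2 ≤ C * s ^ 3) × (s ^ 3 ≤ C * m′ ^ 2))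
-- From s = 5 on, K² ≥ s gives K ≥ 3, which `grid-system` requires.
order-three-halves k = C , 5 , λ s 5≤s → finish s 5≤s (root 2 s (s≤s z≤n) (≤-trans (s≤s z≤n) 5≤s))
  where
  c = upper₂-constant k
  C = 4 * (c * c) + lower₂-constant k
  sq : ∀ m → m ^ 2 ≡ m * m
  sq m = cong (m *_) (*-identityʳ m)
  cb : ∀ m → m ^ 3 ≡ m * m * m
  cb m = trans (cong (m *_) (sq m)) (sym (*-assoc m m m))
  upper : ∀ s K → 5 ≤ s → 3 ≤ K → s ≤ K * K → K * K ≤ 4 * s → At (3 + k) (4 + k) s (_≤ c * (s * K))
  upper s K 5≤s 3≤K s≤ K²≤ = subst (λ t → At (3 + k) t s (_≤ c * (s * K))) (+-comm k 4) (build (grid-system s K 3≤K s≤))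
    where
    N = suc (s + (K + K))
    1≤s : 1 ≤ s
    1≤s = ≤-trans (s≤s z≤n) 5≤s
    1≤K : 1 ≤ K
    1≤K = ≤-trans (s≤s z≤n) 3≤K
    K≤4s : K ≤ 4 * s
    K≤4s = ≤-trans (m≤m*n K K {{>-nonZero 1≤K}}) K²≤
    N≤ : N ≤ 10 * s
    N≤ = ≤-trans (+-mono-≤ 1≤s (+-monoʳ-≤ s (+-mono-≤ K≤4s K≤4s))) (≤-reflexive (e s))
      where
      e : ∀ s → s + (s + (4 * s + 4 * s)) ≡ 10 * s
      e = solve-∀
    D≤ : 1 + (K + K) ≤ 3 * K
    D≤ = ≤-trans (+-monoˡ-≤ (K + K) 1≤K) (≤-reflexive (e K))
      where
      e : ∀ K → K + (K + K) ≡ 3 * K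
      e = solve-∀
    build : (Σ[ X ∈ MaxRTSystem 3 4 s ] (v# X ≡ N) × (2 * e# X ≤ N * (1 + (K + K)) + (1 + (K + K)) * N)) → At (3 + k) (k + 4) s (_≤ c * (s * K))
    build (X , n≡ , le) = let Y , eq , _ = join-many k X in Y , bound (e# Y) eq
      where
      bound : ∀ y → y * 2 + k ≡ e# X * 2 + k * (2 * v# X) + k * k → y ≤ c * (s * K)
      bound y eq = begin
        y                                                   ≤⟨ m≤m+n y _ ⟩
        2 * y                                               ≤⟨ joined-value {k} {e# X} {y} {v# X} eq ⟩
        2 * e# X + k * (2 * v# X) + k * k                   ≡⟨ cong (λ z → 2 * e# X + k * (2 * z) + k * k) n≡ ⟩
        2 * e# X + k * (2 * N) + k * k                      ≤⟨ +-mono-≤ (+-mono-≤ (≤-trans le (+-mono-≤ (*-mono-≤ N≤ D≤) (*-mono-≤ D≤ N≤)))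
                                                                 (*-monoʳ-≤ k (*-monoʳ-≤ 2 (≤-trans N≤ (m≤m*n (10 * s) K {{>-nonZero 1≤K}})))))
                                                                 (≤-trans (m≤m*n (k * k) (s * K) {{>-nonZero (*-mono-≤ 1≤s 1≤K)}}) ≤-refl) ⟩
        10 * s * (3 * K) + 3 * K * (10 * s) + k * (2 * (10 * s * K)) + k * k * (s * K) ≡⟨ e k s K ⟩
        c * (s * K)                                         ∎
        where
        open ≤-Reasoning
        e : ∀ k s K → 10 * s * (3 * K) + 3 * K * (10 * s) + k * (2 * (10 * s * K)) + k * k * (s * K) ≡ (60 + 20 * k + k * k) * (s * K)
        e = solve-∀
  finish : ∀ s → 5 ≤ s → Σ[ K ∈ ℕ ] (s ≤ K ^ 2) × (K ^ 2 ≤ 2 ^ 2 * s) →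
    (Σ ℕ λ m → IsE (3 + k) (4 + k) s m × (m ^ 2 ≤ C * s ^ 3) × (s ^ 3 ≤ C * m ^ 2)) ×
    (Σ ℕ λ m′ → IsE' (3 + k) (4 + k) s m′ × (m′ ^ 2 ≤ C * s ^ 3) × (s ^ 3 ≤ C * m′ ^ 2))
  finish s 5≤s (K , lo , hi) =
    let m , m′ , E , E′ , L , L′ , m≤m′ , m′≤ = both-minima {b = c * (s * K)} (≤-trans (s≤s z≤n) 5≤s) (upper s K 5≤s 3≤K lo′ hi′) (λ m → s * s * s ≤ lower₂-constant k * (m * m)) low
    in (m , E , up m (≤-trans m≤m′ m′≤) , down m L) , (m′ , E′ , up m′ m′≤ , down m′ L′)
    where
    lo′ : s ≤ K * K
    lo′ = ≤-trans lo (≤-reflexive (sq K))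
    hi′ : K * K ≤ 4 * s
    hi′ = ≤-trans (≤-reflexive (sym (sq K))) hi
    3≤K : 3 ≤ K
    3≤K = ≰⇒> λ K≤2 → 1+n≰n (≤-trans 5≤s (≤-trans lo′ (*-mono-≤ K≤2 K≤2)))
    low : ∀ (X : RTSystem (3 + k) (4 + k) s) → s * s * s ≤ lower₂-constant k * (edges (RTSystem.H X) * edges (RTSystem.H X))
    low X = lower₂ (proj₂ (system⇒Sys X)) (edges (RTSystem.H X)) (edges-pos X 2≤s) (≤-reflexive (handshake (RTSystem.H X))) 2≤s
      where
      2≤s : 2 ≤ s
      2≤s = ≤-trans (m≤m+n 2 3) 5≤s
    down : ∀ m → s * s * s ≤ lower₂-constant k * (m * m) → s ^ 3 ≤ C * m ^ 2
    down m h = ≤-trans (≤-reflexive (cb s)) (≤-trans h (≤-trans (*-monoˡ-≤ (m * m) (m≤n+m (lower₂-constant k) (4 * (c * c)))) (≤-reflexive (cong (C *_) (sym (sq m))))))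
    up : ∀ m → m ≤ c * (s * K) → m ^ 2 ≤ C * s ^ 3
    up m h = begin
      m ^ 2                               ≡⟨ sq m ⟩
      m * m                               ≤⟨ *-mono-≤ h h ⟩
      c * (s * K) * (c * (s * K))         ≡⟨ e₁ c s K ⟩
      c * c * (s * s * (K * K))           ≤⟨ *-monoʳ-≤ (c * c) (*-monoʳ-≤ (s * s) hi′) ⟩
      c * c * (s * s * (4 * s))           ≡⟨ e₂ c s ⟩
      4 * (c * c) * (s * s * s)           ≤⟨ *-mono-≤ (m≤m+n (4 * (c * c)) (lower₂-constant k)) (≤-reflexive (sym (cb s))) ⟩
      C * s ^ 3                           ∎
      where
      open ≤-Reasoning
      e₁ : ∀ c s K → c * (s * K) * (c * (s * K)) ≡ c * c * (s * s * (K * K))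
      e₁ = solve-∀
      e₂ : ∀ c s → c * c * (s * s * (4 * s)) ≡ 4 * (c * c) * (s * s * s)
      e₂ = solve-∀

^-swap : ∀ a b c → (a ^ b) ^ c ≡ (a ^ c) ^ b
^-swap a b c = trans (^-*-assoc a b c) (trans (cong (a ^_) (*-comm b c)) (sym (^-*-assoc a c b)))

upper₃-constant : ℕ → ℕ → ℕ
upper₃-constant k j = ((1 + (4 + j) + k) ^ 2) ^ (4 + j) * (2 ^ (4 + j)) ^ 4

-- After joining k vertices there are at most d q² vertices and fewer than d² q⁴ edges; since q ^ u
-- = O(s), the u-th power of this bound is O(s⁴).
upper₃ : ∀ k j s → 1 ≤ s → Σ[ b ∈ ℕ ] At (3 + k) (k + (5 + j)) s (_≤ b) × (b ^ (4 + j) ≤ upper₃-constant k j * s ^ 4)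
upper₃ k j s 1≤s = build (root u s (s≤s z≤n) 1≤s)
  where
  u = 4 + j
  d = 1 + u + k
  build : Σ[ q ∈ ℕ ] (s ≤ q ^ u) × (q ^ u ≤ 2 ^ u * s) → Σ[ b ∈ ℕ ] At (3 + k) (k + (5 + j)) s (_≤ b) × (b ^ u ≤ upper₃-constant k j * s ^ 4)
  build (q , lo , hi) = d ^ 2 * q ^ 4 , make (cycle-system j q s lo) , power
    where
    open ≤-Reasoning
    N = suc (u * (q * q))
    1≤q : 1 ≤ q
    1≤q = positive q lo
      where
      positive : ∀ q → s ≤ q ^ u → 1 ≤ q
      positive zero h = ≤-trans 1≤s h
      positive (suc q) _ = s≤s z≤n
    1≤q² : 1 ≤ q * q
    1≤q² = *-mono-≤ 1≤q 1≤q
    make : (Σ[ X ∈ MaxRTSystem 3 (5 + j) s ] (v# X ≡ N) × (2 * e# X ≤ N * N + 0)) → At (3 + k) (k + (5 + j)) s (_≤ d ^ 2 * q ^ 4)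
    make (X , n≡ , le) = let Y , eq , _ = join-many k X in Y , bound (e# Y) eq
      where
      N+k≤ : N + k ≤ d * (q * q)
      N+k≤ = ≤-trans (+-mono-≤ (+-monoˡ-≤ (u * (q * q)) 1≤q²) (m≤m*n k (q * q) {{>-nonZero 1≤q²}})) (≤-reflexive (e u k (q * q)))
        where
        e : ∀ u k Q → Q + u * Q + k * Q ≡ (1 + u + k) * Q
        e = solve-∀
      bound : ∀ y → y * 2 + k ≡ e# X * 2 + k * (2 * v# X) + k * k → y ≤ d ^ 2 * q ^ 4
      bound y eq = begin
        y                                          ≤⟨ m≤m+n y _ ⟩
        2 * y                                      ≤⟨ joined-value {k} {e# X} {y} {v# X} eq ⟩
        2 * e# X + k * (2 * v# X) + k * k          ≤⟨ +-monoˡ-≤ (k * k) (+-mono-≤ le (≤-reflexive (cong (λ z → k * (2 * z)) n≡))) ⟩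
        N * N + 0 + k * (2 * N) + k * k            ≡⟨ e₁ N k ⟩
        (N + k) * (N + k)                          ≤⟨ *-mono-≤ N+k≤ N+k≤ ⟩
        d * (q * q) * (d * (q * q))                ≡⟨ e₂ d q ⟩
        d ^ 2 * q ^ 4                              ∎
        where
        e₁ : ∀ N k → N * N + 0 + k * (2 * N) + k * k ≡ (N + k) * (N + k)
        e₁ = solve-∀
        e₂ : ∀ d q → d * (q * q) * (d * (q * q)) ≡ (d * (d * 1)) * (q * (q * (q * (q * 1))))
        e₂ = solve-∀
    power : (d ^ 2 * q ^ 4) ^ u ≤ upper₃-constant k j * s ^ 4
    power = begin
      (d ^ 2 * q ^ 4) ^ u                     ≡⟨ ^-distribʳ-* u (d ^ 2) (q ^ 4) ⟩
      (d ^ 2) ^ u * (q ^ 4) ^ u               ≡⟨ cong ((d ^ 2) ^ u *_) (^-swap q 4 u) ⟩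
      (d ^ 2) ^ u * (q ^ u) ^ 4               ≤⟨ *-monoʳ-≤ ((d ^ 2) ^ u) (^-monoˡ-≤ 4 hi) ⟩
      (d ^ 2) ^ u * (2 ^ u * s) ^ 4           ≡⟨ cong ((d ^ 2) ^ u *_) (^-distribʳ-* 4 (2 ^ u) s) ⟩
      (d ^ 2) ^ u * ((2 ^ u) ^ 4 * s ^ 4)     ≡⟨ *-assoc ((d ^ 2) ^ u) _ _ ⟨
      upper₃-constant k j * s ^ 4             ∎

-- The exponent 4 + j = t - r + 2 has two origins: it is the number of elements of a set outside a
-- clique on r - 2 vertices, and the number of layers of the cyclic product.
general-bounds : ∀ k j → Σ ℕ λ C → Σ ℕ λ s₀ → ∀ s → s₀ ≤ s → Σ ℕ λ m → Σ ℕ λ m′ → IsE (3 + k) (k + (5 + j)) s m × IsE' (3 + k) (k + (5 + j)) s m′ ×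
  (s ≤ C * m ^ (4 + j)) × (m ≤ m′) × (m′ ^ (4 + j) ≤ C * s ^ 4)
general-bounds k j = lo + upper₃-constant k j , 2 , λ s 2≤s → finish s 2≤s (upper₃ k j s (≤-trans (n≤1+n 1) 2≤s))
  where
  t = k + (5 + j)
  u = 4 + j
  lo = t ^ (1 + k) * (t + 2) ^ u
  t≡ : t ≡ (1 + k) + u
  t≡ = e k j
    where
    e : ∀ k j → k + (5 + j) ≡ 1 + k + (4 + j)
    e = solve-∀
  finish : ∀ s → 2 ≤ s → Σ[ b ∈ ℕ ] At (3 + k) t s (_≤ b) × (b ^ u ≤ upper₃-constant k j * s ^ 4) →
    Σ ℕ λ m → Σ ℕ λ m′ → IsE (3 + k) t s m × IsE' (3 + k) t s m′ ×
      (s ≤ (lo + upper₃-constant k j) * m ^ u) × (m ≤ m′) × (m′ ^ u ≤ (lo + upper₃-constant k j) * s ^ 4)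
  finish s 2≤s (b , Y , pow) =
    let m , m′ , E , E′ , L , _ , m≤m′ , m′≤ = both-minima (≤-trans (n≤1+n 1) 2≤s) Y (λ m → s ≤ lo * m ^ u) (λ X → count-lower X t≡ 2≤s)
    in m , m′ , E , E′ , ≤-trans L (*-monoˡ-≤ (m ^ u) (m≤m+n lo (upper₃-constant k j))) , m≤m′ ,
       ≤-trans (^-monoˡ-≤ u m′≤) (≤-trans pow (*-monoˡ-≤ (s ^ 4) (m≤n+m (upper₃-constant k j) lo)))

triangle-free-bounds : ∀ j → Σ ℕ λ C → Σ ℕ λ s₀ → ∀ s → s₀ ≤ s → Σ ℕ λ m → Σ ℕ λ m′ → IsE 3 (5 + j) s m × IsE' 3 (5 + j) s m′ ×
  (s ^ 2 ≤ C * m ^ (2 + j)) × (m ≤ m′) × (m′ ^ (4 + j) ≤ C * s ^ 4)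
triangle-free-bounds j = lo + upper₃-constant 0 j , 2 , λ s 2≤s → finish s 2≤s (upper₃ 0 j s (≤-trans (n≤1+n 1) 2≤s))
  where
  t = 5 + j
  lo = t * t * (4 ^ j * (C₄ * C₄))
  finish : ∀ s → 2 ≤ s → Σ[ b ∈ ℕ ] At 3 t s (_≤ b) × (b ^ (4 + j) ≤ upper₃-constant 0 j * s ^ 4) →
    Σ ℕ λ m → Σ ℕ λ m′ → IsE 3 t s m × IsE' 3 t s m′ ×
      (s ^ 2 ≤ (lo + upper₃-constant 0 j) * m ^ (2 + j)) × (m ≤ m′) × (m′ ^ (4 + j) ≤ (lo + upper₃-constant 0 j) * s ^ 4)
  finish s 2≤s (b , Y , pow) =
    let m , m′ , E , E′ , L , _ , m≤m′ , m′≤ = both-minima (≤-trans (n≤1+n 1) 2≤s) Y (λ m → s * s ≤ lo * m ^ (2 + j)) (λ X → square-lower X j refl 2≤s)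
    in m , m′ , E , E′ , ≤-trans (≤-reflexive (cong (s *_) (*-identityʳ s))) (≤-trans L (*-monoˡ-≤ (m ^ (2 + j)) (m≤m+n lo (upper₃-constant 0 j)))) , m≤m′ ,
       ≤-trans (^-monoˡ-≤ (4 + j) m′≤) (≤-trans pow (*-monoˡ-≤ (s ^ 4) (m≤n+m (upper₃-constant 0 j) lo)))

isqrt : ∀ s → Σ[ κ ∈ ℕ ] (κ * κ ≤ s) × (s < suc κ * suc κ)
isqrt s = let κ , hi , low = least (λ κ → s < suc κ * suc κ) (λ κ → suc s ≤? suc κ * suc κ) s (s≤s (m≤m+n s _)) in κ , below κ low , hi
  where
  below : ∀ κ → (∀ κ′ → s < suc κ′ * suc κ′ → κ ≤ κ′) → κ * κ ≤ s
  below zero    _   = z≤n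
  below (suc κ) low = ≮⇒≥ (λ lt → 1+n≰n (low κ lt))

quotient : ∀ s κ → 1 ≤ κ → Σ[ Q ∈ ℕ ] (Q * κ ≤ s) × (s < suc Q * κ)
quotient s κ 1≤κ = let Q , hi , low = least (λ Q → s < suc Q * κ) (λ Q → suc s ≤? suc Q * κ) s (m≤m*n (suc s) κ {{>-nonZero 1≤κ}}) in Q , below Q low , hi
  where
  below : ∀ Q → (∀ Q′ → s < suc Q′ * κ → Q ≤ Q′) → Q * κ ≤ s
  below zero    _   = z≤n
  below (suc Q) low = ≮⇒≥ (λ lt → 1+n≰n (low Q lt))

-- Take K = 3 + κ to be √s rounded down as the number of columns and s / K rounded down, written 3 +
-- q, as the number of full rows, so that q ≤ κ + 2. Twice the number of edges is then at most 4 K²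
-- + 95 K, where 95 is generous, and K ≥ 95 (k + 1) makes the error at most s / (k + 1).
upper₅ : ∀ k s → (3 + suc k * 95) * (3 + suc k * 95) ≤ s → Σ[ b ∈ ℕ ] At 3 5 s (_≤ b) × (suc k * b ≤ (2 * suc k + 1) * s)
upper₅ k s L²≤s = step₁ (isqrt s)
  where
  L = 3 + suc k * 95
  Goal = Σ[ b ∈ ℕ ] At 3 5 s (_≤ b) × (suc k * b ≤ (2 * suc k + 1) * s)
  step₂ : ∀ κ → L ≤ 3 + κ → (3 + κ) * (3 + κ) ≤ s → s < (4 + κ) * (4 + κ) → Σ[ Q ∈ ℕ ] (Q * (3 + κ) ≤ s) × (s < suc Q * (3 + κ)) → Goal
  step₂ κ L≤ lo hi (Q , Qlo , Qhi) = step₃ Q κ≤Q Qlo Qhi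
    where
    κ≤Q : 3 + κ ≤ Q
    κ≤Q = ≤-pred (*-cancelʳ-< (3 + κ) (3 + κ) (suc Q) (≤-trans (s≤s lo) Qhi))
    step₃ : ∀ Q → 3 + κ ≤ Q → Q * (3 + κ) ≤ s → s < suc Q * (3 + κ) → Goal
    step₃ (suc (suc (suc q))) (s≤s (s≤s (s≤s κ≤q))) Qlo Qhi = make (two-crowns q κ s κ≤q Qlo (≤-trans (n≤1+n s) Qhi))
      where
      q≤ : q ≤ 2 + κ
      q≤ = ≤-pred (≤-pred (≤-pred (*-cancelʳ-≤ (3 + q) (5 + κ) (3 + κ) (≤-trans Qlo (≤-trans (≤-pred hi) (≤-reflexive (e κ)))))))
        where
        e : ∀ κ → 3 + κ + (3 + κ) * (4 + κ) ≡ (5 + κ) * (3 + κ)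
        e = solve-∀
      N = suc ((4 + q) * 2 + (3 + κ) * 2)
      make : (Σ[ X ∈ MaxRTSystem 3 5 s ] 2 * e# X ≤ N * (3 + (3 + q)) + 3 * N) → Goal
      make (X , le) = e# X , (X , ≤-refl) , *-cancelˡ-≤ 2 (begin
        2 * (suc k * e# X)                                   ≡⟨ e₁ (suc k) (e# X) ⟩
        suc k * (2 * e# X)                                   ≤⟨ *-monoʳ-≤ (suc k) (≤-trans le (+-mono-≤ (*-mono-≤ N≤ (+-monoʳ-≤ 6 q≤)) (*-monoʳ-≤ 3 N≤))) ⟩
        suc k * (N′ * (3 + (3 + (2 + κ))) + 3 * N′)          ≤⟨ *-monoʳ-≤ (suc k) (≤-trans (m≤m+n _ _) (≤-reflexive (e₂ κ))) ⟩
        suc k * (4 * ((3 + κ) * (3 + κ)) + 95 * (3 + κ))     ≡⟨ e₃ (suc k) (3 + κ) ⟩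
        suc k * 4 * ((3 + κ) * (3 + κ)) + suc k * 95 * (3 + κ) ≤⟨ +-mono-≤ (*-monoʳ-≤ (suc k * 4) lo) (≤-trans (*-monoˡ-≤ (3 + κ) (≤-trans (m≤n+m (suc k * 95) 3) L≤)) lo) ⟩
        suc k * 4 * s + s                                    ≤⟨ m≤m+n _ s ⟩
        suc k * 4 * s + s + s                                ≡⟨ e₄ (suc k) s ⟩
        2 * ((2 * suc k + 1) * s)                            ∎)
        where
        open ≤-Reasoning
        N′ = suc ((4 + (2 + κ)) * 2 + (3 + κ) * 2)
        N≤ : N ≤ N′
        N≤ = s≤s (+-monoˡ-≤ ((3 + κ) * 2) (*-monoˡ-≤ 2 (+-monoʳ-≤ 4 q≤)))
        e₁ : ∀ a b → 2 * (a * b) ≡ a * (2 * b)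
        e₁ = solve-∀
        e₂ : ∀ κ → suc ((4 + (2 + κ)) * 2 + (3 + κ) * 2) * (3 + (3 + (2 + κ))) + 3 * suc ((4 + (2 + κ)) * 2 + (3 + κ) * 2) + (56 * κ + 112)
          ≡ 4 * ((3 + κ) * (3 + κ)) + 95 * (3 + κ)
        e₂ = solve-∀
        e₃ : ∀ a b → a * (4 * (b * b) + 95 * b) ≡ a * 4 * (b * b) + a * 95 * b
        e₃ = solve-∀
        e₄ : ∀ a s → a * 4 * s + s + s ≡ 2 * ((2 * a + 1) * s)
        e₄ = solve-∀
  step₁ : Σ[ κ ∈ ℕ ] (κ * κ ≤ s) × (s < suc κ * suc κ) → Goal
  step₁ (κ₀ , lo , hi) = go κ₀ (≮⇒≥ λ κ<L → <⇒≱ hi (≤-trans (*-mono-≤ κ<L κ<L) L²≤s)) lo hi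
    where
    go : ∀ κ → L ≤ κ → κ * κ ≤ s → s < suc κ * suc κ → Goal
    go (suc (suc (suc κ))) L≤@(s≤s (s≤s (s≤s _))) lo hi = step₂ κ L≤ lo hi (quotient s (3 + κ) (s≤s z≤n))

-- An error s / (k + 1) for every k stands for o(s): the inequalities read m ≥ (2/3) s - s / (k + 1)
-- and m′ ≤ 2 s + s / (k + 1).
linear-bounds : ∀ k → Σ ℕ λ s₀ → ∀ s → s₀ ≤ s → Σ ℕ λ m → Σ ℕ λ m′ → IsE 3 5 s m × IsE' 3 5 s m′ ×
  (2 * suc k * s ≤ 3 * suc k * m + 3 * s) × (m ≤ m′) × (suc k * m′ ≤ (2 * suc k + 1) * s)
linear-bounds k = 2 + five-threshold k + P , λ s s≥ → finish s (≤-trans (m≤m+n (2 + five-threshold k) P) s≥) (upper₅ k s (≤-trans (m≤n+m P (2 + five-threshold k)) s≥))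
  where
  P = (3 + suc k * 95) * (3 + suc k * 95)
  finish : ∀ s → 2 + five-threshold k ≤ s → Σ[ b ∈ ℕ ] At 3 5 s (_≤ b) × (suc k * b ≤ (2 * suc k + 1) * s) →
    Σ ℕ λ m → Σ ℕ λ m′ → IsE 3 5 s m × IsE' 3 5 s m′ ×
      (2 * suc k * s ≤ 3 * suc k * m + 3 * s) × (m ≤ m′) × (suc k * m′ ≤ (2 * suc k + 1) * s)
  finish s s≥ (b , Y , le) =
    let m , m′ , E , E′ , L , _ , m≤m′ , m′≤ = both-minima (≤-trans (m≤m+n 1 _) s≥) Y (λ m → 2 * suc k * s ≤ 3 * suc k * m + 3 * s) (λ X → five-lower X k s≥)
    in m , m′ , E , E′ , L , m≤m′ , ≤-trans (*-monoʳ-≤ (suc k) m′≤) le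

theorem14 : (∀ r → 3 ≤ r → Σ ℕ λ s₀ → ∀ s → s₀ ≤ s →
    Σ ℕ λ m → (+ m ≡ formula1 r s) × IsE r r s m × IsE' r r s m)
    ×
    (∀ r → 3 ≤ r → Σ ℕ λ C → Σ ℕ λ s₀ → ∀ s → s₀ ≤ s →
    (Σ ℕ λ m → IsE r (r + 1) s m × (m ^ 2 ≤ C * s ^ 3) × (s ^ 3 ≤ C * m ^ 2)) ×
    (Σ ℕ λ m′ → IsE' r (r + 1) s m′ × (m′ ^ 2 ≤ C * s ^ 3) × (s ^ 3 ≤ C * m′ ^ 2)))
    ×
    (∀ r t → 3 ≤ r → r + 2 ≤ t → Σ ℕ λ C → Σ ℕ λ s₀ → ∀ s → s₀ ≤ s →
    Σ ℕ λ m → Σ ℕ λ m′ → IsE r t s m × IsE' r t s m′ ×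
    (s ≤ C * m ^ (t ∸ r + 2)) × (m ≤ m′) × (m′ ^ (t ∸ r + 2) ≤ C * s ^ 4))
    ×
    (∀ t → 5 ≤ t → Σ ℕ λ C → Σ ℕ λ s₀ → ∀ s → s₀ ≤ s →
    Σ ℕ λ m → Σ ℕ λ m′ → IsE 3 t s m × IsE' 3 t s m′ ×
    (s ^ 2 ≤ C * m ^ (t ∸ 3)) × (m ≤ m′) × (m′ ^ (t ∸ 1) ≤ C * s ^ 4))
    ×
    (∀ k → Σ ℕ λ s₀ → ∀ s → s₀ ≤ s →
    Σ ℕ λ m → Σ ℕ λ m′ → IsE 3 5 s m × IsE' 3 5 s m′ ×
    (2 * suc k * s ≤ 3 * suc k * m + 3 * s) × (m ≤ m′) ×
    (suc k * m′ ≤ (2 * suc k + 1) * s))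
theorem14 = exact , three-halves , general , triangle-free , linear-bounds
  where
  exact : ∀ r → 3 ≤ r → Σ ℕ λ s₀ → ∀ s → s₀ ≤ s →
    Σ ℕ λ m → (+ m ≡ formula1 r s) × IsE r r s m × IsE' r r s m
  exact (suc (suc (suc k))) (s≤s (s≤s (s≤s _))) = exact-minimum k
  three-halves : ∀ r → 3 ≤ r → Σ ℕ λ C → Σ ℕ λ s₀ → ∀ s → s₀ ≤ s →
    (Σ ℕ λ m → IsE r (r + 1) s m × (m ^ 2 ≤ C * s ^ 3) × (s ^ 3 ≤ C * m ^ 2)) ×
    (Σ ℕ λ m′ → IsE' r (r + 1) s m′ × (m′ ^ 2 ≤ C * s ^ 3) × (s ^ 3 ≤ C * m′ ^ 2))
  three-halves (suc (suc (suc k))) (s≤s (s≤s (s≤s _))) = subst (λ t → Σ ℕ λ C → Σ ℕ λ s₀ → ∀ s → s₀ ≤ s →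
    (Σ ℕ λ m → IsE (3 + k) t s m × (m ^ 2 ≤ C * s ^ 3) × (s ^ 3 ≤ C * m ^ 2)) ×
    (Σ ℕ λ m′ → IsE' (3 + k) t s m′ × (m′ ^ 2 ≤ C * s ^ 3) × (s ^ 3 ≤ C * m′ ^ 2))) (+-comm 1 (3 + k)) (order-three-halves k)
  general : ∀ r t → 3 ≤ r → r + 2 ≤ t → Σ ℕ λ C → Σ ℕ λ s₀ → ∀ s → s₀ ≤ s →
    Σ ℕ λ m → Σ ℕ λ m′ → IsE r t s m × IsE' r t s m′ ×
    (s ≤ C * m ^ (t ∸ r + 2)) × (m ≤ m′) × (m′ ^ (t ∸ r + 2) ≤ C * s ^ 4)
  general (suc (suc (suc k))) t (s≤s (s≤s (s≤s _))) h with m≤n⇒∃[o]m+o≡n h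
  ... | j , refl = subst₂ (λ t u → Σ ℕ λ C → Σ ℕ λ s₀ → ∀ s → s₀ ≤ s →
      Σ ℕ λ m → Σ ℕ λ m′ → IsE (3 + k) t s m × IsE' (3 + k) t s m′ ×
      (s ≤ C * m ^ u) × (m ≤ m′) × (m′ ^ u ≤ C * s ^ 4)) (e₁ k j)
      (sym (trans (cong (λ z → z ∸ (3 + k) + 2) (+-assoc (3 + k) 2 j)) (trans (cong (_+ 2) (m+n∸m≡n (3 + k) (2 + j))) (e₂ j)))) (general-bounds k j)
    where
    e₁ : ∀ k j → k + (5 + j) ≡ 3 + k + 2 + j
    e₁ = solve-∀
    e₂ : ∀ j → 2 + j + 2 ≡ 4 + j
    e₂ = solve-∀
  triangle-free : ∀ t → 5 ≤ t → Σ ℕ λ C → Σ ℕ λ s₀ → ∀ s → s₀ ≤ s →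
    Σ ℕ λ m → Σ ℕ λ m′ → IsE 3 t s m × IsE' 3 t s m′ ×
    (s ^ 2 ≤ C * m ^ (t ∸ 3)) × (m ≤ m′) × (m′ ^ (t ∸ 1) ≤ C * s ^ 4)
  triangle-free (suc (suc (suc (suc (suc j))))) (s≤s (s≤s (s≤s (s≤s (s≤s _))))) = triangle-free-bounds j
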